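{- There is an algorithm that, given an input-consistent DFA $\mathcal{A}=(Q,\delta,s)$ (satisfying the standing assumptions below), computes in $O(|\delta|\log|Q|)$ time a minimum chain partition of the smallest-width co-lex order of $\mathcal{A}$.
   Context: $\Sigma$ is a fixed finite nonempty alphabet with a strict total order $<$. An NFA is $\mathcal{A}=(Q,\delta,s)$ with $\delta:Q\times\Sigma\to 2^Q$ and source $s$; it is a DFA if $|\delta(v,a)|\le1$ for all $v,a$. $|\delta|$ is the number of transitions. Write $\delta_a(u)=\delta(u,a)$. Standing assumptions: $s$ has no incoming transitions; every state is reachable from $s$; input-consistent means every $v\neq s$ has incoming transitions labeled by exactly one letter; every letter labels at least one transition. A co-lex order for $\mathcal{A}$ is a strict partial order $\prec$ on $Q$ with $s\prec v$ for all $v\neq s$ such that for all $v\in\delta_a(u)$, $v'\in\delta_{a'}(u')$: (1) if $a<a'$ then $v\prec v'$; (2) if $a=a'$, $v\prec v'$ and $u\neq u'$ then $u\prec u'$. The width of a strict partial order is the maximum size of a set of pairwise incomparable elements. For a DFA the co-lex order of minimum width is unique; it is the relation $\prec_{\mathcal{A}}$ given by $u\prec_{\mathcal{A}}v$ iff $\alpha<\beta$ for all $\alpha\in S_u,\beta\in S_v$, where $S_v$ is the set of strings labeling walks from $s$ to $v$ and $<$ on strings is the co-lexicographic order (strings compared from right to left, a proper suffix being smaller). A chain partition of a strict partial order on $Q$ is a partition of $Q$ into parts each totally ordered by it; it is minimum if it has the fewest parts. -}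

module Defs where

open import Data.Fin using (Fin; toℕ)
import Data.Fin as Fin
open import Data.Fin.Subset using (Subset; _∈_; _∉_; ∣_∣)
open import Data.Fin.Subset.Properties using (_∈?_)
open import Data.List using (List; []; _∷_; allFin; cartesianProduct; filter; length; map; reverse)
open import Data.List.Relation.Binary.Lex.Strict using (Lex-<)
open import Data.Nat using (ℕ; zero; suc; _+_; _*_; _^_; _∸_; _%_; _≤_; _<_; _≟_)
open import Data.Nat.Logarithm using (⌈log₂_⌉)
open import Data.Nat.Properties using (m^n≢0)
open import Data.Product using (_×_; _,_; ∃₂; ∃!; ∃-syntax)
open import Data.Sum using (_⊎_)
open import Function.Definitions using (Surjective)
open import Level using (0ℓ)
open import Relation.Binary.Core using (Rel)
open import Relation.Binary.PropositionalEquality using (_≡_; _≢_)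
open import Relation.Binary.Structures using (IsStrictPartialOrder)
open import Relation.Nullary using (¬_; does)
open import Data.Bool using (if_then_else_)

------------------------------------------------------------------------
-- Automata with states Fin n over the alphabet Fin σ, ordered as usual

record NFA (n σ : ℕ) : Set where
  field
    δ      : Fin n → Fin σ → Subset n
    source : Fin n

open NFA public

Transition : ℕ → ℕ → Set
Transition n σ = Fin n × Fin σ × Fin n

module _ {n σ : ℕ} (A : NFA n σ) where

  transitions : List (Transition n σ)
  transitions =
    filter (λ (u , a , v) → v ∈? δ A u a)
           (cartesianProduct (allFin n) (cartesianProduct (allFin σ) (allFin n)))

  ∣δ∣ : ℕ
  ∣δ∣ = length transitions

  IsDFA : Set
  IsDFA = ∀ u a → ∣ δ A u a ∣ ≤ 1

  data Walk : Fin n → List (Fin σ) → Fin n → Set where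
    []  : ∀ {u} → Walk u [] u
    _∷_ : ∀ {u v w a α} → v ∈ δ A u a → Walk v α w → Walk u (a ∷ α) w

  -- α ∈S v : the string α labels a walk from the source to v.
  infix 4 _∈S_
  _∈S_ : List (Fin σ) → Fin n → Set
  α ∈S v = Walk (source A) α v

  record StandingAssumptions : Set where
    field
      source-no-incoming : ∀ u a → source A ∉ δ A u a
      reachable          : ∀ v → ∃[ α ] α ∈S v
      letters-used       : ∀ a → ∃₂ λ u v → v ∈ δ A u a

  InputConsistent : Set
  InputConsistent = ∀ v → v ≢ source A → ∃! _≡_ λ a → ∃[ u ] v ∈ δ A u a

------------------------------------------------------------------------
-- Co-lex orders, width and chain partitions

infix 4 _<ᶜ_
_<ᶜ_ : ∀ {σ} → Rel (List (Fin σ)) 0ℓ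
α <ᶜ β = Lex-< _≡_ Fin._<_ (reverse α) (reverse β)

module _ {n : ℕ} (_≺_ : Rel (Fin n) 0ℓ) where

  Antichain : Subset n → Set
  Antichain S = ∀ {u v} → u ∈ S → v ∈ S → u ≢ v → ¬ (u ≺ v) × ¬ (v ≺ u)

  HasWidth : ℕ → Set
  HasWidth w = (∃[ S ] Antichain S × ∣ S ∣ ≡ w) × (∀ S → Antichain S → ∣ S ∣ ≤ w)

  -- A partition into k nonempty parts is a surjection onto Fin k; the parts
  -- are its fibres.
  record IsChainPartition {k : ℕ} (part : Fin n → Fin k) : Set where
    field
      nonempty : Surjective _≡_ _≡_ part
      chain    : ∀ {u v} → part u ≡ part v → u ≢ v → u ≺ v ⊎ v ≺ u

  record IsMinimumChainPartition {k : ℕ} (part : Fin n → Fin k) : Set where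
    field
      isChainPartition : IsChainPartition part
      minimum : ∀ {l} (part′ : Fin n → Fin l) → IsChainPartition part′ → k ≤ l

module _ {n σ : ℕ} (A : NFA n σ) where

  record IsCoLexOrder (_≺_ : Rel (Fin n) 0ℓ) : Set where
    field
      isStrictPartialOrder : IsStrictPartialOrder _≡_ _≺_
      source-first : ∀ {v} → v ≢ source A → source A ≺ v
      by-letter    : ∀ {u u′ v v′ a a′} → v ∈ δ A u a → v′ ∈ δ A u′ a′ →
                     a Fin.< a′ → v ≺ v′
      backward     : ∀ {u u′ v v′ a} → v ∈ δ A u a → v′ ∈ δ A u′ a →
                     v ≺ v′ → u ≢ u′ → u ≺ u′

  record IsSmallestWidthCoLexOrder (_≺_ : Rel (Fin n) 0ℓ) : Set₁ where
    field
      isCoLexOrder : IsCoLexOrder _≺_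
      width        : ℕ
      hasWidth     : HasWidth _≺_ width
      smallest     : ∀ {_≺′_ : Rel (Fin n) 0ℓ} {w} →
                     IsCoLexOrder _≺′_ → HasWidth _≺′_ w → width ≤ w

  -- The relation ≺_A.
  StringOrder : Rel (Fin n) 0ℓ
  StringOrder u v = ∀ {α β} → _∈S_ A α u → _∈S_ A β v → α <ᶜ β

------------------------------------------------------------------------
-- A word RAM, programmed in a structured language
--
-- A program is a finite piece of syntax and so uses a fixed finite number of
-- variables and arrays.  Words have w bits.  Evaluating an expression costs
-- its number of nodes; every other basic step costs one.

data Exp : Set where
  lit     : ℕ → Exp
  var     : ℕ → Exp
  _[_]    : ℕ → Exp → Exp
  _⊕_ _⊖_ : Exp → Exp → Exp

data Cmd : Set where
  skip               : Cmd
  _≔_                : ℕ → Exp → Cmd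
  _[_]≔_             : ℕ → Exp → Exp → Cmd
  _⨾_                : Cmd → Cmd → Cmd
  ifLess             : Exp → Exp → Cmd → Cmd → Cmd
  whileLess          : Exp → Exp → Cmd → Cmd

infixl 7 _⊕_ _⊖_
infix  8 _[_]
infix  5 _≔_ _[_]≔_
infixr 4 _⨾_

record Store : Set where
  constructor store
  field
    vars : ℕ → ℕ
    arrs : ℕ → ℕ → ℕ

open Store public

_[_↦_] : ∀ {X : Set} → (ℕ → X) → ℕ → X → (ℕ → X)
(f [ i ↦ x ]) j = if does (j ≟ i) then x else f j

cost : Exp → ℕ
cost (lit _)   = 1
cost (var _)   = 1
cost (_ [ e ]) = suc (cost e)
cost (e ⊕ f)   = suc (cost e + cost f)
cost (e ⊖ f)   = suc (cost e + cost f)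

module _ (w : ℕ) where

  wrap : ℕ → ℕ
  wrap x = _%_ x (2 ^ w) {{m^n≢0 2 w}}

  eval : Store → Exp → ℕ
  eval ρ (lit k)   = wrap k
  eval ρ (var x)   = vars ρ x
  eval ρ (a [ e ]) = arrs ρ a (eval ρ e)
  eval ρ (e ⊕ f)   = wrap (eval ρ e + eval ρ f)
  eval ρ (e ⊖ f)   = eval ρ e ∸ eval ρ f

  -- Run C ρ ρ′ t : started in ρ, the program C halts in ρ′ after t steps.
  data Run : Cmd → Store → Store → ℕ → Set where
    skip : ∀ {ρ} → Run skip ρ ρ 1
    assign : ∀ {ρ x e} →
      Run (x ≔ e) ρ (store (vars ρ [ x ↦ eval ρ e ]) (arrs ρ)) (suc (cost e))
    write : ∀ {ρ a e f} →
      Run (a [ e ]≔ f) ρ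
          (store (vars ρ) (arrs ρ [ a ↦ arrs ρ a [ eval ρ e ↦ eval ρ f ] ]))
          (suc (cost e + cost f))
    seq : ∀ {ρ₁ ρ₂ ρ₃ C D s t} →
      Run C ρ₁ ρ₂ s → Run D ρ₂ ρ₃ t → Run (C ⨾ D) ρ₁ ρ₃ (s + t)
    if-yes : ∀ {ρ ρ′ e f C D t} → eval ρ e < eval ρ f → Run C ρ ρ′ t →
      Run (ifLess e f C D) ρ ρ′ (suc (cost e + cost f) + t)
    if-no : ∀ {ρ ρ′ e f C D t} → eval ρ f ≤ eval ρ e → Run D ρ ρ′ t →
      Run (ifLess e f C D) ρ ρ′ (suc (cost e + cost f) + t)
    while-yes : ∀ {ρ₁ ρ₂ ρ₃ e f C s t} → eval ρ₁ e < eval ρ₁ f →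
      Run C ρ₁ ρ₂ s → Run (whileLess e f C) ρ₂ ρ₃ t →
      Run (whileLess e f C) ρ₁ ρ₃ (suc (cost e + cost f) + (s + t))
    while-no : ∀ {ρ e f C} → eval ρ f ≤ eval ρ e →
      Run (whileLess e f C) ρ ρ (suc (cost e + cost f))

------------------------------------------------------------------------
-- Input and output conventions

nth : List ℕ → ℕ → ℕ
nth []       _       = 0
nth (x ∷ _)  zero    = x
nth (_ ∷ xs) (suc i) = nth xs i

-- Variables 0, …, 3 hold |Q|, |Σ|, |δ| and the source; arrays 0, 1, 2 hold
-- the origins, letters and targets of the transitions listed in ts.  All other
-- memory is zero.
input : ∀ {n σ} → NFA n σ → List (Transition n σ) → Store
input {n} {σ} A ts = store
  (nth (n ∷ σ ∷ length ts ∷ toℕ (source A) ∷ []))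
  λ where
    0 → nth (map (λ (u , _ , _) → toℕ u) ts)
    1 → nth (map (λ (_ , a , _) → toℕ a) ts)
    2 → nth (map (λ (_ , _ , v) → toℕ v) ts)
    _ → λ _ → 0

-- Variable 0 holds the number of parts and array 0 maps each state to its part.
Outputs : ∀ {n k} → Store → (Fin n → Fin k) → Set
Outputs {k = k} ρ part =
  vars ρ 0 ≡ k × (∀ v → arrs ρ 0 (toℕ v) ≡ toℕ (part v))

-- Words of O(log N) bits, N = |Q| + |δ|.  As d ranges over ℕ the factor suc d
-- ranges over the positive constants, so the input always consists of words.
wordSize : ∀ {n σ} → ℕ → NFA n σ → ℕ
wordSize {n} d A = suc d * ⌈log₂ (n + ∣δ∣ A) ⌉

{-# OPTIONS --safe #-}

{-
Read every string backwards and let S v be the set of the reversed strings of the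
walks from s to v, ordered lexicographically.  Then u ≺ v iff u ≠ v and
sup S u ≤ inf S v, so ≺ is an interval order: states are incomparable iff their
intervals overlap.  Colouring the intervals greedily from left to right opens a new
colour only if every colour is in use, and at that moment one state of each colour
forms an antichain.  Hence the colours are a minimum chain partition and the width is
their number.  Any co-lex order is contained in ≺, so no co-lex order is narrower.

It remains to sort the 2n endpoints.  inf S v is the letter of v followed by the least
inf S u over the predecessors u of v, and likewise for suprema, so a graph on 2n nodes
is to be ordered by its backward walks.  Starting from the order by letters, an ordered
partition is refined as in the Paige-Tarjan algorithm: each compound block is cut at a
boundary of fine blocks, the edges leaving its smaller half are scanned, and the nodes
whose extremal predecessor block changes are split off their fine blocks.  A node is
scanned only when its compound block has shrunk to at most half, so the sum over nodes
and edges of the logarithms of the block sizes is a potential paying for all scans.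
-}

module Submission where

open import Defs
open import Data.Bool using (Bool; true; false; _∨_; _∧_; if_then_else_) renaming (T to IsTrue)
open import Data.Bool.Properties using (T-∧)
open import Data.Empty using (⊥)
open import Data.Fin using (Fin; toℕ; fromℕ<)
import Data.Fin as Fin
open import Data.Fin.Properties using (toℕ<n; toℕ-fromℕ<; fromℕ<-toℕ; toℕ-injective; injective⇒≤)
import Data.Fin.Properties as Finₚ
open import Data.Fin.Subset using (Subset; _∈_; ∣_∣; ⁅_⁆; _∪_)
import Data.Fin.Subset as Subset
open import Data.Fin.Subset.Properties using (x∈⁅x⁆; x∈⁅y⁆⇒x≡y; ∣⁅x⁆∣≡1; p⊂q⇒∣p∣<∣q∣; x∈p∪q⁻; x∈p∪q⁺; ∉⊥; _∈?_)
open import Data.List using (List; []; _∷_; length; map; lookup; reverse; reverseAcc; _++_; allFin; cartesianProduct)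
open import Data.List.Membership.Propositional using () renaming (_∈_ to _∈ˡ_)
open import Data.List.Membership.Propositional.Properties using (∈-filter⁺; ∈-filter⁻; ∈-cartesianProduct⁺; ∈-allFin; ∈-lookup)
open import Data.List.Properties using (reverse-involutive; unfold-reverse)
import Data.List.Relation.Binary.Lex.Core as Lex
open import Data.List.Relation.Binary.Lex.Strict using (Lex-<)
open import Data.List.Relation.Binary.Permutation.Propositional using (_↭_; ↭-refl; ↭-sym)
open import Data.List.Relation.Binary.Permutation.Propositional.Properties using (∈-resp-↭; ↭-length)
open import Data.List.Relation.Unary.Any using (index)
open import Data.List.Relation.Unary.Any.Properties using (lookup-index)
open import Data.Nat using (ℕ; zero; suc; _+_; _*_; _∸_; _^_; _≤_; _<_; z≤n; s≤s; _≟_; _≤?_; _<?_; _≡ᵇ_; NonZero; ≢-nonZero⁻¹; ⌊_/2⌋; ⌈_/2⌉)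
open import Data.Nat.DivMod using (m<n⇒m%n≡m)
open import Data.Nat.Induction using (<-wellFounded)
open import Data.Nat.Logarithm
open import Data.Nat.Properties hiding (_≟_; _≤?_; _<?_)
open import Data.Nat.Tactic.RingSolver using (solve)
open import Data.Product using (_×_; _,_; proj₁; proj₂; ∃-syntax; Σ-syntax)
open import Data.Sum using (_⊎_; inj₁; inj₂)
open import Data.Unit using (⊤)
import Data.Vec as Vec
open import Function using (_∘_; case_of_; Equivalence)
open import Function.Definitions using (Injective)
open import Induction.WellFounded using (Acc; acc)
open import Relation.Binary.Definitions using (tri<; tri≈; tri>)
open import Relation.Binary.PropositionalEquality hiding ([_]; J)
open import Relation.Binary.Structures using (IsStrictPartialOrder)
open import Relation.Nullary using (¬_; yes; no; does; contradiction)
open import Relation.Nullary.Decidable using (dec-true; dec-false)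

-- The suprema and infima are in general infinite strings, and they never occur as objects. The
-- proof works with numerical ranks of the 2n nodes and certifies only comparisons between an
-- infimum and a supremum. If sup u ranks at most as high as inf v, this passes to all pairs of
-- predecessors, and an induction over finite walks orders all strings of u and v; determinism keeps
-- the two states distinct on the way. If inf u ranks strictly below sup v, the refinement supplies
-- two finite strings as witnesses. Ties are the delicate point of the sort: at equal ranks the end
-- of one interval has to precede the start of another, yet a state whose two ends have equal rank
-- must remain an interval. Hence ranks are multiplied by 4 and offsets break the ties. Arithmetic
-- is modulo a power of two, so every step needs a bound on its result. One number Z bounds all of
-- them; with m transitions it lies below (n + m)^5, hence words of 5 ⌈log₂ (n + m)⌉ bits. Times are
-- explicit: loop invariants contain the time left, and potentials are credit within it.

-- Arithmetic, updated functions and finite sums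

-- Turns a linear consequence into an identity for the ring solver: the hypotheses are added up to
-- `A ≤ B`, and `s` is the slack.
lin : ∀ {A B x y} s → A ≤ B → x + B + s ≡ y + A → x ≤ y
lin {A} {B} {x} {y} s p eq =
  +-cancelʳ-≤ A x y (≤-trans (+-monoʳ-≤ x p) (≤-trans (m≤m+n (x + B) s) (≤-reflexive eq)))

module _ {X : Set} where

  upd≡ : ∀ (f : ℕ → X) i x → (f [ i ↦ x ]) i ≡ x
  upd≡ f i x rewrite dec-true (i ≟ i) refl = refl

  upd≢ : ∀ (f : ℕ → X) i x {j} → j ≢ i → (f [ i ↦ x ]) j ≡ f j
  upd≢ f i x {j} j≢i rewrite dec-false (j ≟ i) j≢i = refl

  -- `R` may depend on the index because most facts about an array entry do; the old entry is asked
  -- for only where it has not been overwritten.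
  upd-elim : ∀ {f : ℕ → X} {i x} (R : ℕ → X → Set) → R i x →
             ∀ j → (j ≢ i → R j (f j)) → R j ((f [ i ↦ x ]) j)
  upd-elim {f} {i} {x} R p j q with j ≟ i
  ... | yes refl = subst (R i) (sym (upd≡ f i x)) p
  ... | no j≢i   = subst (R j) (sym (upd≢ f i x j≢i)) (q j≢i)

  upd-cong : ∀ {f g : ℕ → X} {i j x y} → i ≡ j → x ≡ y → (∀ k → f k ≡ g k) →
             ∀ k → (f [ i ↦ x ]) k ≡ (g [ j ↦ y ]) k
  upd-cong {i = i} refl refl f≗g k with k ≡ᵇ i
  ... | true  = refl
  ... | false = f≗g k

Σ< : ℕ → (ℕ → ℕ) → ℕ
Σ< zero    f = 0
Σ< (suc n) f = f n + Σ< n f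

Σ-cong : ∀ n {f g} → (∀ i → i < n → f i ≡ g i) → Σ< n f ≡ Σ< n g
Σ-cong zero    eq = refl
Σ-cong (suc n) eq = cong₂ _+_ (eq n ≤-refl) (Σ-cong n (λ i i<n → eq i (m<n⇒m<1+n i<n)))

Σ-mono : ∀ n {f g} → (∀ i → i < n → f i ≤ g i) → Σ< n f ≤ Σ< n g
Σ-mono zero    le = z≤n
Σ-mono (suc n) le = +-mono-≤ (le n ≤-refl) (Σ-mono n (λ i i<n → le i (m<n⇒m<1+n i<n)))

Σ-const : ∀ n {f c} → (∀ i → i < n → f i ≡ c) → Σ< n f ≡ n * c
Σ-const zero    eq = refl
Σ-const (suc n) eq = cong₂ _+_ (eq n ≤-refl) (Σ-const n (λ i i<n → eq i (m<n⇒m<1+n i<n)))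

Σ-zero : ∀ n {f} → (∀ i → i < n → f i ≡ 0) → Σ< n f ≡ 0
Σ-zero n eq = trans (Σ-const n eq) (*-zeroʳ n)

Σ-+ : ∀ n f g → Σ< n (λ i → f i + g i) ≡ Σ< n f + Σ< n g
Σ-+ zero    f g = refl
Σ-+ (suc n) f g rewrite Σ-+ n f g = assoc₄ (f n) (g n) (Σ< n f) (Σ< n g)
  where
  assoc₄ : ∀ a b c d → a + b + (c + d) ≡ a + c + (b + d)
  assoc₄ a b c d = solve (a ∷ b ∷ c ∷ d ∷ [])

Σ-pos : ∀ n f → 0 < Σ< n f → ∃[ i ] i < n × 0 < f i
Σ-pos (suc n) f p with f n in eq
... | suc x = n , ≤-refl , subst (0 <_) (sym eq) (s≤s z≤n)
... | zero with Σ-pos n f p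
...   | i , i<n , q = i , m<n⇒m<1+n i<n , q

Σ-term : ∀ n f {i} → i < n → f i ≤ Σ< n f
Σ-term (suc n) f {i} i<1+n with m≤n⇒m<n∨m≡n (≤-pred i<1+n)
... | inj₁ i<n  = ≤-trans (Σ-term n f i<n) (m≤n+m _ (f n))
... | inj₂ refl = m≤m+n (f n) _

-- Both sides are moved so that no subtraction occurs.
Σ-point : ∀ n {f g i} → i < n → (∀ j → j < n → j ≢ i → f j ≡ g j) →
          Σ< n g + f i ≡ Σ< n f + g i
Σ-point (suc n) {f} {g} {i} i<1+n eq with i ≟ n
... | yes refl
  rewrite Σ-cong n {f} {g} (λ j j<n → eq j (m<n⇒m<1+n j<n) (<⇒≢ j<n))
  = swap (g n) (Σ< n g) (f n)
  where
  swap : ∀ a b c → a + b + c ≡ c + b + a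
  swap a b c = solve (a ∷ b ∷ c ∷ [])
... | no i≢n
  rewrite eq n ≤-refl (i≢n ∘ sym)
        | +-assoc (g n) (Σ< n g) (f i) | +-assoc (g n) (Σ< n f) (g i)
  = cong (g n +_) (Σ-point n (≤∧≢⇒< (≤-pred i<1+n) i≢n) (λ j j<n → eq j (m<n⇒m<1+n j<n)))

-- The Kronecker delta, with values in ℕ so that sums of products of deltas count edges.
δ? : ℕ → ℕ → ℕ
δ? i j = if does (i ≟ j) then 1 else 0

δ?-≡ : ∀ {i j} → i ≡ j → δ? i j ≡ 1
δ?-≡ {i} refl rewrite dec-true (i ≟ i) refl = refl

δ?-≢ : ∀ {i j} → i ≢ j → δ? i j ≡ 0
δ?-≢ {i} {j} i≢j rewrite dec-false (i ≟ j) i≢j = refl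

δ?-pos : ∀ {i j} → 0 < δ? i j → i ≡ j
δ?-pos {i} {j} p with i ≟ j
... | yes eq = eq
... | no neq = contradiction (subst (0 <_) (δ?-≢ neq) p) λ ()

δ?≤1 : ∀ i j → δ? i j ≤ 1
δ?≤1 i j with i ≟ j
... | yes eq rewrite δ?-≡ eq = ≤-refl
... | no ne rewrite δ?-≢ ne = z≤n

-- The pigeonhole principle with a left inverse in place of injectivity, since the arrays `E` and
-- `P` come as such a pair.
retract-≤ : ∀ {m n} (f g : ℕ → ℕ) → (∀ i → i < m → f i < n) → (∀ i → i < m → g (f i) ≡ i) → m ≤ n
retract-≤ {m} {n} f g f< gf = injective⇒≤ {f = λ i → fromℕ< (f< (toℕ i) (toℕ<n i))} inj
  where
  inj : ∀ {i j : Fin m} → fromℕ< (f< (toℕ i) (toℕ<n i)) ≡ fromℕ< (f< (toℕ j) (toℕ<n j)) → i ≡ j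
  inj {i} {j} eq = toℕ-injective (trans (sym (gf _ (toℕ<n i))) (trans (cong g
    (trans (sym (toℕ-fromℕ< (f< (toℕ i) (toℕ<n i))))
      (trans (cong toℕ eq) (toℕ-fromℕ< (f< (toℕ j) (toℕ<n j)))))) (gf _ (toℕ<n j))))

<-or-≥ : ∀ m n → m < n ⊎ n ≤ m
<-or-≥ m n with m <? n
... | yes p = inj₁ p
... | no p  = inj₂ (≮⇒≥ p)

infix 4 _≋_

-- Running times of programs

-- Stores contain functions, and the stores that invariants speak about agree with the actual ones
-- only pointwise; runs are therefore carried along this relation instead of along equality.
record _≋_ (ρ ρ′ : Store) : Set where
  constructor _,_
  field
    vars≋ : ∀ x → vars ρ x ≡ vars ρ′ x
    arrs≋ : ∀ a i → arrs ρ a i ≡ arrs ρ′ a i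

open _≋_

≋-refl : ∀ {ρ} → ρ ≋ ρ
≋-refl = (λ _ → refl) , (λ _ _ → refl)

≋-sym : ∀ {ρ ρ′} → ρ ≋ ρ′ → ρ′ ≋ ρ
≋-sym (v , a) = (λ x → sym (v x)) , (λ b i → sym (a b i))

≋-trans : ∀ {ρ ρ′ ρ″} → ρ ≋ ρ′ → ρ′ ≋ ρ″ → ρ ≋ ρ″
≋-trans (v , a) (v′ , a′) = (λ x → trans (v x) (v′ x)) , (λ b i → trans (a b i) (a′ b i))

≋-eval : ∀ w {ρ ρ′} → ρ ≋ ρ′ → ∀ e → eval w ρ e ≡ eval w ρ′ e
≋-eval w eq (lit k)   = refl
≋-eval w eq (var x)   = vars≋ eq x
≋-eval w {ρ} eq (a [ e ]) = trans (cong (arrs ρ a) (≋-eval w eq e)) (arrs≋ eq a _)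
≋-eval w eq (e ⊕ f)   = cong₂ (λ x y → wrap w (x + y)) (≋-eval w eq e) (≋-eval w eq f)
≋-eval w eq (e ⊖ f)   = cong₂ _∸_ (≋-eval w eq e) (≋-eval w eq f)

arrs-cong : ∀ {f g : ℕ → ℕ → ℕ} {a i j x y} → i ≡ j → x ≡ y → (∀ b k → f b k ≡ g b k) →
            ∀ b k → (f [ a ↦ f a [ i ↦ x ] ]) b k ≡ (g [ a ↦ g a [ j ↦ y ] ]) b k
arrs-cong {f} {g} {a} i≡j x≡y f≗g b k with b ≡ᵇ a
... | true  = upd-cong {f = f a} i≡j x≡y (f≗g a) k
... | false = f≗g b k

≋-run : ∀ {w C ρ ρ′ σ t} → ρ ≋ σ → Run w C ρ ρ′ t → ∃[ σ′ ] Run w C σ σ′ t × ρ′ ≋ σ′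
≋-run eq skip = _ , skip , eq
≋-run {w} eq (assign {x = x} {e}) =
  _ , assign , (upd-cong {i = x} refl (≋-eval w eq e) (vars≋ eq) , arrs≋ eq)
≋-run {w} eq (write {e = e} {f}) =
  _ , write , (vars≋ eq , arrs-cong (≋-eval w eq e) (≋-eval w eq f) (arrs≋ eq))
≋-run eq (seq r s) with ≋-run eq r
... | _ , r′ , eq′ with ≋-run eq′ s
...   | _ , s′ , eq″ = _ , seq r′ s′ , eq″
≋-run {w} eq (if-yes {e = e} {f} p r) with ≋-run eq r
... | _ , r′ , eq′ = _ , if-yes (subst₂ _<_ (≋-eval w eq e) (≋-eval w eq f) p) r′ , eq′
≋-run {w} eq (if-no {e = e} {f} p r) with ≋-run eq r
... | _ , r′ , eq′ = _ , if-no (subst₂ _≤_ (≋-eval w eq f) (≋-eval w eq e) p) r′ , eq′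
≋-run {w} eq (while-yes {e = e} {f} p r s) with ≋-run eq r
... | _ , r′ , eq′ with ≋-run eq′ s
...   | _ , s′ , eq″ =
  _ , while-yes (subst₂ _<_ (≋-eval w eq e) (≋-eval w eq f) p) r′ s′ , eq″
≋-run {w} eq (while-no {e = e} {f} p) =
  _ , while-no (subst₂ _≤_ (≋-eval w eq f) (≋-eval w eq e) p) , eq

mem : ℕ → List ℕ → Bool
mem x []       = false
mem x (y ∷ ys) = (x ≡ᵇ y) ∨ mem x ys

-- A Boolean, so that for a concrete program the proof `ok` that it writes nothing else is found by
-- evaluation.
writesOnly : List ℕ → List ℕ → Cmd → Bool
writesOnly vs as skip             = true
writesOnly vs as (x ≔ _)          = mem x vs
writesOnly vs as (a [ _ ]≔ _)     = mem a as
writesOnly vs as (C ⨾ D)          = writesOnly vs as C ∧ writesOnly vs as D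
writesOnly vs as (ifLess _ _ C D) = writesOnly vs as C ∧ writesOnly vs as D
writesOnly vs as (whileLess _ _ C) = writesOnly vs as C

-- Reading a variable or array that is not listed reduces definitionally to
-- reading it in ρ, so that facts about it survive a loop without transport.
havoc : List ℕ → List ℕ → Store → Store → Store
havoc vs as ρ σ = store (λ x → if mem x vs then vars σ x else vars ρ x)
                        (λ a → if mem a as then arrs σ a else arrs ρ a)

private
  ∧-split : ∀ {a b} → IsTrue (a ∧ b) → IsTrue a × IsTrue b
  ∧-split = Equivalence.to T-∧

  mem-no : ∀ {x y vs} → IsTrue (mem y vs) → mem x vs ≡ false → x ≢ y
  mem-no p q refl = subst IsTrue q p

frame : ∀ {w vs as C ρ ρ′ t} → IsTrue (writesOnly vs as C) → Run w C ρ ρ′ t →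
        (∀ x → mem x vs ≡ false → vars ρ′ x ≡ vars ρ x) ×
        (∀ a → mem a as ≡ false → arrs ρ′ a ≡ arrs ρ a)
frame ok skip = (λ _ _ → refl) , (λ _ _ → refl)
frame {vs = vs} ok (assign {ρ} {x}) =
  (λ y q → upd≢ (vars ρ) x _ (mem-no {vs = vs} ok q)) , (λ _ _ → refl)
frame {as = as} ok (write {ρ} {a}) =
  (λ _ _ → refl) , (λ b q → upd≢ (arrs ρ) a _ (mem-no {vs = as} ok q))
frame {vs = vs} {as} {C = C ⨾ D} ok (seq r s)
  with ∧-split {writesOnly vs as C} ok
... | okC , okD with frame okC r | frame okD s
...   | v , a | v′ , a′ = (λ x q → trans (v′ x q) (v x q)) , (λ b q → trans (a′ b q) (a b q))
frame {vs = vs} {as} {C = ifLess _ _ C D} ok (if-yes _ r) = frame (proj₁ (∧-split {writesOnly vs as C} ok)) r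
frame {vs = vs} {as} {C = ifLess _ _ C D} ok (if-no _ r)  = frame (proj₂ (∧-split {writesOnly vs as C} ok)) r
frame ok (while-yes _ r s) with frame ok r | frame ok s
... | v , a | v′ , a′ = (λ x q → trans (v′ x q) (v x q)) , (λ b q → trans (a′ b q) (a b q))
frame ok (while-no _) = (λ _ _ → refl) , (λ _ _ → refl)

havoc-≋ : ∀ vs as {ρ ρ′ σ} →
          (∀ x → mem x vs ≡ false → vars ρ′ x ≡ vars ρ x) ×
          (∀ a → mem a as ≡ false → arrs ρ′ a ≡ arrs ρ a) →
          ρ′ ≋ σ → ρ′ ≋ havoc vs as ρ σ
havoc-≋ vs as {ρ} {ρ′} {σ} (v , a) eq = v′ , a′
  where
  v′ : ∀ x → vars ρ′ x ≡ vars (havoc vs as ρ σ) x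
  v′ x with mem x vs in q
  ... | true  = vars≋ eq x
  ... | false = v x q
  a′ : ∀ b i → arrs ρ′ b i ≡ arrs (havoc vs as ρ σ) b i
  a′ b i with mem b as in q
  ... | true  = arrs≋ eq b i
  ... | false = cong (λ f → f i) (a b q)

-- k is the time available.  As Q receives the time left, potentials can be
-- part of postconditions and running times never have to be added up.
record Halts (w : ℕ) (C : Cmd) (ρ : Store) (k : ℕ) (Q : ℕ → Store → Set) : Set where
  constructor halts
  field
    {final view} : Store
    {time left}  : ℕ
    run          : Run w C ρ final time
    same         : final ≋ view
    paid         : time + left ≤ k
    post         : Q left view

module _ {w : ℕ} {Q : ℕ → Store → Set} where

  ≋-halts : ∀ {C ρ σ k} → ρ ≋ σ → Halts w C σ k Q → Halts w C ρ k Q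
  ≋-halts eq (halts r s p q) with ≋-run (≋-sym eq) r
  ... | _ , r′ , eq′ = halts r′ (≋-trans (≋-sym eq′) s) p q

  weaken : ∀ {C ρ k k′} → k ≤ k′ → Halts w C ρ k Q → Halts w C ρ k′ Q
  weaken k≤k′ (halts r s p q) = halts r s (≤-trans p k≤k′) q

  infixr 4 _then_
  _then_ : ∀ {C D ρ k R} → Halts w C ρ k R → (∀ {k′ σ} → R k′ σ → Halts w D σ k′ Q) →
           Halts w (C ⨾ D) ρ k Q
  _then_ {k = k} (halts {time = t₁} r s p q) f with f q
  ... | halts {time = t₂} {left} r₂ s₂ p₂ q₂ with ≋-run (≋-sym s) r₂
  ...   | _ , r₂′ , eq = halts (seq r r₂′) (≋-trans (≋-sym eq) s₂)
    (≤-trans (≤-reflexive (+-assoc t₁ t₂ left)) (≤-trans (+-monoʳ-≤ t₁ p₂) p)) q₂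

  skip! : ∀ {ρ k} → Q k ρ → Halts w skip ρ (suc k) Q
  skip! q = halts skip ≋-refl ≤-refl q

  -- The cost is added to the time `k` that is left over, so the budget of a straight-line program
  -- is composed from its end by unification.
  asg : ∀ {x e ρ k v} → eval w ρ e ≡ v → Q k (store (vars ρ [ x ↦ v ]) (arrs ρ)) →
        Halts w (x ≔ e) ρ (suc (cost e) + k) Q
  asg refl q = halts assign ≋-refl ≤-refl q

  wrt : ∀ {a e f ρ k i v} → eval w ρ e ≡ i → eval w ρ f ≡ v →
        Q k (store (vars ρ) (arrs ρ [ a ↦ arrs ρ a [ i ↦ v ] ])) →
        Halts w (a [ e ]≔ f) ρ (suc (cost e + cost f) + k) Q
  wrt refl refl q = halts write ≋-refl ≤-refl q

  ifl : ∀ {e f C D ρ k} →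
        (eval w ρ e < eval w ρ f → Halts w C ρ k Q) →
        (eval w ρ f ≤ eval w ρ e → Halts w D ρ k Q) →
        Halts w (ifLess e f C D) ρ (suc (cost e + cost f) + k) Q
  ifl {e} {f} {ρ = ρ} yes′ no′ with <-or-≥ (eval w ρ e) (eval w ρ f)
  ... | inj₁ lt with yes′ lt
  ...   | halts {time = t} r s p q = halts (if-yes lt r) s
    (≤-trans (≤-reflexive (+-assoc (suc (cost e + cost f)) t _)) (+-monoʳ-≤ (suc (cost e + cost f)) p)) q
  ifl {e} {f} {ρ = ρ} yes′ no′ | inj₂ ge with no′ ge
  ...   | halts {time = t} r s p q = halts (if-no ge r) s
    (≤-trans (≤-reflexive (+-assoc (suc (cost e + cost f)) t _)) (+-monoʳ-≤ (suc (cost e + cost f)) p)) q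

  call : ∀ vs as {C ρ k R} {ok : IsTrue (writesOnly vs as C)} → Halts w C ρ k R →
         (∀ {k′ σ} → R k′ σ → Q k′ (havoc vs as ρ σ)) → Halts w C ρ k Q
  call vs as {ok = ok} (halts r s p q) f = halts r (havoc-≋ vs as (frame ok r) s) p (f q)

  -- The invariant is only to mention the variables vs and the arrays as; all
  -- others keep their values in ρ.
  while : ∀ vs as (I : ℕ → Store → Set) {e f C ρ k} {ok : IsTrue (writesOnly vs as C)} →
    (∀ {k σ} → I k σ → let ρ′ = havoc vs as ρ σ in
       eval w ρ′ e < eval w ρ′ f →
       ∃[ k′ ] suc (cost e + cost f) + k′ ≤ k × Halts w C ρ′ k′ I) →
    (∀ {k σ} → I k σ → let ρ′ = havoc vs as ρ σ in
       eval w ρ′ f ≤ eval w ρ′ e →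
       ∃[ k′ ] suc (cost e + cost f) + k′ ≤ k × Q k′ ρ′) →
    I k ρ → Halts w (whileLess e f C) ρ k Q
  while vs as I {e} {f} {C} {ρ} {k} {ok} body exit i₀ =
    -- Testing the guard costs at least one unit, so the time left decreases and serves as the
    -- termination measure.
    go (<-wellFounded k) i₀ (havoc-≋ vs as ((λ _ _ → refl) , (λ _ _ → refl)) ≋-refl)
    where
    g = suc (cost e + cost f)
    go : ∀ {k σ τ} → Acc _<_ k → I k σ → τ ≋ havoc vs as ρ σ →
         Halts w (whileLess e f C) τ k Q
    go {k} {σ} (acc rs) i eq with <-or-≥ (eval w (havoc vs as ρ σ) e) (eval w (havoc vs as ρ σ) f)
    ... | inj₂ ge with exit i ge
    ...   | k′ , p , q = ≋-halts eq (halts (while-no ge) ≋-refl p q)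
    go {k} {σ} (acc rs) i eq | inj₁ lt with body i lt
    ... | k′ , p , halts {time = t} {left} r s p₂ i′ with frame {vs = vs} {as} ok r
    ...   | fv , fa with go {left} (rs (≤-trans (s≤s (≤-trans (m≤n+m left t)
        (≤-trans p₂ (m≤n+m k′ (cost e + cost f))))) p))
                     i′ (havoc-≋ vs as ((λ x q → trans (fv x q) (keepv x q)) , (λ a q → trans (fa a q) (keepa a q))) s)
      where
      keepv : ∀ x → mem x vs ≡ false → vars (havoc vs as ρ σ) x ≡ vars ρ x
      keepv x q rewrite q = refl
      keepa : ∀ a → mem a as ≡ false → arrs (havoc vs as ρ σ) a ≡ arrs ρ a
      keepa a q rewrite q = refl
    ...     | halts {time = t₂} {left₂} r₂ s₂ p₃ q =
      ≋-halts eq (halts (while-yes lt r r₂) s₂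
        (≤-trans (arith g t t₂ left₂) (≤-trans (+-monoʳ-≤ g (≤-trans (+-monoʳ-≤ t p₃) p₂)) p)) q)
      where
      arith : ∀ g t t₂ l → g + (t + t₂) + l ≤ g + (t + (t₂ + l))
      arith g t t₂ l = ≤-reflexive (solve (g ∷ t ∷ t₂ ∷ l ∷ []))

module _ {w : ℕ} {Q : ℕ → Store → Set} where

  asg⨾ : ∀ {x e D ρ k v} → eval w ρ e ≡ v →
         Halts w D (store (vars ρ [ x ↦ v ]) (arrs ρ)) k Q →
         Halts w (x ≔ e ⨾ D) ρ (suc (cost e) + k) Q
  asg⨾ {x} {ρ = ρ} {k} {v} eq h =
    asg {Q = λ l σ → l ≡ k × σ ≡ store (vars ρ [ x ↦ v ]) (arrs ρ)} eq (refl , refl) then λ { (refl , refl) → h }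

  wrt⨾ : ∀ {a e f D ρ k i v} → eval w ρ e ≡ i → eval w ρ f ≡ v →
         Halts w D (store (vars ρ) (arrs ρ [ a ↦ arrs ρ a [ i ↦ v ] ])) k Q →
         Halts w (a [ e ]≔ f ⨾ D) ρ (suc (cost e + cost f) + k) Q
  wrt⨾ {a} {ρ = ρ} {k} {i} {v} eq eq′ h =
    wrt {Q = λ l σ → l ≡ k × σ ≡ store (vars ρ) (arrs ρ [ a ↦ arrs ρ a [ i ↦ v ] ])} eq eq′ (refl , refl) then
        λ { (refl , refl) → h }

  skip⨾ : ∀ {D ρ k} → Halts w D ρ k Q → Halts w (skip ⨾ D) ρ (suc k) Q
  skip⨾ {ρ = ρ} {k} h = skip! {Q = λ l σ → l ≡ k × σ ≡ ρ} (refl , refl) then λ { (refl , refl) → h }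

  assoc⨾ : ∀ {C D E ρ k} → Halts w (C ⨾ D ⨾ E) ρ k Q → Halts w ((C ⨾ D) ⨾ E) ρ k Q
  assoc⨾ {k = k} (halts {left = l} (seq {s = s} r (seq {s = s′} {t} r′ r″)) eq p q) =
    halts (seq (seq r r′) r″) eq (subst (λ x → x + l ≤ k) (sym (+-assoc s s′ t)) p) q

  -- The continuation `E` is proved once in each branch, so the branches need no common
  -- postcondition.
  ifl⨾ : ∀ {e f C D E ρ k} →
         (eval w ρ e < eval w ρ f → Halts w (C ⨾ E) ρ k Q) →
         (eval w ρ f ≤ eval w ρ e → Halts w (D ⨾ E) ρ k Q) →
         Halts w (ifLess e f C D ⨾ E) ρ (suc (cost e + cost f) + k) Q
  ifl⨾ {e} {f} {ρ = ρ} yes′ no′ with <-or-≥ (eval w ρ e) (eval w ρ f)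
  ... | inj₁ lt with yes′ lt
  ...   | halts (seq {s = s} {t} r r′) eq p q = halts (seq (if-yes lt r) r′) eq
    (≤-trans (arith (suc (cost e + cost f)) s t _) (+-monoʳ-≤ (suc (cost e + cost f)) p)) q
    where
    arith : ∀ g s t l → g + s + t + l ≤ g + (s + t + l)
    arith g s t l = ≤-reflexive (solve (g ∷ s ∷ t ∷ l ∷ []))
  ifl⨾ {e} {f} {ρ = ρ} yes′ no′ | inj₂ ge with no′ ge
  ...   | halts (seq {s = s} {t} r r′) eq p q = halts (seq (if-no ge r) r′) eq
    (≤-trans (arith (suc (cost e + cost f)) s t _) (+-monoʳ-≤ (suc (cost e + cost f)) p)) q
    where
    arith : ∀ g s t l → g + s + t + l ≤ g + (s + t + l)
    arith g s t l = ≤-reflexive (solve (g ∷ s ∷ t ∷ l ∷ []))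

  call⨾ : ∀ vs as {C D ρ k R} {ok : IsTrue (writesOnly vs as C)} → Halts w C ρ k R →
          (∀ {k′ σ} → R k′ σ → Halts w D (havoc vs as ρ σ) k′ Q) → Halts w (C ⨾ D) ρ k Q
  call⨾ vs as {ρ = ρ} {R = R} {ok} h f =
    call {Q = λ l τ → ∃[ σ ] (R l σ × τ ≡ havoc vs as ρ σ)} vs as {ok = ok} h (λ r → _ , r , refl)
    then λ { (_ , r , refl) → f r }

  while⨾ : ∀ vs as (I : ℕ → Store → Set) {e f C D ρ k} {ok : IsTrue (writesOnly vs as C)} →
    (∀ {k σ} → I k σ → let ρ′ = havoc vs as ρ σ in
       eval w ρ′ e < eval w ρ′ f →
       ∃[ k′ ] suc (cost e + cost f) + k′ ≤ k × Halts w C ρ′ k′ I) →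
    (∀ {k σ} → I k σ → let ρ′ = havoc vs as ρ σ in
       eval w ρ′ f ≤ eval w ρ′ e →
       ∃[ k′ ] suc (cost e + cost f) + k′ ≤ k × Halts w D ρ′ k′ Q) →
    I k ρ → Halts w (whileLess e f C ⨾ D) ρ k Q
  while⨾ vs as I {D = D} {ok = ok} body exit i₀ =
    while {Q = λ l σ → Halts w D σ l Q} vs as I {ok = ok} body exit i₀ then λ h → h

wrap-id : ∀ w {x} → x < 2 ^ w → wrap w x ≡ x
wrap-id w = m<n⇒m%n≡m {{m^n≢0 2 w}}

-- Permutations and blocks of positions

record Perm (N : ℕ) (E P : ℕ → ℕ) : Set where
  field
    E<  : ∀ p → p < N → E p < N
    P<  : ∀ x → x < N → P x < N
    E∘P : ∀ x → x < N → E (P x) ≡ x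
    P∘E : ∀ p → p < N → P (E p) ≡ p

-- J names for each position the block it lies in; blocks are intervals [lo, hi).
record Blocks (N : ℕ) (J lo hi : ℕ → ℕ) (k : ℕ) : Set where
  field
    id<   : ∀ p → p < N → J p < k
    lo≤   : ∀ p → p < N → lo (J p) ≤ p
    <hi   : ∀ p → p < N → p < hi (J p)
    exact : ∀ i p → i < k → lo i ≤ p → p < hi i → p < N × J p ≡ i

module _ {N : ℕ} {J lo hi : ℕ → ℕ} {k : ℕ} (B : Blocks N J lo hi k) where
  open Blocks B

  same-block : ∀ {p q} → p < N → lo (J p) ≤ q → q < hi (J p) → J q ≡ J p
  same-block {p} {q} p<N l h = proj₂ (exact (J p) q (id< p p<N) l h)

  start-injective : ∀ {p q} → p < N → q < N → lo (J p) ≡ lo (J q) → J p ≡ J q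
  start-injective {p} {q} p<N q<N eq with ≤-total p q
  ... | inj₁ p≤q = same-block q<N (≤-trans (≤-reflexive (sym eq)) (lo≤ p p<N)) (≤-<-trans p≤q (<hi q q<N))
  ... | inj₂ q≤p = sym (same-block p<N (≤-trans (≤-reflexive eq) (lo≤ q q<N)) (≤-<-trans q≤p (<hi p p<N)))

  disjoint : ∀ {i j} → i < k → j < k → lo i < lo j → lo j < hi j → hi i ≤ lo j
  disjoint {i} {j} i<k j<k li<lj ne with <-or-≥ (lo j) (hi i)
  ... | inj₂ ge = ge
  ... | inj₁ lt = contradiction
    (cong lo (trans (sym (proj₂ (exact i (lo j) i<k (<⇒≤ li<lj) lt))) (proj₂ (exact j (lo j) j<k ≤-refl ne))))
    (<⇒≢ li<lj)

  start-order : ∀ {p q} → p < N → q < N → lo (J p) < lo (J q) → p < q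
  start-order {p} {q} p<N q<N lt with <-or-≥ p q
  ... | inj₁ p<q = p<q
  ... | inj₂ q≤p = contradiction
    (cong lo (same-block p<N (≤-trans (<⇒≤ lt) (lo≤ q q<N)) (≤-<-trans q≤p (<hi p p<N))))
    (>⇒≢ lt)

  Blocks-cong : ∀ {J′} → (∀ p → p < N → J p ≡ J′ p) → Blocks N J′ lo hi k
  Blocks-cong {J′} eq = record
    { id< = λ p p<N → subst (_< k) (eq p p<N) (id< p p<N)
    ; lo≤ = λ p p<N → subst (λ i → lo i ≤ p) (eq p p<N) (lo≤ p p<N)
    ; <hi = λ p p<N → subst (λ i → p < hi i) (eq p p<N) (<hi p p<N)
    ; exact = λ i p i<k l h → let p<N , e = exact i p i<k l h in p<N , trans (sym (eq p p<N)) e }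

  -- The new name gets the empty interval at `b`. It holds no position yet, so `J` need not change;
  -- `b` is chosen where the block is to grow.
  new-block : ∀ b → Blocks N J (lo [ k ↦ b ]) (hi [ k ↦ b ]) (suc k)
  new-block b = record
    { id< = λ p p<N → m<n⇒m<1+n (id< p p<N)
    ; lo≤ = λ p p<N → subst (_≤ p) (sym (upd≢ lo k b (<⇒≢ (id< p p<N)))) (lo≤ p p<N)
    ; <hi = λ p p<N → subst (p <_) (sym (upd≢ hi k b (<⇒≢ (id< p p<N)))) (<hi p p<N)
    ; exact = ex }
    where
    ex : ∀ i p → i < suc k → (lo [ k ↦ b ]) i ≤ p → p < (hi [ k ↦ b ]) i → p < N × J p ≡ i
    ex i p i< l h with i ≟ k
    ... | yes refl rewrite upd≡ lo i b | upd≡ hi i b = contradiction (≤-<-trans l h) (<-irrefl refl)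
    ... | no i≢k rewrite upd≢ lo k b i≢k | upd≢ hi k b i≢k = exact i p (≤∧≢⇒< (≤-pred i<) i≢k) l h

no-blocks : ∀ {J lo hi} → Blocks 0 J lo hi 0
no-blocks = record { id< = λ _ () ; lo≤ = λ _ () ; <hi = λ _ () ; exact = λ _ _ () }

extend-last : ∀ {N J J′ lo hi k} → Blocks N J lo (hi [ k ↦ N ]) (suc k) → lo k ≤ N →
  (∀ p → p < N → J′ p ≡ J p) → J′ N ≡ k → Blocks (suc N) J′ lo (hi [ k ↦ suc N ]) (suc k)
extend-last {N} {J} {J′} {lo} {hi} {k} B lo≤N eq eqN = record
  { id< = id<′ ; lo≤ = lo≤′ ; <hi = <hi′ ; exact = ex }
  where
  open Blocks B
  split : ∀ {p} → p < suc N → p < N ⊎ p ≡ N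
  split p< = m≤n⇒m<n∨m≡n (≤-pred p<)
  id<′ : ∀ p → p < suc N → J′ p < suc k
  id<′ p p< with split p<
  ... | inj₁ p<N rewrite eq p p<N = id< p p<N
  ... | inj₂ refl rewrite eqN = ≤-refl
  lo≤′ : ∀ p → p < suc N → lo (J′ p) ≤ p
  lo≤′ p p< with split p<
  ... | inj₁ p<N rewrite eq p p<N = lo≤ p p<N
  ... | inj₂ refl rewrite eqN = lo≤N
  <hi′ : ∀ p → p < suc N → p < (hi [ k ↦ suc N ]) (J′ p)
  <hi′ p p< with split p<
  ... | inj₂ refl rewrite eqN | upd≡ hi k (suc N) = ≤-refl
  ... | inj₁ p<N rewrite eq p p<N with J p ≟ k | <hi p p<N
  ...   | yes e | _ rewrite e | upd≡ hi k (suc N) = m<n⇒m<1+n p<N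
  ...   | no ne | h rewrite upd≢ hi k (suc N) ne | upd≢ hi k N ne = h
  ex : ∀ i p → i < suc k → lo i ≤ p → p < (hi [ k ↦ suc N ]) i → p < suc N × J′ p ≡ i
  ex i p i< l h with i ≟ k
  ... | no ne rewrite upd≢ hi k (suc N) ne with exact i p i< l (subst (p <_) (sym (upd≢ hi k N ne)) h)
  ...   | p<N , e = m<n⇒m<1+n p<N , trans (eq p p<N) e
  ex i p i< l h | yes refl rewrite upd≡ hi i (suc N) with split h
  ... | inj₂ refl = ≤-refl , eqN
  ... | inj₁ p<N = m<n⇒m<1+n p<N ,
    trans (eq p p<N) (proj₂ (exact i p i< l (subst (p <_) (sym (upd≡ hi i N)) p<N)))

-- The entries for `s` and `v` are written last and override the first ones, so the formula also
-- covers the case that `v` already stands at `s`.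
swap-perm : ∀ {N E P} → Perm N E P → ∀ {v s} → v < N → s < N →
  Perm N ((E [ P v ↦ E s ]) [ s ↦ v ]) ((P [ E s ↦ P v ]) [ v ↦ s ])
swap-perm {N} {E} {P} π {v} {s} v<N s<N = record
  { E< = λ p p<N → upd-elim {f = E₁} (λ _ x → x < N) v<N p λ _ →
      upd-elim {f = E} (λ _ x → x < N) (E< s s<N) p λ _ → E< p p<N
  ; P< = λ x x<N → upd-elim {f = P₁} (λ _ p → p < N) s<N x λ _ →
      upd-elim {f = P} (λ _ p → p < N) (P< v v<N) x λ _ → P< x x<N
  ; E∘P = ep ; P∘E = pe }
  where
  open Perm π
  E₁ = E [ P v ↦ E s ]
  P₁ = P [ E s ↦ P v ]
  ep : ∀ x → x < N → (E₁ [ s ↦ v ]) ((P₁ [ v ↦ s ]) x) ≡ x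
  ep x x<N with x ≟ v
  ... | yes refl rewrite upd≡ P₁ x s = upd≡ E₁ s x
  ... | no x≢v rewrite upd≢ P₁ v s x≢v with x ≟ E s
  ...   | yes refl rewrite upd≡ P (E s) (P v) = trans (upd≢ E₁ s v λ Pv≡s →
            x≢v (trans (cong E (sym Pv≡s)) (E∘P v v<N))) (upd≡ E (P v) (E s))
  ...   | no x≢y rewrite upd≢ P (E s) (P v) x≢y =
    trans (upd≢ E₁ s v λ Px≡s → x≢y (trans (sym (E∘P x x<N)) (cong E Px≡s)))
      (trans (upd≢ E (P v) (E s) λ eq → x≢v (trans (sym (E∘P x x<N)) (trans (cong E eq) (E∘P v v<N))))
        (E∘P x x<N))
  pe : ∀ p → p < N → (P₁ [ v ↦ s ]) ((E₁ [ s ↦ v ]) p) ≡ p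
  pe p p<N with p ≟ s
  ... | yes refl rewrite upd≡ E₁ p v = upd≡ P₁ v p
  ... | no p≢s rewrite upd≢ E₁ s v p≢s with p ≟ P v
  ...   | yes refl rewrite upd≡ E (P v) (E s) = trans (upd≢ P₁ v s λ Es≡v →
            p≢s (trans (cong P (sym Es≡v)) (P∘E s s<N))) (upd≡ P (E s) (P v))
  ...   | no p≢Pv rewrite upd≢ E (P v) (E s) p≢Pv =
    trans (upd≢ P₁ v s λ Ep≡v → p≢Pv (trans (sym (P∘E p p<N)) (cong P Ep≡v)))
      (trans (upd≢ P (E s) (P v) λ eq → p≢s (trans (sym (P∘E p p<N)) (trans (cong P eq) (P∘E s s<N))))
        (P∘E p p<N))

-- Needed for two labellings of the nodes, the fine blocks at the start of a round and the current
-- ones.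
swap-class : ∀ {N E P} → Perm N E P → ∀ {v s} (G : ℕ → ℕ) → v < N → s < N → G v ≡ G (E s) →
  ∀ p → p < N → G (((E [ P v ↦ E s ]) [ s ↦ v ]) p) ≡ G (E p)
swap-class {N} {E} {P} π {v} {s} G v<N s<N eq p p<N with p ≟ s
... | yes refl rewrite upd≡ (E [ P v ↦ E p ]) p v = eq
... | no p≢s rewrite upd≢ (E [ P v ↦ E s ]) s v p≢s with p ≟ P v
...   | yes refl rewrite upd≡ E (P v) (E s) = trans (sym eq) (cong G (sym (Perm.E∘P π v v<N)))
...   | no p≢Pv rewrite upd≢ E (P v) (E s) p≢Pv = refl

module _ {N : ℕ} {J J′ lo hi : ℕ → ℕ} {k : ℕ} (B : Blocks N J lo hi k) {s f : ℕ} (s<N : s < N) (f<k : f < k) (f≢ : f ≢ J s)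
         (at : J′ s ≡ f) (away : ∀ p → p < N → p ≢ s → J′ p ≡ J p) where
  open Blocks B
  private D = J s

  -- The block `f`, possibly empty, ends where `D` begins. Handing over the first position of `D`
  -- only shifts the common boundary, so both remain intervals.
  grow-right : lo D ≡ s → hi f ≡ s → lo f ≤ s → Blocks N J′ (lo [ D ↦ suc s ]) (hi [ f ↦ suc s ]) k
  grow-right loD hif lof = record { id< = i< ; lo≤ = l≤ ; <hi = <h ; exact = ex }
    where
    i< : ∀ p → p < N → J′ p < k
    i< p p<N with p ≟ s
    ... | yes refl rewrite at = f<k
    ... | no p≢s rewrite away p p<N p≢s = id< p p<N
    l≤ : ∀ p → p < N → (lo [ D ↦ suc s ]) (J′ p) ≤ p
    l≤ p p<N with p ≟ s
    ... | yes refl rewrite at | upd≢ lo D (suc s) f≢ = lof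
    ... | no p≢s rewrite away p p<N p≢s with J p ≟ D | lo≤ p p<N
    ...   | yes eq | l rewrite eq | upd≡ lo D (suc s) = ≤∧≢⇒< (subst (_≤ p) loD l) (p≢s ∘ sym)
    ...   | no ne  | l rewrite upd≢ lo D (suc s) ne = l
    <h : ∀ p → p < N → p < (hi [ f ↦ suc s ]) (J′ p)
    <h p p<N with p ≟ s
    ... | yes refl rewrite at | upd≡ hi f (suc s) = ≤-refl
    ... | no p≢s rewrite away p p<N p≢s with J p ≟ f | <hi p p<N
    ...   | yes eq | h rewrite eq | upd≡ hi f (suc s) = m<n⇒m<1+n (subst (p <_) hif h)
    ...   | no ne  | h rewrite upd≢ hi f (suc s) ne = h
    ex : ∀ i p → i < k → (lo [ D ↦ suc s ]) i ≤ p → p < (hi [ f ↦ suc s ]) i → p < N × J′ p ≡ i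
    ex i p i<k l h with i ≟ f
    ... | yes refl rewrite upd≡ hi f (suc s) | upd≢ lo D (suc s) f≢ with m≤n⇒m<n∨m≡n (≤-pred h)
    ...   | inj₂ refl = s<N , at
    ...   | inj₁ p<s with exact f p i<k l (subst (p <_) (sym hif) p<s)
    ...     | p<N , eq = p<N , trans (away p p<N (<⇒≢ p<s)) eq
    ex i p i<k l h | no i≢f rewrite upd≢ hi f (suc s) i≢f with i ≟ D
    ... | yes refl rewrite upd≡ lo D (suc s) with exact D p i<k (subst (_≤ p) (sym loD) (<⇒≤ l)) h
    ...   | p<N , eq = p<N , trans (away p p<N (>⇒≢ l)) eq
    ex i p i<k l h | no i≢f | no i≢D rewrite upd≢ lo D (suc s) i≢D with exact i p i<k l h
    ... | p<N , eq = p<N , trans (away p p<N λ { refl → i≢D (sym eq) }) eq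

  grow-left : hi D ≡ suc s → lo f ≡ suc s → suc s ≤ hi f → Blocks N J′ (lo [ f ↦ s ]) (hi [ D ↦ s ]) k
  grow-left hiD lof hif = record { id< = i< ; lo≤ = l≤ ; <hi = <h ; exact = ex }
    where
    i< : ∀ p → p < N → J′ p < k
    i< p p<N with p ≟ s
    ... | yes refl rewrite at = f<k
    ... | no p≢s rewrite away p p<N p≢s = id< p p<N
    <h : ∀ p → p < N → p < (hi [ D ↦ s ]) (J′ p)
    <h p p<N with p ≟ s
    ... | yes refl rewrite at | upd≢ hi D s f≢ = hif
    ... | no p≢s rewrite away p p<N p≢s with J p ≟ D | <hi p p<N
    ...   | yes eq | h rewrite eq | upd≡ hi D s = ≤∧≢⇒< (≤-pred (subst (p <_) hiD h)) p≢s
    ...   | no ne  | h rewrite upd≢ hi D s ne = h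
    l≤ : ∀ p → p < N → (lo [ f ↦ s ]) (J′ p) ≤ p
    l≤ p p<N with p ≟ s
    ... | yes refl rewrite at | upd≡ lo f p = ≤-refl
    ... | no p≢s rewrite away p p<N p≢s with J p ≟ f | lo≤ p p<N
    ...   | yes eq | l rewrite eq | upd≡ lo f s = <⇒≤ (subst (_≤ p) lof l)
    ...   | no ne  | l rewrite upd≢ lo f s ne = l
    ex : ∀ i p → i < k → (lo [ f ↦ s ]) i ≤ p → p < (hi [ D ↦ s ]) i → p < N × J′ p ≡ i
    ex i p i<k l h with i ≟ f
    ... | yes refl rewrite upd≡ lo f s | upd≢ hi D s f≢ with m≤n⇒m<n∨m≡n l
    ...   | inj₂ refl = s<N , at
    ...   | inj₁ s<p with exact f p i<k (subst (_≤ p) (sym lof) s<p) h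
    ...     | p<N , eq = p<N , trans (away p p<N (>⇒≢ s<p)) eq
    ex i p i<k l h | no i≢f rewrite upd≢ lo f s i≢f with i ≟ D
    ... | yes refl rewrite upd≡ hi D s with exact D p i<k l (subst (p <_) (sym hiD) (m<n⇒m<1+n h))
    ...   | p<N , eq = p<N , trans (away p p<N (<⇒≢ h)) eq
    ex i p i<k l h | no i≢f | no i≢D rewrite upd≢ hi D s i≢D with exact i p i<k l h
    ... | p<N , eq = p<N , trans (away p p<N λ { refl → i≢D (sym eq) }) eq

-- Names of variables and arrays, and word arithmetic

vOut vΣ vm vN vn vi ve vj va vx vK vCnt : ℕ
vOut = 0
vΣ = 1
vm = 2
vN = 4
vn = 5
vi = 6
ve = 7
vj = 8
va = 9
vx = 10
vK = 11
vCnt = 12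

aKEY aHEAD aNEXT aE aP aF afs afe : ℕ
aKEY = 3
aHEAD = 4
aNEXT = 5
aE = 6
aP = 7
aF = 8
afs = 9
afe = 10

bump : ℕ → Cmd
bump x = x ≔ var x ⊕ lit 1

lit-id : ∀ w {k x} → k ≤ x → x < 2 ^ w → wrap w k ≡ k
lit-id w k≤x x< = wrap-id w (≤-<-trans k≤x x<)

inc : ∀ w {x} → suc x < 2 ^ w → wrap w (x + wrap w 1) ≡ suc x
inc w {x} x< = trans (cong (λ y → wrap w (x + y)) (lit-id w (s≤s z≤n) x<))
  (trans (cong (wrap w) (+-comm x 1)) (wrap-id w x<))

zero-id : ∀ w → wrap w 0 ≡ 0
zero-id w = wrap-id w (m^n>0 2 w)

-- Loop invariants count the iterations left, `i + r ≡ K`. Then `r` is a successor in the body, and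
-- a budget `r * t` releases its `t` by computation.
next-left : ∀ {i r K} → i < K → i + r ≡ K → ∃[ r′ ] r ≡ suc r′ × suc i + r′ ≡ K
next-left {i} {zero}  i<K eq = contradiction (trans (sym eq) (+-identityʳ i)) (>⇒≢ i<K)
next-left {i} {suc r} i<K eq = r , refl , trans (sym (+-suc i r)) eq

-- Bucket sort

chain : Cmd
chain =
  vi ≔ lit 0 ⨾
  whileLess (var vi) (var vK) (aHEAD [ var vi ]≔ lit 0 ⨾ bump vi) ⨾
  vi ≔ lit 0 ⨾
  whileLess (var vi) (var vCnt)
    (bump vi ⨾
     va ≔ aKEY [ var vi ] ⨾
     aNEXT [ var vi ]≔ aHEAD [ var va ] ⨾
     aHEAD [ var va ]≔ var vi)

-- The chain of key a is linked from its last index to its first, as the indices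
-- 1, …, c are inserted in order; 0 ends a chain.
Top : (ℕ → ℕ) → ℕ → ℕ → ℕ → Set
Top key h c a = (h ≡ 0 ⊎ (1 ≤ h × key h ≡ a)) × h ≤ c × (∀ i → h < i → i ≤ c → key i ≢ a)

-- `Top` without maximality: enough for an index met on the way down a chain, where `Done` records
-- what has been passed.
On : (ℕ → ℕ) → ℕ → ℕ → ℕ → Set
On key h c a = (h ≡ 0 ⊎ (1 ≤ h × key h ≡ a)) × h ≤ c

record IsChain (head next key : ℕ → ℕ) (c K : ℕ) : Set where
  constructor _,_
  field
    heads : ∀ a → a < K → Top key (head a) c a
    nexts : ∀ i → i < c → Top key (next (suc i)) i (key (suc i))

open IsChain

-- The new index exceeds all inserted ones, so it is the top of its chain, and the former top, saved
-- in `next`, is the top among the smaller indices.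
chain-step : ∀ {head next key c K} → key (suc c) < K → IsChain head next key c K →
  IsChain (head [ key (suc c) ↦ suc c ]) (next [ suc c ↦ head (key (suc c)) ]) key (suc c) K
chain-step {head} {next} {key} {c} {K} key< (tops , nexts) = tops′ , nexts′
  where
  a = key (suc c)
  tops′ : ∀ b → b < K → Top key ((head [ a ↦ suc c ]) b) (suc c) b
  tops′ b b<K = upd-elim {f = head} (λ b h → Top key h (suc c) b)
    (inj₂ (s≤s z≤n , refl) , ≤-refl , λ i lt le → contradiction (<-≤-trans lt le) (<-irrefl refl)) b
    λ b≢a → let s , le , none = tops b b<K in
      s , m≤n⇒m≤1+n le , λ i lt i≤ → case m≤n⇒m<n∨m≡n i≤ of λ where
        (inj₁ i<)   → none i lt (≤-pred i<)
        (inj₂ refl) → b≢a ∘ sym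
  nexts′ : ∀ i → i < suc c → Top key ((next [ suc c ↦ head a ]) (suc i)) i (key (suc i))
  nexts′ i i< = upd-elim {f = next} (λ { zero _ → ⊤ ; (suc i) h → Top key h i (key (suc i)) })
    (tops a key<) (suc i)
    λ i≢c → nexts i (≤∧≢⇒< (≤-pred i<) (i≢c ∘ cong suc))

chainTime : ℕ → ℕ → ℕ → ℕ
chainTime K c k = 2 + (K * 10 + (5 + (c * 17 + (3 + k))))

chain-halts : ∀ {w ρ k} → let K = vars ρ vK; c = vars ρ vCnt; key = arrs ρ aKEY in
  K < 2 ^ w → c < 2 ^ w → (∀ i → i < c → key (suc i) < K) →
  Halts w chain ρ (chainTime K c k)
    (λ k′ σ → k′ ≡ k × IsChain (arrs σ aHEAD) (arrs σ aNEXT) key c K)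
chain-halts {w} {ρ} {k} K< c< keys =
  asg⨾ (zero-id w)
  (while⨾ (vi ∷ []) (aHEAD ∷ []) I₁
    (λ { {σ = σ} (i≤ , r , eq , z , p) i<K → case next-left i<K eq of λ where
      (r′ , refl , eq′) → _ , p ,
        wrt⨾ refl (zero-id w) (asg (inc w (≤-<-trans i<K K<))
          (i<K , r′ , eq′ ,
           (λ a a≤ → upd-elim {f = arrs σ aHEAD} (λ _ h → h ≡ 0) refl a
             (λ a≢ → z a (≤∧≢⇒< (≤-pred a≤) a≢))) , ≤-refl)) })
    (λ { {σ = σ} (i≤ , r , eq , z , p) K≤i → _ , ≤-trans (m≤n+m _ (r * 10)) p ,
      asg⨾ (zero-id w)
      (while (vi ∷ va ∷ []) (aHEAD ∷ aNEXT ∷ []) I₂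
        (λ { {σ = σ} (r , eq , ch , p) i<c → case next-left i<c eq of λ where
          (r′ , refl , eq′) → _ , p ,
            asg⨾ (inc w (≤-<-trans i<c c<)) (asg⨾ refl (wrt⨾ refl refl (wrt refl refl
              (r′ , eq′ , chain-step (keys _ i<c) ch , ≤-refl)))) })
        (λ { {σ = σ} (r , eq , ch , p) c≤i → _ , ≤-trans (m≤n+m _ (r * 17)) p , refl ,
          subst (λ c → IsChain (arrs σ aHEAD) (arrs σ aNEXT) key c K)
            (≤-antisym (m+n≤o⇒m≤o _ (≤-reflexive eq)) c≤i) ch })
        (c , refl , ((λ a a<K → inj₁ (z a (<-≤-trans a<K K≤i)) ,
            ≤-reflexive (z a (<-≤-trans a<K K≤i)) ,
            λ i lt le → contradiction (<-≤-trans lt le) λ ()) , λ _ ()) , ≤-refl)) })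
    (z≤n , K , refl , (λ _ ()) , ≤-refl))
  where
  K = vars ρ vK
  c = vars ρ vCnt
  key = arrs ρ aKEY
  I₁ I₂ : ℕ → Store → Set
  I₁ l σ = vars σ vi ≤ K × ∃[ r ] (vars σ vi + r ≡ K ×
    (∀ a → a < vars σ vi → arrs σ aHEAD a ≡ 0) × r * 10 + (3 + (2 + (c * 17 + (3 + k)))) ≤ l)
  I₂ l σ = ∃[ r ] (vars σ vi + r ≡ c ×
    IsChain (arrs σ aHEAD) (arrs σ aNEXT) key (vars σ vi) K × r * 17 + (3 + k) ≤ l)

drain : Cmd
drain =
  whileLess (lit 0) (var ve)
    (vx ≔ var ve ⊖ lit 1 ⨾
     aE [ var vj ]≔ var vx ⨾
     aP [ var vx ]≔ var vj ⨾
     aF [ var vx ]≔ var va ⨾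
     bump vj ⨾
     ve ≔ aNEXT [ var ve ])

spread : Cmd
spread =
  vj ≔ lit 0 ⨾
  va ≔ lit 0 ⨾
  whileLess (var va) (var vK)
    (afs [ var va ]≔ var vj ⨾
     ve ≔ aHEAD [ var va ] ⨾
     drain ⨾
     afe [ var va ]≔ var vj ⨾
     bump va)

module _ (key : ℕ → ℕ) (N : ℕ) where

  -- A chain is emptied from its largest index down; node y has index suc y.
  Done : ℕ → ℕ → ℕ → Set
  Done a e y = key (suc y) < a ⊎ (key (suc y) ≡ a × e < suc y)

  record Placing (E P F : ℕ → ℕ) (j a e : ℕ) : Set where
    field
      node : ∀ x → x < N → Done a e x → P x < j × E (P x) ≡ x
      posE : ∀ p → p < j → E p < N
      posP : ∀ p → p < j → P (E p) ≡ p
      posD : ∀ p → p < j → Done a e (E p)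
      posF : ∀ p → p < j → F (E p) ≡ key (suc (E p))

    j≤N : j ≤ N
    j≤N = retract-≤ E P posE posP

  open Placing

  shift : ∀ {E P F j a e a′ e′} → (∀ y → y < N → Done a e y → Done a′ e′ y) →
          (∀ y → y < N → Done a′ e′ y → Done a e y) → Placing E P F j a e → Placing E P F j a′ e′
  shift to from pl = record
    { node = λ x x<N d → node pl x x<N (from x x<N d)
    ; posE = posE pl ; posP = posP pl
    ; posD = λ p p<j → to _ (posE pl p p<j) (posD pl p p<j)
    ; posF = posF pl }

  -- With `N` as well as with the head of the chain, no node of bucket `a` counts as done.
  bucket-start : ∀ {E P F j a e} → Top key e N a → Placing E P F j a N → Placing E P F j a e
  bucket-start (_ , _ , none) = shift
    (λ { y y<N (inj₁ lt) → inj₁ lt ; y y<N (inj₂ (_ , lt)) → contradiction (<-≤-trans lt y<N) (<-irrefl refl) })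
    (λ { y y<N (inj₁ lt) → inj₁ lt ; y y<N (inj₂ (eq , lt)) → contradiction eq (none (suc y) lt y<N) })

  bucket-end : ∀ {E P F j a} → Placing E P F j a 0 → Placing E P F j (suc a) N
  bucket-end = shift
    (λ { y y<N (inj₁ lt) → inj₁ (m<n⇒m<1+n lt) ; y y<N (inj₂ (eq , _)) → inj₁ (s≤s (≤-reflexive eq)) })
    (λ { y y<N (inj₁ lt) → case m≤n⇒m<n∨m≡n (≤-pred lt) of λ where
           (inj₁ lt′) → inj₁ lt′
           (inj₂ eq)  → inj₂ (eq , s≤s z≤n)
       ; y y<N (inj₂ (_ , lt)) → contradiction (<-≤-trans lt y<N) (<-irrefl refl) })

  place : ∀ {E P F j a x e} → key (suc x) ≡ a → x < N → Top key e x a → Placing E P F j a (suc x) →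
          Placing (E [ j ↦ x ]) (P [ x ↦ j ]) (F [ x ↦ a ]) (suc j) a e
  place {E} {P} {F} {j} {a} {x} {e} keyx x<N (_ , e≤x , none) pl = record
    { node = nd
    ; posE = λ p p< → upd-elim {f = E} (λ _ y → y < N) x<N p λ p≢j → posE pl p (lt p< p≢j)
    ; posP = λ p p< → pP p p<
    ; posD = λ p p< → upd-elim {f = E} (λ _ y → Done a e y) (inj₂ (keyx , s≤s e≤x)) p
        λ p≢j → case posD pl p (lt p< p≢j) of λ where
          (inj₁ l)       → inj₁ l
          (inj₂ (k , l)) → inj₂ (k , ≤-<-trans (m≤n⇒m≤1+n e≤x) l)
    ; posF = λ p p< → pF p p< }
    where
    lt : ∀ {p} → p < suc j → p ≢ j → p < j
    lt p< p≢j = ≤∧≢⇒< (≤-pred p<) p≢j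
    old≢x : ∀ {p} → p < j → E p ≢ x
    old≢x {p} p<j refl = case posD pl p p<j of λ where
      (inj₁ l)       → <⇒≢ l keyx
      (inj₂ (_ , l)) → <-irrefl refl l
    pP : ∀ p → p < suc j → (P [ x ↦ j ]) ((E [ j ↦ x ]) p) ≡ p
    pP p p< with p ≟ j
    ... | yes refl rewrite upd≡ E p x = upd≡ P x p
    ... | no p≢j rewrite upd≢ E j x p≢j = trans (upd≢ P x j (old≢x (lt p< p≢j))) (posP pl p (lt p< p≢j))
    pF : ∀ p → p < suc j → (F [ x ↦ a ]) ((E [ j ↦ x ]) p) ≡ key (suc ((E [ j ↦ x ]) p))
    pF p p< with p ≟ j
    ... | yes refl rewrite upd≡ E p x = trans (upd≡ F x a) (sym keyx)
    ... | no p≢j rewrite upd≢ E j x p≢j = trans (upd≢ F x a (old≢x (lt p< p≢j))) (posF pl p (lt p< p≢j))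
    was : ∀ y → y < N → y ≢ x → Done a e y → Done a (suc x) y
    was y y<N y≢x (inj₁ l) = inj₁ l
    was y y<N y≢x (inj₂ (k , l)) = inj₂ (k , ≰⇒> λ le →
      none (suc y) l (≤∧≢⇒< (≤-pred le) y≢x) k)
    nd : ∀ y → y < N → Done a e y → (P [ x ↦ j ]) y < suc j × (E [ j ↦ x ]) ((P [ x ↦ j ]) y) ≡ y
    nd y y<N d with y ≟ x
    ... | yes refl rewrite upd≡ P y j = ≤-refl , upd≡ E j y
    ... | no y≢x rewrite upd≢ P x j y≢x with node pl y y<N (was y y<N y≢x d)
    ...   | l , eq = m<n⇒m<1+n l , trans (upd≢ E j x (<⇒≢ l)) eq

record Sorted (N K : ℕ) (key E P F fs fe : ℕ → ℕ) : Set where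
  field
    perm   : Perm N E P
    blocks : Blocks N (F ∘ E) fs fe K
    F≡key  : ∀ x → x < N → F x ≡ key (suc x)
    mono   : ∀ p q → p ≤ q → q < N → F (E p) ≤ F (E q)

Mono : (ℕ → ℕ) → ℕ → Set
Mono J j = ∀ p q → p ≤ q → q < j → J p ≤ J q

mono-extend : ∀ {J J′ j a} → (∀ p → p < j → J p < suc a) → (∀ p → p < j → J′ p ≡ J p) →
  J′ j ≡ a → Mono J j → Mono J′ (suc j)
mono-extend {J} {J′} {j} lt eq eqj mo p q p≤q q< with m≤n⇒m<n∨m≡n (≤-pred q<)
... | inj₁ q<j rewrite eq q q<j | eq p (≤-<-trans p≤q q<j) = mo p q p≤q q<j
... | inj₂ refl rewrite eqj with m≤n⇒m<n∨m≡n p≤q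
...   | inj₁ p<j rewrite eq p p<j = ≤-pred (lt p p<j)
...   | inj₂ refl = ≤-reflexive eqj

-- `afe` is written only after the bucket is drained, so meanwhile the blocks are stated with the
-- end `fe [ a ↦ vj ]` that will be written. `s` counts the positions still free and is passed on
-- from bucket to bucket, so the nodes are paid for over all buckets together.
drain-halts : ∀ {w ρ k K N key fs fe} C → let a = vars ρ va in
  K < 2 ^ w → N < 2 ^ w → a < K → IsChain (arrs ρ aHEAD) (arrs ρ aNEXT) key N K → fs a ≤ vars ρ vj →
  On key (vars ρ ve) N a → ∀ s → vars ρ vj + s ≡ N →
  Placing key N (arrs ρ aE) (arrs ρ aP) (arrs ρ aF) (vars ρ vj) a (vars ρ ve) →
  Blocks (vars ρ vj) (arrs ρ aF ∘ arrs ρ aE) fs (fe [ a ↦ vars ρ vj ]) (suc a) →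
  Mono (arrs ρ aF ∘ arrs ρ aE) (vars ρ vj) → s * 23 + (3 + C) ≤ k →
  Halts w drain ρ k (λ k′ σ → ∃[ s ] (vars σ vj + s ≡ N ×
    Placing key N (arrs σ aE) (arrs σ aP) (arrs σ aF) (vars σ vj) a 0 ×
    Blocks (vars σ vj) (arrs σ aF ∘ arrs σ aE) fs (fe [ a ↦ vars σ vj ]) (suc a) ×
    Mono (arrs σ aF ∘ arrs σ aE) (vars σ vj) × s * 23 + C ≤ k′))
drain-halts {w} {ρ} {k} {K} {N} {key} {fs} {fe} C K< N< a<K ch l≤j tp s eqs pl bl mo p =
  while (vj ∷ ve ∷ vx ∷ []) (aE ∷ aP ∷ aF ∷ []) I
    (λ { (s , eqs , tp , pl , bl , l≤j , mo , p) e>0 → body s eqs tp pl bl l≤j mo p (subst (_< _) (zero-id w) e>0) })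
    (λ { {σ = σ} (s , eqs , tp , pl , bl , l≤j , mo , p) e≤0 → s * 23 + C ,
      ≤-trans (≤-reflexive (arith (s * 23) C)) p , s , eqs ,
      subst (Placing key N _ _ _ _ _) (n≤0⇒n≡0 (subst (vars σ ve ≤_) (zero-id w) e≤0)) pl , bl , mo , ≤-refl })
    (s , eqs , tp , pl , bl , l≤j , mo , p)
  where
  a = vars ρ va
  open Placing
  arith : ∀ s c → 3 + (s + c) ≡ s + (3 + c)
  arith s c = solve (s ∷ c ∷ [])
  I : ℕ → Store → Set
  I l σ = ∃[ s ] (vars σ vj + s ≡ N × On key (vars σ ve) N a ×
    Placing key N (arrs σ aE) (arrs σ aP) (arrs σ aF) (vars σ vj) a (vars σ ve) ×
    Blocks (vars σ vj) (arrs σ aF ∘ arrs σ aE) fs (fe [ a ↦ vars σ vj ]) (suc a) ×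
    fs a ≤ vars σ vj ×
    Mono (arrs σ aF ∘ arrs σ aE) (vars σ vj) ×
    s * 23 + (3 + C) ≤ l)
  body : ∀ {l σ} s → vars σ vj + s ≡ N → On key (vars σ ve) N a →
    Placing key N (arrs σ aE) (arrs σ aP) (arrs σ aF) (vars σ vj) a (vars σ ve) →
    Blocks (vars σ vj) (arrs σ aF ∘ arrs σ aE) fs (fe [ a ↦ vars σ vj ]) (suc a) →
    fs a ≤ vars σ vj → Mono (arrs σ aF ∘ arrs σ aE) (vars σ vj) →
    s * 23 + (3 + C) ≤ l → 0 < vars σ ve →
    ∃[ k′ ] 3 + k′ ≤ l × Halts w
      (vx ≔ var ve ⊖ lit 1 ⨾ aE [ var vj ]≔ var vx ⨾ aP [ var vx ]≔ var vj ⨾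
       aF [ var vx ]≔ var va ⨾ bump vj ⨾ ve ≔ aNEXT [ var ve ])
      (havoc (vj ∷ ve ∷ vx ∷ []) (aE ∷ aP ∷ aF ∷ []) ρ σ) k′ I
  body {l} {σ} s eqs (inj₁ e≡0 , _) pl bl l≤j mo p e>0 = contradiction e≡0 (>⇒≢ e>0)
  body {l} {σ} s eqs (inj₂ (_ , keye) , e≤N) pl bl l≤j mo p e>0 = case next-left j<N eqs of λ {
    (s′ , refl , eq′) → 20 + (s′ * 23 + (3 + C)) , p ,
      asg⨾ (cong (e ∸_) (lit-id w (s≤s z≤n) (≤-<-trans j<N N<)))
      (wrt⨾ refl refl (wrt⨾ refl refl (wrt⨾ refl refl (asg⨾ (inc w (≤-<-trans j<N N<)) (asg refl
        (s′ , eq′ , nexton , pl′ , extend-last bl l≤j old new , m≤n⇒m≤1+n l≤j ,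
         mono-extend (Blocks.id< bl) old new mo , ≤-refl)))))) }
    where
    j = vars σ vj
    E = arrs σ aE
    P = arrs σ aP
    F = arrs σ aF
    e = vars σ ve
    x = e ∸ 1
    e≡ : suc x ≡ e
    e≡ = m+[n∸m]≡n e>0
    x<N : x < N
    x<N = subst (_≤ N) (sym e≡) e≤N
    keyx : key (suc x) ≡ a
    keyx = trans (cong key e≡) keye
    top-x : Top key (arrs ρ aNEXT e) x a
    top-x = subst₂ (λ i b → Top key (arrs ρ aNEXT i) x b) e≡ keyx (nexts ch x x<N)
    nexton : On key (arrs ρ aNEXT e) N a
    nexton = proj₁ top-x , ≤-trans (proj₁ (proj₂ top-x)) (<⇒≤ x<N)
    pl-x : Placing key N E P F j a (suc x)
    pl-x = subst (Placing key N E P F j a) (sym e≡) pl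
    pl′ : Placing key N (E [ j ↦ x ]) (P [ x ↦ j ]) (F [ x ↦ a ]) (suc j) a (arrs ρ aNEXT e)
    pl′ = place key N keyx x<N top-x pl-x
    -- Read off after the fact: `pl′` already has `suc j` distinct nodes placed.
    j<N : j < N
    j<N = j≤N pl′
    old : ∀ p → p < j → (F [ x ↦ a ]) ((E [ j ↦ x ]) p) ≡ F (E p)
    old p p<j rewrite upd≢ E j x (<⇒≢ p<j) = upd≢ F x a λ Ep≡x → case posD pl-x p p<j of λ where
      (inj₁ l)       → <⇒≢ l (trans (cong (key ∘ suc) Ep≡x) keyx)
      (inj₂ (_ , l)) → <-irrefl (sym (cong suc Ep≡x)) l
    new : (F [ x ↦ a ]) ((E [ j ↦ x ]) j) ≡ a
    new rewrite upd≡ E j x = upd≡ F x a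

spread-halts : ∀ {w ρ k} → let K = vars ρ vK; N = vars ρ vCnt; key = arrs ρ aKEY in
  K < 2 ^ w → N < 2 ^ w → (∀ i → i < N → key (suc i) < K) →
  IsChain (arrs ρ aHEAD) (arrs ρ aNEXT) key N K →
  Halts w spread ρ (4 + (K * 19 + (N * 23 + (3 + k))))
    (λ k′ σ → k′ ≡ k × Sorted N K key (arrs σ aE) (arrs σ aP) (arrs σ aF) (arrs σ afs) (arrs σ afe))
spread-halts {w} {ρ} {k} K< N< keys ch =
  asg⨾ (zero-id w) (asg⨾ (zero-id w)
  (while (va ∷ vj ∷ ve ∷ vx ∷ []) (aE ∷ aP ∷ aF ∷ afs ∷ afe ∷ []) I₁
    (λ { {σ = σ} (r , s , eq , eqs , pl , bl , mo , p) a<K → case next-left a<K eq of λ where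
      (r′ , refl , eq′) → 16 + (r′ * 19 + (s * 23 + (3 + k))) , p ,
        wrt⨾ refl refl (asg⨾ refl
        (call⨾ (vj ∷ ve ∷ vx ∷ []) (aE ∷ aP ∷ aF ∷ [])
          (drain-halts {key = key} {fs = arrs σ afs [ vars σ va ↦ vars σ vj ]} {fe = arrs σ afe}
            (7 + (r′ * 19 + (3 + k))) K< N< a<K ch (≤-reflexive (upd≡ (arrs σ afs) _ _))
            (let t , le , _ = heads ch _ a<K in t , le) s eqs (bucket-start key N (heads ch _ a<K) pl)
            (new-block bl _) mo (≤-reflexive (arith₁ (r′ * 19) (s * 23) k)))
          λ { (s , eqs , pl , bl , mo , p) → weaken p (weaken (≤-reflexive (arith₂ (r′ * 19) (s * 23) k))
            (wrt⨾ refl refl (asg (inc w (≤-<-trans a<K K<))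
              (r′ , s , eq′ , eqs , bucket-end key N pl , bl , mo , ≤-refl)))) })) })
    (λ { {σ = σ} (r , s , eq , eqs , pl , bl , mo , p) K≤a →
      k , ≤-trans (m≤n+m _ (s * 23)) (≤-trans (m≤n+m _ (r * 19)) p) , refl ,
      finish (≤-antisym (m+n≤o⇒m≤o _ (≤-reflexive eq)) K≤a) pl bl mo })
    (K , N , refl , refl ,
      record { node = λ { x x<N (inj₂ (_ , lt)) → contradiction (<-≤-trans lt x<N) (<-irrefl refl) }
             ; posE = λ _ () ; posP = λ _ () ; posD = λ _ () ; posF = λ _ () } ,
      no-blocks , (λ _ _ _ ()) , ≤-refl)))
  where
  K = vars ρ vK
  N = vars ρ vCnt
  key = arrs ρ aKEY
  I₁ : ℕ → Store → Set
  I₁ l σ = ∃[ r ] ∃[ s ] (vars σ va + r ≡ K × vars σ vj + s ≡ N ×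
    Placing key N (arrs σ aE) (arrs σ aP) (arrs σ aF) (vars σ vj) (vars σ va) N ×
    Blocks (vars σ vj) (arrs σ aF ∘ arrs σ aE) (arrs σ afs) (arrs σ afe) (vars σ va) ×
    Mono (arrs σ aF ∘ arrs σ aE) (vars σ vj) ×
    r * 19 + (s * 23 + (3 + k)) ≤ l)
  arith₁ : ∀ r s k → s + (10 + (r + (3 + k))) ≡ 10 + (r + (s + (3 + k)))
  arith₁ r s k = solve (r ∷ s ∷ k ∷ [])
  arith₂ : ∀ r s k → 7 + (r + (s + (3 + k))) ≡ s + (7 + (r + (3 + k)))
  arith₂ r s k = solve (r ∷ s ∷ k ∷ [])
  finish : ∀ {E P F j a fs fe} → a ≡ K → Placing key N E P F j a N →
    Blocks j (F ∘ E) fs fe a → Mono (F ∘ E) j → Sorted N K key E P F fs fe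
  -- All nodes are placed, so pigeonhole bounds in both directions give `j ≡ N`.
  finish {E} {P} {F} {j} refl pl bl mo = go (≤-antisym (j≤N pl)
      (retract-≤ P E (λ x x<N → proj₁ (at x x<N)) (λ x x<N → proj₂ (at x x<N))))
    where
    open Placing
    at : ∀ x → x < N → P x < j × E (P x) ≡ x
    at x x<N = node pl x x<N (inj₁ (keys x x<N))
    go : j ≡ N → Sorted N K key E P F _ _
    go refl = record
      { perm = record { E< = posE pl ; P< = λ x x<N → proj₁ (at x x<N)
                      ; E∘P = λ x x<N → proj₂ (at x x<N) ; P∘E = posP pl }
      ; blocks = bl
      ; F≡key = λ x x<N → subst (λ y → F y ≡ key (suc y)) (proj₂ (at x x<N)) (posF pl (P x) (proj₁ (at x x<N)))
      ; mono = mo }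

-- Ordered partition refinement

-- A node x < n stands for the infimum and a node x ≥ n for the supremum of the
-- reversed strings of a state; W x y says that some such string for x is below
-- some such string for y.
record Graph : Set₁ where
  field
    n N M       : ℕ
    lab src tgt : ℕ → ℕ
    W           : ℕ → ℕ → Set
    src<    : ∀ e → e < M → src e < N
    tgt<    : ∀ e → e < M → tgt e < N
    lo-lo   : ∀ e → e < M → tgt e < n → src e < n
    hi-hi   : ∀ e → e < M → n ≤ tgt e → n ≤ src e
    lab≢0   : ∀ e → e < M → lab (tgt e) ≢ 0
    pred    : ∀ x → x < N → lab x ≢ 0 → ∃[ e ] e < M × tgt e ≡ x
    W-label : ∀ {x y} → x < n → n ≤ y → y < N → lab x < lab y → W x y
    W-edge  : ∀ {e e′} → e < M → e′ < M → tgt e < n → n ≤ tgt e′ → lab (tgt e) ≡ lab (tgt e′) →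
              W (src e) (src e′) → W (tgt e) (tgt e′)

-- E lists the nodes in the current order and P is its inverse.  The fine blocks
-- F and the compound blocks C, unions of fine blocks, are intervals of positions
-- from fs to fe and from cs to ce.  The first nb entries of B are the boundaries
-- of fine blocks at which compound blocks are to be cut.
record View : Set where
  constructor view
  field
    E P F fs fe C cs ce cnt cb K child par B : ℕ → ℕ
    nf nc nb : ℕ

vnf vnc vq vnb vb vc vlo vhi vside vp vtl vv vg vD vf vs vy vpv vr : ℕ
vnf = 14
vnc = 16
vq = 17
vnb = 18
vb = 19
vc = 20
vlo = 21
vhi = 22
vside = 23
vp = 24
vtl = 25
vv = 26
vg = 27
vD = 28
vf = 29
vs = 30
vy = 31
vpv = 32
vr = 33

aC acs ace aTG acnt acb aK aT achild apar aB : ℕ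
aC = 11
acs = 12
ace = 13
aTG = 14
acnt = 15
acb = 16
aK = 17
aT = 18
achild = 19
apar = 20
aB = 21

viewOf : Store → View
viewOf ρ = view (arrs ρ aE) (arrs ρ aP) (arrs ρ aF) (arrs ρ afs) (arrs ρ afe)
  (arrs ρ aC) (arrs ρ acs) (arrs ρ ace) (arrs ρ acnt) (arrs ρ acb) (arrs ρ aK)
  (arrs ρ achild) (arrs ρ apar) (arrs ρ aB) (vars ρ vnf) (vars ρ vnc) (vars ρ vnb)

-- The refinement program

emitOne : ℕ → Cmd
emitOne x =
  ifLess (afs [ var x ]) (afe [ var x ])
    (aB [ var vnb ]≔ afs [ var x ] ⨾ bump vnb)
    skip

emits : Cmd
emits =
  whileLess (var vr) (var vnf)
    (emitOne vr ⨾
     vf ≔ apar [ var vr ] ⨾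
     emitOne vf ⨾
     bump vr)

scanEdges : Cmd
scanEdges =
  whileLess (lit 0) (var ve)
    (vv ≔ aTG [ var ve ] ⨾
     aT [ var vtl ]≔ var vv ⨾
     bump vtl ⨾
     aK [ var vv ]≔ aK [ var vv ] ⊕ lit 1 ⨾
     ve ≔ aNEXT [ var ve ])

scan : Cmd
scan =
  whileLess (var vp) (var vhi)
    (vx ≔ aE [ var vp ] ⨾
     aC [ var vx ]≔ var vnc ⨾
     ve ≔ aHEAD [ var vx ] ⨾
     scanEdges ⨾
     bump vp)

makeChild : Cmd
makeChild =
  achild [ var vD ]≔ var vnf ⨾
  apar [ var vnf ]≔ var vD ⨾
  ifLess (lit 0) (var vside) (vs ≔ afe [ var vD ]) (vs ≔ afs [ var vD ]) ⨾
  afs [ var vnf ]≔ var vs ⨾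
  afe [ var vnf ]≔ var vs ⨾
  bump vnf

exchange : Cmd
exchange =
  vy ≔ aE [ var vs ] ⨾
  vpv ≔ aP [ var vv ] ⨾
  aE [ var vpv ]≔ var vy ⨾
  aP [ var vy ]≔ var vpv ⨾
  aE [ var vs ]≔ var vv ⨾
  aP [ var vv ]≔ var vs ⨾
  aF [ var vv ]≔ var vf

relocate : Cmd
relocate =
  acnt [ var vv ]≔ aK [ var vv ] ⨾
  acb [ var vv ]≔ var vnc ⨾
  vf ≔ achild [ var vD ] ⨾
  ifLess (lit 0) (var vside)
    (vs ≔ afe [ var vD ] ⊖ lit 1 ⨾ afe [ var vD ]≔ var vs ⨾ afs [ var vf ]≔ var vs)
    (vs ≔ afs [ var vD ] ⨾ afs [ var vD ]≔ var vs ⊕ lit 1 ⨾ afe [ var vf ]≔ var vs ⊕ lit 1) ⨾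
  exchange

move : Cmd
move =
  vD ≔ aF [ var vv ] ⨾
  -- `vr` is the number of fine blocks at the start of the round, so a smaller child stems from an
  -- earlier round. As names only grow, `achild` never has to be reset.
  ifLess (achild [ var vD ]) (var vr) makeChild skip ⨾
  relocate

treat : Cmd
treat =
  -- `vg` is the number of best edges of the node that still come from `c`. It is set to 0 when `d`
  -- is the better half for it, so that one test decides whether the node moves.
  vg ≔ acnt [ var vv ] ⊖ aK [ var vv ] ⨾
  ifLess (var vv) (var vn)
    (ifLess (lit 0) (var vside) skip (vg ≔ lit 0))
    (ifLess (lit 0) (var vside) (vg ≔ lit 0) skip) ⨾
  ifLess (lit 0) (var vg) (acnt [ var vv ]≔ var vg) move

touch : Cmd
touch =
  whileLess (var vj) (var vtl)
    (vv ≔ aT [ var vj ] ⨾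
     ifLess (lit 0) (aK [ var vv ])
       -- The only test is less-than; two of them single out the nodes whose best block equals `vc`.
       (ifLess (acb [ var vv ]) (var vc) skip
         (ifLess (var vc) (acb [ var vv ]) skip treat))
       skip ⨾
     aK [ var vv ]≔ lit 0 ⨾
     bump vj)

halve : Cmd
halve =
  vlo ≔ acs [ var vc ] ⨾
  vhi ≔ ace [ var vc ] ⨾
  ifLess (var vhi ⊖ var vb) (var vb ⊖ var vlo)
    (vside ≔ lit 1 ⨾ ace [ var vc ]≔ var vb ⨾ vlo ≔ var vb)
    (vside ≔ lit 0 ⨾ acs [ var vc ]≔ var vb ⨾ vhi ≔ var vb) ⨾
  acs [ var vnc ]≔ var vlo ⨾
  ace [ var vnc ]≔ var vhi

round : Cmd
round =
  vp ≔ var vlo ⨾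
  vtl ≔ lit 0 ⨾
  scan ⨾
  vj ≔ lit 0 ⨾
  touch ⨾
  bump vnc ⨾
  emits

refine : Cmd
refine =
  whileLess (var vq) (var vnb)
    (vb ≔ aB [ var vq ] ⨾
     bump vq ⨾
     vc ≔ aC [ aE [ var vb ] ] ⨾
     ifLess (acs [ var vc ]) (var vb)
       (halve ⨾ round)
       skip)

vsRefine asRefine : List ℕ
vsRefine = vq ∷ vb ∷ vc ∷ vlo ∷ vhi ∷ vside ∷ vp ∷ vx ∷ ve ∷ vv ∷ vtl ∷ vj ∷ vg ∷ vD ∷ vf ∷ vs ∷ vy ∷ vpv ∷
           vnf ∷ vnc ∷ vr ∷ vnb ∷ []
asRefine = aE ∷ aP ∷ aF ∷ afs ∷ afe ∷ aC ∷ acs ∷ ace ∷ acnt ∷ acb ∷ aK ∷ achild ∷ apar ∷ aT ∷ aB ∷ []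

-- Correctness of a refinement round

module Refinement (graph : Graph) where
  open Graph graph

  -- The number of edges into `v` with label `i`. The label `g` belongs to the edge and not to its
  -- source, because the scan relabels edges one at a time.
  live : (ℕ → ℕ) → ℕ → ℕ → ℕ
  live g v i = Σ< M (λ e → δ? (tgt e) v * δ? (g e) i)

  live-cong : ∀ {g h} → (∀ e → e < M → g e ≡ h e) → ∀ v i → live g v i ≡ live h v i
  live-cong eq v i = Σ-cong M λ e e<M → cong (λ j → δ? (tgt e) v * δ? j i) (eq e e<M)

  live-pos : ∀ g v i → 0 < live g v i → ∃[ e ] e < M × tgt e ≡ v × g e ≡ i
  live-pos g v i p with Σ-pos M _ p
  ... | e , e<M , q = e , e<M , δ?-pos (pos₁ q) , δ?-pos (pos₂ (δ? (tgt e) v) q)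
    where
    pos₁ : ∀ {a b} → 0 < a * b → 0 < a
    pos₁ {suc a} _ = s≤s z≤n
    pos₂ : ∀ a {b} → 0 < a * b → 0 < b
    pos₂ a {zero} q = contradiction (subst (0 <_) (*-zeroʳ a) q) λ ()
    pos₂ a {suc b} _ = s≤s z≤n

  live-term : ∀ {g v i e} → e < M → tgt e ≡ v → g e ≡ i → 0 < live g v i
  live-term {g} {v} {i} {e} e<M eq eq′ = ≤-trans
    (≤-reflexive (sym (cong₂ _*_ (δ?-≡ eq) (δ?-≡ eq′)))) (Σ-term M _ e<M)

  -- The block cbv is the least (for v < n) or greatest block with a
  -- predecessor of v, and cnt is the number of edges from there to v.
  record Best (C cs : ℕ → ℕ) (v cbv cntv : ℕ) : Set where
    field
      cnt≡ : cntv ≡ live (C ∘ src) v cbv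
      cnt> : ∀ e → e < M → tgt e ≡ v → 0 < cntv
      low  : v < n → ∀ e → e < M → tgt e ≡ v → cs cbv ≤ cs (C (src e))
      high : n ≤ v → ∀ e → e < M → tgt e ≡ v → cs (C (src e)) ≤ cs cbv

  -- A fine block that does not begin a compound block has its start in the queue
  -- B, unless it is one of the blocks r, …, nf - 1 created in the current round
  -- or has lost such a block.
  record Inv (v : View) (q r : ℕ) : Set where
    open View v
    field
      perm     : Perm N E P
      fine     : Blocks N (F ∘ E) fs fe nf
      coarse   : Blocks N (C ∘ E) cs ce nc
      nonempty : ∀ i → i < nc → cs i < ce i
      refines  : ∀ x y → x < N → y < N → F x ≡ F y → C x ≡ C y
      cb<      : ∀ x → x < N → cb x < nc
      root     : ∀ x → x < N → lab x ≡ 0 → cb x ≡ 0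
      best     : ∀ x → x < N → Best C cs x (cb x) (cnt x)
      K≡0      : ∀ x → x < N → K x ≡ 0
      key≡     : ∀ x y → x < N → y < N → F x ≡ F y → lab x ≡ lab y × cb x ≡ cb y
      key<     : ∀ x y → x < N → y < N → fs (F x) < fs (F y) →
                 lab x < lab y ⊎ (lab x ≡ lab y × cs (cb x) < cs (cb y))
      witness  : ∀ x y → x < n → n ≤ y → y < N → cs (C x) < cs (C y) → W x y
      pending  : ∀ j → q ≤ j → j < nb → B j < N × fs (F (E (B j))) ≡ B j
      queued   : ∀ x → x < N → fs (F x) ≡ cs (C x) ⊎
                 (∃[ j ] q ≤ j × j < nb × B j ≡ fs (F x)) ⊎
                 (∃[ f ] r ≤ f × f < nf × (f ≡ F x ⊎ par f ≡ F x))
      child<   : ∀ d → child d < nf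
      par<     : ∀ d → par d < nf

  -- The new name d goes to the left half if side is 0, to the right one if 1.
  record Halves (side b c d : ℕ) (cs ce cs′ ce′ : ℕ → ℕ) : Set where
    field
      other-s : ∀ i → i ≢ c → i ≢ d → cs′ i ≡ cs i
      other-e : ∀ i → i ≢ c → i ≢ d → ce′ i ≡ ce i
      shape   : (side ≡ 0 × cs′ d ≡ cs c × ce′ d ≡ b × cs′ c ≡ b × ce′ c ≡ ce c) ⊎
                (side ≡ 1 × cs′ c ≡ cs c × ce′ c ≡ b × cs′ d ≡ b × ce′ d ≡ ce c)

  module Round (v₀ : View) (q : ℕ) (I : Inv v₀ q (View.nf v₀)) (q<nb : q < View.nb v₀)
    (side c b : ℕ) (b≡ : b ≡ View.B v₀ q) (c≡ : c ≡ View.C v₀ (View.E v₀ b)) (cs<b : View.cs v₀ c < b)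
    (C′ cs′ ce′ : ℕ → ℕ)
    (H : Halves side b c (View.nc v₀) (View.cs v₀) (View.ce v₀) cs′ ce′)
    (new : ∀ x → x < N → cs′ (View.nc v₀) ≤ View.P v₀ x → View.P v₀ x < ce′ (View.nc v₀) → C′ x ≡ View.nc v₀)
    (old : ∀ x → x < N → ¬ (cs′ (View.nc v₀) ≤ View.P v₀ x × View.P v₀ x < ce′ (View.nc v₀)) → C′ x ≡ View.C v₀ x)
    where
    open View v₀ renaming (nc to d)
    open Inv I
    open Perm perm
    open Halves H

    b<N : b < N
    b<N = subst (_< N) (sym b≡) (proj₁ (pending q ≤-refl q<nb))

    fs-b : fs (F (E b)) ≡ b
    fs-b = subst (λ b → fs (F (E b)) ≡ b) (sym b≡) (proj₂ (pending q ≤-refl q<nb))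

    c<d : c < d
    c<d = subst (_< d) (sym c≡) (Blocks.id< coarse b b<N)

    c≢d : c ≢ d
    c≢d = <⇒≢ c<d

    b<ce : b < ce c
    b<ce = subst (λ c → b < ce c) (sym c≡) (Blocks.<hi coarse b b<N)

    -- `i′` is a possible name, after the cut, of a node whose compound block was named `i`.
    Part : ℕ → ℕ → Set
    Part i i′ = i′ ≡ i ⊎ (i′ ≡ d × i ≡ c)

    part-s : ∀ {i i′} → i < d → Part i i′ → cs i ≤ cs′ i′
    part-s {i} i<d (inj₁ refl) with i ≟ c
    ... | no i≢c = ≤-reflexive (sym (other-s i i≢c (<⇒≢ i<d)))
    ... | yes refl with shape
    ...   | inj₁ (_ , _ , _ , s , _) = subst (cs i ≤_) (sym s) (<⇒≤ cs<b)
    ...   | inj₂ (_ , s , _) = ≤-reflexive (sym s)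
    part-s i<d (inj₂ (refl , refl)) with shape
    ... | inj₁ (_ , s , _) = ≤-reflexive (sym s)
    ... | inj₂ (_ , _ , _ , s , _) = subst (cs c ≤_) (sym s) (<⇒≤ cs<b)

    part-< : ∀ {i i′} → i < d → Part i i′ → cs′ i′ < ce i
    part-< {i} i<d (inj₁ refl) with i ≟ c
    ... | no i≢c = subst (_< ce i) (sym (other-s i i≢c (<⇒≢ i<d))) (nonempty i i<d)
    ... | yes refl with shape
    ...   | inj₁ (_ , _ , _ , s , _) = subst (_< ce i) (sym s) b<ce
    ...   | inj₂ (_ , s , _) = subst (_< ce i) (sym s) (nonempty i i<d)
    part-< i<d (inj₂ (refl , refl)) with shape
    ... | inj₁ (_ , s , _) = subst (_< ce c) (sym s) (nonempty c c<d)
    ... | inj₂ (_ , _ , _ , s , _) = subst (_< ce c) (sym s) b<ce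

    -- The parts of a compound block stay inside its interval, and the intervals of different blocks
    -- are disjoint.
    part-mono : ∀ {i j i′ j′} → i < d → j < d → Part i i′ → Part j j′ → cs i < cs j → cs′ i′ < cs′ j′
    part-mono i<d j<d pi pj lt =
      <-≤-trans (part-< i<d pi) (≤-trans (disjoint coarse i<d j<d lt (nonempty _ j<d)) (part-s j<d pj))

    cs-injective : ∀ {i j} → i < d → j < d → cs i ≡ cs j → i ≡ j
    cs-injective {i} {j} i<d j<d eq =
      trans (sym (proj₂ (Blocks.exact coarse i (cs i) i<d ≤-refl (nonempty i i<d))))
        (proj₂ (Blocks.exact coarse j (cs i) j<d (≤-reflexive (sym eq)) (subst (_< ce j) (sym eq) (nonempty j j<d))))

    C<d : ∀ {x} → x < N → C x < d
    C<d {x} x<N = subst (λ y → C y < d) (E∘P x x<N) (Blocks.id< coarse (P x) (P< x x<N))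

    C-inside : ∀ {x} → x < N → cs (C x) ≤ P x × P x < ce (C x)
    C-inside {x} x<N = subst (λ y → cs (C y) ≤ P x × P x < ce (C y)) (E∘P x x<N)
      (Blocks.lo≤ coarse (P x) (P< x x<N) , Blocks.<hi coarse (P x) (P< x x<N))

    C-exact : ∀ {x i} → x < N → i < d → cs i ≤ P x → P x < ce i → C x ≡ i
    C-exact {x} {i} x<N i<d l h = subst (λ y → C y ≡ i) (E∘P x x<N) (proj₂ (Blocks.exact coarse i (P x) i<d l h))

    F-inside : ∀ {x} → x < N → fs (F x) ≤ P x × P x < fe (F x)
    F-inside {x} x<N = subst (λ y → fs (F y) ≤ P x × P x < fe (F y)) (E∘P x x<N)
      (Blocks.lo≤ fine (P x) (P< x x<N) , Blocks.<hi fine (P x) (P< x x<N))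

    data Relabelled (x : ℕ) : Set where
      moved : C′ x ≡ d → C x ≡ c → cs′ d ≤ P x → P x < ce′ d → Relabelled x
      kept  : C′ x ≡ C x → (C x ≡ c → cs′ c ≤ P x × P x < ce′ c) → Relabelled x

    relabelled : ∀ {x} → x < N → Relabelled x
    relabelled {x} x<N with cs′ d ≤? P x | P x <? ce′ d
    ... | yes l | yes h = moved (new x x<N l h) (C-exact x<N c<d lc hc) l h
      where
      lc : cs c ≤ P x
      lc with shape
      ... | inj₁ (_ , s , _) = subst (_≤ P x) s l
      ... | inj₂ (_ , _ , _ , s , _) = ≤-trans (<⇒≤ cs<b) (subst (_≤ P x) s l)
      hc : P x < ce c
      hc with shape
      ... | inj₁ (_ , _ , s , _) = <-trans (subst (P x <_) s h) b<ce
      ... | inj₂ (_ , _ , _ , _ , s) = subst (P x <_) s h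
    ... | no l | _ = kept (old x x<N (l ∘ proj₁)) λ Cx → rest (subst (λ i → cs i ≤ P x × P x < ce i) Cx (C-inside x<N))
      where
      rest : cs c ≤ P x × P x < ce c → cs′ c ≤ P x × P x < ce′ c
      rest (lc , hc) with shape
      ... | inj₁ (_ , s , _) = contradiction (subst (_≤ P x) (sym s) lc) l
      ... | inj₂ (_ , s , t , u , _) = subst (_≤ P x) (sym s) lc , subst (P x <_) (sym t) (subst (P x <_) u (≰⇒> l))
    ... | yes l | no h = kept (old x x<N (h ∘ proj₂)) λ Cx →
        rest (subst (λ i → cs i ≤ P x × P x < ce i) Cx (C-inside x<N))
      where
      rest : cs c ≤ P x × P x < ce c → cs′ c ≤ P x × P x < ce′ c
      rest (lc , hc) with shape
      ... | inj₁ (_ , _ , s , t , u) = subst (_≤ P x) (sym t) (subst (_≤ P x) s (≮⇒≥ h)) , subst (P x <_) (sym u) hc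
      ... | inj₂ (_ , _ , _ , _ , s) = contradiction (subst (P x <_) (sym s) hc) h

    C-part : ∀ {x} → x < N → Part (C x) (C′ x)
    C-part x<N with relabelled x<N
    ... | moved eq Cx _ _ = inj₂ (eq , Cx)
    ... | kept eq _ = inj₁ eq

    -- `b` is itself the start of a fine block, so it cannot lie strictly inside one.
    F-side : ∀ {x y} → x < N → y < N → F x ≡ F y → P x < b → P y < b
    F-side {x} {y} x<N y<N eq Px<b with <-or-≥ (P y) b
    ... | inj₁ lt = lt
    ... | inj₂ ge = contradiction Px<b (≤⇒≯ (subst (_≤ P x) fsx≡b (proj₁ (F-inside x<N))))
      where
      b∈ : fs (F x) ≤ b × b < fe (F x)
      b∈ = ≤-trans (proj₁ (F-inside x<N)) (<⇒≤ Px<b) , subst (λ f → b < fe f) (sym eq)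
          (≤-<-trans ge (proj₂ (F-inside y<N)))
      fsx≡b : fs (F x) ≡ b
      fsx≡b = trans (cong fs (trans (sym (cong F (E∘P x x<N)))
        (sym (same-block fine (P< x x<N)
          (subst (λ y → fs (F y) ≤ b) (sym (E∘P x x<N)) (proj₁ b∈))
          (subst (λ y → b < fe (F y)) (sym (E∘P x x<N)) (proj₂ b∈)))))) fs-b

    C′-left : ∀ {x} → x < N → C x ≡ c → P x < b → C′ x ≡ (case shape of λ { (inj₁ _) → d ; (inj₂ _) → c })
    C′-left {x} x<N Cx Px<b with shape | relabelled x<N
    ... | inj₁ (_ , _ , s , _) | moved eq _ _ _ = eq
    ... | inj₁ (_ , _ , _ , t , _) | kept _ r = contradiction Px<b (≤⇒≯ (subst (_≤ P x) t (proj₁ (r Cx))))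
    ... | inj₂ (_ , _ , _ , s , _) | moved _ _ l _ = contradiction Px<b (≤⇒≯ (subst (_≤ P x) s l))
    ... | inj₂ _ | kept eq _ = trans eq Cx

    C′-right : ∀ {x} → x < N → C x ≡ c → b ≤ P x → C′ x ≡ (case shape of λ { (inj₁ _) → c ; (inj₂ _) → d })
    C′-right {x} x<N Cx b≤Px with shape | relabelled x<N
    ... | inj₁ (_ , _ , s , _) | moved _ _ _ h = contradiction (subst (P x <_) s h) (≤⇒≯ b≤Px)
    ... | inj₁ _ | kept eq _ = trans eq Cx
    ... | inj₂ _ | moved eq _ _ _ = eq
    ... | inj₂ (_ , _ , t , _) | kept _ r = contradiction (subst (P x <_) t (proj₂ (r Cx))) (≤⇒≯ b≤Px)

    C′-other : ∀ {x} → x < N → C x ≢ c → C′ x ≡ C x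
    C′-other x<N ne with relabelled x<N
    ... | moved _ Cx _ _ = contradiction Cx ne
    ... | kept eq _ = eq

    cs′-left : ∀ {x} → x < N → C x ≡ c → P x < b → cs′ (C′ x) ≡ cs c
    cs′-left x<N Cx lt with shape | C′-left x<N Cx lt
    ... | inj₁ (_ , s , _) | eq = trans (cong cs′ eq) s
    ... | inj₂ (_ , s , _) | eq = trans (cong cs′ eq) s

    cs′-right : ∀ {x} → x < N → C x ≡ c → b ≤ P x → cs′ (C′ x) ≡ b
    cs′-right x<N Cx ge with shape | C′-right x<N Cx ge
    ... | inj₁ (_ , _ , _ , s , _) | eq = trans (cong cs′ eq) s
    ... | inj₂ (_ , _ , _ , s , _) | eq = trans (cong cs′ eq) s

    refines′ : ∀ x y → x < N → y < N → F x ≡ F y → C′ x ≡ C′ y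
    refines′ x y x<N y<N eq with C x ≟ c
    ... | no ne = trans (C′-other x<N ne) (trans (refines x y x<N y<N eq)
                    (sym (C′-other y<N (ne ∘ trans (refines x y x<N y<N eq)))))
    ... | yes Cx with <-or-≥ (P x) b
    ...   | inj₁ lt = trans (C′-left x<N Cx lt)
              (sym (C′-left y<N (trans (sym (refines x y x<N y<N eq)) Cx) (F-side x<N y<N eq lt)))
    ...   | inj₂ ge = trans (C′-right x<N Cx ge)
              (sym (C′-right y<N (trans (sym (refines x y x<N y<N eq)) Cx)
                (≮⇒≥ λ lt → ≤⇒≯ ge (F-side y<N x<N (sym eq) lt))))

    d-range : cs′ d < ce′ d × cs′ c < ce′ c
    d-range with shape
    ... | inj₁ (_ , s , t , u , v) = subst₂ _<_ (sym s) (sym t) cs<b , subst₂ _<_ (sym u) (sym v) b<ce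
    ... | inj₂ (_ , s , t , u , v) = subst₂ _<_ (sym u) (sym v) b<ce , subst₂ _<_ (sym s) (sym t) cs<b

    nonempty′ : ∀ i → i < suc d → cs′ i < ce′ i
    nonempty′ i i< with i ≟ d | i ≟ c
    ... | yes refl | _        = proj₁ d-range
    ... | no _     | yes refl = proj₂ d-range
    ... | no i≢d   | no i≢c   = subst₂ _<_ (sym (other-s i i≢c i≢d)) (sym (other-e i i≢c i≢d))
                                  (nonempty i (≤∧≢⇒< (≤-pred i<) i≢d))

    coarse′ : Blocks N (C′ ∘ E) cs′ ce′ (suc d)
    coarse′ = record
      { id< = λ p p<N → case relabelled (E< p p<N) of λ where
          (moved eq _ _ _) → subst (_< suc d) (sym eq) ≤-refl
          (kept eq _) → subst (_< suc d) (sym eq) (m<n⇒m<1+n (C<d (E< p p<N)))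
      ; lo≤ = λ p p<N → subst (cs′ (C′ (E p)) ≤_) (P∘E p p<N) (proj₁ (inside (E< p p<N)))
      ; <hi = λ p p<N → subst (_< ce′ (C′ (E p))) (P∘E p p<N) (proj₂ (inside (E< p p<N)))
      ; exact = ex }
      where
      inside : ∀ {x} → x < N → cs′ (C′ x) ≤ P x × P x < ce′ (C′ x)
      inside {x} x<N with relabelled x<N
      ... | moved eq _ l h rewrite eq = l , h
      ... | kept eq r rewrite eq with C x ≟ c
      ...   | yes Cx = subst (λ i → cs′ i ≤ P x × P x < ce′ i) (sym Cx) (r Cx)
      ...   | no ne  = subst₂ (λ l h → l ≤ P x × P x < h) (sym (other-s _ ne (<⇒≢ (C<d x<N))))
                        (sym (other-e _ ne (<⇒≢ (C<d x<N)))) (C-inside x<N)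
      within : ∀ p → cs′ c ≤ p × p < ce′ c ⊎ cs′ d ≤ p × p < ce′ d → cs c ≤ p × p < ce c
      within p r with shape
      within p (inj₁ (l , h)) | inj₁ (_ , s , t , u , v) = ≤-trans (<⇒≤ cs<b) (subst (_≤ p) u l) , subst (p <_) v h
      within p (inj₂ (l , h)) | inj₁ (_ , s , t , u , v) = subst (_≤ p) s l , <-trans (subst (p <_) t h) b<ce
      within p (inj₁ (l , h)) | inj₂ (_ , s , t , u , v) = subst (_≤ p) s l , <-trans (subst (p <_) t h) b<ce
      within p (inj₂ (l , h)) | inj₂ (_ , s , t , u , v) = ≤-trans (<⇒≤ cs<b) (subst (_≤ p) u l) , subst (p <_) v h
      apart : ∀ {p} → cs′ c ≤ p → p < ce′ c → cs′ d ≤ p → p < ce′ d → ⊥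
      apart {p} lc hc ld hd with shape
      ... | inj₁ (_ , _ , t , u , _) = ≤⇒≯ (subst (_≤ p) u lc) (subst (p <_) t hd)
      ... | inj₂ (_ , _ , t , u , _) = ≤⇒≯ (subst (_≤ p) u ld) (subst (p <_) t hc)
      ex : ∀ i p → i < suc d → cs′ i ≤ p → p < ce′ i → p < N × C′ (E p) ≡ i
      ex i p i< l h with i ≟ d
      ... | yes refl = let p<N , _ = Blocks.exact coarse c p c<d (proj₁ w) (proj₂ w) in
          p<N , new (E p) (E< p p<N) (subst (cs′ i ≤_) (sym (P∘E p p<N)) l) (subst (_< ce′ i) (sym (P∘E p p<N)) h)
        where w = within p (inj₂ (l , h))
      ... | no i≢d with i ≟ c
      ...   | no i≢c with Blocks.exact coarse i p (≤∧≢⇒< (≤-pred i<) i≢d)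
                       (subst (_≤ p) (other-s i i≢c i≢d) l) (subst (p <_) (other-e i i≢c i≢d) h)
      ...     | p<N , eq = p<N , trans (C′-other (E< p p<N) (i≢c ∘ trans (sym eq))) eq
      ex i p i< l h | no i≢d | yes refl
        with Blocks.exact coarse c p c<d (proj₁ (within p (inj₁ (l , h)))) (proj₂ (within p (inj₁ (l , h))))
      ... | p<N , eq = p<N , trans (old (E p) (E< p p<N)
              λ { (ld , hd) → apart l h (subst (cs′ d ≤_) (P∘E p p<N) ld) (subst (_< ce′ d) (P∘E p p<N) hd) }) eq

    -- A strict comparison of keys comes from the labels or from the best predecessor blocks. In the
    -- second case some edge realises each best block, since its counter is positive; `witness`
    -- compares the sources, and `W-edge` carries this to the targets. Label 0 is excluded because
    -- all such nodes have best block 0.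
    key-witness : ∀ x y → x < n → n ≤ y → x < N → y < N → fs (F x) < fs (F y) → W x y
    key-witness x y x<n n≤y x<N y<N lt with key< x y x<N y<N lt
    ... | inj₁ l = W-label x<n n≤y y<N l
    ... | inj₂ (leq , l) with lab x ≟ 0
    ...   | yes l0 = contradiction l (<-irrefl (cong cs
        (trans (root x x<N l0) (sym (root y y<N (trans (sym leq) l0))))))
    ...   | no ne with live-edge x x<N ne | live-edge y y<N (ne ∘ trans leq)
      where
      live-edge : ∀ x → x < N → lab x ≢ 0 → ∃[ e ] e < M × tgt e ≡ x × C (src e) ≡ cb x
      live-edge x x<N ne with pred x x<N ne
      ... | e , e<M , eq = live-pos (C ∘ src) x (cb x)
        (subst (0 <_) (Best.cnt≡ (best x x<N)) (Best.cnt> (best x x<N) e e<M eq))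
    ...     | e , e<M , refl , eqC | e′ , e′<M , refl , eqC′ =
      W-edge e<M e′<M x<n n≤y leq (witness (src e) (src e′) (lo-lo e e<M x<n) (hi-hi e′ e′<M n≤y) (src< e′ e′<M)
        (subst₂ (λ i j → cs i < cs j) (sym eqC) (sym eqC′) l))

    fs-mono : ∀ {x y} → x < N → y < N → fs (F x) < fs (F y) ⊎ P y ≤ P x ⊎ F x ≡ F y
    fs-mono {x} {y} x<N y<N with <-or-≥ (P x) (P y)
    ... | inj₂ ge = inj₂ (inj₁ ge)
    ... | inj₁ lt with <-or-≥ (P y) (fe (F x))
    ...   | inj₁ l = inj₂ (inj₂ (trans (sym (cong F (E∘P x x<N))) (trans (sym (same-block fine (P< x x<N)
              (subst (λ z → fs (F z) ≤ P y) (sym (E∘P x x<N)) (≤-trans (proj₁ (F-inside x<N)) (<⇒≤ lt)))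
              (subst (λ z → P y < fe (F z)) (sym (E∘P x x<N)) l))) (cong F (E∘P y y<N)))))
    ...   | inj₂ l with <-or-≥ (fs (F x)) (fs (F y))
    ...     | inj₁ l′ = inj₁ l′
    ...     | inj₂ l′ = inj₂ (inj₂ (sym (trans (sym (cong F (E∘P y y<N))) (trans (sym (same-block fine (P< y y<N)
              (subst (λ z → fs (F z) ≤ P x) (sym (E∘P y y<N)) (≤-trans l′ (proj₁ (F-inside x<N))))
              (subst (λ z → P x < fe (F z)) (sym (E∘P y y<N)) (<-trans lt (proj₂ (F-inside y<N))))))
                  (cong F (E∘P x x<N))))))

    -- The only new comparisons are between the two sides of `b` within `c`. Such nodes lie in
    -- different fine blocks, so their keys supply the witness.
    witness′ : ∀ x y → x < n → n ≤ y → y < N → cs′ (C′ x) < cs′ (C′ y) → W x y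
    witness′ x y x<n n≤y y<N lt = go
      where
      x<N : x < N
      x<N = <-≤-trans x<n (≤-trans n≤y (<⇒≤ y<N))
      go : W x y
      go with <-or-≥ (cs (C x)) (cs (C y))
      ... | inj₁ l = witness x y x<n n≤y y<N l
      ... | inj₂ ge with m≤n⇒m<n∨m≡n ge
      ...   | inj₁ gt = contradiction lt (<-asym (part-mono (C<d y<N) (C<d x<N) (C-part y<N) (C-part x<N) gt))
      ...   | inj₂ eq with cs-injective (C<d y<N) (C<d x<N) eq | C x ≟ c
      ...     | eqC | no ne = contradiction lt (<-irrefl (cong cs′
                  (trans (C′-other x<N ne) (trans (sym eqC) (sym (C′-other y<N (ne ∘ trans (sym eqC))))))))
      ...     | eqC | yes Cx with <-or-≥ (P x) b | <-or-≥ (P y) b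
      ...       | inj₂ gx | _ = contradiction lt (≤⇒≯ (subst (cs′ (C′ y) ≤_) (sym (cs′-right x<N Cx gx))
          (bound (trans eqC Cx))))
        where
        bound : C y ≡ c → cs′ (C′ y) ≤ b
        bound Cy with <-or-≥ (P y) b
        ... | inj₁ l = subst (_≤ b) (sym (cs′-left y<N Cy l)) (<⇒≤ cs<b)
        ... | inj₂ g = ≤-reflexive (cs′-right y<N Cy g)
      ...       | inj₁ lx | inj₁ ly = contradiction lt (<-irrefl
          (trans (cs′-left x<N Cx lx) (sym (cs′-left y<N (trans eqC Cx) ly))))
      ...       | inj₁ lx | inj₂ gy with fs-mono x<N y<N
      ...         | inj₁ l = key-witness x y x<n n≤y x<N y<N l
      ...         | inj₂ (inj₁ ge) = contradiction (≤-<-trans ge lx) (≤⇒≯ gy)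
      ...         | inj₂ (inj₂ eqF) = contradiction (F-side x<N y<N eqF lx) (≤⇒≯ gy)

    -- Consuming the entry `b` is safe because `b` is now the start of a compound block. A fine
    -- block that began `c` still begins the left half.
    queued′ : ∀ x → x < N → fs (F x) ≡ cs′ (C′ x) ⊎ (∃[ j ] suc q ≤ j × j < nb × B j ≡ fs (F x))
    queued′ x x<N with queued x x<N
    ... | inj₂ (inj₂ (f , l , h , _)) = contradiction h (≤⇒≯ l)
    ... | inj₂ (inj₁ (j , q≤j , j<nb , eq)) with m≤n⇒m<n∨m≡n q≤j
    ...   | inj₁ lt = inj₂ (j , lt , j<nb , eq)
    ...   | inj₂ refl = inj₁ (trans fsx (sym (cs′-right x<N Cx (subst (_≤ P x) fsx (proj₁ (F-inside x<N))))))
      where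
      fsx : fs (F x) ≡ b
      fsx = trans (sym eq) (sym b≡)
      Fx : F x ≡ F (E b)
      Fx = trans (sym (cong F (E∘P x x<N))) (start-injective fine (P< x x<N) b<N
        (trans (cong (fs ∘ F) (E∘P x x<N)) (trans fsx (sym fs-b))))
      Cx : C x ≡ c
      Cx = trans (refines x (E b) x<N (E< b b<N) Fx) (sym c≡)
    queued′ x x<N | inj₁ eq with C x ≟ c
    ... | no ne = inj₁ (trans eq (trans (sym (other-s (C x) ne (<⇒≢ (C<d x<N)))) (cong cs′ (sym (C′-other x<N ne)))))
    ... | yes Cx with <-or-≥ (P x) b
    ...   | inj₁ lt = inj₁ (trans eq (trans (cong cs Cx) (sym (cs′-left x<N Cx lt))))
    ...   | inj₂ ge = contradiction (trans (trans (cong fs (sym Fx)) (trans eq (cong cs Cx))) refl)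
        (>⇒≢ (subst (cs c <_) (sym fs-b) cs<b))
      where
      Fx : F x ≡ F (E b)
      Fx = trans (sym (cong F (E∘P x x<N))) (sym (same-block fine (P< x x<N)
        (subst (λ y → fs (F y) ≤ b) (sym (E∘P x x<N)) (subst (_≤ b) (sym (trans eq (cong cs Cx))) (<⇒≤ cs<b)))
        (subst (λ y → b < fe (F y)) (sym (E∘P x x<N)) (≤-<-trans ge (proj₂ (F-inside x<N))))))

    live-other : ∀ v i → i ≢ c → i ≢ d → live (C ∘ src) v i ≡ live (C′ ∘ src) v i
    live-other v i i≢c i≢d = Σ-cong M λ e e<M → cong (δ? (tgt e) v *_) (case relabelled (src< e e<M) of λ where
      (moved eq Cx _ _) → trans (δ?-≢ (i≢c ∘ sym ∘ trans (sym Cx))) (sym (δ?-≢ (i≢d ∘ sym ∘ trans (sym eq))))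
      (kept eq _) → cong (λ j → δ? j i) (sym eq))

    -- The reason why the larger half need not be scanned: its counts are the old ones minus those
    -- found for `d`.
    live-split : ∀ v → live (C ∘ src) v c ≡ live (C′ ∘ src) v c + live (C′ ∘ src) v d
    live-split v = trans (Σ-cong M λ e e<M → trans (cong (δ? (tgt e) v *_) (case relabelled (src< e e<M) of λ where
        (moved eq Cx _ _) → trans (δ?-≡ Cx) (sym (cong₂ _+_ (δ?-≢ (λ Cc → c≢d (trans (sym Cc) eq))) (δ?-≡ eq)))
        (kept eq _) → trans (sym (+-identityʳ _)) (cong₂ _+_ (cong (λ j → δ? j c) (sym eq))
          (sym (δ?-≢ λ C′≡d → <⇒≢ (C<d (src< e e<M)) (trans (sym eq) C′≡d))))))
      (*-distribˡ-+ (δ? (tgt e) v) (δ? (C′ (src e)) c) (δ? (C′ (src e)) d)))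
      (Σ-+ M (λ e → δ? (tgt e) v * δ? (C′ (src e)) c) (λ e → δ? (tgt e) v * δ? (C′ (src e)) d))

    both-parts : ∀ {j} → j ≢ c → j < d → cs c ≤ cs j → cs′ c < cs′ j × cs′ d < cs′ j
    both-parts {j} j≢c j<d le =
      part-mono c<d j<d (inj₁ refl) (inj₁ refl) lt , part-mono c<d j<d (inj₂ (refl , refl)) (inj₁ refl) lt
      where
      lt = ≤∧≢⇒< le (j≢c ∘ sym ∘ cs-injective c<d j<d)

    both-parts′ : ∀ {j} → j ≢ c → j < d → cs j ≤ cs c → cs′ j < cs′ c × cs′ j < cs′ d
    both-parts′ {j} j≢c j<d le =
      part-mono j<d c<d (inj₁ refl) (inj₁ refl) lt , part-mono j<d c<d (inj₁ refl) (inj₂ (refl , refl)) lt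
      where
      lt = ≤∧≢⇒< le (j≢c ∘ cs-injective j<d c<d)

    data Source (e : ℕ) : Set where
      in-d  : C′ (src e) ≡ d → Source e
      in-c  : C′ (src e) ≡ c → Source e
      other : C (src e) ≢ c → C′ (src e) ≡ C (src e) → Source e

    source-of : ∀ e → e < M → Source e
    source-of e e<M with relabelled (src< e e<M)
    ... | moved eq _ _ _ = in-d eq
    ... | kept eq _ with C (src e) ≟ c
    ...   | yes Cc = in-c (trans eq Cc)
    ...   | no ne = other ne eq

    part-≤ : ∀ {i j j′} → i < d → i ≢ c → j < d → Part j j′ → cs i ≤ cs j → cs′ i ≤ cs′ j′
    part-≤ {i} {j} i<d i≢c j<d pj le with m≤n⇒m<n∨m≡n le
    ... | inj₁ lt = <⇒≤ (part-mono i<d j<d (inj₁ refl) pj lt)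
    ... | inj₂ eq with cs-injective i<d j<d eq | pj
    ...   | refl | inj₁ refl = ≤-refl
    ...   | refl | inj₂ (_ , i≡c) = contradiction i≡c i≢c

    part-≥ : ∀ {i j j′} → i < d → i ≢ c → j < d → Part j j′ → cs j ≤ cs i → cs′ j′ ≤ cs′ i
    part-≥ {i} {j} i<d i≢c j<d pj le with m≤n⇒m<n∨m≡n le
    ... | inj₁ lt = <⇒≤ (part-mono j<d i<d pj (inj₁ refl) lt)
    ... | inj₂ eq with cs-injective j<d i<d eq | pj
    ...   | refl | inj₁ refl = ≤-refl
    ...   | refl | inj₂ (_ , i≡c) = contradiction i≡c i≢c

    module _ {v : ℕ} (v<N : v < N) where
      open Best (best v v<N)

      best-far : cb v ≢ c → Best C′ cs′ v (cb v) (cnt v)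
      best-far ne = record
        { cnt≡ = trans cnt≡ (live-other v (cb v) ne (<⇒≢ (cb< v v<N)))
        ; cnt> = cnt>
        ; low  = λ v<n e e<M eq → part-≤ (cb< v v<N) ne (C<d (src< e e<M)) (C-part (src< e e<M)) (low v<n e e<M eq)
        ; high = λ n≤v e e<M eq → part-≥ (cb< v v<N) ne (C<d (src< e e<M)) (C-part (src< e e<M)) (high n≤v e e<M eq) }

      cnt-split : cb v ≡ c → cnt v ≡ live (C′ ∘ src) v c + live (C′ ∘ src) v d
      cnt-split eq = trans cnt≡ (trans (cong (live (C ∘ src) v) eq) (live-split v))

      low-c : cb v ≡ c → v < n → ∀ e → e < M → tgt e ≡ v → cs c ≤ cs (C (src e))
      low-c eq v<n e e<M te = subst (λ i → cs i ≤ cs (C (src e))) eq (low v<n e e<M te)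

      high-c : cb v ≡ c → n ≤ v → ∀ e → e < M → tgt e ≡ v → cs (C (src e)) ≤ cs c
      high-c eq n≤v e e<M te = subst (λ i → cs (C (src e)) ≤ cs i) eq (high n≤v e e<M te)

      -- `d` is the better half for `v`: an infimum wants the left half, a supremum the right one.
      Prefers : Set
      Prefers = (side ≡ 0 × v < n) ⊎ (side ≡ 1 × n ≤ v)

      best-untouched : cb v ≡ c → live (C′ ∘ src) v d ≡ 0 → Best C′ cs′ v c (cnt v)
      best-untouched eq z = record
        { cnt≡ = trans (cnt-split eq) (trans (cong (live (C′ ∘ src) v c +_) z) (+-identityʳ _))
        ; cnt> = cnt>
        ; low  = λ v<n e e<M te → case source-of e e<M of λ where
            (in-d Cd) → contradiction z (>⇒≢ (live-term {C′ ∘ src} e<M te Cd))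
            (in-c Cc) → ≤-reflexive (cong cs′ (sym Cc))
            (other ne eq′) → <⇒≤ (subst (λ i → cs′ c < cs′ i) (sym eq′)
              (proj₁ (both-parts ne (C<d (src< e e<M)) (low-c eq v<n e e<M te))))
        ; high = λ n≤v e e<M te → case source-of e e<M of λ where
            (in-d Cd) → contradiction z (>⇒≢ (live-term {C′ ∘ src} e<M te Cd))
            (in-c Cc) → ≤-reflexive (cong cs′ Cc)
            (other ne eq′) → <⇒≤ (subst (λ i → cs′ i < cs′ c) (sym eq′)
              (proj₁ (both-parts′ ne (C<d (src< e e<M)) (high-c eq n≤v e e<M te)))) }

      -- `d` becomes the best block either because it is the better half or because all best edges
      -- of `v` come from it: if `d` accounts for all of `cnt v`, then by `cnt-split` nothing is
      -- left for `c`.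
      best-moved : cb v ≡ c → 0 < live (C′ ∘ src) v d → Prefers ⊎ cnt v ≤ live (C′ ∘ src) v d →
                   Best C′ cs′ v d (live (C′ ∘ src) v d)
      best-moved eq pos why = record
        { cnt≡ = refl
        ; cnt> = λ _ _ _ → pos
        ; low  = λ v<n e e<M te → case source-of e e<M of λ where
            (in-d Cd) → ≤-reflexive (cong cs′ (sym Cd))
            (in-c Cc) → subst (λ i → cs′ d ≤ cs′ i) (sym Cc) (lo-c why v<n (live-term {C′ ∘ src} e<M te Cc))
            (other ne eq′) → <⇒≤ (subst (λ i → cs′ d < cs′ i) (sym eq′)
              (proj₂ (both-parts ne (C<d (src< e e<M)) (low-c eq v<n e e<M te))))
        ; high = λ n≤v e e<M te → case source-of e e<M of λ where
            (in-d Cd) → ≤-reflexive (cong cs′ Cd)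
            (in-c Cc) → subst (λ i → cs′ i ≤ cs′ d) (sym Cc) (hi-c why n≤v (live-term {C′ ∘ src} e<M te Cc))
            (other ne eq′) → <⇒≤ (subst (λ i → cs′ i < cs′ d) (sym eq′)
              (proj₂ (both-parts′ ne (C<d (src< e e<M)) (high-c eq n≤v e e<M te)))) }
        where
        all-d : cnt v ≤ live (C′ ∘ src) v d → ¬ 0 < live (C′ ∘ src) v c
        all-d le p = ≤⇒≯ (subst (_≤ live (C′ ∘ src) v d) (cnt-split eq) le) (m<n+m _ p)
        lo-c : Prefers ⊎ cnt v ≤ live (C′ ∘ src) v d → v < n → 0 < live (C′ ∘ src) v c → cs′ d ≤ cs′ c
        lo-c pr v<n p with shape | pr
        ... | inj₁ (_ , s , _ , t , _) | _ = subst₂ _≤_ (sym s) (sym t) (<⇒≤ cs<b)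
        ... | inj₂ _ | inj₂ le = contradiction p (all-d le)
        ... | inj₂ _ | inj₁ (inj₂ (_ , n≤v)) = contradiction v<n (≤⇒≯ n≤v)
        ... | inj₂ (s1 , _) | inj₁ (inj₁ (s0 , _)) = contradiction (trans (sym s1) s0) λ ()
        hi-c : Prefers ⊎ cnt v ≤ live (C′ ∘ src) v d → n ≤ v → 0 < live (C′ ∘ src) v c → cs′ c ≤ cs′ d
        hi-c pr n≤v p with shape | pr
        ... | inj₂ (_ , s , _ , t , _) | _ = subst₂ _≤_ (sym s) (sym t) (<⇒≤ cs<b)
        ... | inj₁ _ | inj₂ le = contradiction p (all-d le)
        ... | inj₁ _ | inj₁ (inj₁ (_ , v<n)) = contradiction v<n (≤⇒≯ n≤v)
        ... | inj₁ (s0 , _) | inj₁ (inj₂ (s1 , _)) = contradiction (trans (sym s1) s0) λ ()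

      -- An edge from `c` remains because fewer than `cnt v` of the best edges come from `d`; and as
      -- `d` is not preferred, `c` is the better half.
      best-stays : cb v ≡ c → ¬ Prefers → live (C′ ∘ src) v d < cnt v →
                   Best C′ cs′ v c (cnt v ∸ live (C′ ∘ src) v d)
      best-stays eq ¬pref lt = record
        { cnt≡ = trans (cong (_∸ live (C′ ∘ src) v d) (cnt-split eq)) (m+n∸n≡m _ (live (C′ ∘ src) v d))
        ; cnt> = λ _ _ _ → m<n⇒0<n∸m lt
        ; low  = λ v<n e e<M te → case source-of e e<M of λ where
            (in-d Cd) → subst (λ i → cs′ c ≤ cs′ i) (sym Cd) (lo-d v<n)
            (in-c Cc) → ≤-reflexive (cong cs′ (sym Cc))
            (other ne eq′) → <⇒≤ (subst (λ i → cs′ c < cs′ i) (sym eq′)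
              (proj₁ (both-parts ne (C<d (src< e e<M)) (low-c eq v<n e e<M te))))
        ; high = λ n≤v e e<M te → case source-of e e<M of λ where
            (in-d Cd) → subst (λ i → cs′ i ≤ cs′ c) (sym Cd) (hi-d n≤v)
            (in-c Cc) → ≤-reflexive (cong cs′ Cc)
            (other ne eq′) → <⇒≤ (subst (λ i → cs′ i < cs′ c) (sym eq′)
              (proj₁ (both-parts′ ne (C<d (src< e e<M)) (high-c eq n≤v e e<M te)))) }
        where
        lo-d : v < n → cs′ c ≤ cs′ d
        lo-d v<n with shape
        ... | inj₁ (s0 , _) = contradiction (inj₁ (s0 , v<n)) ¬pref
        ... | inj₂ (_ , s , _ , t , _) = subst₂ _≤_ (sym s) (sym t) (<⇒≤ cs<b)
        hi-d : n ≤ v → cs′ d ≤ cs′ c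
        hi-d n≤v with shape
        ... | inj₁ (_ , s , _ , t , _) = subst₂ _≤_ (sym s) (sym t) (<⇒≤ cs<b)
        ... | inj₂ (s1 , _) = contradiction (inj₂ (s1 , n≤v)) ¬pref

    -- The nodes that leave `D` change their best block from `c` to `d`, so the child `f` must take
    -- the same end of `D` as `d` takes of `c`.
    Cut : (fs₁ fe₁ : ℕ → ℕ) → ℕ → ℕ → Set
    Cut fs₁ fe₁ D f =
      (side ≡ 0 × fs₁ f ≡ fs D × fe₁ f ≡ fs₁ D × fe₁ D ≡ fe D × fs D ≤ fs₁ D × fs₁ D ≤ fe₁ D) ⊎
      (side ≡ 1 × fs₁ D ≡ fs D × fe₁ D ≡ fs₁ f × fe₁ f ≡ fe D × fs₁ D ≤ fe₁ D × fs₁ f ≤ fe₁ f)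

    -- The touched nodes T j, …, T (tl - 1) are still to be treated.  The nodes
    -- that leave the fine block D in this round form its child.
    record Touched (v : View) (j tl : ℕ) (T : ℕ → ℕ) : Set where
      module V = View v
      field
        perm₁  : Perm N V.E V.P
        same   : ∀ p → p < N → F (V.E p) ≡ F (E p)
        fine₁  : Blocks N (V.F ∘ V.E) V.fs V.fe V.nf
        nf≤    : nf ≤ V.nf
        step   : ∀ x → x < N → (V.F x ≡ F x × V.cb x ≡ cb x) ⊎
                   (nf ≤ V.F x × V.child (F x) ≡ V.F x × cb x ≡ c × V.cb x ≡ d × lab x ≢ 0)
        cut    : ∀ D → D < nf → (V.child D < nf × V.fs D ≡ fs D × V.fe D ≡ fe D) ⊎
                   (nf ≤ V.child D × V.par (V.child D) ≡ D × Cut V.fs V.fe D (V.child D))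
        child₁ : ∀ D → V.child D < V.nf
        par₁   : ∀ D → V.par D < V.nf
        status : ∀ x → x < N → (V.K x ≡ 0 × Best C′ cs′ x (V.cb x) (V.cnt x)) ⊎
                   ((∃[ i ] j ≤ i × i < tl × T i ≡ x) × V.K x ≡ live (C′ ∘ src) x d ×
                    V.cb x ≡ cb x × V.cnt x ≡ cnt x × V.F x ≡ F x)

    best-if-zero : ∀ x → x < N → live (C′ ∘ src) x d ≡ 0 ⊎ cb x ≢ c → Best C′ cs′ x (cb x) (cnt x)
    best-if-zero x x<N h with cb x ≟ c | h
    ... | no ne | _ = best-far x<N ne
    ... | yes eq | inj₁ z = subst (λ i → Best C′ cs′ x i (cnt x)) (sym eq) (best-untouched x<N eq z)
    ... | yes eq | inj₂ ne = contradiction eq ne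

    touched-start : ∀ {tl T C₁ cs₁ ce₁ nc₁} {K₁ : ℕ → ℕ} →
      (∀ x → x < N → K₁ x ≡ live (C′ ∘ src) x d) → (∀ x → x < N → 0 < K₁ x → ∃[ i ] i < tl × T i ≡ x) →
      Touched (record v₀ { C = C₁ ; cs = cs₁ ; ce = ce₁ ; nc = nc₁ ; K = K₁ }) 0 tl T
    touched-start {tl} {T} {K₁ = K₁} K≡ T∋ = record
      { perm₁ = perm ; same = λ _ _ → refl ; fine₁ = fine ; nf≤ = ≤-refl
      ; step = λ _ _ → inj₁ (refl , refl)
      ; cut = λ D _ → inj₁ (child< D , refl , refl)
      ; child₁ = child< ; par₁ = par<
      ; status = st }
      where
      st : ∀ x → x < N → _
      st x x<N with K₁ x ≟ 0
      ... | yes z = inj₁ (z , best-if-zero x x<N (inj₁ (trans (sym (K≡ x x<N)) z)))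
      ... | no nz with T∋ x x<N (n≢0⇒n>0 nz)
      ...   | i , i<tl , eq = inj₂ ((i , z≤n , i<tl , eq) , K≡ x x<N , refl , refl , refl)

    module _ {v : View} {j tl : ℕ} {T : ℕ → ℕ} (τ : Touched v j tl T) where
      open Touched τ

      Status : (cb₁ cnt₁ K₁ F₁ : ℕ → ℕ) → ℕ → ℕ → Set
      Status cb₁ cnt₁ K₁ F₁ j x = (K₁ x ≡ 0 × Best C′ cs′ x (cb₁ x) (cnt₁ x)) ⊎
        ((∃[ i ] j ≤ i × i < tl × T i ≡ x) × K₁ x ≡ live (C′ ∘ src) x d ×
         cb₁ x ≡ cb x × cnt₁ x ≡ cnt x × F₁ x ≡ F x)

      later : ∀ {x} → x ≢ T j → (∃[ i ] j ≤ i × i < tl × T i ≡ x) → ∃[ i ] suc j ≤ i × i < tl × T i ≡ x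
      later ne (i , j≤i , i<tl , eq) = i , ≤∧≢⇒< j≤i (λ { refl → ne (sym eq) }) , i<tl , eq

      settle : ∀ {i m f} → Best C′ cs′ (T j) i m → ∀ x → x < N →
        Status (V.cb [ T j ↦ i ]) (V.cnt [ T j ↦ m ]) (V.K [ T j ↦ 0 ]) (V.F [ T j ↦ f ]) (suc j) x
      settle {i} {m} {f} bst x x<N with x ≟ T j
      ... | yes refl rewrite upd≡ V.cb (T j) i | upd≡ V.cnt (T j) m | upd≡ V.K (T j) 0 = inj₁ (refl , bst)
      ... | no ne rewrite upd≢ V.cb (T j) i ne | upd≢ V.cnt (T j) m ne | upd≢ V.K (T j) 0 ne | upd≢ V.F (T j) f ne
        with status x x<N
      ...   | inj₁ s = inj₁ s
      ...   | inj₂ (t , r) = inj₂ (later ne t , r)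

      settle-stay : ∀ {m} → Best C′ cs′ (T j) (V.cb (T j)) m → ∀ x → x < N →
        Status V.cb (V.cnt [ T j ↦ m ]) (V.K [ T j ↦ 0 ]) V.F (suc j) x
      settle-stay {m} bst x x<N with x ≟ T j
      ... | yes refl rewrite upd≡ V.cnt (T j) m | upd≡ V.K (T j) 0 = inj₁ (refl , bst)
      ... | no ne rewrite upd≢ V.cnt (T j) m ne | upd≢ V.K (T j) 0 ne with status x x<N
      ...   | inj₁ s = inj₁ s
      ...   | inj₂ (t , r) = inj₂ (later ne t , r)

      settle-skip : Best C′ cs′ (T j) (V.cb (T j)) (V.cnt (T j)) → ∀ x → x < N →
        Status V.cb V.cnt (V.K [ T j ↦ 0 ]) V.F (suc j) x
      settle-skip bst x x<N with x ≟ T j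
      ... | yes refl rewrite upd≡ V.K (T j) 0 = inj₁ (refl , bst)
      ... | no ne rewrite upd≢ V.K (T j) 0 ne with status x x<N
      ...   | inj₁ s = inj₁ s
      ...   | inj₂ (t , r) = inj₂ (later ne t , r)

      -- A node occurs in `T` once for every scanned edge into it. Its first treatment resets `K`,
      -- so further occurrences pass here, as do nodes whose best block is not `c`.
      touched-skip : T j < N → V.K (T j) ≡ 0 ⊎ V.cb (T j) ≢ c →
        Touched (record v { K = V.K [ T j ↦ 0 ] }) (suc j) tl T
      touched-skip u<N why = record
        { perm₁ = perm₁ ; same = same ; fine₁ = fine₁ ; nf≤ = nf≤ ; step = step ; cut = cut
        ; child₁ = child₁ ; par₁ = par₁ ; status = settle-skip bst }
        where
        bst : Best C′ cs′ (T j) (V.cb (T j)) (V.cnt (T j))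
        bst with status (T j) u<N
        ... | inj₁ (_ , bs) = bs
        ... | inj₂ (_ , K≡ , cb≡ , cnt≡ , _) = subst₂ (Best C′ cs′ (T j)) (sym cb≡) (sym cnt≡)
          (best-if-zero (T j) u<N (case why of λ where
            (inj₁ z)  → inj₁ (trans (sym K≡) z)
            (inj₂ ne) → inj₂ (ne ∘ trans cb≡)))

      module Treat (u<N : T j < N) (K> : 0 < V.K (T j)) (cb≡c : V.cb (T j) ≡ c) where

        private
          u = T j
          waiting : V.K u ≡ live (C′ ∘ src) u d × V.cb u ≡ cb u × V.cnt u ≡ cnt u × V.F u ≡ F u
          waiting with status u u<N
          ... | inj₁ (z , _) = contradiction z (>⇒≢ K>)
          ... | inj₂ (_ , r) = r
          K≡ : V.K u ≡ live (C′ ∘ src) u d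
          K≡ = proj₁ waiting
          cb₀≡c : cb u ≡ c
          cb₀≡c = trans (sym (proj₁ (proj₂ waiting))) cb≡c
          cnt₁≡ : V.cnt u ≡ cnt u
          cnt₁≡ = proj₁ (proj₂ (proj₂ waiting))

        F₁≡ : V.F u ≡ F u
        F₁≡ = proj₂ (proj₂ (proj₂ waiting))

        touched-stay : ¬ Prefers u<N → V.K u < V.cnt u →
          Touched (record v { cnt = V.cnt [ u ↦ V.cnt u ∸ V.K u ] ; K = V.K [ u ↦ 0 ] }) (suc j) tl T
        touched-stay ¬pref lt = record
          { perm₁ = perm₁ ; same = same ; fine₁ = fine₁ ; nf≤ = nf≤ ; step = step ; cut = cut
          ; child₁ = child₁ ; par₁ = par₁
          ; status = settle-stay (subst₂ (Best C′ cs′ u) (sym cb≡c) (sym (cong₂ _∸_ cnt₁≡ K≡))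
              (best-stays u<N cb₀≡c ¬pref (subst₂ _<_ K≡ cnt₁≡ lt))) }

        private
          D = F u
          f = V.child D

        D<nf : D < nf
        D<nf = subst (λ x → F x < nf) (E∘P u u<N) (Blocks.id< fine (P u) (P< u u<N))

        F₁-inside : V.fs D ≤ V.P u × V.P u < V.fe D
        F₁-inside = subst (λ i → V.fs i ≤ V.P u × V.P u < V.fe i) F₁≡
          (subst (λ x → V.fs (V.F x) ≤ V.P u × V.P u < V.fe (V.F x)) (Perm.E∘P perm₁ u u<N)
            (Blocks.lo≤ fine₁ (V.P u) (Perm.P< perm₁ u u<N) , Blocks.<hi fine₁ (V.P u) (Perm.P< perm₁ u u<N)))

        slot : ∀ {s} → V.fs D ≤ s → s < V.fe D → s < N × V.F (V.E s) ≡ D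
        slot = Blocks.exact fine₁ D _ (<-≤-trans D<nf nf≤)

        -- The node u is exchanged with the node at position s, an end of its block.
        touched-move : nf ≤ f → Prefers u<N ⊎ V.cnt u ≤ V.K u → ∀ s → V.fs D ≤ s → s < V.fe D →
          ∀ {fs₂ fe₂} → (∀ i → i ≢ D → i ≢ f → fs₂ i ≡ V.fs i × fe₂ i ≡ V.fe i) →
          (∀ {J′} → J′ s ≡ f → (∀ p → p < N → p ≢ s → J′ p ≡ V.F (V.E p)) → Blocks N J′ fs₂ fe₂ V.nf) →
          (Cut V.fs V.fe D f → Cut fs₂ fe₂ D f) →
          Touched (record v { E = (V.E [ V.P u ↦ V.E s ]) [ s ↦ u ] ; P = (V.P [ V.E s ↦ V.P u ]) [ u ↦ s ]
                            ; F = V.F [ u ↦ f ] ; fs = fs₂ ; fe = fe₂ ; cb = V.cb [ u ↦ d ]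
                            ; cnt = V.cnt [ u ↦ V.K u ] ; K = V.K [ u ↦ 0 ] }) (suc j) tl T
        touched-move nf≤f why s fs≤s s<fe {fs₂} {fe₂} away blocks newcut = record
          { perm₁ = perm₂
          ; same = λ p p<N → trans (swap-class perm₁ F u<N s<N Fu≡Fy p p<N) (same p p<N)
          ; fine₁ = blocks (trans (cong (V.F [ u ↦ f ]) (upd≡ E₁ s u)) (upd≡ V.F u f)) λ p p<N p≢s →
              trans (upd≢ V.F u f λ Ep≡u → p≢s (trans (sym (Perm.P∘E perm₂ p p<N))
                (trans (cong P₂ Ep≡u) (upd≡ (V.P [ V.E s ↦ V.P u ]) u s))))
                (swap-class perm₁ V.F u<N s<N (trans F₁≡ (sym (proj₂ sl))) p p<N)
          ; nf≤ = nf≤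
          ; step = st
          ; cut = ct
          ; child₁ = child₁ ; par₁ = par₁
          ; status = settle (subst (Best C′ cs′ u d) (sym K≡) (best-moved u<N cb₀≡c (subst (0 <_) K≡ K>)
              (case why of λ { (inj₁ p) → inj₁ p ; (inj₂ le) → inj₂ (subst₂ _≤_ cnt₁≡ K≡ le) }))) }
          where
          sl = slot fs≤s s<fe
          s<N = proj₁ sl
          E₁ = V.E [ V.P u ↦ V.E s ]
          P₂ = (V.P [ V.E s ↦ V.P u ]) [ u ↦ s ]
          perm₂ = swap-perm perm₁ u<N s<N
          D≢f : ∀ {i} → i < nf → i ≢ f
          D≢f i<nf refl = ≤⇒≯ nf≤f i<nf
          -- The node at `s` carries the old name `D`, whereas moved nodes carry names from `nf` on;
          -- so it has not moved in this round.
          Fu≡Fy : F u ≡ F (V.E s)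
          Fu≡Fy with step (V.E s) (Perm.E< perm₁ s s<N)
          ... | inj₁ (eq , _) = trans (sym (proj₂ sl)) eq
          ... | inj₂ (le , _) = contradiction D<nf (≤⇒≯ (subst (nf ≤_) (proj₂ sl) le))
          lab≢ : lab u ≢ 0
          lab≢ with live-pos (C′ ∘ src) u d (subst (0 <_) K≡ K>)
          ... | e , e<M , eq , _ = subst (λ x → lab x ≢ 0) eq (lab≢0 e e<M)
          st : ∀ x → x < N → ((V.F [ u ↦ f ]) x ≡ F x × (V.cb [ u ↦ d ]) x ≡ cb x) ⊎
               (nf ≤ (V.F [ u ↦ f ]) x × V.child (F x) ≡ (V.F [ u ↦ f ]) x × cb x ≡ c × (V.cb [ u ↦ d ]) x ≡ d ×
                   lab x ≢ 0)
          st x x<N with x ≟ u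
          ... | no ne rewrite upd≢ V.F u f ne | upd≢ V.cb u d ne = step x x<N
          ... | yes refl rewrite upd≡ V.F u f | upd≡ V.cb u d = inj₂ (nf≤f , refl , cb₀≡c , refl , lab≢)
          child-inj : ∀ {D′} → nf ≤ V.child D′ → V.par (V.child D′) ≡ D′ → D′ ≢ D → V.child D′ ≢ f
          child-inj _ par≡ ne eq with cut D D<nf
          ... | inj₁ (lt , _) = ≤⇒≯ nf≤f lt
          ... | inj₂ (_ , par≡′ , _) = ne (trans (sym par≡) (trans (cong V.par eq) par≡′))
          ct : ∀ D′ → D′ < nf → (V.child D′ < nf × fs₂ D′ ≡ fs D′ × fe₂ D′ ≡ fe D′) ⊎
               (nf ≤ V.child D′ × V.par (V.child D′) ≡ D′ × Cut fs₂ fe₂ D′ (V.child D′))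
          ct D′ D′<nf with D′ ≟ D | cut D′ D′<nf
          ... | yes refl | inj₁ (lt , _) = contradiction lt (≤⇒≯ nf≤f)
          ... | yes refl | inj₂ (l , p , cu) = inj₂ (l , p , newcut cu)
          ... | no ne | inj₁ (lt , a , b) = let a′ , b′ = away D′ ne (D≢f D′<nf) in inj₁ (lt , trans a′ a , trans b′ b)
          ... | no ne | inj₂ (l , p , cu) rewrite proj₁ (away D′ ne (D≢f D′<nf)) | proj₂ (away D′ ne (D≢f D′<nf))
            | proj₁ (away (V.child D′) (λ eq → ≤⇒≯ l (subst (_< nf) (sym eq) D<nf)) (child-inj l p ne))
            | proj₂ (away (V.child D′) (λ eq → ≤⇒≯ l (subst (_< nf) (sym eq) D<nf)) (child-inj l p ne)) =
                inj₂ (l , p , cu)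

        private
          D≢f : nf ≤ f → D ≢ f
          D≢f nf≤f eq = ≤⇒≯ nf≤f (subst (_< nf) eq D<nf)

          the-cut : nf ≤ f → Cut V.fs V.fe D f
          the-cut nf≤f with cut D D<nf
          ... | inj₁ (lt , _) = contradiction lt (≤⇒≯ nf≤f)
          ... | inj₂ (_ , _ , cu) = cu

        touched-move-left : side ≡ 0 → nf ≤ f → Prefers u<N ⊎ V.cnt u ≤ V.K u → let s = V.fs D in
          Touched (record v { E = (V.E [ V.P u ↦ V.E s ]) [ s ↦ u ] ; P = (V.P [ V.E s ↦ V.P u ]) [ u ↦ s ]
                            ; F = V.F [ u ↦ f ] ; fs = V.fs [ D ↦ suc s ] ; fe = V.fe [ f ↦ suc s ]
                            ; cb = V.cb [ u ↦ d ] ; cnt = V.cnt [ u ↦ V.K u ] ; K = V.K [ u ↦ 0 ] }) (suc j) tl T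
        touched-move-left s0 nf≤f why = touched-move nf≤f why s ≤-refl s<fe
          (λ i i≢D i≢f → upd≢ V.fs D (suc s) i≢D , upd≢ V.fe f (suc s) i≢f)
          (λ {J′} at aw → subst (λ i → Blocks N J′ (V.fs [ i ↦ suc s ]) (V.fe [ f ↦ suc s ]) V.nf) (proj₂ sl)
            (grow-right fine₁ (proj₁ sl) (child₁ D) (λ eq → D≢f nf≤f (sym (trans eq (proj₂ sl)))) at aw
              (cong V.fs (proj₂ sl)) (proj₁ (ends (the-cut nf≤f))) (proj₂ (ends (the-cut nf≤f)))))
          newcut
          where
          s = V.fs D
          s<fe : s < V.fe D
          s<fe = ≤-<-trans (proj₁ F₁-inside) (proj₂ F₁-inside)
          sl = slot ≤-refl s<fe
          ends : Cut V.fs V.fe D f → V.fe f ≡ s × V.fs f ≤ s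
          ends (inj₁ (_ , a , b , _ , le , _)) = b , subst (_≤ s) (sym a) le
          ends (inj₂ (s1 , _)) = contradiction (trans (sym s0) s1) λ ()
          newcut : Cut V.fs V.fe D f → Cut (V.fs [ D ↦ suc s ]) (V.fe [ f ↦ suc s ]) D f
          newcut (inj₂ (s1 , _)) = contradiction (trans (sym s0) s1) λ ()
          newcut (inj₁ (_ , a , b , e , le , _))
            rewrite upd≢ V.fs D (suc s) (D≢f nf≤f ∘ sym) | upd≡ V.fe f (suc s) | upd≡ V.fs D (suc s)
                  | upd≢ V.fe f (suc s) (D≢f nf≤f)
            = inj₁ (s0 , a , refl , e , m≤n⇒m≤1+n le , s<fe)

        touched-move-right : side ≡ 1 → nf ≤ f → Prefers u<N ⊎ V.cnt u ≤ V.K u → let s = V.fe D ∸ 1 in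
          Touched (record v { E = (V.E [ V.P u ↦ V.E s ]) [ s ↦ u ] ; P = (V.P [ V.E s ↦ V.P u ]) [ u ↦ s ]
                            ; F = V.F [ u ↦ f ] ; fs = V.fs [ f ↦ s ] ; fe = V.fe [ D ↦ s ]
                            ; cb = V.cb [ u ↦ d ] ; cnt = V.cnt [ u ↦ V.K u ] ; K = V.K [ u ↦ 0 ] }) (suc j) tl T
        touched-move-right s1 nf≤f why = touched-move nf≤f why s fs≤s (≤-reflexive s+1)
          (λ i i≢D i≢f → upd≢ V.fs f s i≢f , upd≢ V.fe D s i≢D)
          (λ {J′} at aw → subst (λ i → Blocks N J′ (V.fs [ f ↦ s ]) (V.fe [ i ↦ s ]) V.nf) (proj₂ sl)
            (grow-left fine₁ (proj₁ sl) (child₁ D) (λ eq → D≢f nf≤f (sym (trans eq (proj₂ sl)))) at aw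
              (trans (cong V.fe (proj₂ sl)) (sym s+1)) (proj₁ (ends (the-cut nf≤f))) (proj₂ (ends (the-cut nf≤f)))))
          newcut
          where
          s = V.fe D ∸ 1
          s+1 : suc s ≡ V.fe D
          s+1 = m+[n∸m]≡n (≤-trans (s≤s z≤n) (proj₂ F₁-inside))
          fs≤s : V.fs D ≤ s
          fs≤s = ≤-pred (subst (suc (V.fs D) ≤_) (sym s+1) (≤-<-trans (proj₁ F₁-inside) (proj₂ F₁-inside)))
          sl = slot fs≤s (≤-reflexive s+1)
          ends : Cut V.fs V.fe D f → V.fs f ≡ suc s × suc s ≤ V.fe f
          ends (inj₁ (s0 , _)) = contradiction (trans (sym s0) s1) λ ()
          ends (inj₂ (_ , _ , a , _ , _ , le)) = trans (sym a) (sym s+1) , subst (_≤ V.fe f)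
              (trans (sym a) (sym s+1)) le
          newcut : Cut V.fs V.fe D f → Cut (V.fs [ f ↦ s ]) (V.fe [ D ↦ s ]) D f
          newcut (inj₁ (s0 , _)) = contradiction (trans (sym s0) s1) λ ()
          newcut cu@(inj₂ (_ , a , b , e , _ , le))
            rewrite upd≡ V.fs f s | upd≡ V.fe D s | upd≢ V.fs f s (D≢f nf≤f) | upd≢ V.fe D s (D≢f nf≤f ∘ sym)
            = inj₂ (s1 , a , refl , e , fs≤s , ≤-trans (n≤1+n s) (proj₂ (ends cu)))

      -- The child starts out empty at that end of `D` where nodes are split off; the moves then
      -- fill it.
      touched-child : ∀ D → D < nf → V.child D < nf → V.fs D ≤ V.fe D → ∀ {p} →
        (side ≡ 0 × p ≡ V.fs D) ⊎ (side ≡ 1 × p ≡ V.fe D) →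
        Touched (record v { child = V.child [ D ↦ V.nf ] ; fs = V.fs [ V.nf ↦ p ] ; fe = V.fe [ V.nf ↦ p ]
                          ; par = V.par [ V.nf ↦ D ] ; nf = suc V.nf }) j tl T
      touched-child D D<nf fresh le {p} where-p = record
        { perm₁ = perm₁ ; same = same ; fine₁ = new-block fine₁ p ; nf≤ = m≤n⇒m≤1+n nf≤
        ; step = λ x x<N → case step x x<N of λ where
            (inj₁ r) → inj₁ r
            (inj₂ (l , eq , r)) → inj₂ (l , trans (upd≢ V.child D V.nf λ Fx≡D →
               ≤⇒≯ l (subst (_< nf) (trans (cong V.child (sym Fx≡D)) eq) fresh)) eq , r)
        ; cut = ct
        ; child₁ = λ i → upd-elim {f = V.child} (λ _ h → h < suc V.nf) ≤-refl i λ _ → m<n⇒m<1+n (child₁ i)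
        ; par₁ = λ i → upd-elim {f = V.par} (λ _ h → h < suc V.nf) (m<n⇒m<1+n (<-≤-trans D<nf nf≤)) i λ _ →
            m<n⇒m<1+n (par₁ i)
        ; status = status }
        where
        fs₂ = V.fs [ V.nf ↦ p ]
        fe₂ = V.fe [ V.nf ↦ p ]
        ct : ∀ D′ → D′ < nf → ((V.child [ D ↦ V.nf ]) D′ < nf × fs₂ D′ ≡ fs D′ × fe₂ D′ ≡ fe D′) ⊎
             (nf ≤ (V.child [ D ↦ V.nf ]) D′ × (V.par [ V.nf ↦ D ]) ((V.child [ D ↦ V.nf ]) D′) ≡ D′ ×
              Cut fs₂ fe₂ D′ ((V.child [ D ↦ V.nf ]) D′))
        ct D′ D′<nf with D′ ≟ D
        ... | yes refl rewrite upd≡ V.child D′ V.nf | upd≡ V.par V.nf D′ | upd≡ V.fs V.nf p | upd≡ V.fe V.nf p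
            | upd≢ V.fs V.nf p (<⇒≢ (<-≤-trans D<nf nf≤)) | upd≢ V.fe V.nf p (<⇒≢ (<-≤-trans D<nf nf≤))
            with cut D′ D<nf
        ...   | inj₂ (l , _) = contradiction fresh (≤⇒≯ l)
        ...   | inj₁ (_ , a , b) = inj₂ (nf≤ , refl , (case where-p of λ where
                (inj₁ (s0 , p≡)) → inj₁ (s0 , trans p≡ a , p≡ , b , ≤-reflexive (sym a) , le)
                (inj₂ (s1 , p≡)) → inj₂ (s1 , a , sym p≡ , trans p≡ b , le , ≤-refl)))
        ct D′ D′<nf | no ne rewrite upd≢ V.child D V.nf ne | upd≢ V.par V.nf D (<⇒≢ (child₁ D′))
            | upd≢ V.fs V.nf p (<⇒≢ (<-≤-trans D′<nf nf≤)) | upd≢ V.fe V.nf p (<⇒≢ (<-≤-trans D′<nf nf≤))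
            | upd≢ V.fs V.nf p (<⇒≢ (child₁ D′)) | upd≢ V.fe V.nf p (<⇒≢ (child₁ D′)) = cut D′ D′<nf

    touched-end : ∀ {v tl T} → Touched v tl tl T →
      Inv (record v { C = C′ ; cs = cs′ ; ce = ce′ ; nc = suc d ; B = B ; nb = nb }) (suc q) nf
    touched-end {v} {tl} {T} τ = record
      { perm = perm₁ ; fine = fine₁
      -- Nodes were exchanged only within fine blocks of the start of the round, and on these `C′`
      -- is constant.
      ; coarse = Blocks-cong coarse′ λ p p<N → sym (refines′ _ _ (Perm.E< perm₁ p p<N) (E< p p<N) (same p p<N))
      ; nonempty = nonempty′
      ; refines = λ x y x<N y<N eq → refines′ x y x<N y<N (same-F x<N y<N eq)
      ; cb< = λ x x<N → case step x x<N of λ where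
          (inj₁ (_ , eq)) → subst (_< suc d) (sym eq) (m<n⇒m<1+n (cb< x x<N))
          (inj₂ (_ , _ , _ , eq , _)) → subst (_< suc d) (sym eq) ≤-refl
      ; root = λ x x<N l0 → case step x x<N of λ where
          (inj₁ (_ , eq)) → trans eq (root x x<N l0)
          (inj₂ (_ , _ , _ , _ , ne)) → contradiction l0 ne
      ; best = λ x x<N → proj₂ (settled x x<N)
      ; K≡0 = λ x x<N → proj₁ (settled x x<N)
      ; key≡ = key≡′ ; key< = key<′
      ; witness = witness′
      ; pending = λ j lt j<nb → let b<N , eq = pending j (<⇒≤ lt) j<nb in b<N , still-start b<N eq
      ; queued = qd
      ; child< = child₁ ; par< = par₁ }
      where
      open Touched τ
      settled : ∀ x → x < N → V.K x ≡ 0 × Best C′ cs′ x (V.cb x) (V.cnt x)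
      settled x x<N with status x x<N
      ... | inj₁ s = s
      ... | inj₂ ((i , l , h , _) , _) = contradiction h (≤⇒≯ l)
      F<nf : ∀ {x} → x < N → F x < nf
      F<nf {x} x<N = subst (λ y → F y < nf) (E∘P x x<N) (Blocks.id< fine (P x) (P< x x<N))
      child-cut : ∀ {D} → D < nf → nf ≤ V.child D → V.par (V.child D) ≡ D × Cut V.fs V.fe D (V.child D)
      child-cut {D} D<nf l with cut D D<nf
      ... | inj₁ (lt , _) = contradiction lt (≤⇒≯ l)
      ... | inj₂ (_ , r) = r
      same-F : ∀ {x y} → x < N → y < N → V.F x ≡ V.F y → F x ≡ F y
      same-F {x} {y} x<N y<N eq with step x x<N | step y y<N
      ... | inj₁ (a , _) | inj₁ (b , _) = trans (sym a) (trans eq b)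
      ... | inj₁ (a , _) | inj₂ (l , _) = contradiction (subst (_< nf) (trans (sym a) eq) (F<nf x<N)) (≤⇒≯ l)
      ... | inj₂ (l , _) | inj₁ (b , _) = contradiction (subst (_< nf) (trans (sym b) (sym eq)) (F<nf y<N)) (≤⇒≯ l)
      ... | inj₂ (l , a , _) | inj₂ (l′ , b , _) =
        trans (sym (proj₁ (child-cut (F<nf x<N) (subst (nf ≤_) (sym a) l))))
          (trans (cong V.par (trans a (trans eq (sym b)))) (proj₁ (child-cut (F<nf y<N) (subst (nf ≤_) (sym b) l′))))
      hull : ∀ {x} → x < N → fs (F x) ≤ V.fs (V.F x) × V.fe (V.F x) ≤ fe (F x)
      hull {x} x<N with step x x<N
      ... | inj₂ (l , a , _) rewrite sym a with proj₂ (child-cut (F<nf x<N) l)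
      ...   | inj₁ (_ , e₁ , e₂ , e₃ , _ , le) = ≤-reflexive (sym e₁) , subst₂ _≤_ (sym e₂) e₃ le
      ...   | inj₂ (_ , e₁ , e₂ , e₃ , le , _) = subst₂ _≤_ e₁ e₂ le , ≤-reflexive e₃
      hull {x} x<N | inj₁ (a , _) rewrite a with cut (F x) (F<nf x<N)
      ... | inj₁ (_ , e₁ , e₂) = ≤-reflexive (sym e₁) , ≤-reflexive e₂
      ... | inj₂ (_ , _ , inj₁ (_ , _ , _ , e , le , _)) = le , ≤-reflexive e
      ... | inj₂ (_ , _ , inj₂ (_ , e₁ , e₂ , e₃ , _ , le)) = ≤-reflexive (sym e₁) , subst₂ _≤_ (sym e₂) e₃ le
      inside : ∀ {x} → x < N → V.fs (V.F x) ≤ V.P x × V.P x < V.fe (V.F x)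
      inside {x} x<N = subst (λ y → V.fs (V.F y) ≤ V.P x × V.P x < V.fe (V.F y)) (Perm.E∘P perm₁ x x<N)
        (Blocks.lo≤ fine₁ (V.P x) (Perm.P< perm₁ x x<N) , Blocks.<hi fine₁ (V.P x) (Perm.P< perm₁ x x<N))
      still-start : ∀ {b′} → b′ < N → fs (F (E b′)) ≡ b′ → V.fs (V.F (V.E b′)) ≡ b′
      still-start {b′} b<N eq = ≤-antisym
        (subst (V.fs (V.F (V.E b′)) ≤_) (Perm.P∘E perm₁ b′ b<N) (proj₁ (inside (Perm.E< perm₁ b′ b<N))))
        (subst (_≤ V.fs (V.F (V.E b′))) (trans (cong fs (same b′ b<N)) eq) (proj₁ (hull (Perm.E< perm₁ b′ b<N))))
      key≡′ : ∀ x y → x < N → y < N → V.F x ≡ V.F y → lab x ≡ lab y × V.cb x ≡ V.cb y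
      key≡′ x y x<N y<N eq with key≡ x y x<N y<N (same-F x<N y<N eq) | step x x<N | step y y<N
      ... | l , b≡b | inj₁ (_ , a) | inj₁ (_ , b) = l , trans a (trans b≡b (sym b))
      ... | l , _ | inj₂ (_ , _ , _ , a , _) | inj₂ (_ , _ , _ , b , _) = l , trans a (sym b)
      ... | _ | inj₁ (a , _) | inj₂ (l , _) = contradiction (subst (_< nf) (trans (sym a) eq) (F<nf x<N)) (≤⇒≯ l)
      ... | _ | inj₂ (l , _) | inj₁ (b , _) = contradiction (subst (_< nf) (trans (sym b) (sym eq)) (F<nf y<N)) (≤⇒≯ l)
      cb-part : ∀ {x} → x < N → Part (cb x) (V.cb x)
      cb-part {x} x<N with step x x<N
      ... | inj₁ (_ , eq) = inj₁ eq
      ... | inj₂ (_ , _ , eq , eq′ , _) = inj₂ (eq′ , eq)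
      Key< : ℕ → ℕ → Set
      Key< x y = lab x < lab y ⊎ (lab x ≡ lab y × cs′ (V.cb x) < cs′ (V.cb y))
      apart : ∀ {x y} → x < N → y < N → fs (F x) < fs (F y) → Key< x y
      apart {x} {y} x<N y<N lt with key< x y x<N y<N lt
      ... | inj₁ l = inj₁ l
      ... | inj₂ (e , l) = inj₂ (e , part-mono (cb< x x<N) (cb< y y<N) (cb-part x<N) (cb-part y<N) l)
      -- Blocks that were distinct before keep their order. The two parts of a block cut in this
      -- round differ in the best block, `c` or `d`, and the child was placed on the side of `d`.
      key<′ : ∀ x y → x < N → y < N → V.fs (V.F x) < V.fs (V.F y) → Key< x y
      key<′ x y x<N y<N lt with F x ≟ F y
      ... | no ne with <-or-≥ (fs (F x)) (fs (F y))
      ...   | inj₁ l = apart x<N y<N l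
      ...   | inj₂ ge with m≤n⇒m<n∨m≡n ge
      ...     | inj₂ eq = contradiction (trans (sym (cong F (E∘P x x<N)))
          (trans (start-injective fine (P< x x<N) (P< y y<N)
                  (trans (cong (fs ∘ F) (E∘P x x<N)) (trans (sym eq) (cong (fs ∘ F) (sym (E∘P y y<N))))))
                      (cong F (E∘P y y<N)))) ne
      ...     | inj₁ gt = contradiction lt (<-asym (<-≤-trans (≤-<-trans (proj₁ (inside y<N)) (proj₂ (inside y<N)))
                  (≤-trans (proj₂ (hull y<N)) (≤-trans
                    (disjoint fine (F<nf y<N) (F<nf x<N) gt (≤-<-trans (proj₁ (F-inside x<N)) (proj₂ (F-inside x<N))))
                    (proj₁ (hull x<N))))))
      key<′ x y x<N y<N lt | yes eq with step x x<N | step y y<N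
      ... | inj₁ (a , _) | inj₁ (b , _) = contradiction lt (<-irrefl (cong V.fs (trans a (trans eq (sym b)))))
      ... | inj₂ (_ , a , _) | inj₂ (_ , b , _) = contradiction lt
          (<-irrefl (cong V.fs (trans (sym a) (trans (cong V.child eq) b))))
      ... | inj₁ (a , cbx) | inj₂ (l , b , cby , cby′ , _) rewrite sym b | a | cby′ | cbx
          | proj₂ (key≡ x y x<N y<N eq) | cby with proj₂ (child-cut (F<nf y<N) l) | shape
      ...   | inj₁ (_ , e , _ , _ , le , _) | _ =
              contradiction (subst₂ _<_ (cong V.fs eq) e lt) (≤⇒≯ le)
      ...   | inj₂ (s1 , _) | inj₁ (s0 , _) = contradiction (trans (sym s0) s1) λ ()
      ...   | inj₂ _ | inj₂ (_ , s , _ , t , _) = inj₂ (proj₁ (key≡ x y x<N y<N eq) , subst₂ _<_ (sym s) (sym t) cs<b)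
      key<′ x y x<N y<N lt | yes eq | inj₂ (l , a , cbx , cbx′ , _) | inj₁ (b , cby) rewrite sym a | b | cbx′ | cby
          | sym (proj₂ (key≡ x y x<N y<N eq)) | cbx with proj₂ (child-cut (F<nf x<N) l) | shape
      ... | inj₂ (_ , _ , e , _ , le , _) | _ =
              contradiction (subst₂ _<_ (sym e) (cong V.fs (sym eq)) lt) (≤⇒≯ le)
      ... | inj₁ (s0 , _) | inj₂ (s1 , _) = contradiction (trans (sym s0) s1) λ ()
      ... | inj₁ _ | inj₁ (_ , s , _ , t , _) = inj₂ (proj₁ (key≡ x y x<N y<N eq) , subst₂ _<_ (sym s) (sym t) cs<b)
      qd : ∀ x → x < N → V.fs (V.F x) ≡ cs′ (C′ x) ⊎ (∃[ j ] suc q ≤ j × j < nb × B j ≡ V.fs (V.F x)) ⊎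
           (∃[ f ] nf ≤ f × f < V.nf × (f ≡ V.F x ⊎ V.par f ≡ V.F x))
      qd x x<N with step x x<N
      ... | inj₂ (l , eq , _) = inj₂ (inj₂ (V.F x , l , subst (_< V.nf) eq (child₁ (F x)) , inj₁ refl))
      ... | inj₁ (eq , _) with cut (F x) (F<nf x<N)
      ...   | inj₂ (l , par≡ , _) = inj₂ (inj₂ (V.child (F x) , l , child₁ (F x) , inj₂ (trans par≡ (sym eq))))
      ...   | inj₁ (_ , e , _) with queued′ x x<N
      ...     | inj₁ good = inj₁ (trans (cong V.fs eq) (trans e good))
      ...     | inj₂ (j , a , b , Bj) = inj₂ (inj₁ (j , a , b , trans Bj (sym (trans (cong V.fs eq) e))))

  module _ {v : View} {q r : ℕ} (I : Inv v q r) where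
    open View v
    open Inv I
    open Perm perm

    enqueue : q ≤ nb → ∀ {i} → i < nf → fs i < fe i →
      Inv (record v { B = B [ nb ↦ fs i ] ; nb = suc nb }) q r
    enqueue q≤nb {i} i<nf ne = record
      { perm = perm ; fine = fine ; coarse = coarse ; nonempty = nonempty ; refines = refines ; cb< = cb<
      ; root = root ; best = best ; K≡0 = K≡0 ; key≡ = key≡ ; key< = key< ; witness = witness
      ; pending = λ j q≤j j< → upd-elim {f = B} (λ _ b → b < N × fs (F (E b)) ≡ b)
          (let b<N , eq = Blocks.exact fine i (fs i) i<nf ≤-refl ne in b<N , cong fs eq) j
          λ j≢nb → pending j q≤j (≤∧≢⇒< (≤-pred j<) j≢nb)
      ; queued = λ x x<N → case queued x x<N of λ where
          (inj₁ g) → inj₁ g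
          (inj₂ (inj₁ (j , a , b , eq))) → inj₂ (inj₁ (j , a , m<n⇒m<1+n b , trans (upd≢ B nb (fs i) (<⇒≢ b)) eq))
          (inj₂ (inj₂ t)) → inj₂ (inj₂ t)
      ; child< = child< ; par< = par< }

    advance : (∀ i → i ≡ r ⊎ i ≡ par r → fs i < fe i → ∃[ j ] q ≤ j × j < nb × B j ≡ fs i) → Inv v q (suc r)
    advance done = record
      { perm = perm ; fine = fine ; coarse = coarse ; nonempty = nonempty ; refines = refines ; cb< = cb<
      ; root = root ; best = best ; K≡0 = K≡0 ; key≡ = key≡ ; key< = key< ; witness = witness ; pending = pending
      ; queued = λ x x<N → case queued x x<N of λ where
          (inj₁ g) → inj₁ g
          (inj₂ (inj₁ t)) → inj₂ (inj₁ t)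
          (inj₂ (inj₂ (f , r≤f , f<nf , why))) → case m≤n⇒m<n∨m≡n r≤f of λ where
            (inj₁ lt)   → inj₂ (inj₂ (f , lt , f<nf , why))
            (inj₂ refl) → inj₂ (inj₁ (done (F x) (case why of λ { (inj₁ eq) → inj₁ (sym eq)
                                                      ; (inj₂ eq) → inj₂ (sym eq) })
              (subst (λ y → fs (F y) < fe (F y)) (E∘P x x<N)
                (≤-<-trans (Blocks.lo≤ fine (P x) (P< x x<N)) (Blocks.<hi fine (P x) (P< x x<N))))))
      ; child< = child< ; par< = par< }

  -- Beginning and result of the refinement

  -- All that is kept of the refinement. `rank-≤` and `rank-<` pass a comparison on to all
  -- predecessors, which suits induction over walks; `rank-W` yields finite witnesses for an infimum
  -- below a supremum.
  record Ranking (rank : ℕ → ℕ) : Set where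
    field
      rank-≤  : ∀ x y → n ≤ x → x < N → y < n → rank x ≤ rank y → lab x < lab y ⊎
                (lab x ≡ lab y × (∀ e e′ → e < M → e′ < M → tgt e ≡ x → tgt e′ ≡ y → rank (src e) ≤ rank (src e′)))
      rank-<  : ∀ x y → n ≤ x → x < N → y < n → rank x < rank y → lab x < lab y ⊎
                (lab x ≡ lab y × lab x ≢ 0 ×
                 (∀ e e′ → e < M → e′ < M → tgt e ≡ x → tgt e′ ≡ y → rank (src e) < rank (src e′)))
      rank-W  : ∀ x y → x < n → n ≤ y → y < N → rank x < rank y → W x y

  -- With nothing queued, every fine block begins its compound block, so ranks compare as keys do,
  -- and keys compare best predecessor blocks. `high` and `low` of `Best` extend this to all
  -- predecessors.
  ranking : ∀ {v q} → View.nb v ≤ q → Inv v q (View.nf v) → n ≤ N → Ranking (View.cs v ∘ View.C v)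
  ranking {v} {q} nb≤q I n≤N = record { rank-≤ = r≤ ; rank-< = r< ; rank-W = witness }
    where
    open View v
    open Inv I
    open Perm perm
    final : ∀ {x} → x < N → cs (C x) ≡ fs (F x)
    final {x} x<N with queued x x<N
    ... | inj₁ eq = sym eq
    ... | inj₂ (inj₁ (j , q≤j , j<nb , _)) = contradiction j<nb (≤⇒≯ (≤-trans nb≤q q≤j))
    ... | inj₂ (inj₂ (_ , a , b , _)) = contradiction b (≤⇒≯ a)
    order : ∀ {x y} → x < N → y < N → cs (C x) ≤ cs (C y) →
      (F x ≡ F y) ⊎ fs (F x) < fs (F y)
    order {x} {y} x<N y<N le with m≤n⇒m<n∨m≡n (subst₂ _≤_ (final x<N) (final y<N) le)
    ... | inj₁ lt = inj₂ lt
    ... | inj₂ eq = inj₁ (trans (sym (cong F (E∘P x x<N))) (trans (start-injective fine (P< x x<N) (P< y y<N)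
            (trans (cong (fs ∘ F) (E∘P x x<N)) (trans eq (cong (fs ∘ F) (sym (E∘P y y<N)))))) (cong F (E∘P y y<N))))
    r≤ : ∀ x y → n ≤ x → x < N → y < n → cs (C x) ≤ cs (C y) → lab x < lab y ⊎
      (lab x ≡ lab y × (∀ e e′ → e < M → e′ < M → tgt e ≡ x → tgt e′ ≡ y → cs (C (src e)) ≤ cs (C (src e′))))
    r≤ x y n≤x x<N y<n le = go (order x<N y<N le)
      where
      y<N = <-≤-trans y<n n≤N
      edges : cs (cb x) ≤ cs (cb y) → ∀ e e′ → e < M → e′ < M → tgt e ≡ x → tgt e′ ≡ y → cs (C (src e)) ≤
        cs (C (src e′))
      edges l e e′ e< e′< te te′ = ≤-trans (Best.high (best x x<N) n≤x e e< te)
        (≤-trans l (Best.low (best y y<N) y<n e′ e′< te′))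
      go : (F x ≡ F y) ⊎ fs (F x) < fs (F y) → _
      go (inj₁ eq) with key≡ x y x<N y<N eq
      ... | l , c = inj₂ (l , edges (≤-reflexive (cong cs c)))
      go (inj₂ lt) with key< x y x<N y<N lt
      ... | inj₁ l = inj₁ l
      ... | inj₂ (l , c) = inj₂ (l , edges (<⇒≤ c))
    r< : ∀ x y → n ≤ x → x < N → y < n → cs (C x) < cs (C y) → lab x < lab y ⊎
      (lab x ≡ lab y × lab x ≢ 0 × (∀ e e′ → e < M → e′ < M → tgt e ≡ x → tgt e′ ≡ y →
        cs (C (src e)) < cs (C (src e′))))
    r< x y n≤x x<N y<n lt with key< x y x<N (<-≤-trans y<n n≤N) (subst₂ _<_ (final x<N) (final (<-≤-trans y<n n≤N)) lt)
    ... | inj₁ l = inj₁ l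
    ... | inj₂ (l , c) = inj₂ (l ,
      (λ l0 → <-irrefl (cong cs (trans (root x x<N l0) (sym (root y (<-≤-trans y<n n≤N) (trans (sym l) l0))))) c) ,
      λ e e′ e< e′< te te′ → ≤-<-trans (Best.high (best x x<N) n≤x e e< te)
        (<-≤-trans c (Best.low (best y (<-≤-trans y<n n≤N)) y<n e′ e′< te′)))

  -- There is one compound block, so it is the best block of every node, and the counters are
  -- in-degrees. With `r` equal to 0 all fine blocks count as new, so none of their starts has to be
  -- queued yet.
  initially : ∀ {v key} → let open View v in 0 < N → Sorted N nf key E P F fs fe → 0 < nf →
    (∀ x → x < N → key (suc x) ≡ lab x) → (∀ x → C x ≡ 0) → cs 0 ≡ 0 → ce 0 ≡ N → nc ≡ 1 →
    (∀ x → cb x ≡ 0) → (∀ x → x < N → cnt x ≡ Σ< M (λ e → δ? (tgt e) x)) → (∀ x → K x ≡ 0) →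
    (∀ x → child x ≡ 0) → (∀ x → par x ≡ 0) → nb ≡ 0 → Inv v 0 0
  initially {v} {key} N> S nf> key≡lab C0 cs0 ce0 refl cb0 cnt≡ K0 child0 par0 refl = record
    { perm = perm ; fine = blocks
    ; coarse = record
        { id< = λ p _ → subst (_< 1) (sym (C0 (E p))) ≤-refl
        ; lo≤ = λ p _ → subst (_≤ p) (sym (trans (cong cs (C0 (E p))) cs0)) z≤n
        ; <hi = λ p p<N → subst (p <_) (sym (trans (cong ce (C0 (E p))) ce0)) p<N
        ; exact = λ { zero p _ _ h → subst (p <_) ce0 h , C0 (E p) ; (suc _) _ (s≤s ()) } }
    ; nonempty = λ { zero _ → subst₂ _<_ (sym cs0) (sym ce0) N> ; (suc _) (s≤s ()) }
    ; refines = λ x y _ _ _ → trans (C0 x) (sym (C0 y))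
    ; cb< = λ x _ → subst (_< 1) (sym (cb0 x)) ≤-refl
    ; root = λ x _ _ → cb0 x
    ; best = λ x x<N → record
        { cnt≡ = cnt-live x x<N
        ; cnt> = λ e e<M te → subst (0 <_) (sym (cnt-live x x<N))
            (live-term {C ∘ src} e<M te (trans (C0 _) (sym (cb0 x))))
        ; low  = λ _ e _ _ → ≤-reflexive (cong cs (trans (cb0 x) (sym (C0 (src e)))))
        ; high = λ _ e _ _ → ≤-reflexive (cong cs (trans (C0 (src e)) (sym (cb0 x)))) }
    ; K≡0 = λ x _ → K0 x
    ; key≡ = λ x y x<N y<N eq → trans (sym (F≡lab x x<N)) (trans eq (F≡lab y y<N)) , trans (cb0 x) (sym (cb0 y))
    ; key< = λ x y x<N y<N lt → inj₁ (subst₂ _<_ (F≡lab x x<N) (F≡lab y y<N)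
        (≤∧≢⇒< (F-mono x<N y<N (<⇒≤ (fs-start x<N y<N lt))) λ eq → <-irrefl (cong fs eq) lt))
    ; witness = λ x y _ _ _ lt → contradiction lt (<-irrefl (cong cs (trans (C0 x) (sym (C0 y)))))
    ; pending = λ _ _ ()
    ; queued = λ x x<N → inj₂ (inj₂ (F x , z≤n ,
        subst (λ y → F y < nf) (E∘P x x<N) (Blocks.id< blocks (P x) (P< x x<N)) , inj₁ refl))
    ; child< = λ i → subst (_< nf) (sym (child0 i)) nf>
    ; par< = λ i → subst (_< nf) (sym (par0 i)) nf> }
    where
    open View v
    open Sorted S
    open Perm perm
    F≡lab : ∀ x → x < N → F x ≡ lab x
    F≡lab x x<N = trans (F≡key x x<N) (key≡lab x x<N)
    F-mono : ∀ {x y} → x < N → y < N → P x ≤ P y → F x ≤ F y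
    F-mono {x} {y} x<N y<N le = subst₂ _≤_ (cong F (E∘P x x<N)) (cong F (E∘P y y<N)) (mono (P x) (P y) le (P< y y<N))
    fs-start : ∀ {x y} → x < N → y < N → fs (F x) < fs (F y) → P x < P y
    fs-start {x} {y} x<N y<N lt = start-order blocks (P< x x<N) (P< y y<N)
      (subst₂ (λ a b → fs (F a) < fs (F b)) (sym (E∘P x x<N)) (sym (E∘P y y<N)) lt)
    cnt-live : ∀ x → x < N → cnt x ≡ live (C ∘ src) x (cb x)
    cnt-live x x<N = trans (cnt≡ x x<N) (Σ-cong M λ e _ → sym (trans
      (cong (δ? (tgt e) x *_) (δ?-≡ (trans (C0 (src e)) (sym (cb0 x))))) (*-identityʳ _)))

  -- An entry that already starts a compound block calls for no cut: the fine block it was queued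
  -- for satisfies the first alternative of `queued`.
  dismiss : ∀ {v q r} → let open View v in Inv v q r → q < nb → B q ≤ cs (C (E (B q))) → Inv v (suc q) r
  dismiss {v} {q} {r} I q<nb b≤ = record
    { perm = perm ; fine = fine ; coarse = coarse ; nonempty = nonempty ; refines = refines ; cb< = cb<
    ; root = root ; best = best ; K≡0 = K≡0 ; key≡ = key≡ ; key< = key< ; witness = witness
    ; pending = λ j lt → pending j (<⇒≤ lt)
    ; queued = λ x x<N → case queued x x<N of λ where
        (inj₁ g) → inj₁ g
        (inj₂ (inj₂ t)) → inj₂ (inj₂ t)
        (inj₂ (inj₁ (j , q≤j , j<nb , eq))) → case m≤n⇒m<n∨m≡n q≤j of λ where
          (inj₁ lt)   → inj₂ (inj₁ (j , lt , j<nb , eq))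
          (inj₂ refl) → inj₁ (trans (sym eq) (good x<N eq))
    ; child< = child< ; par< = par< }
    where
    open View v
    open Inv I
    open Perm perm
    b = B q
    b<N = proj₁ (pending q ≤-refl q<nb)
    good : ∀ {x} → x < N → b ≡ fs (F x) → b ≡ cs (C x)
    good {x} x<N eq = trans (≤-antisym b≤ (Blocks.lo≤ coarse b b<N)) (cong cs (sym (refines x (E b) x<N (E< b b<N) Fx)))
      where
      Fx : F x ≡ F (E b)
      Fx = trans (sym (cong F (E∘P x x<N))) (start-injective fine (P< x x<N) b<N
        (trans (cong (fs ∘ F) (E∘P x x<N)) (trans (sym eq) (sym (proj₂ (pending q ≤-refl q<nb))))))

  extent : View → ℕ → ℕ
  extent v i = ⌊log₂ (View.ce v i ∸ View.cs v i) ⌋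

  weight : View → ℕ
  weight v = Σ< N (extent v ∘ View.C v) + Σ< M (extent v ∘ View.C v ∘ src)

  -- Running time of the refinement

  -- `Z` bounds the numbers that are computed and so excludes overflow; `κ` is the credit that a
  -- scanned edge leaves for the treatment of its target.
  module RefineProgram (w Z κ : ℕ) (Z< : Z < 2 ^ w) (M≤Z : M ≤ Z)
                       (N≤Z : N ≤ Z) where

    record Adjacency (head next key tg : ℕ → ℕ) : Set where
      field
        is-chain : IsChain head next key M N
        key≡     : ∀ e → e < M → key (suc e) ≡ src e
        tg≡      : ∀ e → e < M → tg (suc e) ≡ tgt e

    live≤M : ∀ g v i → live g v i ≤ M
    live≤M g v i = ≤-trans (Σ-mono M λ e _ → *-mono-≤ (δ?≤1 (tgt e) v) (δ?≤1 (g e) i))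
      (≤-reflexive (trans (Σ-const M {c = 1} λ _ _ → refl) (*-identityʳ M)))

    emitOne-halts : ∀ {ρ k q r x} → let open View (viewOf ρ); v = viewOf ρ in
      Inv v q r → q ≤ nb → vars ρ x < nf → nb < Z →
      Halts w (emitOne x) ρ (13 + k) (λ k′ σ → k ≤ k′ ×
        Inv (record v { B = arrs σ aB ; nb = vars σ vnb }) q r ×
        nb ≤ vars σ vnb × vars σ vnb ≤ suc nb × (∀ j → j < nb → arrs σ aB j ≡ B j) ×
        (fs (vars ρ x) < fe (vars ρ x) → ∃[ j ] q ≤ j × j < vars σ vnb × arrs σ aB j ≡ fs (vars ρ x)))
    emitOne-halts {ρ} {k} I q≤nb i<nf nb<Z = ifl
      (λ ne → wrt⨾ refl refl (asg (inc w (≤-<-trans nb<Z Z<))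
        (≤-refl , enqueue I q≤nb i<nf ne , n≤1+n _ , ≤-refl ,
         (λ j j<nb → upd≢ (arrs ρ aB) _ _ (<⇒≢ j<nb)) ,
         λ _ → _ , q≤nb , ≤-refl , upd≡ (arrs ρ aB) _ _)))
      (λ ge → weaken (s≤s (m≤n+m k 7)) (skip! (m≤n+m _ _ , I , ≤-refl , n≤1+n _ , (λ _ _ → refl) ,
        λ lt → contradiction lt (≤⇒≯ ge))))

    emits-halts : ∀ {ρ k q} R → let open View (viewOf ρ); v = viewOf ρ in
      Inv v q (vars ρ vr) → q ≤ nb → nf ≤ Z → ∀ s → vars ρ vr + s ≡ nf → nb + s * 2 ≤ Z →
      s * 36 + (3 + R) ≤ k →
      Halts w emits ρ k (λ k′ σ → R ≤ k′ × vars σ vr ≡ nf × nb ≤ vars σ vnb × vars σ vnb ≤ nb + s * 2 ×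
        Inv (record v { B = arrs σ aB ; nb = vars σ vnb }) q nf)
    emits-halts {ρ} {k} {q} R I₀ q≤nb₀ nf≤Z s₀ eq₀ nb≤₀ p₀ =
      while (vr ∷ vf ∷ vnb ∷ []) (aB ∷ []) Loop
        (λ { {σ = σ} (s , eq , I , nb₀≤ , nb≤ , p) r<nf → case next-left r<nf eq of λ { (s′ , refl , eq′) →
          33 + (s′ * 36 + (3 + R)) , p ,
          call⨾ (vnb ∷ []) (aB ∷ []) (emitOne-halts {x = vr} I (≤-trans q≤nb₀ nb₀≤) r<nf
              (bound₁ (vars σ vnb) (s′ * 2) nb≤))
            λ { {σ = σ₁} (k≤ , I₁ , le₁ , le₁′ , keep₁ , in₁) → weaken k≤ (asg⨾ refl
              (call⨾ (vnb ∷ []) (aB ∷ []) (emitOne-halts {x = vf} I₁ (≤-trans q≤nb₀ (≤-trans nb₀≤ le₁)) (Inv.par< I₁ _)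
                  (bound₂ (vars σ vnb) (s′ * 2) (vars σ₁ vnb) nb≤ le₁′))
                λ { {σ = σ₂} (k≤ , I₂ , le₂ , le₂′ , keep₂ , in₂) → weaken k≤
                  (asg (inc w (≤-<-trans (≤-trans r<nf nf≤Z) Z<))
                    (s′ , eq′ , advance I₂ (λ where
                         i (inj₁ refl) ne → let j , a , b , e = in₁ ne in
                           j , a , <-≤-trans b le₂ , trans (keep₂ j b) e
                         i (inj₂ refl) ne → in₂ ne) ,
                      ≤-trans nb₀≤ (≤-trans le₁ le₂) ,
                      bound₃ (vars σ vnb) (s′ * 2) (vars σ₁ vnb) (vars σ₂ vnb) nb≤ le₁′ le₂′ , ≤-refl)) })) } } })
        (λ { {σ = σ} (s , eq , I , nb₀≤ , nb≤ , p) nf≤r → R , ≤-trans (m≤n+m _ (s * 36)) p , ≤-refl ,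
          ≤-antisym (m+n≤o⇒m≤o _ (≤-reflexive eq)) nf≤r , nb₀≤ , m+n≤o⇒m≤o _ nb≤ ,
          subst (Inv (record v₀ { B = arrs σ aB ; nb = vars σ vnb }) q)
            (≤-antisym (m+n≤o⇒m≤o _ (≤-reflexive eq)) nf≤r) I })
        (s₀ , eq₀ , I₀ , ≤-refl , ≤-refl , p₀)
      where
      v₀ = viewOf ρ
      nb₀ = vars ρ vnb
      Loop : ℕ → Store → Set
      Loop l σ = ∃[ s ] (vars σ vr + s ≡ vars ρ vnf ×
        Inv (record v₀ { B = arrs σ aB ; nb = vars σ vnb }) q (vars σ vr) ×
        nb₀ ≤ vars σ vnb × vars σ vnb + s * 2 ≤ nb₀ + s₀ * 2 × s * 36 + (3 + R) ≤ l)
      bound₁ : ∀ x t → x + suc (suc t) ≤ nb₀ + s₀ * 2 → x < Z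
      bound₁ x t le = ≤-trans (≤-trans (≤-trans (m≤m+n (suc x) (suc t)) (≤-reflexive (sym (+-suc x (suc t))))) le) nb≤₀
      bound₂ : ∀ x t y → x + suc (suc t) ≤ nb₀ + s₀ * 2 → y ≤ suc x → y < Z
      bound₂ x t y le le′ = ≤-trans (s≤s le′) (≤-trans (≤-trans
        (≤-trans (m≤m+n (suc (suc x)) t) (≤-reflexive (sym (trans (+-suc x (suc t)) (cong suc (+-suc x t)))))) le) nb≤₀)
      bound₃ : ∀ x t y z → x + suc (suc t) ≤ nb₀ + s₀ * 2 → y ≤ suc x → z ≤ suc y → z + t ≤ nb₀ + s₀ * 2
      bound₃ x t y z le le′ le″ = ≤-trans (+-monoˡ-≤ t (≤-trans le″ (s≤s le′)))
        (≤-trans (≤-reflexive (sym (trans (+-suc x (suc t)) (cong suc (+-suc x t))))) le)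

    -- L is the logarithm of the block size, which drops since d is the smaller half.
    module Scan (c d : ℕ) (L : ℕ → ℕ) (drop : L d < L c) (c≢d : c ≢ d) where

      relabel-drop : ∀ {m f i} → i < m → f i ≡ c → suc (Σ< m (L ∘ (f [ i ↦ d ]))) ≤ Σ< m (L ∘ f)
      relabel-drop {m} {f} {i} i<m fi = +-cancelʳ-≤ (L d) _ _ (≤-trans
        (≤-trans (≤-reflexive (sym (+-suc _ (L d)))) (+-monoʳ-≤ _ (subst (λ j → L d < L j) (sym fi) drop)))
        (≤-reflexive (trans (Σ-point m {L ∘ f} {L ∘ (f [ i ↦ d ])} i<m
          (λ j _ j≢i → sym (cong L (upd≢ f i d j≢i)))) (cong (λ x → Σ< m (L ∘ f) + L x) (upd≡ f i d)))))

      live-relabel : ∀ {g e} → e < M → g e ≡ c → ∀ v → live (g [ e ↦ d ]) v d ≡ live g v d + δ? (tgt e) v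
      live-relabel {g} {e} e<M ge v = trans (trans (sym (+-identityʳ _)) (cong (live (g [ e ↦ d ]) v d +_) (sym zero′)))
        (trans (Σ-point M {λ i → δ? (tgt i) v * δ? (g i) d} {λ i → δ? (tgt i) v * δ? ((g [ e ↦ d ]) i) d} e<M
          (λ j _ j≢e → cong (λ i → δ? (tgt j) v * δ? i d) (sym (upd≢ g e d j≢e)))) (cong (live g v d +_) one))
        where
        zero′ : δ? (tgt e) v * δ? (g e) d ≡ 0
        zero′ = trans (cong (δ? (tgt e) v *_) (δ?-≢ (c≢d ∘ trans (sym ge)))) (*-zeroʳ (δ? (tgt e) v))
        one : δ? (tgt e) v * δ? ((g [ e ↦ d ]) e) d ≡ δ? (tgt e) v
        one = trans (cong (δ? (tgt e) v *_) (δ?-≡ (upd≡ g e d))) (*-identityʳ _)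

      -- The edges from x numbered above ve have been relabelled.
      record Scanned (C g : ℕ → ℕ) (x ve : ℕ) : Set where
        field
          away : ∀ e → e < M → src e ≢ x → g e ≡ C (src e)
          todo : ∀ e → e < M → src e ≡ x → e < ve → g e ≡ c
          done : ∀ e → e < M → src e ≡ x → ve ≤ e → g e ≡ d

      Listed : (K T : ℕ → ℕ) → ℕ → Set
      Listed K T tl = (∀ i → i < tl → T i < N) × (∀ v → v < N → 0 < K v → ∃[ i ] i < tl × T i ≡ v)

      list-one : ∀ {K T tl v} k → v < N → Listed K T tl → Listed (K [ v ↦ k ]) (T [ tl ↦ v ]) (suc tl)
      list-one {K} {T} {tl} {v} k v<N (T< , ∋T) =
        (λ i i< → upd-elim {f = T} (λ _ x → x < N) v<N i λ i≢ → T< i (≤∧≢⇒< (≤-pred i<) i≢)) ,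
        λ x x<N pos → case x ≟ v of λ where
          (yes refl) → tl , ≤-refl , upd≡ T tl v
          (no ne) → let i , i< , eq = ∋T x x<N (subst (0 <_) (upd≢ K v k ne) pos) in
            i , m<n⇒m<1+n i< , trans (upd≢ T tl v (<⇒≢ i<)) eq

      -- Each relabelled edge lowers the potential by at least one unit, worth `22 + κ`: 22 for the
      -- step itself and `κ` saved in `vtl * κ`. For the same reason list length plus potential
      -- stays below `U`, which keeps `vtl` within a word.
      scanEdges-halts : ∀ {ρ k} R U {g x} → let C = arrs ρ aC in
        Adjacency (arrs ρ aHEAD) (arrs ρ aNEXT) (arrs ρ aKEY) (arrs ρ aTG) → x < N → U ≤ Z → C x ≡ d →
        Scanned C g x (vars ρ ve) → On (arrs ρ aKEY) (vars ρ ve) M x →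
        (∀ v → v < N → arrs ρ aK v ≡ live g v d) → Listed (arrs ρ aK) (arrs ρ aT) (vars ρ vtl) →
        vars ρ vtl + Σ< M (L ∘ g) ≤ U →
        Σ< M (L ∘ g) * (22 + κ) + (vars ρ vtl * κ + (3 + R)) ≤ k →
        Halts w scanEdges ρ k (λ k′ σ →
          (∀ v → v < N → arrs σ aK v ≡ live (C ∘ src) v d) × Listed (arrs σ aK) (arrs σ aT) (vars σ vtl) ×
          vars σ vtl + Σ< M (L ∘ C ∘ src) ≤ U ×
          Σ< M (L ∘ C ∘ src) * (22 + κ) + (vars σ vtl * κ + R) ≤ k′)
      scanEdges-halts {ρ} {k} R U {g₀} {x} adj x<N U≤Z Cx sc on K≡ li tl≤ p =
        while (ve ∷ vv ∷ vtl ∷ []) (aT ∷ aK ∷ []) Loop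
          (λ { (g , sc , on , K≡ , li , tl≤ , p) e>0 → body g sc on K≡ li tl≤ p (subst (_< _) (zero-id w) e>0) })
          (λ { {σ = σ} (g , sc , on , K≡ , li , tl≤ , p) e≤0 →
            let g≡ = all-done sc (n≤0⇒n≡0 (subst (vars σ ve ≤_) (zero-id w) e≤0))
                S≡ = Σ-cong M {L ∘ g} {L ∘ C ∘ src} (λ e e<M → cong L (g≡ e e<M)) in
            Σ< M (L ∘ C ∘ src) * (22 + κ) + (vars σ vtl * κ + R) ,
            ≤-trans (≤-reflexive (arith₀ (Σ< M (L ∘ C ∘ src) * (22 + κ)) (vars σ vtl * κ) R))
              (subst (λ s → s * (22 + κ) + (vars σ vtl * κ + (3 + R)) ≤ _) S≡ p) ,
            (λ v v<N → trans (K≡ v v<N) (live-cong g≡ v d)) , li ,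
            subst (λ s → vars σ vtl + s ≤ U) S≡ tl≤ , ≤-refl })
          (g₀ , sc , on , K≡ , li , tl≤ , p)
        where
        open Adjacency adj
        C = arrs ρ aC
        key = arrs ρ aKEY
        next = arrs ρ aNEXT
        arith₀ : ∀ s t r → 3 + (s + (t + r)) ≡ s + (t + (3 + r))
        arith₀ s t r = solve (s ∷ t ∷ r ∷ [])
        Loop : ℕ → Store → Set
        Loop l σ = ∃[ g ] (Scanned C g x (vars σ ve) × On key (vars σ ve) M x ×
          (∀ v → v < N → arrs σ aK v ≡ live g v d) × Listed (arrs σ aK) (arrs σ aT) (vars σ vtl) ×
          vars σ vtl + Σ< M (L ∘ g) ≤ U ×
          Σ< M (L ∘ g) * (22 + κ) + (vars σ vtl * κ + (3 + R)) ≤ l)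
        all-done : ∀ {g e} → Scanned C g x e → e ≡ 0 → ∀ i → i < M → g i ≡ C (src i)
        all-done sc refl i i<M with src i ≟ x
        ... | yes eq = trans (Scanned.done sc i i<M eq z≤n) (sym (trans (cong C eq) Cx))
        ... | no ne = Scanned.away sc i i<M ne
        body : ∀ {l σ} g → Scanned C g x (vars σ ve) → On key (vars σ ve) M x →
          (∀ v → v < N → arrs σ aK v ≡ live g v d) → Listed (arrs σ aK) (arrs σ aT) (vars σ vtl) →
          vars σ vtl + Σ< M (L ∘ g) ≤ U →
          Σ< M (L ∘ g) * (22 + κ) + (vars σ vtl * κ + (3 + R)) ≤ l → 0 < vars σ ve →
          ∃[ k′ ] 3 + k′ ≤ l × Halts w
            (vv ≔ aTG [ var ve ] ⨾ aT [ var vtl ]≔ var vv ⨾ bump vtl ⨾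
             aK [ var vv ]≔ aK [ var vv ] ⊕ lit 1 ⨾ ve ≔ aNEXT [ var ve ])
            (havoc (ve ∷ vv ∷ vtl ∷ []) (aT ∷ aK ∷ []) ρ σ) k′ Loop
        body {l} {σ} g sc (inj₁ e≡0 , _) K≡ li tl≤ p e>0 = contradiction e≡0 (>⇒≢ e>0)
        body {l} {σ} g sc (inj₂ (_ , keye) , e≤M) K≡ li tl≤ p e>0 =
          19 + (Σ< M (L ∘ g′) * (22 + κ) + (suc tl * κ + (3 + R))) ,
          ≤-trans (arith₁ (Σ< M (L ∘ g′)) (Σ< M (L ∘ g)) (tl * κ) (3 + R) κ dropped) p ,
          asg⨾ TG≡ (wrt⨾ refl refl (asg⨾ (inc w (≤-<-trans tl<Z Z<))
          (wrt⨾ refl (inc w (≤-<-trans Kv<Z Z<)) (asg refl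
            (g′ , sc′ , on′ , K≡′ , list-one (suc (K (tgt e))) (tgt< e e<M) li ,
             arith₂ tl (Σ< M (L ∘ g′)) (Σ< M (L ∘ g)) dropped tl≤ , ≤-refl)))))
          where
          e = vars σ ve ∸ 1
          tl = vars σ vtl
          K = arrs σ aK
          g′ = g [ e ↦ d ]
          e≡ : suc e ≡ vars σ ve
          e≡ = m+[n∸m]≡n e>0
          e<M : e < M
          e<M = subst (_≤ M) (sym e≡) e≤M
          src≡ : src e ≡ x
          src≡ = trans (sym (key≡ e e<M)) (trans (cong key e≡) keye)
          TG≡ : arrs ρ aTG (vars σ ve) ≡ tgt e
          TG≡ = trans (cong (arrs ρ aTG) (sym e≡)) (tg≡ e e<M)
          ge : g e ≡ c
          ge = Scanned.todo sc e e<M src≡ (≤-reflexive e≡)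
          dropped : suc (Σ< M (L ∘ g′)) ≤ Σ< M (L ∘ g)
          dropped = relabel-drop e<M ge
          top-e : Top key (next (vars σ ve)) e x
          top-e = subst₂ (λ i a → Top key (next i) e a) e≡ (trans (key≡ e e<M) src≡) (IsChain.nexts is-chain e e<M)
          on′ : On key (next (vars σ ve)) M x
          on′ = proj₁ top-e , ≤-trans (proj₁ (proj₂ top-e)) (<⇒≤ e<M)
          sc′ : Scanned C g′ x (next (vars σ ve))
          sc′ = record
            { away = λ i i<M ne → trans (upd≢ g e d λ i≡e → ne (trans (cong src i≡e) src≡)) (Scanned.away sc i i<M ne)
            ; todo = λ i i<M eq lt → trans (upd≢ g e d (<⇒≢ (<-≤-trans lt (proj₁ (proj₂ top-e)))))
                (Scanned.todo sc i i<M eq (<-≤-trans lt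
                    (≤-trans (proj₁ (proj₂ top-e)) (≤-trans (n≤1+n e) (≤-reflexive e≡)))))
            ; done = λ i i<M eq le → upd-elim {f = g} (λ _ a → a ≡ d) refl i λ i≢e → case <-or-≥ i e of λ where
                (inj₁ lt) → contradiction (trans (key≡ i i<M) eq) (proj₂ (proj₂ top-e) (suc i) (s≤s le) lt)
                (inj₂ ge) → Scanned.done sc i i<M eq (subst (_≤ i) e≡ (≤∧≢⇒< ge (i≢e ∘ sym))) }
          K≡′ : ∀ v → v < N → (K [ tgt e ↦ suc (K (tgt e)) ]) v ≡ live g′ v d
          K≡′ v v<N = trans (upd-elim {f = K} (λ v y → y ≡ K v + δ? (tgt e) v)
            (trans (+-comm 1 _) (cong (K (tgt e) +_) (sym (δ?-≡ {tgt e} refl)))) v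
            λ v≢ → trans (sym (+-identityʳ _)) (cong (K v +_) (sym (δ?-≢ (v≢ ∘ sym)))))
            (trans (cong (_+ δ? (tgt e) v) (K≡ v v<N)) (sym (live-relabel e<M ge v)))
          Kv<Z : suc (K (tgt e)) ≤ Z
          Kv<Z = ≤-trans (≤-trans (≤-reflexive (trans (sym (upd≡ K (tgt e) _)) (K≡′ (tgt e) (tgt< e e<M))))
            (live≤M g′ (tgt e) d)) M≤Z
          tl<Z : suc tl ≤ Z
          tl<Z = ≤-trans (≤-trans (≤-trans (m≤m+n (suc tl) (Σ< M (L ∘ g′)))
            (≤-reflexive (sym (+-suc tl _)))) (+-monoʳ-≤ tl dropped)) (≤-trans tl≤ U≤Z)
          arith₁ : ∀ s′ s t r κ → suc s′ ≤ s → 22 + (s′ * (22 + κ) + ((κ + t) + r)) ≤ s * (22 + κ) + (t + r)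
          arith₁ s′ s t r κ le = ≤-trans (≤-reflexive eq) (+-monoˡ-≤ (t + r) (*-monoˡ-≤ (22 + κ) le))
            where
            eq : 22 + (s′ * (22 + κ) + ((κ + t) + r)) ≡ suc s′ * (22 + κ) + (t + r)
            eq = solve (s′ ∷ t ∷ r ∷ κ ∷ [])
          arith₂ : ∀ t s′ s → suc s′ ≤ s → t + s ≤ U → suc t + s′ ≤ U
          arith₂ t s′ s le h = ≤-trans (≤-trans (≤-reflexive (sym (+-suc t s′))) (+-monoʳ-≤ t le)) h

      record Swept (C₀ P C : ℕ → ℕ) (lo p : ℕ) : Set where
        field
          swept   : ∀ x → x < N → lo ≤ P x → P x < p → C x ≡ d
          unswept : ∀ x → x < N → ¬ (lo ≤ P x × P x < p) → C x ≡ C₀ x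

      -- The inequality between `hi` and `lo` in the conclusion says that every scanned position
      -- costs the nodes a unit of potential. It later bounds the number of compound blocks.
      scan-halts : ∀ {ρ k} R U → let E = arrs ρ aE; P = arrs ρ aP; C₀ = arrs ρ aC; lo = vars ρ vp; hi = vars ρ vhi in
        Adjacency (arrs ρ aHEAD) (arrs ρ aNEXT) (arrs ρ aKEY) (arrs ρ aTG) → Perm N E P → U ≤ Z →
        vars ρ vnc ≡ d → lo ≤ hi → hi ≤ N → (∀ p → lo ≤ p → p < hi → C₀ (E p) ≡ c) →
        (∀ v → v < N → arrs ρ aK v ≡ live (C₀ ∘ src) v d) → Listed (arrs ρ aK) (arrs ρ aT) (vars ρ vtl) →
        vars ρ vtl + Σ< M (L ∘ C₀ ∘ src) ≤ U →
        Σ< N (L ∘ C₀) * (22 + κ) + (Σ< M (L ∘ C₀ ∘ src) * (22 + κ) + (vars ρ vtl * κ + (3 + R))) ≤ k →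
        Halts w scan ρ k (λ k′ σ → Swept C₀ P (arrs σ aC) lo hi ×
          (∀ v → v < N → arrs σ aK v ≡ live (arrs σ aC ∘ src) v d) × Listed (arrs σ aK) (arrs σ aT) (vars σ vtl) ×
          vars σ vtl + Σ< M (L ∘ arrs σ aC ∘ src) ≤ U × hi + Σ< N (L ∘ arrs σ aC) ≤ lo + Σ< N (L ∘ C₀) ×
          Σ< N (L ∘ arrs σ aC) * (22 + κ) + (Σ< M (L ∘ arrs σ aC ∘ src) * (22 + κ) + (vars σ vtl * κ + R)) ≤ k′)
      scan-halts {ρ} {k} R U adj π U≤Z refl lo≤hi hi≤N in-c K≡₀ li₀ tl≤₀ p₀ =
        while (vp ∷ vx ∷ ve ∷ vv ∷ vtl ∷ []) (aC ∷ aT ∷ aK ∷ []) Loop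
          (λ { (lo≤p , p≤hi , sw , K≡ , li , tl≤ , dr , b) p<hi → body lo≤p p<hi sw K≡ li tl≤ dr b })
          (λ { {σ = σ} (lo≤p , p≤hi , sw , K≡ , li , tl≤ , dr , b) hi≤p →
            Σ< N (L ∘ arrs σ aC) * (22 + κ) + (Σ< M (L ∘ arrs σ aC ∘ src) * (22 + κ) + (vars σ vtl * κ + R)) ,
            ≤-trans (≤-reflexive (arith₀ (Σ< N (L ∘ arrs σ aC) * (22 + κ))
                (Σ< M (L ∘ arrs σ aC ∘ src) * (22 + κ)) (vars σ vtl * κ) R)) b ,
            subst (Swept C₀ P (arrs σ aC) lo) (≤-antisym p≤hi hi≤p) sw , K≡ , li , tl≤ ,
            subst (λ p → p + Σ< N (L ∘ arrs σ aC) ≤ lo + Σ< N (L ∘ C₀)) (≤-antisym p≤hi hi≤p) dr , ≤-refl })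
          (≤-refl , lo≤hi , record { swept = λ x _ l h → contradiction h (≤⇒≯ l) ; unswept = λ _ _ _ → refl } ,
           K≡₀ , li₀ , tl≤₀ , ≤-refl , p₀)
        where
        open Adjacency adj
        open Perm π
        E = arrs ρ aE
        P = arrs ρ aP
        C₀ = arrs ρ aC
        lo = vars ρ vp
        hi = vars ρ vhi
        arith₀ : ∀ a s t r → 3 + (a + (s + (t + r))) ≡ a + (s + (t + (3 + r)))
        arith₀ a s t r = solve (a ∷ s ∷ t ∷ r ∷ [])
        Loop : ℕ → Store → Set
        Loop l σ = lo ≤ vars σ vp × vars σ vp ≤ hi × Swept C₀ P (arrs σ aC) lo (vars σ vp) ×
          (∀ v → v < N → arrs σ aK v ≡ live (arrs σ aC ∘ src) v d) × Listed (arrs σ aK) (arrs σ aT) (vars σ vtl) ×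
          vars σ vtl + Σ< M (L ∘ arrs σ aC ∘ src) ≤ U × vars σ vp + Σ< N (L ∘ arrs σ aC) ≤ lo + Σ< N (L ∘ C₀) ×
          Σ< N (L ∘ arrs σ aC) * (22 + κ) + (Σ< M (L ∘ arrs σ aC ∘ src) * (22 + κ) + (vars σ vtl * κ + (3 + R))) ≤ l
        body : ∀ {l σ} → lo ≤ vars σ vp → vars σ vp < hi → Swept C₀ P (arrs σ aC) lo (vars σ vp) →
          (∀ v → v < N → arrs σ aK v ≡ live (arrs σ aC ∘ src) v d) → Listed (arrs σ aK) (arrs σ aT) (vars σ vtl) →
          vars σ vtl + Σ< M (L ∘ arrs σ aC ∘ src) ≤ U → vars σ vp + Σ< N (L ∘ arrs σ aC) ≤ lo + Σ< N (L ∘ C₀) →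
          Σ< N (L ∘ arrs σ aC) * (22 + κ) + (Σ< M (L ∘ arrs σ aC ∘ src) * (22 + κ) + (vars σ vtl * κ + (3 + R))) ≤ l →
          ∃[ k′ ] 3 + k′ ≤ l × Halts w
            (vx ≔ aE [ var vp ] ⨾ aC [ var vx ]≔ var vnc ⨾ ve ≔ aHEAD [ var vx ] ⨾ scanEdges ⨾ bump vp)
            (havoc (vp ∷ vx ∷ ve ∷ vv ∷ vtl ∷ []) (aC ∷ aT ∷ aK ∷ []) ρ σ) k′ Loop
        body {l} {σ} lo≤p p<hi sw K≡ li tl≤ dr b =
          9 + (Se * (22 + κ) + (tl * κ + (3 + (4 + (Sn′ * (22 + κ) + (3 + R)))))) ,
          ≤-trans (arith₁ Sn′ Sn Se (tl * κ) R κ (relabel-drop x<N Cx)) b ,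
          asg⨾ refl (wrt⨾ refl refl (asg⨾ refl
          (call⨾ (ve ∷ vv ∷ vtl ∷ []) (aT ∷ aK ∷ [])
            (scanEdges-halts (4 + (Sn′ * (22 + κ) + (3 + R))) U adj x<N U≤Z (upd≡ C x d) sc
              (proj₁ top-x , proj₁ (proj₂ top-x)) K≡ li tl≤ ≤-refl)
            λ { {σ = τ} (K≡′ , li′ , tl≤′ , b′) → weaken b′
                (weaken (≤-reflexive (arith₂ Sn′ (Σ< M (L ∘ C′ ∘ src)) (vars τ vtl * κ) R κ))
              (asg (inc w (≤-<-trans (≤-trans p<hi (≤-trans hi≤N N≤Z)) Z<))
                (m≤n⇒m≤1+n lo≤p , p<hi , sw′ , K≡′ , li′ , tl≤′ ,
                 ≤-trans (≤-trans (≤-reflexive (sym (+-suc p Sn′))) (+-monoʳ-≤ p (relabel-drop x<N Cx))) dr ,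
                     ≤-refl))) })))
          where
          p = vars σ vp
          C = arrs σ aC
          tl = vars σ vtl
          x = E p
          C′ = C [ x ↦ d ]
          p<N : p < N
          p<N = <-≤-trans p<hi hi≤N
          x<N : x < N
          x<N = E< p p<N
          Cx : C x ≡ c
          Cx = trans (Swept.unswept sw x x<N λ { (_ , lt) → <-irrefl (P∘E p p<N) lt }) (in-c p lo≤p p<hi)
          Sn = Σ< N (L ∘ C)
          Sn′ = Σ< N (L ∘ C′)
          Se = Σ< M (L ∘ C ∘ src)
          top-x : Top (arrs ρ aKEY) (arrs ρ aHEAD x) M x
          top-x = IsChain.heads is-chain x x<N
          sc : Scanned C′ (C ∘ src) x (arrs ρ aHEAD x)
          sc = record
            { away = λ e e<M ne → sym (upd≢ C x d ne)
            ; todo = λ e e<M eq _ → trans (cong C eq) Cx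
            ; done = λ e e<M eq le → contradiction (trans (key≡ e e<M) eq) (proj₂ (proj₂ top-x) (suc e) (s≤s le) e<M) }
          sw′ : Swept C₀ P C′ lo (suc p)
          sw′ = record
            { swept = λ y y<N l h → upd-elim {f = C} (λ _ a → a ≡ d) refl y λ y≢x →
                Swept.swept sw y y<N l (≤∧≢⇒< (≤-pred h) λ Py≡p → y≢x (trans (sym (E∘P y y<N)) (cong E Py≡p)))
            ; unswept = λ y y<N out → trans (upd≢ C x d λ { refl → out (subst (lo ≤_) (sym (P∘E p p<N)) lo≤p ,
                  s≤s (≤-reflexive (P∘E p p<N))) })
                (Swept.unswept sw y y<N λ { (l , h) → out (l , m<n⇒m<1+n h) }) }
          arith₁ : ∀ a′ a s t r κ → suc a′ ≤ a →
            12 + (s * (22 + κ) + (t + (3 + (4 + (a′ * (22 + κ) + (3 + r)))))) ≤ a * (22 + κ)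
                + (s * (22 + κ) + (t + (3 + r)))
          -- A node needs only 19 of its `22 + κ` units; the slack `3 + κ` allows nodes and edges
          -- the same coefficient.
          arith₁ a′ a s t r κ le = ≤-trans (≤-trans (m≤m+n _ (3 + κ)) (≤-reflexive eq))
              (+-monoˡ-≤ (s * (22 + κ) + (t + (3 + r))) (*-monoˡ-≤ (22 + κ) le))
            where
            eq : 12 + (s * (22 + κ) + (t + (3 + (4 + (a′ * (22 + κ) + (3 + r)))))) + (3 + κ) ≡
                suc a′ * (22 + κ) + (s * (22 + κ) + (t + (3 + r)))
            eq = solve (a′ ∷ s ∷ t ∷ r ∷ κ ∷ [])
          arith₂ : ∀ a s t r κ → 4 + (a * (22 + κ) + (s * (22 + κ) + (t + (3 + r)))) ≡
              s * (22 + κ) + (t + (4 + (a * (22 + κ) + (3 + r))))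
          arith₂ a s t r κ = solve (a ∷ s ∷ t ∷ r ∷ κ ∷ [])

    -- The view of σ, except for what the loop over the touched nodes leaves alone.
    touchedView : Store → Store → View
    touchedView ρ σ = record (viewOf ρ)
      { E = arrs σ aE ; P = arrs σ aP ; F = arrs σ aF ; fs = arrs σ afs ; fe = arrs σ afe
      ; cnt = arrs σ acnt ; cb = arrs σ acb ; K = arrs σ aK ; child = arrs σ achild ; par = arrs σ apar
      ; nf = vars σ vnf }

    module Touch (v₀ : View) (q : ℕ) (I : Inv v₀ q (View.nf v₀)) (q<nb : q < View.nb v₀)
      (side c b : ℕ) (b≡ : b ≡ View.B v₀ q) (c≡ : c ≡ View.C v₀ (View.E v₀ b)) (cs<b : View.cs v₀ c < b)
      (C′ cs′ ce′ : ℕ → ℕ)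
      (H : Halves side b c (View.nc v₀) (View.cs v₀) (View.ce v₀) cs′ ce′)
      (new : ∀ x → x < N → cs′ (View.nc v₀) ≤ View.P v₀ x → View.P v₀ x < ce′ (View.nc v₀) → C′ x ≡ View.nc v₀)
      (old : ∀ x → x < N → ¬ (cs′ (View.nc v₀) ≤ View.P v₀ x × View.P v₀ x < ce′ (View.nc v₀)) → C′ x ≡ View.C v₀ x)
      where
      open Round v₀ q I q<nb side c b b≡ c≡ cs<b C′ cs′ ce′ H new old
      private
        d = View.nc v₀
        nf₀ = View.nf v₀

      side≡1 : wrap w 0 < side → side ≡ 1
      side≡1 lt with Halves.shape H
      ... | inj₁ (s0 , _) = contradiction lt (≤⇒≯ (≤-trans (≤-reflexive s0) z≤n))
      ... | inj₂ (s1 , _) = s1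

      side≡0 : side ≤ wrap w 0 → side ≡ 0
      side≡0 le = n≤0⇒n≡0 (subst (side ≤_) (zero-id w) le)

      record Context (ρ : Store) (u : ℕ) : Set where
        constructor context
        field
          r≡    : vars ρ vr ≡ nf₀
          d≡    : vars ρ vnc ≡ d
          side≡ : vars ρ vside ≡ side
          n≡    : vars ρ vn ≡ n
          u≡    : vars ρ vv ≡ u

      child-halts : ∀ {ρ k j tl T} → Touched (viewOf ρ) j tl T → vars ρ vr ≡ nf₀ → vars ρ vside ≡ side →
        let D = vars ρ vD in D < nf₀ → arrs ρ afs D ≤ arrs ρ afe D → suc (vars ρ vnf) ≤ Z →
        Halts w (ifLess (achild [ var vD ]) (var vr) makeChild skip) ρ (26 + k) (λ k′ σ → k ≤ k′ ×
          Touched (record (viewOf ρ) { fs = arrs σ afs ; fe = arrs σ afe ; child = arrs σ achild ; par = arrs σ apar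
                                     ; nf = vars σ vnf }) j tl T ×
          nf₀ ≤ arrs σ achild D × vars σ vnf ≤ suc (vars ρ vnf))
      child-halts {ρ} {k} τ refl refl D<nf le nf<Z = ifl
        (λ lt → wrt⨾ refl refl (wrt⨾ refl refl (ifl⨾
          (λ s → asg⨾ refl (wrt⨾ refl refl (wrt⨾ refl refl (asg (inc w (≤-<-trans nf<Z Z<))
            (≤-refl , touched-child τ D D<nf lt le (inj₂ (side≡1 s , refl)) ,
             subst (nf₀ ≤_) (sym (upd≡ (arrs ρ achild) D _)) (Touched.nf≤ τ) , ≤-refl)))))
          (λ s → asg⨾ refl (wrt⨾ refl refl (wrt⨾ refl refl (asg (inc w (≤-<-trans nf<Z Z<))
            (≤-refl , touched-child τ D D<nf lt le (inj₁ (side≡0 s , refl)) ,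
             subst (nf₀ ≤_) (sym (upd≡ (arrs ρ achild) D _)) (Touched.nf≤ τ) , ≤-refl))))))))
        (λ ge → weaken (s≤s (m≤n+m k 21)) (skip! (m≤n+m k 0 , τ , ge , n≤1+n _)))
        where
        D = vars ρ vD

      exchange-halts : ∀ {ρ k u} → vars ρ vv ≡ u → let E = arrs ρ aE; P = arrs ρ aP; s = vars ρ vs in
        Halts w exchange ρ (21 + k) (λ k′ σ → k′ ≡ k × arrs σ aE ≡ (E [ P u ↦ E s ]) [ s ↦ u ] ×
          arrs σ aP ≡ (P [ E s ↦ P u ]) [ u ↦ s ] × arrs σ aF ≡ arrs ρ aF [ u ↦ vars ρ vf ])
      exchange-halts refl = asg⨾ refl (asg⨾ refl (wrt⨾ refl refl (wrt⨾ refl refl (wrt⨾ refl refl (wrt⨾ refl refl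
        (wrt refl refl (refl , refl , refl , refl)))))))

      relocate-halts : ∀ {ρ k j tl T} (τ : Touched (viewOf ρ) j tl T) → Context ρ (T j) →
        (u<N : T j < N) (K> : 0 < arrs ρ aK (T j)) (cb≡c : arrs ρ acb (T j) ≡ c) →
        Prefers u<N ⊎ arrs ρ acnt (T j) ≤ arrs ρ aK (T j) → vars ρ vD ≡ View.F v₀ (T j) →
        nf₀ ≤ arrs ρ achild (View.F v₀ (T j)) →
        Halts w relocate ρ (47 + k) (λ k′ σ → k ≤ k′ ×
          Touched (record (viewOf ρ) { E = arrs σ aE ; P = arrs σ aP ; F = arrs σ aF ; fs = arrs σ afs ; fe = arrs σ afe
                                     ; cnt = arrs σ acnt ; cb = arrs σ acb ; K = arrs ρ aK [ T j ↦ 0 ] }) (suc j) tl T)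
      relocate-halts {ρ} {k} {j} {tl} {T} τ (context r≡ d≡ side≡ n≡ u≡) u<N K> cb≡c why D≡ nf≤f =
        wrt⨾ u≡ (cong (arrs ρ aK) u≡) (wrt⨾ u≡ d≡ (asg⨾ (cong (arrs ρ achild) D≡) (ifl⨾ right left)))
        where
        D = View.F v₀ (T j)
        f = arrs ρ achild D
        ρ₁ : Store
        ρ₁ = store (vars ρ [ vf ↦ f ])
          ((arrs ρ [ acnt ↦ arrs ρ acnt [ T j ↦ arrs ρ aK (T j) ] ]) [ acb ↦ arrs ρ acb [ T j ↦ d ] ])
        s-inside = Treat.F₁-inside τ u<N K> cb≡c
        Post : ℕ → Store → Set
        Post k′ σ = k ≤ k′ ×
          Touched (record (viewOf ρ) { E = arrs σ aE ; P = arrs σ aP ; F = arrs σ aF ; fs = arrs σ afs ; fe = arrs σ afe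
                                     ; cnt = arrs σ acnt ; cb = arrs σ acb ; K = arrs ρ aK [ T j ↦ 0 ] }) (suc j) tl T
        after : ∀ {E P F : ℕ → ℕ} fs fe {E′ P′ F′} → E′ ≡ E → P′ ≡ P → F′ ≡ F →
          Touched (record (viewOf ρ) { E = E ; P = P ; F = F ; fs = fs ; fe = fe
            ; cnt = arrs ρ acnt [ T j ↦ arrs ρ aK (T j) ] ; cb = arrs ρ acb [ T j ↦ d ] ; K =
                arrs ρ aK [ T j ↦ 0 ] }) (suc j) tl T →
          Touched (record (viewOf ρ) { E = E′ ; P = P′ ; F = F′ ; fs = fs ; fe = fe
            ; cnt = arrs ρ acnt [ T j ↦ arrs ρ aK (T j) ] ; cb = arrs ρ acb [ T j ↦ d ] ; K =
                arrs ρ aK [ T j ↦ 0 ] }) (suc j) tl T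
        after _ _ refl refl refl t = t
        right : wrap w 0 < vars ρ vside →
          Halts w ((vs ≔ afe [ var vD ] ⊖ lit 1 ⨾ afe [ var vD ]≔ var vs ⨾ afs [ var vf ]≔ var vs) ⨾ exchange)
              ρ₁ (34 + k) Post
        right 0<s = weaken (m≤n+m _ 2) (assoc⨾ (asg⨾
          (cong₂ _∸_ (cong (arrs ρ afe) D≡) (lit-id w (≤-trans (≤-trans (s≤s z≤n) u<N) N≤Z) Z<))
          (assoc⨾ (wrt⨾ D≡ refl (wrt⨾ refl refl
          (call (vy ∷ vpv ∷ []) (aE ∷ aP ∷ aF ∷ []) (exchange-halts u≡)
            λ { (refl , eE , eP , eF) → ≤-refl , after (arrs ρ afs [ f ↦ arrs ρ afe D ∸ 1 ])
                (arrs ρ afe [ D ↦ arrs ρ afe D ∸ 1 ]) eE eP eF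
              (Treat.touched-move-right τ u<N K> cb≡c (side≡1 (subst (wrap w 0 <_) side≡ 0<s)) nf≤f why) }))))))
        left : vars ρ vside ≤ wrap w 0 →
          Halts w ((vs ≔ afs [ var vD ] ⨾ afs [ var vD ]≔ var vs ⊕ lit 1 ⨾ afe [ var vf ]≔ var vs ⊕ lit 1) ⨾
              exchange) ρ₁ (34 + k) Post
        left s≤0 = assoc⨾ (asg⨾ (cong (arrs ρ afs) D≡) (assoc⨾ (wrt⨾ D≡ (inc w s<) (wrt⨾ refl (inc w s<)
          (call (vy ∷ vpv ∷ []) (aE ∷ aP ∷ aF ∷ []) (exchange-halts u≡)
            λ { (refl , eE , eP , eF) → ≤-refl , after (arrs ρ afs [ D ↦ suc (arrs ρ afs D) ])
                (arrs ρ afe [ f ↦ suc (arrs ρ afs D) ]) eE eP eF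
              (Treat.touched-move-left τ u<N K> cb≡c (side≡0 (subst (_≤ wrap w 0) side≡ s≤0)) nf≤f why) })))))
          where
          s< : suc (arrs ρ afs D) < 2 ^ w
          s< = ≤-<-trans (≤-trans (proj₁ (Treat.slot τ u<N K> cb≡c ≤-refl
            (≤-<-trans (proj₁ s-inside) (proj₂ s-inside)))) N≤Z) Z<

      move-halts : ∀ {ρ k j tl T} (τ : Touched (viewOf ρ) j tl T) → Context ρ (T j) →
        (u<N : T j < N) (K> : 0 < arrs ρ aK (T j)) (cb≡c : arrs ρ acb (T j) ≡ c) →
        Prefers u<N ⊎ arrs ρ acnt (T j) ≤ arrs ρ aK (T j) → suc (vars ρ vnf) ≤ Z →
        Halts w move ρ (76 + k) (λ k′ σ → k ≤ k′ × vars σ vnf ≤ suc (vars ρ vnf) ×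
          Touched (record (touchedView ρ σ) { K = arrs ρ aK [ T j ↦ 0 ] }) (suc j) tl T)
      move-halts {ρ} {k} {j} {tl} {T} τ (context r≡ d≡ side≡ n≡ u≡) u<N K> cb≡c why nf<Z =
        asg⨾ (trans (cong (arrs ρ aF) u≡) (Treat.F₁≡ τ u<N K> cb≡c))
        (call⨾ (vs ∷ vnf ∷ []) (achild ∷ apar ∷ afs ∷ afe ∷ [])
          (child-halts τ r≡ side≡ (Treat.D<nf τ u<N K> cb≡c)
            (let l , h = Treat.F₁-inside τ u<N K> cb≡c in ≤-trans l (<⇒≤ h)) nf<Z)
        λ { (k≤ , τ′ , nf≤f , nf≤) → weaken k≤
          (call (vf ∷ vs ∷ vy ∷ vpv ∷ []) (aE ∷ aP ∷ aF ∷ afs ∷ afe ∷ acnt ∷ acb ∷ [])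
            (relocate-halts τ′ (context r≡ d≡ side≡ n≡ u≡) u<N K> cb≡c why refl nf≤f)
            λ { (k≤ , τ″) → k≤ , nf≤ , τ″ }) })

      treat-halts : ∀ {ρ k j tl T} (τ : Touched (viewOf ρ) j tl T) → Context ρ (T j) →
        T j < N → 0 < arrs ρ aK (T j) → arrs ρ acb (T j) ≡ c → suc (vars ρ vnf) ≤ Z →
        Halts w treat ρ (93 + k) (λ k′ σ → k ≤ k′ × vars σ vnf ≤ suc (vars ρ vnf) ×
          Touched (record (touchedView ρ σ) { K = arrs ρ aK [ T j ↦ 0 ] }) (suc j) tl T)
      treat-halts {ρ} {k} {j} {tl} {T} τ ctx@(context r≡ d≡ side≡ n≡ u≡) u<N K> cb≡c nf<Z =
        asg⨾ (cong₂ _∸_ (cong (arrs ρ acnt) u≡) (cong (arrs ρ aK) u≡)) (ifl⨾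
          (λ u<n → ifl⨾
            (λ 0<s → weaken (n≤1+n _) (skip⨾ (unless λ where
              (inj₁ (s0 , _)) → 0≢1 (trans (sym s0) (side≡1 (subst (wrap w 0 <_) side≡ 0<s)))
              (inj₂ (_ , n≤u)) → ≤⇒≯ n≤u (subst₂ _<_ u≡ n≡ u<n))))
            (λ s≤0 → asg⨾ (zero-id w) (reset (inj₁ (side≡0 (subst (_≤ wrap w 0) side≡ s≤0) , subst₂ _<_ u≡ n≡ u<n)))))
          (λ n≤u → ifl⨾
            (λ 0<s → asg⨾ (zero-id w) (reset (inj₂ (side≡1 (subst (wrap w 0 <_) side≡ 0<s) , subst₂ _≤_ n≡ u≡ n≤u))))
            (λ s≤0 → weaken (n≤1+n _) (skip⨾ (unless λ where
              (inj₁ (_ , u<n)) → ≤⇒≯ (subst₂ _≤_ n≡ u≡ n≤u) u<n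
              (inj₂ (s1 , _)) → 0≢1 (trans (sym (side≡0 (subst (_≤ wrap w 0) side≡ s≤0))) s1)))))) 
        where
        Post : ℕ → Store → Set
        Post k′ σ = k ≤ k′ × vars σ vnf ≤ suc (vars ρ vnf) ×
          Touched (record (touchedView ρ σ) { K = arrs ρ aK [ T j ↦ 0 ] }) (suc j) tl T
        0≢1 : 0 ≢ 1
        0≢1 ()
        last : Cmd
        last = ifLess (lit 0) (var vg) (acnt [ var vv ]≔ var vg) move
        g = arrs ρ acnt (T j) ∸ arrs ρ aK (T j)
        ρ₁ = store (vars ρ [ vg ↦ g ]) (arrs ρ)
        ρ₂ = store ((vars ρ [ vg ↦ g ]) [ vg ↦ 0 ]) (arrs ρ)
        unless : ¬ Prefers u<N → Halts w last ρ₁ (79 + k) Post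
        unless ¬pref = ifl
          (λ g> → let 0<g = subst (_< g) (zero-id w) g> in
            weaken (m≤n+m _ 73) (wrt u≡ refl (≤-refl , n≤1+n _ ,
              Treat.touched-stay τ u<N K> cb≡c ¬pref (m<n+o⇒m∸n<o′ 0<g))))
          (λ g≤ → move-halts τ (context r≡ d≡ side≡ n≡ u≡) u<N K> cb≡c
            (inj₂ (m∸n≡0⇒m≤n (n≤0⇒n≡0 (subst (g ≤_) (zero-id w) g≤)))) nf<Z)
          where
          m<n+o⇒m∸n<o′ : ∀ {m n} → 0 < m ∸ n → n < m
          m<n+o⇒m∸n<o′ {m} {n} p = ≰⇒> λ le → contradiction (m≤n⇒m∸n≡0 le) (>⇒≢ p)
        reset : Prefers u<N → Halts w last ρ₂ (79 + k) Post
        reset pref = ifl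
          (λ 0<0 → contradiction 0<0 (≤⇒≯ z≤n))
          (λ _ → move-halts τ (context r≡ d≡ side≡ n≡ u≡) u<N K> cb≡c (inj₁ pref) nf<Z)

      -- Treating an entry of `T` creates at most one child, which is why the number of fine blocks
      -- is controlled by the length of the list.
      touch-halts : ∀ {ρ k} R → let tl = vars ρ vtl; T = arrs ρ aT in
        Touched (viewOf ρ) 0 tl T → vars ρ vj ≡ 0 → vars ρ vr ≡ nf₀ → vars ρ vnc ≡ d → vars ρ vside ≡ side →
        vars ρ vn ≡ n → vars ρ vc ≡ c → (∀ i → i < tl → T i < N) → vars ρ vnf + tl ≤ Z →
        tl * 118 + (3 + R) ≤ k →
        Halts w touch ρ k (λ k′ σ → R ≤ k′ × Touched (touchedView ρ σ) tl tl T × vars σ vnf ≤ vars ρ vnf + tl)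
      touch-halts {ρ} {k} R τ₀ j≡0 r≡ d≡ side≡ n≡ refl T< nf≤Z p₀ =
        while (vj ∷ vv ∷ vg ∷ vD ∷ vf ∷ vs ∷ vy ∷ vpv ∷ vnf ∷ [])
              (aE ∷ aP ∷ aF ∷ afs ∷ afe ∷ acnt ∷ acb ∷ aK ∷ achild ∷ apar ∷ []) Loop
          (λ { (s , eq , τ , nf≤ , p) j<tl → case next-left j<tl eq of λ { (s′ , refl , eq′) →
            115 + (s′ * 118 + (3 + R)) , p , body {s = s′} eq′ τ nf≤ j<tl } })
          (λ { {σ = σ} (s , eq , τ , nf≤ , p) tl≤j → R , ≤-trans (m≤n+m _ (s * 118)) p , ≤-refl ,
            subst (λ j → Touched (touchedView ρ σ) j tl T) (≤-antisym (m+n≤o⇒m≤o _ (≤-reflexive eq)) tl≤j) τ ,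
            m+n≤o⇒m≤o _ nf≤ })
          (tl , cong (_+ tl) j≡0 , subst (λ j → Touched (viewOf ρ) j tl T) (sym j≡0) τ₀ , ≤-refl , p₀)
        where
        tl = vars ρ vtl
        T = arrs ρ aT
        Loop : ℕ → Store → Set
        Loop l σ = ∃[ s ] (vars σ vj + s ≡ tl × Touched (touchedView ρ σ) (vars σ vj) tl T ×
          vars σ vnf + s ≤ vars ρ vnf + tl × s * 118 + (3 + R) ≤ l)
        tl<Z : tl ≤ Z
        tl<Z = ≤-trans (m≤n+m tl (vars ρ vnf)) nf≤Z
        body : ∀ {σ s} → suc (vars σ vj) + s ≡ tl → Touched (touchedView ρ σ) (vars σ vj) tl T →
          vars σ vnf + suc s ≤ vars ρ vnf + tl → vars σ vj < tl →
          Halts w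
            (vv ≔ aT [ var vj ] ⨾
             ifLess (lit 0) (aK [ var vv ])
               (ifLess (acb [ var vv ]) (var vc) skip
                 (ifLess (var vc) (acb [ var vv ]) skip treat))
               skip ⨾
             aK [ var vv ]≔ lit 0 ⨾
             bump vj)
            (havoc (vj ∷ vv ∷ vg ∷ vD ∷ vf ∷ vs ∷ vy ∷ vpv ∷ vnf ∷ [])
              (aE ∷ aP ∷ aF ∷ afs ∷ afe ∷ acnt ∷ acb ∷ aK ∷ achild ∷ apar ∷ []) ρ σ)
            (115 + (s * 118 + (3 + R))) Loop
        body {σ} {s} eq τ nf≤ j<tl = asg⨾ refl (ifl⨾
          (λ K> → let K>0 = subst (_< arrs σ aK u) (zero-id w) K> in ifl⨾
            (λ lt → pass 96 (inj₂ (<⇒≢ lt)))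
            (λ c≤ → ifl⨾
              (λ lt → pass 92 (inj₂ (>⇒≢ lt)))
              (λ ≤c → call⨾ (vg ∷ vD ∷ vf ∷ vs ∷ vy ∷ vpv ∷ vnf ∷ [])
                  (aE ∷ aP ∷ aF ∷ afs ∷ afe ∷ acnt ∷ acb ∷ achild ∷ apar ∷ [])
                  (treat-halts τ (context r≡ d≡ side≡ n≡ refl) (T< _ j<tl) K>0 (≤-antisym ≤c c≤)
                    (≤-trans (≤-trans (≤-trans (m≤m+n (suc (vars σ vnf)) s)
                        (≤-reflexive (sym (+-suc (vars σ vnf) s)))) nf≤) nf≤Z))
                λ { {σ = σ′} (k≤ , nf′≤ , τ′) → weaken k≤
                    (wrt⨾ refl (zero-id w) (asg (inc w (≤-<-trans (≤-trans j<tl tl<Z) Z<))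
                  (s , eq , τ′ ,
                   ≤-trans (≤-trans (+-monoˡ-≤ s nf′≤) (≤-reflexive (sym (+-suc (vars σ vnf) s)))) nf≤ , ≤-refl))) })))
          (λ K≤ → pass 100 (inj₁ (n≤0⇒n≡0 (subst (arrs σ aK u ≤_) (zero-id w) K≤)))))
          where
          u = T (vars σ vj)
          now : Store
          now = havoc (vj ∷ vv ∷ vg ∷ vD ∷ vf ∷ vs ∷ vy ∷ vpv ∷ vnf ∷ [])
            (aE ∷ aP ∷ aF ∷ afs ∷ afe ∷ acnt ∷ acb ∷ aK ∷ achild ∷ apar ∷ []) ρ σ
          pass : ∀ m → arrs σ aK u ≡ 0 ⊎ arrs σ acb u ≢ c →
            Halts w (skip ⨾ aK [ var vv ]≔ lit 0 ⨾ bump vj) (store (vars now [ vv ↦ u ]) (arrs now))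
              (m + (8 + (s * 118 + (3 + R)))) Loop
          pass m why = weaken (m≤n+m _ m) (skip⨾ (wrt⨾ refl (zero-id w) (asg (inc w (≤-<-trans (≤-trans j<tl tl<Z) Z<))
            (s , eq , touched-skip τ (T< _ j<tl) why ,
             ≤-trans (≤-trans (n≤1+n _) (≤-reflexive (sym (+-suc (vars σ vnf) s)))) nf≤ , ≤-refl))))

    -- Halving `t`, which is at least 2, lowers its rounded logarithm by one.
    log-half : ∀ {s t} → 0 < s → s + s ≤ t → ⌊log₂ s ⌋ < ⌊log₂ t ⌋
    log-half {s} {t} 0<s 2s≤t = ≤-<-trans (≤-trans (⌊log₂⌋-mono-≤ s≤half) (≤-reflexive (⌊log₂⌊n/2⌋⌋≡⌊log₂n⌋∸1 t)))
      (pred< (⌊log₂⌋-mono-≤ {2} {t} (≤-trans (+-mono-≤ 0<s 0<s) 2s≤t)))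
      where
      s≤half : s ≤ ⌊ t /2⌋
      s≤half = subst (_≤ ⌊ t /2⌋) (sym (n≡⌊n+n/2⌋ s)) (⌊n/2⌋-mono 2s≤t)
      pred< : ∀ {l} → 1 ≤ l → l ∸ 1 < l
      pred< {suc l} _ = ≤-refl

    -- An entry of `T` costs 118 in `touch`. It leads to at most one new fine block, costing 36 in
    -- `emits`, and so to at most two queue entries of 63 each. Thus 118 + 36 + 2 * 63 = 280 is the
    -- credit asked of `κ`.
    round-halts : ∀ {ρ k} R q cs₀ ce₀ → 280 ≤ κ →
      let open View (record (viewOf ρ) { cs = cs₀ ; ce = ce₀ }); v₀ = record (viewOf ρ) { cs = cs₀ ; ce = ce₀ }
          c = vars ρ vc; b = vars ρ vb
          lo = vars ρ vlo; hi = vars ρ vhi; Φ = weight v₀ in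
      Adjacency (arrs ρ aHEAD) (arrs ρ aNEXT) (arrs ρ aKEY) (arrs ρ aTG) → vars ρ vn ≡ n → vars ρ vr ≡ nf →
      Inv v₀ q nf → q < nb → b ≡ B q → c ≡ C (E b) → cs₀ c < b →
      Halves (vars ρ vside) b c nc cs₀ ce₀ (arrs ρ acs) (arrs ρ ace) →
      lo ≡ arrs ρ acs nc → hi ≡ arrs ρ ace nc → (hi ∸ lo) + (hi ∸ lo) ≤ ce₀ c ∸ cs₀ c →
      nf + Φ ≤ Z → nb + Φ * 2 ≤ Z → nc + Φ ≤ Z →
      Φ * (22 + κ) + (19 + R) ≤ k →
      Halts w round ρ k (λ k′ σ → let v = record (touchedView ρ σ)
                                        { C = arrs σ aC ; B = arrs σ aB ; nc = vars σ vnc ; nb = vars σ vnb } in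
        ∃[ t ] vars σ vnb ≡ nb + t × Inv v (suc q) (View.nf v) × vars σ vr ≡ View.nf v ×
        View.nf v + weight v ≤ Z × View.nb v + weight v * 2 ≤ Z × View.nc v + weight v ≤ Z ×
        weight v * (22 + κ) + (t * 63 + R) ≤ k′)
    round-halts {ρ} {k} R q cs₀ ce₀ κ≥ adj n≡ r≡ I q<nb b≡ c≡ cs<b H lo≡ hi≡ half nf≤ nb≤ nc≤ p =
      weaken (≤-trans (≤-reflexive (trans (arith₁ Sn Se R (22 + κ)) (cong (λ Φ → Φ * (22 + κ) + (19 + R)) Sn+Se))) p)
      (asg⨾ refl (asg⨾ (zero-id w)
      (call⨾ (vp ∷ vx ∷ ve ∷ vv ∷ vtl ∷ []) (aC ∷ aT ∷ aK ∷ [])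
        (Scan.scan-halts c d L drop c≢d (12 + R) (Σ< M (L ∘ C ∘ src)) adj perm
            (≤-trans Se≤Φ (≤-trans (m≤n+m _ nf) nf≤)) refl lo≤hi hi≤N in-c
          K≡live ((λ _ ()) , λ v v<N K> → contradiction (K≡0 v v<N) (>⇒≢ K>)) ≤-refl ≤-refl)
      λ { {σ = σ₁} (sw , K≡ , (T< , ∋T) , tl≤ , dr , b₁) →
        let open After sw in
        weaken (≤-trans (arith₂ Sn′ Se′ (vars σ₁ vtl) R (22 + κ) (*-monoʳ-≤ (vars σ₁ vtl) κ≥)) b₁) (asg⨾ (zero-id w)
        (call⨾ (vj ∷ vv ∷ vg ∷ vD ∷ vf ∷ vs ∷ vy ∷ vpv ∷ vnf ∷ [])
            (aE ∷ aP ∷ aF ∷ afs ∷ afe ∷ acnt ∷ acb ∷ aK ∷ achild ∷ apar ∷ [])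
          (Touch.touch-halts v₀ q I q<nb (vars ρ vside) c b b≡ c≡ cs<b (arrs σ₁ aC) cs′ ce′ H new old
            (4 + (vars σ₁ vtl * 36 + (3 + rest (vars σ₁ vtl))))
                (Round.touched-start v₀ q I q<nb (vars ρ vside) c b b≡ c≡ cs<b (arrs σ₁ aC) cs′ ce′ H new old K≡ ∋T)
            refl r≡ refl refl n≡ refl T< (nf+tl≤ tl≤) ≤-refl)
        λ { {σ = σ₂} (k≤₂ , τ , nf₂≤) → weaken k≤₂ (asg⨾ (inc w (≤-<-trans (d< dr) Z<))
            (call (vr ∷ vf ∷ vnb ∷ []) (aB ∷ [])
          (emits-halts (rest (vars σ₁ vtl)) (subst (Inv _ (suc q)) (sym r≡)
              (Round.touched-end v₀ q I q<nb (vars ρ vside) c b b≡ c≡ cs<b (arrs σ₁ aC) cs′ ce′ H new old τ))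
            q<nb (≤-trans nf₂≤ (nf+tl≤ tl≤)) (vars σ₂ vnf ∸ nf)
                (trans (cong (_+ (vars σ₂ vnf ∸ nf)) r≡) (m+[n∸m]≡n (Round.Touched.nf≤ τ)))
            (≤-trans (+-monoʳ-≤ nb (*-monoˡ-≤ 2 (≤-trans (s≤tl nf₂≤) (tl≤Φ tl≤)))) nb≤)
            (+-monoˡ-≤ (3 + rest (vars σ₁ vtl)) (*-monoˡ-≤ 36 (s≤tl nf₂≤))))
          λ { {σ = σ₃} (k≤₃ , r≡₃ , nb≤₃ , nb≤₃′ , I₃) →
              let t≤ = ≤-trans (m≤n+o⇒m∸n≤o _ nb nb≤₃′) (*-monoˡ-≤ 2 (s≤tl nf₂≤)) in
              vars σ₃ vnb ∸ nb , sym (m+[n∸m]≡n nb≤₃) , I₃ , r≡₃ ,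
              arith₃ nf (vars σ₂ vnf) (vars σ₁ vtl) _ Sn Se nf₂≤ tl≤ wt (<⇒≤ (Sn′< dr))
                  (subst (λ Φ → nf + Φ ≤ Z) (sym Sn+Se) nf≤) ,
              arith₄ nb (vars σ₃ vnb) (vars σ₁ vtl) _ Sn Se
                  (≤-trans nb≤₃′ (+-monoʳ-≤ nb (*-monoˡ-≤ 2 (s≤tl nf₂≤)))) tl≤ wt (<⇒≤ (Sn′< dr))
                (subst (λ Φ → nb + Φ * 2 ≤ Z) (sym Sn+Se) nb≤) ,
              arith₅ d _ Sn Se wt (Sn′< dr) (≤-trans (m≤n+m _ _) tl≤) (subst (λ Φ → d + Φ ≤ Z) (sym Sn+Se) nc≤) ,
              ≤-trans (arith₆ (vars σ₁ vtl) (vars σ₃ vnb ∸ nb) _ wt t≤) k≤₃ })) })) })))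
      where
      v₀ = record (viewOf ρ) { cs = cs₀ ; ce = ce₀ }
      open View v₀ renaming (nc to d)
      open Inv I
      open Perm perm
      c = vars ρ vc
      b = vars ρ vb
      lo = vars ρ vlo
      hi = vars ρ vhi
      cs′ = arrs ρ acs
      ce′ = arrs ρ ace
      b<N : b < N
      b<N = subst (_< N) (sym b≡) (proj₁ (pending q ≤-refl q<nb))
      c<d : c < d
      c<d = subst (_< d) (sym c≡) (Blocks.id< coarse b b<N)
      b<ce : b < ce₀ c
      b<ce = subst (λ c → b < ce₀ c) (sym c≡) (Blocks.<hi coarse b b<N)
      c≢d : c ≢ d
      c≢d = <⇒≢ c<d
      -- Only `d` gets a new extent. While the round runs, `c` is charged at its old size; `size≤`
      -- shows that this is an upper bound.
      L : ℕ → ℕ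
      L = extent v₀ [ d ↦ ⌊log₂ (hi ∸ lo) ⌋ ]
      ends : cs₀ c ≤ lo × lo < hi × hi ≤ ce₀ c
      ends with Halves.shape H
      ... | inj₁ (_ , s , t , _ , _) = ≤-reflexive (sym (trans lo≡ s)) ,
        subst₂ _<_ (sym (trans lo≡ s)) (sym (trans hi≡ t)) cs<b , subst (_≤ ce₀ c) (sym (trans hi≡ t)) (<⇒≤ b<ce)
      ... | inj₂ (_ , _ , _ , s , t) = subst (cs₀ c ≤_) (sym (trans lo≡ s)) (<⇒≤ cs<b) ,
        subst₂ _<_ (sym (trans lo≡ s)) (sym (trans hi≡ t)) b<ce , ≤-reflexive (trans hi≡ t)
      drop : L d < L c
      drop = subst₂ _<_ (sym (upd≡ (extent v₀) d _)) (sym (upd≢ (extent v₀) d _ c≢d))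
        (log-half (m<n⇒0<n∸m (proj₁ (proj₂ ends))) half)
      lo≤hi = <⇒≤ (proj₁ (proj₂ ends))
      in-c : ∀ p → lo ≤ p → p < hi → C (E p) ≡ c
      in-c p l h = proj₂ (Blocks.exact coarse c p c<d (≤-trans (proj₁ ends) l) (<-≤-trans h (proj₂ (proj₂ ends))))
      hi≤N : hi ≤ N
      hi≤N = ≮⇒≥ λ N<hi → <-irrefl refl (proj₁ (Blocks.exact coarse c N c<d
        (≤-trans (Blocks-lo≤N) (≤-refl)) (<-≤-trans N<hi (proj₂ (proj₂ ends)))))
        where
        Blocks-lo≤N : cs₀ c ≤ N
        Blocks-lo≤N = ≤-trans (<⇒≤ cs<b) (<⇒≤ b<N)
      Sn = Σ< N (L ∘ C)
      Se = Σ< M (L ∘ C ∘ src)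
      C<d : ∀ x → x < N → C x < d
      C<d x x<N = subst (λ y → C y < d) (E∘P x x<N) (Blocks.id< coarse (P x) (P< x x<N))
      L≡ : ∀ x → x < N → L (C x) ≡ extent v₀ (C x)
      L≡ x x<N = upd≢ (extent v₀) d _ (<⇒≢ (C<d x x<N))
      Sn+Se : Sn + Se ≡ weight v₀
      Sn+Se = cong₂ _+_ (Σ-cong N L≡) (Σ-cong M λ e e<M → L≡ (src e) (src< e e<M))
      Se≤Φ : Se ≤ weight v₀
      Se≤Φ = ≤-trans (m≤n+m Se Sn) (≤-reflexive Sn+Se)
      tl≤Φ : ∀ {tl Se′} → tl + Se′ ≤ Se → tl ≤ weight v₀
      tl≤Φ {tl} le = ≤-trans (m+n≤o⇒m≤o tl le) Se≤Φ
      K≡live : ∀ v → v < N → arrs ρ aK v ≡ live (C ∘ src) v d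
      K≡live v v<N = trans (K≡0 v v<N) (sym (Σ-zero M λ e e<M →
        trans (cong (δ? (tgt e) v *_) (δ?-≢ (<⇒≢ (C<d (src e) (src< e e<M))))) (*-zeroʳ (δ? (tgt e) v))))
      nf+tl≤ : ∀ {tl Se′} → tl + Se′ ≤ Se → nf + tl ≤ Z
      nf+tl≤ le = ≤-trans (+-monoʳ-≤ nf (tl≤Φ le)) nf≤
      Sn′< : ∀ {Sn′} → hi + Sn′ ≤ lo + Sn → Sn′ < Sn
      Sn′< {Sn′} le = +-cancelˡ-< lo Sn′ Sn (<-≤-trans (+-monoˡ-< Sn′ (proj₁ (proj₂ ends))) le)
      d< : ∀ {Sn′} → hi + Sn′ ≤ lo + Sn → suc d ≤ Z
      d< le = ≤-trans (≤-trans (≤-trans (≤-reflexive (+-comm 1 d)) (+-monoʳ-≤ d (≤-trans (s≤s z≤n) (Sn′< le))))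
        (+-monoʳ-≤ d (≤-trans (m≤m+n Sn Se) (≤-reflexive Sn+Se)))) nc≤
      arith₁ : ∀ a e r m → 2 + (2 + (a * m + (e * m + (3 + (12 + r))))) ≡ (a + e) * m + (19 + r)
      arith₁ a e r m = solve (a ∷ e ∷ r ∷ m ∷ [])
      arith₂ : ∀ a e t r m {x} → t * 280 ≤ x →
        2 + (t * 118 + (3 + (4 + (t * 36 + (3 + (t * 126 + ((a + e) * m + r))))))) ≤ a * m + (e * m + (x + (12 + r)))
      arith₂ a e t r m {x} h = lin 0 h (solve (a ∷ e ∷ t ∷ r ∷ m ∷ x ∷ []))
      s≤tl : ∀ {nf₂ tl} → nf₂ ≤ nf + tl → nf₂ ∸ nf ≤ tl
      s≤tl = m≤n+o⇒m∸n≤o _ nf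
      arith₃ : ∀ nf nf₂ tl w a e {a′ e′} → nf₂ ≤ nf + tl → tl + e′ ≤ e → w ≤ a′ + e′ → a′ ≤ a →
          nf + (a + e) ≤ Z → nf₂ + w ≤ Z
      arith₃ nf nf₂ tl w a e {a′} {e′} h₁ h₂ h₃ h₄ h₅ = ≤-trans le h₅
        where
        le : nf₂ + w ≤ nf + (a + e)
        le = lin 0 (+-mono-≤ h₁ (+-mono-≤ h₂ (+-mono-≤ h₃ h₄))) (solve (nf ∷ nf₂ ∷ tl ∷ w ∷ a ∷ e ∷ a′ ∷ e′ ∷ []))
      arith₄ : ∀ nb nb₂ tl w a e {a′ e′} → nb₂ ≤ nb + tl * 2 → tl + e′ ≤ e → w ≤ a′ + e′ → a′ ≤ a →
          nb + (a + e) * 2 ≤ Z → nb₂ + w * 2 ≤ Z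
      arith₄ nb nb₂ tl w a e {a′} {e′} h₁ h₂ h₃ h₄ h₅ = ≤-trans le h₅
        where
        le : nb₂ + w * 2 ≤ nb + (a + e) * 2
        twice : (tl + e′ + (w + a′)) * 2 ≤ (e + (a′ + e′ + a)) * 2
        twice = *-monoˡ-≤ 2 (+-mono-≤ h₂ (+-mono-≤ h₃ h₄))
        le = lin 0 (+-mono-≤ h₁ twice)
          (solve (nb ∷ nb₂ ∷ tl ∷ w ∷ a ∷ e ∷ a′ ∷ e′ ∷ []))
      arith₅ : ∀ d w a e {a′ e′} → w ≤ a′ + e′ → a′ < a → e′ ≤ e → d + (a + e) ≤ Z → suc d + w ≤ Z
      arith₅ d w a e {a′} {e′} h₁ h₂ h₃ h₄ = ≤-trans le h₄
        where
        le : suc d + w ≤ d + (a + e)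
        le = lin 0 (+-mono-≤ h₁ (+-mono-≤ h₂ h₃)) (solve (d ∷ w ∷ a ∷ e ∷ a′ ∷ e′ ∷ []))
      arith₆ : ∀ tl t w {φ} → w ≤ φ → t ≤ tl * 2 → w * (22 + κ) + (t * 63 + R) ≤ tl * 126 + (φ * (22 + κ) + R)
      arith₆ tl t w {φ} h₁ h₂ = ≤-trans (+-mono-≤ (*-monoˡ-≤ (22 + κ) h₁) (+-monoˡ-≤ R (*-monoˡ-≤ 63 h₂)))
        (≤-reflexive (eq tl φ R (22 + κ)))
        where
        eq : ∀ t φ r m → φ * m + (t * 2 * 63 + r) ≡ t * 126 + (φ * m + r)
        eq t φ r m = solve (t ∷ φ ∷ r ∷ m ∷ [])
      module After {C′ : ℕ → ℕ} (sw : Scan.Swept c d L drop c≢d C P C′ lo hi) where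
        new : ∀ x → x < N → cs′ d ≤ P x → P x < ce′ d → C′ x ≡ d
        new x x<N l h = Scan.Swept.swept sw x x<N (subst (_≤ P x) (sym lo≡) l) (subst (P x <_) (sym hi≡) h)
        old : ∀ x → x < N → ¬ (cs′ d ≤ P x × P x < ce′ d) → C′ x ≡ C x
        old x x<N out = Scan.Swept.unswept sw x x<N λ { (l , h) → out (subst (_≤ P x) lo≡ l , subst (P x <_) hi≡ h) }
        Sn′ = Σ< N (L ∘ C′)
        Se′ = Σ< M (L ∘ C′ ∘ src)
        rest : ℕ → ℕ
        rest tl = tl * 126 + ((Sn′ + Se′) * (22 + κ) + R)
        size : ℕ → ℕ
        size i = ⌊log₂ (ce′ i ∸ cs′ i) ⌋
        size≤ : ∀ x → x < N → size (C′ x) ≤ L (C′ x)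
        size≤ x x<N with Round.C-part v₀ q I q<nb (vars ρ vside) c b b≡ c≡ cs<b C′ cs′ ce′ H new old x<N
        ... | inj₂ (eq , _) rewrite eq = ≤-reflexive (trans (cong₂ (λ h l → ⌊log₂ (h ∸ l) ⌋) (sym hi≡) (sym lo≡))
          (sym (upd≡ (extent v₀) d _)))
        ... | inj₁ eq rewrite eq | L≡ x x<N with C x ≟ c
        ...   | no ne = ≤-reflexive (cong₂ (λ h l → ⌊log₂ (h ∸ l) ⌋)
                  (Halves.other-e H _ ne (<⇒≢ (C<d x x<N))) (Halves.other-s H _ ne (<⇒≢ (C<d x x<N))))
        ...   | yes Cx rewrite Cx with Halves.shape H
        ...     | inj₁ (_ , _ , _ , s , t) = ⌊log₂⌋-mono-≤ (subst₂ (λ h l → h ∸ l ≤ ce₀ c ∸ cs₀ c) (sym t) (sym s)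
                    (∸-monoʳ-≤ (ce₀ c) (<⇒≤ cs<b)))
        ...     | inj₂ (_ , s , t , _) = ⌊log₂⌋-mono-≤ (subst₂ (λ h l → h ∸ l ≤ ce₀ c ∸ cs₀ c) (sym t) (sym s)
                    (∸-monoˡ-≤ (cs₀ c) (<⇒≤ b<ce)))
        wt : Σ< N (size ∘ C′) + Σ< M (size ∘ C′ ∘ src) ≤ Sn′ + Se′
        wt = +-mono-≤ (Σ-mono N size≤) (Σ-mono M λ e e<M → size≤ (src e) (src< e e<M))

    halve-halts : ∀ {ρ k} → let c = vars ρ vc; b = vars ρ vb; d = vars ρ vnc; cs = arrs ρ acs; ce = arrs ρ ace in
      cs c < b → b < ce c → c ≢ d → 1 ≤ Z →
      Halts w halve ρ (26 + k) (λ k′ σ → k ≤ k′ × Halves (vars σ vside) b c d cs ce (arrs σ acs) (arrs σ ace) ×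
        vars σ vlo ≡ arrs σ acs d × vars σ vhi ≡ arrs σ ace d ×
        (vars σ vhi ∸ vars σ vlo) + (vars σ vhi ∸ vars σ vlo) ≤ ce c ∸ cs c)
    halve-halts {ρ} {k} cs<b b<ce c≢d 1≤Z = asg⨾ refl (asg⨾ refl (ifl⨾
      (λ lt → assoc⨾ (asg⨾ (lit-id w 1≤Z Z<) (assoc⨾ (wrt⨾ refl refl (asg⨾ refl (wrt⨾ refl refl (wrt refl refl
        (≤-refl , record
          { other-s = λ i _ i≢d → upd≢ cs d b i≢d
          ; other-e = λ i i≢c i≢d → trans (upd≢ (ce [ c ↦ b ]) d (ce c) i≢d) (upd≢ ce c b i≢c)
          ; shape = inj₂ (refl , upd≢ cs d b c≢d , trans (upd≢ (ce [ c ↦ b ]) d (ce c) c≢d) (upd≡ ce c b) ,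
              upd≡ cs d b , upd≡ (ce [ c ↦ b ]) d (ce c)) } ,
         sym (upd≡ cs d b) , sym (upd≡ (ce [ c ↦ b ]) d (ce c)) ,
         ≤-trans (+-monoʳ-≤ (ce c ∸ b) (<⇒≤ lt)) (≤-reflexive halves)))))))))
      (λ ge → assoc⨾ (asg⨾ (zero-id w) (assoc⨾ (wrt⨾ refl refl (asg⨾ refl (wrt⨾ refl refl (wrt refl refl
        (≤-refl , record
          { other-s = λ i i≢c i≢d → trans (upd≢ (cs [ c ↦ b ]) d (cs c) i≢d) (upd≢ cs c b i≢c)
          ; other-e = λ i _ i≢d → upd≢ ce d b i≢d
          ; shape = inj₁ (refl , upd≡ (cs [ c ↦ b ]) d (cs c) , upd≡ ce d b ,
              trans (upd≢ (cs [ c ↦ b ]) d (cs c) c≢d) (upd≡ cs c b) , upd≢ ce d b c≢d) } ,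
         sym (upd≡ (cs [ c ↦ b ]) d (cs c)) , sym (upd≡ ce d b) ,
         ≤-trans (+-monoˡ-≤ (b ∸ cs c) ge) (≤-reflexive halves)))))))))))
      where
      c = vars ρ vc
      b = vars ρ vb
      d = vars ρ vnc
      cs = arrs ρ acs
      ce = arrs ρ ace
      halves : (ce c ∸ b) + (b ∸ cs c) ≡ ce c ∸ cs c
      halves = trans (sym (+-∸-assoc (ce c ∸ b) (<⇒≤ cs<b))) (cong (_∸ cs c) (m∸n+n≡m (<⇒≤ b<ce)))

    -- The 63 units of a queue entry are 3 for the guard, 15 to fetch and test the entry, 26 for
    -- `halve` and 19 for the fixed cost of `round`. The rest of a round is paid by the weight.
    refine-halts : ∀ {ρ k} R → let open View (viewOf ρ); v = viewOf ρ in 280 ≤ κ →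
      Adjacency (arrs ρ aHEAD) (arrs ρ aNEXT) (arrs ρ aKEY) (arrs ρ aTG) → vars ρ vn ≡ n → vars ρ vr ≡ nf →
      Inv v (vars ρ vq) nf → ∀ s → vars ρ vq + s ≡ nb →
      nf + weight v ≤ Z → nb + weight v * 2 ≤ Z → nc + weight v ≤ Z →
      weight v * (22 + κ) + (s * 63 + (3 + R)) ≤ k →
      Halts w refine ρ k (λ k′ σ → R ≤ k′ × ∃[ q ] Inv (viewOf σ) q (vars σ vnf) × vars σ vnb ≤ q)
    refine-halts {ρ} {k} R κ≥ adj n≡ r≡ I s eq nf≤ nb≤ nc≤ p =
      while vsRefine asRefine Loop
        (λ { (s , eq , r≡ , I , nf≤ , nb≤ , nc≤ , p) q<nb → case next-left q<nb eq of λ { (s′ , refl , eq′) →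
          body s′ eq′ r≡ I nf≤ nb≤ nc≤ p q<nb } })
        (λ { {σ = σ} (s , eq , r≡ , I , _ , _ , _ , p) nb≤q → R ,
          ≤-trans (m≤n+m _ (s * 63)) (≤-trans (m≤n+m _ (weight (viewOf σ) * (22 + κ))) p) , ≤-refl , vars σ vq ,
              I , nb≤q })
        (s , eq , r≡ , I , nf≤ , nb≤ , nc≤ , p)
      where
      Loop : ℕ → Store → Set
      Loop l σ = let open View (viewOf σ); v = viewOf σ in ∃[ s ] (vars σ vq + s ≡ nb × vars σ vr ≡ nf × Inv v (vars σ vq) nf ×
        nf + weight v ≤ Z × nb + weight v * 2 ≤ Z × nc + weight v ≤ Z ×
        weight v * (22 + κ) + (s * 63 + (3 + R)) ≤ l)
      arith : ∀ x s r → 3 + (60 + (x + (s * 63 + (3 + r)))) ≡ x + (63 + s * 63 + (3 + r))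
      arith x s r = solve (x ∷ s ∷ r ∷ [])
      body : ∀ {l σ} s → let open View (viewOf σ); v = viewOf σ in suc (vars σ vq) + s ≡ nb → vars σ vr ≡ nf → Inv v (vars σ vq) nf →
        nf + weight v ≤ Z → nb + weight v * 2 ≤ Z → nc + weight v ≤ Z →
        weight v * (22 + κ) + (suc s * 63 + (3 + R)) ≤ l → vars σ vq < nb →
        ∃[ k′ ] 3 + k′ ≤ l × Halts w
          (vb ≔ aB [ var vq ] ⨾ bump vq ⨾ vc ≔ aC [ aE [ var vb ] ] ⨾
           ifLess (acs [ var vc ]) (var vb) (halve ⨾ round) skip)
          (havoc vsRefine asRefine ρ σ) k′ Loop
      body {l} {σ} s eq r≡ I nf≤ nb≤ nc≤ p q<nb =
        60 + (weight v * (22 + κ) + (s * 63 + (3 + R))) ,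
        ≤-trans (≤-reflexive (arith (weight v * (22 + κ)) s R)) p ,
        asg⨾ refl (asg⨾ (inc w (≤-<-trans (≤-trans q<nb (m+n≤o⇒m≤o nb nb≤)) Z<)) (asg⨾ refl (ifl
          (λ cs<b → call⨾ (vlo ∷ vhi ∷ vside ∷ []) (acs ∷ ace ∷ [])
              (halve-halts cs<b b<ce (<⇒≢ c<d) (≤-trans (s≤s z≤n) (≤-trans b<N N≤Z)))
            λ { {σ = σ₁} (k≤ , H , lo≡ , hi≡ , half) → weaken k≤
              (weaken (≤-reflexive (arith₂ (weight v * (22 + κ)) (s * 63 + (3 + R))))
              (call vsRound asRound (round-halts (s * 63 + (3 + R)) (vars σ vq) cs ce κ≥ adj n≡ r≡ I q<nb refl
                  refl cs<b H lo≡ hi≡ half nf≤ nb≤ nc≤ ≤-refl)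
              λ { {σ = τ} (t , nb≡ , I′ , r≡′ , nf≤′ , nb≤′ , nc≤′ , p′) →
                s + t , sym (trans nb≡ (trans (cong (_+ t) (sym eq)) (+-assoc (suc (vars σ vq)) s t))) , r≡′ ,
                    I′ , nf≤′ , nb≤′ , nc≤′ ,
                ≤-trans (≤-reflexive (arith₃
                  (weight (record (viewOf τ) { cs = arrs σ₁ acs ; ce = arrs σ₁ ace }) * (22 + κ)) s t R)) p′ })) })
          (λ b≤cs → weaken (m≤n+m _ 44) (skip!
            (s , eq , r≡ , dismiss I q<nb b≤cs , nf≤ , nb≤ , nc≤ , ≤-refl))))))
        where
        v = viewOf σ
        open View v
        open Inv I
        open Perm perm
        vsRound : List ℕ
        vsRound = vp ∷ vx ∷ ve ∷ vv ∷ vtl ∷ vj ∷ vg ∷ vD ∷ vf ∷ vs ∷ vy ∷ vpv ∷ vnf ∷ vnc ∷ vr ∷ vnb ∷ []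
        asRound : List ℕ
        asRound = aE ∷ aP ∷ aF ∷ afs ∷ afe ∷ aC ∷ acnt ∷ acb ∷ aK ∷ achild ∷ apar ∷ aT ∷ aB ∷ []
        b = B (vars σ vq)
        c = C (E b)
        b<N : b < N
        b<N = proj₁ (pending _ ≤-refl q<nb)
        c<d : c < nc
        c<d = Blocks.id< coarse b b<N
        b<ce : b < ce c
        b<ce = Blocks.<hi coarse b b<N
        arith₂ : ∀ x y → x + (19 + y) ≡ 19 + (x + y)
        arith₂ x y = solve (x ∷ y ∷ [])
        arith₃ : ∀ x s t r → x + ((s + t) * 63 + (3 + r)) ≡ x + (t * 63 + (s * 63 + (3 + r)))
        arith₃ x s t r = solve (x ∷ s ∷ t ∷ r ∷ [])

-- Greedy colouring of intervals

-- Array 0 holds the origins of the transitions at first and is the output array as well; `edges`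
-- has read the origins before colours are written.
vhd vft aCol aFR : ℕ
vhd = 34
vft = 35
aCol = 0
aFR = 22

colour : Cmd
colour =
  vOut ≔ lit 0 ⨾
  vp ≔ lit 0 ⨾
  vhd ≔ lit 0 ⨾
  vft ≔ lit 0 ⨾
  whileLess (var vp) (var vN)
    (vx ≔ aE [ var vp ] ⨾
     ifLess (var vx) (var vn)
       (ifLess (var vhd) (var vft)
         (aCol [ var vx ]≔ aFR [ var vhd ] ⨾ bump vhd)
         (aCol [ var vx ]≔ var vOut ⨾ bump vOut))
       (aFR [ var vft ]≔ aCol [ var vx ⊖ var vn ] ⨾ bump vft) ⨾
     bump vp)

-- The state v occupies the interval from P v to P (v + n).
module Colouring (n : ℕ) (E P : ℕ → ℕ) (π : Perm (n + n) E P) (lo<hi : ∀ v → v < n → P v < P (v + n)) where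
  open Perm π

  record Coloured (k : ℕ) (col : ℕ → ℕ) : Set where
    field
      bounded : ∀ v → v < n → col v < k
      chains  : ∀ u v → u < n → v < n → u ≢ v → col u ≡ col v → P (u + n) < P v ⊎ P (v + n) < P u
      onto    : ∀ c → c < k → ∃[ v ] v < n × col v ≡ c
      clique  : ∃[ p ] (∀ c → c < k → ∃[ v ] v < n × P v ≤ p × p < P (v + n) × col v ≡ c)

  -- Positions below p have been treated; FR hd, …, FR (tl - 1) are the free colours.
  record Partial (p hd tl k : ℕ) (col FR : ℕ → ℕ) : Set where
    field
      col<   : ∀ v → v < n → P v < p → col v < k
      chains : ∀ u v → u < n → v < n → u ≢ v → P u < p → P v < p → col u ≡ col v →
               P (u + n) < P v ⊎ P (v + n) < P u
      free<  : ∀ j → hd ≤ j → j < tl → FR j < k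
      ended  : ∀ j v → hd ≤ j → j < tl → v < n → P v < p → col v ≡ FR j → P (v + n) < p
      free≢  : ∀ i j → hd ≤ i → i < tl → hd ≤ j → j < tl → FR i ≡ FR j → i ≡ j
      busy   : ∀ c → c < k → (∃[ j ] hd ≤ j × j < tl × FR j ≡ c) ⊎
               (∃[ v ] v < n × P v < p × p ≤ P (v + n) × col v ≡ c)
      used   : ∀ c → c < k → ∃[ v ] v < n × P v < p × col v ≡ c
      clique : ∃[ m ] (∀ c → c < k → ∃[ v ] v < n × P v < p × P v ≤ m × m < P (v + n) × col v ≡ c)
      tl≤    : tl ≤ p
      k≤     : k ≤ p

  private
    <n+n : ∀ {v} → v < n → v < n + n
    <n+n v<n = <-≤-trans v<n (m≤m+n n n)

    +n< : ∀ {v} → v < n → v + n < n + n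
    +n< v<n = +-monoˡ-< n v<n

  module Start {p hd tl k : ℕ} {col FR : ℕ → ℕ} (S : Partial p hd tl k col FR) (p<N : p < n + n) (w<n : E p < n) where
    open Partial S
    private
      w = E p
      Pw : P w ≡ p
      Pw = P∘E p p<N

    started : ∀ {v} → v < n → P v < suc p → v ≡ w ⊎ (v ≢ w × P v < p)
    started {v} v<n lt with m≤n⇒m<n∨m≡n (≤-pred lt)
    ... | inj₂ eq = inj₁ (trans (sym (E∘P v (<n+n v<n))) (cong E eq))
    ... | inj₁ l = inj₂ ((λ { refl → <-irrefl Pw l }) , l)

    old≢ : ∀ {v} → P v < p → v ≢ w
    old≢ l refl = <-irrefl Pw l

    -- The position `p` holds the start of an interval and therefore no end.
    still : ∀ {v} → v < n → p ≤ P (v + n) → suc p ≤ P (v + n)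
    still {v} v<n le = ≤∧≢⇒< le λ eq → <⇒≱ w<n (subst (n ≤_)
      (trans (sym (E∘P (v + n) (+n< v<n))) (cong E (sym eq))) (m≤n+m n v))

    open-w : suc p ≤ P (w + n)
    open-w = subst (_< P (w + n)) Pw (lo<hi w w<n)

    keep : ∀ {c v} → P v < p → (col [ w ↦ c ]) v ≡ col v
    keep {c} l = upd≢ col w c (old≢ l)

    chains′ : ∀ c → (∀ v → v < n → P v < p → col v ≡ c → P (v + n) < p) →
      ∀ u v → u < n → v < n → u ≢ v → P u < suc p → P v < suc p →
      (col [ w ↦ c ]) u ≡ (col [ w ↦ c ]) v → P (u + n) < P v ⊎ P (v + n) < P u
    chains′ c gone u v u<n v<n ne lu lv eq with started u<n lu | started v<n lv
    ... | inj₁ refl | inj₁ refl = contradiction refl ne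
    ... | inj₁ refl | inj₂ (_ , l) = inj₂ (subst (P (v + n) <_) (sym Pw)
            (gone v v<n l (trans (sym (keep l)) (trans (sym eq) (upd≡ col w c)))))
    ... | inj₂ (_ , l) | inj₁ refl = inj₁ (subst (P (u + n) <_) (sym Pw)
            (gone u u<n l (trans (sym (keep l)) (trans eq (upd≡ col w c)))))
    ... | inj₂ (_ , lu) | inj₂ (_ , lv) = chains u v u<n v<n ne lu lv (trans (sym (keep lu)) (trans eq (keep lv)))

    reuse : hd < tl → Partial (suc p) (suc hd) tl k (col [ w ↦ FR hd ]) FR
    reuse hd<tl = record
      { col< = λ v v<n l → case started v<n l of λ where
          (inj₁ refl) → subst (_< k) (sym (upd≡ col w c)) (free< hd ≤-refl hd<tl)
          (inj₂ (_ , l)) → subst (_< k) (sym (keep l)) (col< v v<n l)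
      ; chains = chains′ c λ v v<n l eq → ended hd v ≤-refl hd<tl v<n l eq
      ; free< = λ j l → free< j (<⇒≤ l)
      ; ended = λ j v l j< v<n lv eq → case started v<n lv of λ where
          (inj₁ refl) → contradiction (free≢ hd j ≤-refl hd<tl (<⇒≤ l) j< (trans (sym (upd≡ col w c)) eq)) (<⇒≢ l)
          (inj₂ (_ , lv)) → m<n⇒m<1+n (ended j v (<⇒≤ l) j< v<n lv (trans (sym (keep lv)) eq))
      ; free≢ = λ i j li i< lj j< → free≢ i j (<⇒≤ li) i< (<⇒≤ lj) j<
      ; busy = λ c′ c′<k → case busy c′ c′<k of λ where
          (inj₁ (j , l , j< , eq)) → case m≤n⇒m<n∨m≡n l of λ where
            (inj₁ lt)   → inj₁ (j , lt , j< , eq)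
            (inj₂ refl) → inj₂ (w , w<n , s≤s (≤-reflexive Pw) , open-w , trans (upd≡ col w c) eq)
          (inj₂ (v , v<n , l , le , eq)) → inj₂ (v , v<n , m<n⇒m<1+n l , still v<n le , trans (keep l) eq)
      ; used = λ c′ c′<k → let v , v<n , l , eq = used c′ c′<k in v , v<n , m<n⇒m<1+n l , trans (keep l) eq
      ; clique = let m , h = clique in m , λ c′ c′<k → let v , v<n , l , a , b , eq = h c′ c′<k in
          v , v<n , m<n⇒m<1+n l , a , b , trans (keep l) eq
      ; tl≤ = m≤n⇒m≤1+n tl≤ ; k≤ = m≤n⇒m≤1+n k≤ }
      where c = FR hd

    fresh : tl ≤ hd → Partial (suc p) hd tl (suc k) (col [ w ↦ k ]) FR
    fresh tl≤hd = record
      { col< = λ v v<n l → case started v<n l of λ where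
          (inj₁ refl) → subst (_< suc k) (sym (upd≡ col w k)) ≤-refl
          (inj₂ (_ , l)) → subst (_< suc k) (sym (keep l)) (m<n⇒m<1+n (col< v v<n l))
      ; chains = chains′ k λ v v<n l eq → contradiction (col< v v<n l) (≤⇒≯ (≤-reflexive (sym eq)))
      ; free< = λ j l j< → contradiction j< (≤⇒≯ (≤-trans tl≤hd l))
      ; ended = λ j _ l j< → contradiction j< (≤⇒≯ (≤-trans tl≤hd l))
      ; free≢ = λ i _ l i< → contradiction i< (≤⇒≯ (≤-trans tl≤hd l))
      ; busy = λ c c< → inj₂ (let v , v<n , l , _ , a , eq = all-open c c< in v , v<n , l , a , eq)
      ; used = λ c c< → let v , v<n , l , _ , _ , eq = all-open c c< in v , v<n , l , eq
      ; clique = p , λ c c< → let v , v<n , l , a , b , eq = all-open c c< in v , v<n , l , a , b , eq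
      ; tl≤ = m≤n⇒m≤1+n tl≤ ; k≤ = s≤s k≤ }
      where
      all-open : ∀ c → c < suc k → ∃[ v ] v < n × P v < suc p × P v ≤ p × suc p ≤ P (v + n) × (col [ w ↦ k ]) v ≡ c
      all-open c c< with m≤n⇒m<n∨m≡n (≤-pred c<)
      ... | inj₂ refl = w , w<n , s≤s (≤-reflexive Pw) , ≤-reflexive Pw , open-w , upd≡ col w k
      ... | inj₁ c<k with busy c c<k
      ...   | inj₁ (j , l , j< , _) = contradiction j< (≤⇒≯ (≤-trans tl≤hd l))
      ...   | inj₂ (v , v<n , l , le , eq) = v , v<n , m<n⇒m<1+n l , <⇒≤ l , still v<n le , trans (keep l) eq

  module Stop {p hd tl k : ℕ} {col FR : ℕ → ℕ} (S : Partial p hd tl k col FR) (p<N : p < n + n) (n≤x : n ≤ E p) where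
    open Partial S
    private
      w = E p ∸ n
      w+n : w + n ≡ E p
      w+n = m∸n+n≡m n≤x
      w<n : w < n
      w<n = +-cancelʳ-< n w n (subst (_< n + n) (sym w+n) (E< p p<N))
      Pw : P (w + n) ≡ p
      Pw = trans (cong P w+n) (P∘E p p<N)
      w-started : P w < p
      w-started = subst (P w <_) Pw (lo<hi w w<n)
      FR′ = FR [ tl ↦ col w ]

    started : ∀ {v} → v < n → P v < suc p → P v < p
    started {v} v<n lt = ≤∧≢⇒< (≤-pred lt) λ eq → <⇒≱ v<n (subst (n ≤_)
      (trans (cong E (sym eq)) (E∘P v (<n+n v<n))) n≤x)

    position : ∀ {j} → j < suc tl → j ≡ tl ⊎ (j < tl × FR′ j ≡ FR j)
    position {j} lt with m≤n⇒m<n∨m≡n (≤-pred lt)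
    ... | inj₂ eq = inj₁ eq
    ... | inj₁ l = inj₂ (l , upd≢ FR tl (col w) (<⇒≢ l))

    not-free : ∀ j → hd ≤ j → j < tl → FR j ≢ col w
    not-free j l j< eq = <-irrefl Pw (ended j w l j< w<n w-started (sym eq))

    release : hd ≤ tl → Partial (suc p) hd (suc tl) k col FR′
    release hd≤tl = record
      { col< = λ v v<n l → col< v v<n (started v<n l)
      ; chains = λ u v u<n v<n ne lu lv → chains u v u<n v<n ne (started u<n lu) (started v<n lv)
      ; free< = λ j l j< → case position j< of λ where
          (inj₁ refl) → subst (_< k) (sym (upd≡ FR tl (col w))) (col< w w<n w-started)
          (inj₂ (j< , eq)) → subst (_< k) (sym eq) (free< j l j<)
      ; ended = end
      ; free≢ = λ i j li i< lj j< eq → case position i< of λ where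
          (inj₁ refl) → case position j< of λ where
            (inj₁ refl) → refl
            (inj₂ (j< , e)) → contradiction (trans (sym e) (trans (sym eq) (upd≡ FR tl (col w)))) (not-free j lj j<)
          (inj₂ (i< , e)) → case position j< of λ where
            (inj₁ refl) → contradiction (trans (sym e) (trans eq (upd≡ FR tl (col w)))) (not-free i li i<)
            (inj₂ (j< , e′)) → free≢ i j li i< lj j< (trans (sym e) (trans eq e′))
      ; busy = λ c c<k → case busy c c<k of λ where
          (inj₁ (j , l , j< , eq)) → inj₁ (j , l , m<n⇒m<1+n j< , trans (upd≢ FR tl (col w) (<⇒≢ j<)) eq)
          (inj₂ (v , v<n , l , le , eq)) → case m≤n⇒m<n∨m≡n le of λ where
            (inj₁ lt) → inj₂ (v , v<n , m<n⇒m<1+n l , lt , eq)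
            (inj₂ p≡) → inj₁ (tl , hd≤tl , ≤-refl , trans (upd≡ FR tl (col w)) (trans (cong col (+-cancelʳ-≡ n w v
              (trans w+n (trans (cong E p≡) (E∘P (v + n) (+n< v<n)))))) eq))
      ; used = λ c c<k → let v , v<n , l , eq = used c c<k in v , v<n , m<n⇒m<1+n l , eq
      ; clique = let m , h = clique in m , λ c c<k → let v , v<n , l , r = h c c<k in v , v<n , m<n⇒m<1+n l , r
      ; tl≤ = s≤s tl≤ ; k≤ = m≤n⇒m≤1+n k≤ }
      where
      end : ∀ j v → hd ≤ j → j < suc tl → v < n → P v < suc p → col v ≡ FR′ j → P (v + n) < suc p
      end j v l j< v<n lv eq with position j<
      ... | inj₂ (j< , e) = m<n⇒m<1+n (ended j v l j< v<n (started v<n lv) (trans eq e))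
      ... | inj₁ refl with v ≟ w
      ...   | yes refl = s≤s (≤-reflexive Pw)
      -- Another state of the same colour is comparable with `w`. It began before `p`, which is the
      -- end of `w`, so it must have ended before `w` began.
      ...   | no ne with chains v w v<n w<n ne (started v<n lv) w-started (trans eq (upd≡ FR tl (col w)))
      ...     | inj₁ lt = m<n⇒m<1+n (<-trans lt w-started)
      ...     | inj₂ lt = contradiction (started v<n lv) (<-asym (subst (_< P v) Pw lt))

  finished : ∀ {p hd tl k col FR} → n + n ≤ p → Partial p hd tl k col FR → Coloured k col
  finished N≤p S = record
    { bounded = λ v v<n → col< v v<n (all (<n+n v<n))
    ; chains  = λ u v u<n v<n ne → chains u v u<n v<n ne (all (<n+n u<n)) (all (<n+n v<n))
    ; onto    = λ c c<k → let v , v<n , _ , eq = used c c<k in v , v<n , eq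
    ; clique  = let m , h = clique in m , λ c c<k → let v , v<n , _ , r = h c c<k in v , v<n , r }
    where
    open Partial S
    all : ∀ {x} → x < n + n → P x < _
    all x<N = <-≤-trans (P< _ x<N) N≤p

colour-halts : ∀ {w ρ k} n → (let E = arrs ρ aE; P = arrs ρ aP) → (π : Perm (n + n) E P) →
  (lo<hi : ∀ v → v < n → P v < P (v + n)) → vars ρ vN ≡ n + n → vars ρ vn ≡ n → n + n < 2 ^ w →
  Halts w colour ρ (8 + ((n + n) * 24 + (3 + k)))
    (λ k′ σ → Colouring.Coloured n E P π lo<hi (vars σ vOut) (arrs σ aCol))
colour-halts {w} {ρ} {k} n π lo<hi N≡ n≡ N< =
  asg⨾ (zero-id w) (asg⨾ (zero-id w) (asg⨾ (zero-id w) (asg⨾ (zero-id w)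
  (while (vp ∷ vhd ∷ vft ∷ vOut ∷ vx ∷ []) (aCol ∷ aFR ∷ []) Loop
    (λ { {σ = σ} (s , eq , hd≤ , S , p) p<N → let p<2n = subst (vars σ vp <_) N≡ p<N in
      case next-left p<2n eq of λ { (s′ , refl , eq′) → body s′ eq′ hd≤ S p p<2n } })
    (λ { {σ = σ} (s , eq , _ , S , p) N≤p → k , ≤-trans (m≤n+m _ (s * 24)) p , finished
        (subst (_≤ vars σ vp) N≡ N≤p) S })
    (n + n , refl , z≤n , record
      { col< = λ _ _ () ; chains = λ _ _ _ _ _ () ; free< = λ _ _ () ; ended = λ _ _ _ () ; free≢ = λ _ _ _ ()
      ; busy = λ _ () ; used = λ _ () ; clique = 0 , λ _ () ; tl≤ = z≤n ; k≤ = z≤n } , ≤-refl)))))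
  where
  E = arrs ρ aE
  P = arrs ρ aP
  open Colouring n E P π lo<hi
  Loop : ℕ → Store → Set
  Loop l σ = ∃[ s ] (vars σ vp + s ≡ n + n × vars σ vhd ≤ vars σ vft ×
    Partial (vars σ vp) (vars σ vhd) (vars σ vft) (vars σ vOut) (arrs σ aCol) (arrs σ aFR) × s * 24 + (3 + k) ≤ l)
  body : ∀ {l σ} s → suc (vars σ vp) + s ≡ n + n → vars σ vhd ≤ vars σ vft →
    Partial (vars σ vp) (vars σ vhd) (vars σ vft) (vars σ vOut) (arrs σ aCol) (arrs σ aFR) →
    suc s * 24 + (3 + k) ≤ l → vars σ vp < n + n →
    ∃[ k′ ] 3 + k′ ≤ l × Halts w
      (vx ≔ aE [ var vp ] ⨾
       ifLess (var vx) (var vn)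
         (ifLess (var vhd) (var vft)
           (aCol [ var vx ]≔ aFR [ var vhd ] ⨾ bump vhd)
           (aCol [ var vx ]≔ var vOut ⨾ bump vOut))
         (aFR [ var vft ]≔ aCol [ var vx ⊖ var vn ] ⨾ bump vft) ⨾
       bump vp)
      (havoc (vp ∷ vhd ∷ vft ∷ vOut ∷ vx ∷ []) (aCol ∷ aFR ∷ [])
        (store ((((vars ρ [ vOut ↦ 0 ]) [ vp ↦ 0 ]) [ vhd ↦ 0 ]) [ vft ↦ 0 ]) (arrs ρ)) σ) k′ Loop
  body {l} {σ} s eq hd≤ S p p<N = 21 + (s * 24 + (3 + k)) , p , asg⨾ refl (ifl⨾
    (λ x<n → let x<n′ = subst (E (vars σ vp) <_) n≡ x<n in ifl⨾
      (λ hd<tl → assoc⨾ (wrt⨾ refl refl (asg⨾ (inc w (≤-<-trans (≤-trans (≤-trans hd<tl (Partial.tl≤ S)) (<⇒≤ p<N)) N<))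
        (asg (inc w (≤-<-trans p<N N<)) (s , eq , hd<tl , Start.reuse S p<N x<n′ hd<tl , ≤-refl)))))
      (λ tl≤hd → weaken (n≤1+n _) (assoc⨾ (wrt⨾ refl refl (asg⨾ (inc w (≤-<-trans (≤-<-trans (Partial.k≤ S) p<N) N<))
        (asg (inc w (≤-<-trans p<N N<)) (s , eq , hd≤ , Start.fresh S p<N x<n′ tl≤hd , ≤-refl)))))))
    (λ n≤x → weaken (n≤1+n _) (assoc⨾ (wrt⨾ refl
      (cong (λ m → arrs σ aCol (E (vars σ vp) ∸ m)) n≡)
      (asg⨾ (inc w (≤-<-trans (≤-<-trans (Partial.tl≤ S) p<N) N<))
      (asg (inc w (≤-<-trans p<N N<))
        (s , eq , m≤n⇒m≤1+n hd≤ , Stop.release S p<N (subst (_≤ E (vars σ vp)) n≡ n≤x) hd≤ , ≤-refl)))))))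

-- Reading the input and preparing the sort keys

aSrc aLab aTgt : ℕ
aSrc = 0
aLab = 1
aTgt = 2

labels : Cmd
labels =
  vn ≔ var vOut ⨾
  vN ≔ var vOut ⊕ var vOut ⨾
  vi ≔ lit 0 ⨾
  whileLess (var vi) (var vm)
    (vx ≔ aTgt [ var vi ] ⨾
     -- Letters are shifted by one; 0 remains the label of the source, whose keys keep their initial
     -- value.
     va ≔ aLab [ var vi ] ⊕ lit 1 ⨾
     aKEY [ var vx ⊕ lit 1 ]≔ var va ⨾
     aKEY [ var vx ⊕ var vn ⊕ lit 1 ]≔ var va ⨾
     bump vi)

addEdge : Cmd
addEdge =
  bump vj ⨾
  aKEY [ var vj ]≔ var vx ⨾
  aTG [ var vj ]≔ var va ⨾
  acnt [ var va ]≔ acnt [ var va ] ⊕ lit 1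

edges : Cmd
edges =
  vi ≔ lit 0 ⨾
  vj ≔ lit 0 ⨾
  whileLess (var vi) (var vm)
    (vx ≔ aSrc [ var vi ] ⨾
     va ≔ aTgt [ var vi ] ⨾
     addEdge ⨾
     vx ≔ var vx ⊕ var vn ⨾
     va ≔ var va ⊕ var vn ⨾
     addEdge ⨾
     bump vi)

keys : Cmd
keys =
  vi ≔ lit 0 ⨾
  whileLess (var vi) (var vn)
    (vx ≔ acs [ aC [ var vi ] ] ⨾
     va ≔ acs [ aC [ var vi ⊕ var vn ] ] ⨾
     vy ≔ var vx ⊕ var vx ⨾
     vy ≔ var vy ⊕ var vy ⨾
     vg ≔ var va ⊕ var va ⨾
     vg ≔ var vg ⊕ var vg ⨾
     ifLess (var vx) (var va)
       (aKEY [ var vi ⊕ lit 1 ]≔ var vy ⊕ lit 3 ⨾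
        aKEY [ var vi ⊕ var vn ⊕ lit 1 ]≔ var vg)
       (aKEY [ var vi ⊕ lit 1 ]≔ var vy ⊕ lit 1 ⨾
        aKEY [ var vi ⊕ var vn ⊕ lit 1 ]≔ var vy ⊕ lit 2) ⨾
     bump vi)

-- Doubling the states

-- The transitions are numbered 0, …, m - 1.  Lab v is 0 at the source and one
-- more than the letter of the incoming transitions elsewhere.
record Problem : Set₁ where
  field
    n σ m           : ℕ
    src let′ tgt Lab : ℕ → ℕ
    root            : ℕ
    W               : ℕ → ℕ → Set
    src<    : ∀ i → i < m → src i < n
    tgt<    : ∀ i → i < m → tgt i < n
    let<    : ∀ i → i < m → let′ i < σ
    Lab-tgt : ∀ i → i < m → Lab (tgt i) ≡ suc (let′ i)
    root<   : root < n
    Lab-root : Lab root ≡ 0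
    incoming : ∀ v → v < n → v ≢ root → ∃[ i ] i < m × tgt i ≡ v
    W-label : ∀ {u v} → u < n → v < n → Lab u < Lab v → W u v
    W-edge  : ∀ {i j} → i < m → j < m → Lab (tgt i) ≡ Lab (tgt j) → W (src i) (src j) → W (tgt i) (tgt j)

add-inc : ∀ w x y → suc (x + y) < 2 ^ w → wrap w (wrap w (x + y) + wrap w 1) ≡ suc (x + y)
add-inc w x y lt = trans (cong (λ z → wrap w (z + wrap w 1)) (wrap-id w (<-trans ≤-refl lt))) (inc w lt)

module DoubledEdges (problem : Problem) where
  open Problem problem

  Good : ℕ → ℕ → Set
  Good s t = (∃[ i ] i < m × s ≡ src i × t ≡ tgt i) ⊎ (∃[ i ] i < m × s ≡ src i + n × t ≡ tgt i + n)

  record Has (S T : ℕ → ℕ) (j s t : ℕ) : Set where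
    constructor edge
    field
      e   : ℕ
      e<  : e < j
      S≡  : S (suc e) ≡ s
      T≡  : T (suc e) ≡ t

  record Doubled (S T c : ℕ → ℕ) (j i : ℕ) : Set where
    field
      good  : ∀ e → e < j → Good (S (suc e)) (T (suc e))
      has   : ∀ k → k < i → Has S T j (src k) (tgt k) × Has S T j (src k + n) (tgt k + n)
      count : ∀ x → c x ≡ Σ< j (λ e → δ? (T (suc e)) x)

    count≤ : ∀ x → c x ≤ j
    count≤ x = ≤-trans (≤-reflexive (count x)) (≤-trans (Σ-mono j λ e _ → δ?≤1 (T (suc e)) x)
      (≤-reflexive (trans (Σ-const j {c = 1} λ _ _ → refl) (*-identityʳ j))))

  module _ {S T : ℕ → ℕ} {j s t : ℕ} where

    has-old : ∀ {s′ t′} → Has S T j s′ t′ → Has (S [ suc j ↦ s ]) (T [ suc j ↦ t ]) (suc j) s′ t′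
    has-old (edge e e<j a b) = edge e (m<n⇒m<1+n e<j)
      (trans (upd≢ S (suc j) s (<⇒≢ (s≤s e<j))) a) (trans (upd≢ T (suc j) t (<⇒≢ (s≤s e<j))) b)

    has-new : Has (S [ suc j ↦ s ]) (T [ suc j ↦ t ]) (suc j) s t
    has-new = edge j ≤-refl (upd≡ S (suc j) s) (upd≡ T (suc j) t)

    doubled-add : ∀ {c i} → Good s t → Doubled S T c j i →
      Doubled (S [ suc j ↦ s ]) (T [ suc j ↦ t ]) (c [ t ↦ suc (c t) ]) (suc j) i
    doubled-add {c} {i} ok D = record
      { good = λ e e< → case m≤n⇒m<n∨m≡n (≤-pred e<) of λ where
          (inj₂ refl) → subst₂ Good (sym (upd≡ S (suc j) s)) (sym (upd≡ T (suc j) t)) ok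
          (inj₁ lt) → subst₂ Good (sym (upd≢ S (suc j) s (<⇒≢ (s≤s lt))))
              (sym (upd≢ T (suc j) t (<⇒≢ (s≤s lt)))) (good e lt)
      ; has = λ k k<i → has-old (proj₁ (has k k<i)) , has-old (proj₂ (has k k<i))
      ; count = λ x → trans (upd-elim {f = c} (λ x y → y ≡ δ? t x + c x)
            (cong (_+ c t) (sym (δ?-≡ {t} refl))) x λ x≢t → cong (_+ c x) (sym (δ?-≢ (x≢t ∘ sym))))
          (cong₂ _+_ (cong (λ y → δ? y x) (sym (upd≡ T (suc j) t)))
            (trans (count x) (Σ-cong j λ e e<j → cong (λ y → δ? y x) (sym (upd≢ T (suc j) t (<⇒≢ (s≤s e<j)))))))
      }
      where open Doubled D

  record StateRanking (rank : ℕ → ℕ) : Set where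
    field
      rank-≤ : ∀ u v → u < n → v < n → rank (u + n) ≤ rank v → Lab u < Lab v ⊎
               (Lab u ≡ Lab v × (∀ i j → i < m → j < m → tgt i ≡ u → tgt j ≡ v → rank (src i + n) ≤ rank (src j)))
      rank-< : ∀ u v → u < n → v < n → rank (u + n) < rank v → Lab u < Lab v ⊎
               (Lab u ≡ Lab v × Lab u ≢ 0 ×
                (∀ i j → i < m → j < m → tgt i ≡ u → tgt j ≡ v → rank (src i + n) < rank (src j)))
      rank-W : ∀ u v → u < n → v < n → rank u < rank (v + n) → W u v

module Preparation (problem : Problem) (w Z : ℕ) (Z< : Z < 2 ^ w) where
  open Problem problem
  open DoubledEdges problem

  module _ (n≤ : n + n < Z) (σ< : σ < Z) (m≤ : m + m ≤ Z) where

    private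
      +n<Z : ∀ {v} → v < n → suc (v + n) ≤ Z
      +n<Z v<n = ≤-trans (+-monoˡ-< n v<n) (<⇒≤ n≤)
      <Z : ∀ {v} → v < n → suc v ≤ Z
      <Z v<n = ≤-trans v<n (≤-trans (m≤m+n n n) (<⇒≤ n≤))
      m≤Z : m ≤ Z
      m≤Z = ≤-trans (m≤m+n m m) m≤
      fits : ∀ {x} → x ≤ Z → x < 2 ^ w
      fits le = ≤-<-trans le Z<

    record Filled (K : ℕ → ℕ) (i : ℕ) : Set where
      constructor filled
      field
        targets : ∀ j → j < i → K (suc (tgt j)) ≡ Lab (tgt j) × K (suc (tgt j + n)) ≡ Lab (tgt j)
        root₁   : K (suc root) ≡ 0
        root₂   : K (suc (root + n)) ≡ 0

    labels-halts : ∀ {ρ k} → vars ρ vOut ≡ n → vars ρ vm ≡ m →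
      (∀ i → i < m → arrs ρ aTgt i ≡ tgt i) → (∀ i → i < m → arrs ρ aLab i ≡ let′ i) → (∀ x → arrs ρ aKEY x ≡ 0) →
      Halts w labels ρ (8 + (m * 27 + (3 + k))) (λ k′ τ → k′ ≡ k × vars τ vn ≡ n × vars τ vN ≡ n + n ×
        (∀ v → v < n → arrs τ aKEY (suc v) ≡ Lab v × arrs τ aKEY (suc (v + n)) ≡ Lab v))
    labels-halts {ρ} {k} n≡ m≡ T≡ L≡ zero-key =
      asg⨾ n≡ (asg⨾ (trans (cong₂ (λ a b → wrap w (a + b)) n≡ n≡) (wrap-id w (fits (<⇒≤ n≤)))) (asg⨾ (zero-id w)
      (while (vi ∷ vx ∷ va ∷ []) (aKEY ∷ []) Loop
        (λ { {σ = τ} (r , eq , K , p) i<m → let i<m′ = subst (vars τ vi <_) m≡ i<m in case next-left i<m′ eq of λ { (r′ , refl , eq′) →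
          24 + (r′ * 27 + (3 + k)) , p ,
          asg⨾ (T≡ _ i<m′) (asg⨾ (trans (inc w (fits (≤-trans (≤-reflexive (cong suc (L≡ _ i<m′))) (≤-trans (let< _ i<m′) (<⇒≤ σ<)))))
              (cong suc (L≡ _ i<m′)))
          (wrt⨾ (inc w (fits (<Z (tgt< _ i<m′)))) refl
          (wrt⨾ (add-inc w (tgt (vars τ vi)) n (fits (+n<Z (tgt< _ i<m′)))) refl
          (asg (inc w (fits (≤-trans i<m′ m≤Z)))
            (r′ , eq′ , step i<m′ K , ≤-refl))))) } })
        (λ { {σ = τ} (r , eq , K , p) m≤i → k , ≤-trans (m≤n+m _ (r * 27)) p , refl , refl , refl ,
          λ v v<n → finish (subst (_≤ vars τ vi) m≡ m≤i) K v v<n })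
        (m , refl , filled (λ _ ()) (zero-key _) (zero-key _) , ≤-refl))))
      where
      Loop : ℕ → Store → Set
      Loop l τ = ∃[ r ] (vars τ vi + r ≡ m × Filled (arrs τ aKEY) (vars τ vi) × r * 27 + (3 + k) ≤ l)
      step : ∀ {K i} → i < m → Filled K i →
        Filled ((K [ suc (tgt i) ↦ suc (let′ i) ]) [ suc (tgt i + n) ↦ suc (let′ i) ]) (suc i)
      step {K} {i} i<m (filled done r₁ r₂) = filled done′ (away-lo root< root≢ r₁) (away-hi root≢ r₂)
        where
        t = tgt i
        a = suc (let′ i)
        K₁ = K [ suc t ↦ a ]
        K₂ = K₁ [ suc (t + n) ↦ a ]
        -- Targets have positive labels, so the zero keys of the root are never overwritten.
        root≢ : root ≢ t
        root≢ eq = contradiction (trans (sym Lab-root) (trans (cong Lab eq) (Lab-tgt i i<m))) λ ()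
        lo≢hi : ∀ {u v} → u < n → suc u ≢ suc (v + n)
        lo≢hi {u} {v} u<n eq = <⇒≱ u<n (subst (n ≤_) (sym (suc-injective eq)) (m≤n+m n v))
        away-lo : ∀ {u b} → u < n → u ≢ t → K (suc u) ≡ b → K₂ (suc u) ≡ b
        away-lo u<n ne e = trans (upd≢ K₁ _ a (lo≢hi u<n)) (trans (upd≢ K _ a (ne ∘ suc-injective)) e)
        away-hi : ∀ {u b} → u ≢ t → K (suc (u + n)) ≡ b → K₂ (suc (u + n)) ≡ b
        away-hi {u} ne e = trans (upd≢ K₁ _ a (ne ∘ +-cancelʳ-≡ n u t ∘ suc-injective))
          (trans (upd≢ K _ a (lo≢hi (tgt< i i<m) ∘ sym)) e)
        done′ : ∀ j → j < suc i → K₂ (suc (tgt j)) ≡ Lab (tgt j) × K₂ (suc (tgt j + n)) ≡ Lab (tgt j)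
        done′ j j< with tgt j ≟ t
        ... | yes eq rewrite eq = trans (upd≢ K₁ _ a (lo≢hi (tgt< i i<m))) (trans (upd≡ K _ a) (sym (Lab-tgt i i<m))) ,
          trans (upd≡ K₁ (suc (t + n)) a) (sym (Lab-tgt i i<m))
        ... | no ne with m≤n⇒m<n∨m≡n (≤-pred j<)
        ...   | inj₂ refl = contradiction refl ne
        ...   | inj₁ lt = away-lo (tgt< j (<-trans lt i<m)) ne (proj₁ (done j lt)) , away-hi ne (proj₂ (done j lt))
      finish : ∀ {K i} → m ≤ i → Filled K i → ∀ v → v < n → K (suc v) ≡ Lab v × K (suc (v + n)) ≡ Lab v
      finish m≤i (filled done r₁ r₂) v v<n with v ≟ root
      ... | yes refl = trans r₁ (sym Lab-root) , trans r₂ (sym Lab-root)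
      ... | no ne with incoming v v<n ne
      ...   | i , i<m , refl = done i (<-≤-trans i<m m≤i)

    addEdge-halts : ∀ {ρ k s t} → vars ρ vx ≡ s → vars ρ va ≡ t → suc (vars ρ vj) ≤ Z → arrs ρ acnt t ≤ vars ρ vj →
      Halts w addEdge ρ (16 + k) (λ k′ τ → k′ ≡ k × vars τ vj ≡ suc (vars ρ vj) ×
        arrs τ aKEY ≡ arrs ρ aKEY [ suc (vars ρ vj) ↦ s ] × arrs τ aTG ≡ arrs ρ aTG [ suc (vars ρ vj) ↦ t ] ×
        arrs τ acnt ≡ arrs ρ acnt [ t ↦ suc (arrs ρ acnt t) ])
    addEdge-halts refl refl j< c≤ = asg⨾ (inc w (fits j<)) (wrt⨾ refl refl (wrt⨾ refl refl
      (wrt refl (inc w (fits (≤-trans (s≤s c≤) j<))) (refl , refl , refl , refl , refl))))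

    edges-halts : ∀ {ρ k} → vars ρ vn ≡ n → vars ρ vm ≡ m →
      (∀ i → i < m → arrs ρ aSrc i ≡ src i) → (∀ i → i < m → arrs ρ aTgt i ≡ tgt i) → (∀ x → arrs ρ acnt x ≡ 0) →
      Halts w edges ρ (4 + (m * 53 + (3 + k))) (λ k′ τ → k′ ≡ k × vars τ vj ≡ m + m ×
        Doubled (arrs τ aKEY) (arrs τ aTG) (arrs τ acnt) (m + m) m)
    edges-halts {ρ} {k} n≡ m≡ S≡ T≡ zero-cnt = asg⨾ (zero-id w) (asg⨾ (zero-id w)
      (while (vi ∷ vj ∷ vx ∷ va ∷ []) (aKEY ∷ aTG ∷ acnt ∷ []) Loop
        (λ { {σ = τ} (r , eq , j≡ , D , p) i<m → let i<m′ = subst (vars τ vi <_) m≡ i<m in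
          case next-left i<m′ eq of λ { (r′ , refl , eq′) → body r′ eq′ j≡ D p i<m′ } })
        (λ { {σ = τ} (r , eq , j≡ , D , p) m≤i →
          let i≡m = ≤-antisym (m+n≤o⇒m≤o _ (≤-reflexive eq)) (subst (_≤ vars τ vi) m≡ m≤i) in
          k , ≤-trans (m≤n+m _ (r * 53)) p , refl , trans j≡ (cong₂ _+_ i≡m i≡m) ,
          subst₂ (Doubled (arrs τ aKEY) (arrs τ aTG) (arrs τ acnt)) (trans j≡ (cong₂ _+_ i≡m i≡m)) i≡m D })
        (m , refl , refl , record { good = λ _ () ; has = λ _ () ; count = zero-cnt } , ≤-refl)))
      where
      Loop : ℕ → Store → Set
      Loop l τ = ∃[ r ] (vars τ vi + r ≡ m × vars τ vj ≡ vars τ vi + vars τ vi ×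
        Doubled (arrs τ aKEY) (arrs τ aTG) (arrs τ acnt) (vars τ vj) (vars τ vi) × r * 53 + (3 + k) ≤ l)
      body : ∀ {l τ} r → suc (vars τ vi) + r ≡ m → vars τ vj ≡ vars τ vi + vars τ vi →
        Doubled (arrs τ aKEY) (arrs τ aTG) (arrs τ acnt) (vars τ vj) (vars τ vi) → suc r * 53 + (3 + k) ≤ l →
        vars τ vi < m →
        ∃[ k′ ] 3 + k′ ≤ l × Halts w
          (vx ≔ aSrc [ var vi ] ⨾ va ≔ aTgt [ var vi ] ⨾ addEdge ⨾ vx ≔ var vx ⊕ var vn ⨾ va ≔ var va ⊕ var vn ⨾
           addEdge ⨾ bump vi)
          (havoc (vi ∷ vj ∷ vx ∷ va ∷ []) (aKEY ∷ aTG ∷ acnt ∷ [])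
            (store ((vars ρ [ vi ↦ 0 ]) [ vj ↦ 0 ]) (arrs ρ)) τ) k′ Loop
      body {l} {τ} r eq j≡ D p i<m = 50 + (r * 53 + (3 + k)) , p ,
        asg⨾ (S≡ i i<m) (asg⨾ (T≡ i i<m)
        (call⨾ (vj ∷ []) (aKEY ∷ aTG ∷ acnt ∷ []) (addEdge-halts refl refl (<⇒≤ j+2≤) (Doubled.count≤ D (tgt i)))
        λ { {σ = τ₁} (refl , j₁ , K₁ , T₁ , c₁) →
        let D₁ = subst₄ (sym K₁) (sym T₁) (sym c₁) (sym j₁) (doubled-add (inj₁ (i , i<m , refl , refl)) D) in
        asg⨾ (trans (cong (λ y → wrap w (src i + y)) n≡) (wrap-id w (fits (<⇒≤ (+n<Z (src< i i<m))))))
        (asg⨾ (trans (cong (λ y → wrap w (tgt i + y)) n≡) (wrap-id w (fits (<⇒≤ (+n<Z (tgt< i i<m))))))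
        (call⨾ (vj ∷ []) (aKEY ∷ aTG ∷ acnt ∷ [])
          (addEdge-halts refl refl (subst (λ j → suc j ≤ Z) (sym j₁) j+2≤) (Doubled.count≤ D₁ (tgt i + n)))
        λ { {σ = τ₂} (refl , j₂ , K₂ , T₂ , c₂) →
        let D₂ = subst₄ (sym K₂) (sym T₂) (sym c₂) (sym j₂) (doubled-add (inj₂ (i , i<m , refl , refl)) D₁)
            h₁ = subst₃ (sym K₁) (sym T₁) (sym j₁) has-new in
        asg (inc w (fits (≤-trans i<m m≤Z)))
          (r , eq , trans j₂ (trans (cong suc (trans j₁ (cong suc j≡))) (cong suc (sym (+-suc i i)))) ,
           record { good = Doubled.good D₂ ; count = Doubled.count D₂
                  ; has = λ k k< → case m≤n⇒m<n∨m≡n (≤-pred k<) of λ where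
                      (inj₁ lt) → Doubled.has D₂ k lt
                      (inj₂ refl) → subst₃ (sym K₂) (sym T₂) (sym j₂) (has-old h₁) ,
                        subst₃ (sym K₂) (sym T₂) (sym j₂) has-new } , ≤-refl) })) }))
        where
        i = vars τ vi
        subst₄ : ∀ {S S′ T T′ c c′ j j′} → S ≡ S′ → T ≡ T′ → c ≡ c′ → j ≡ j′ → Doubled S T c j i → Doubled S′ T′ c′ j′ i
        subst₄ refl refl refl refl d = d
        subst₃ : ∀ {S S′ T T′ j j′ s t} → S ≡ S′ → T ≡ T′ → j ≡ j′ → Has S T j s t → Has S′ T′ j′ s t
        subst₃ refl refl refl h = h
        j+2≤ : suc (suc (vars τ vj)) ≤ Z
        j+2≤ = ≤-trans (≤-reflexive (trans (cong (suc ∘ suc) j≡) (cong suc (sym (+-suc i i)))))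
          (≤-trans (+-mono-≤ i<m i<m) m≤)

-- Four times the rank, which leaves three values between consecutive ranks for the offsets of
-- `KeyOf`. It is written with additions, as in the program.
quad : ℕ → ℕ
quad r = (r + r) + (r + r)

quad-mono : ∀ {r r′} → r ≤ r′ → quad r ≤ quad r′
quad-mono le = +-mono-≤ (+-mono-≤ le le) (+-mono-≤ le le)

quad-< : ∀ {r r′} → r < r′ → quad r + 4 ≤ quad r′
quad-< {r} {r′} lt = ≤-trans (≤-reflexive (arith r)) (quad-mono lt)
  where
  arith : ∀ r → (r + r) + (r + r) + 4 ≡ (suc r + suc r) + (suc r + suc r)
  arith r = solve (r ∷ [])

-- At equal ranks the ends of proper intervals come first, then a point, then
-- the starts of proper intervals.
data KeyOf (r r′ kl kh : ℕ) : Set where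
  proper : r < r′ → kl ≡ quad r + 3 → kh ≡ quad r′ → KeyOf r r′ kl kh
  point  : r′ ≤ r → kl ≡ quad r + 1 → kh ≡ quad r + 2 → KeyOf r r′ kl kh

keys-halts : ∀ {w ρ k} n Z → Z < 2 ^ w → (let rank = arrs ρ acs ∘ arrs ρ aC) → vars ρ vn ≡ n → quad (n + n) ≤ Z → 3 ≤ Z →
  (∀ x → x < n + n → rank x < n + n) →
  Halts w keys ρ (2 + (n * 52 + (3 + k))) (λ k′ τ → k′ ≡ k ×
    (∀ v → v < n → KeyOf (rank v) (rank (v + n)) (arrs τ aKEY (suc v)) (arrs τ aKEY (suc (v + n)))))
keys-halts {w} {ρ} {k} n Z Z< n≡ quad≤ 3≤Z rank< = asg⨾ (zero-id w)
  (while (vi ∷ vx ∷ va ∷ vy ∷ vg ∷ []) (aKEY ∷ []) Loop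
    (λ { {σ = τ} (r , eq , K , p) i<n → let i<n′ = subst (vars τ vi <_) n≡ i<n in
      case next-left i<n′ eq of λ { (r′ , refl , eq′) → body r′ eq′ K p i<n′ } })
    (λ { {σ = τ} (r , eq , K , p) n≤i → k , ≤-trans (m≤n+m _ (r * 52)) p , refl ,
      λ v v<n → K v (<-≤-trans v<n (subst (_≤ vars τ vi) n≡ n≤i)) })
    (n , refl , (λ _ ()) , ≤-refl))
  where
  rank = arrs ρ acs ∘ arrs ρ aC
  fits : ∀ {x} → x ≤ Z → x < 2 ^ w
  fits le = ≤-<-trans le Z<
  Filled : (ℕ → ℕ) → ℕ → Set
  Filled K i = ∀ v → v < i → KeyOf (rank v) (rank (v + n)) (K (suc v)) (K (suc (v + n)))
  Loop : ℕ → Store → Set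
  Loop l τ = ∃[ r ] (vars τ vi + r ≡ n × Filled (arrs τ aKEY) (vars τ vi) × r * 52 + (3 + k) ≤ l)
  fill : ∀ {K i a b} → i < n → Filled K i → KeyOf (rank i) (rank (i + n)) a b →
    Filled ((K [ suc i ↦ a ]) [ suc (i + n) ↦ b ]) (suc i)
  fill {K} {i} {a} {b} i<n F ok v v< with m≤n⇒m<n∨m≡n (≤-pred v<)
  ... | inj₂ refl = subst₂ (KeyOf (rank v) (rank (v + n)))
    (sym (trans (upd≢ (K [ suc v ↦ a ]) (suc (v + n)) b (lo≢hi v i<n)) (upd≡ K (suc v) a)))
    (sym (upd≡ (K [ suc v ↦ a ]) (suc (v + n)) b)) ok
    where
    lo≢hi : ∀ {u} v → u < n → suc u ≢ suc (v + n)
    lo≢hi v u<n eq = <⇒≱ u<n (subst (n ≤_) (sym (suc-injective eq)) (m≤n+m n v))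
  ... | inj₁ lt = subst₂ (KeyOf (rank v) (rank (v + n)))
    (sym (trans (upd≢ (K [ suc i ↦ a ]) (suc (i + n)) b (lo≢hi i (<-trans lt i<n))) (upd≢ K (suc i) a (<⇒≢ (s≤s lt)))))
    (sym (trans (upd≢ (K [ suc i ↦ a ]) (suc (i + n)) b (<⇒≢ (s≤s (+-monoˡ-< n lt))))
      (upd≢ K (suc i) a (lo≢hi v i<n ∘ sym)))) (F v lt)
    where
    lo≢hi : ∀ {u} v → u < n → suc u ≢ suc (v + n)
    lo≢hi v u<n eq = <⇒≱ u<n (subst (n ≤_) (sym (suc-injective eq)) (m≤n+m n v))
  body : ∀ {l τ} r → suc (vars τ vi) + r ≡ n → Filled (arrs τ aKEY) (vars τ vi) → suc r * 52 + (3 + k) ≤ l →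
      vars τ vi < n →
    ∃[ k′ ] 3 + k′ ≤ l × Halts w
      (vx ≔ acs [ aC [ var vi ] ] ⨾ va ≔ acs [ aC [ var vi ⊕ var vn ] ] ⨾
       vy ≔ var vx ⊕ var vx ⨾ vy ≔ var vy ⊕ var vy ⨾ vg ≔ var va ⊕ var va ⨾ vg ≔ var vg ⊕ var vg ⨾
       ifLess (var vx) (var va)
         (aKEY [ var vi ⊕ lit 1 ]≔ var vy ⊕ lit 3 ⨾ aKEY [ var vi ⊕ var vn ⊕ lit 1 ]≔ var vg)
         (aKEY [ var vi ⊕ lit 1 ]≔ var vy ⊕ lit 1 ⨾ aKEY [ var vi ⊕ var vn ⊕ lit 1 ]≔ var vy ⊕ lit 2) ⨾
       bump vi)
      (havoc (vi ∷ vx ∷ va ∷ vy ∷ vg ∷ []) (aKEY ∷ []) (store (vars ρ [ vi ↦ 0 ]) (arrs ρ)) τ) k′ Loop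
  body {l} {τ} r eq F p i<n = 49 + (r * 52 + (3 + k)) , p ,
    asg⨾ refl (asg⨾ (cong rank i+n≡)
    (asg⨾ (wrap-id w (fits (≤-trans (m≤m+n (R + R) (R + R)) (<⇒≤ qR)))) (asg⨾ (wrap-id w (fits (<⇒≤ qR)))
    (asg⨾ (wrap-id w (fits (≤-trans (m≤m+n (R′ + R′) (R′ + R′)) (<⇒≤ qR′)))) (asg⨾ (wrap-id w (fits (<⇒≤ qR′)))
    (ifl⨾
      (λ lt → weaken (m≤n+m _ 2) (assoc⨾ (wrt⨾ (inc w (fits i<Z)) (plus 3 (s≤s (s≤s (s≤s z≤n))) qR)
        (wrt⨾ (trans (cong (λ m → wrap w (wrap w (i + m) + wrap w 1)) n≡) (add-inc w i n (fits i+n<Z))) refl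
        (asg (inc w (fits i<Z)) (r , eq , fill {K = arrs τ aKEY} i<n F (proper lt refl refl) , ≤-refl))))))
      (λ ge → assoc⨾ (wrt⨾ (inc w (fits i<Z)) (plus 1 (s≤s z≤n) qR)
        (wrt⨾ (trans (cong (λ m → wrap w (wrap w (i + m) + wrap w 1)) n≡) (add-inc w i n (fits i+n<Z)))
          (plus 2 (s≤s (s≤s z≤n)) qR)
        (asg (inc w (fits i<Z)) (r , eq , fill {K = arrs τ aKEY} i<n F (point ge refl refl) , ≤-refl)))))))))))
    where
    i = vars τ vi
    R = rank i
    R′ = rank (i + n)
    i+n<N : i + n < n + n
    i+n<N = +-monoˡ-< n i<n
    N≤Z : n + n ≤ Z
    N≤Z = ≤-trans (m≤m+n (n + n) _) (≤-trans (m≤m+n _ _) quad≤)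
    i+n<Z : suc (i + n) ≤ Z
    i+n<Z = ≤-trans i+n<N N≤Z
    i<Z : suc i ≤ Z
    i<Z = ≤-trans (s≤s (m≤m+n i n)) i+n<Z
    i+n≡ : wrap w (i + vars ρ vn) ≡ i + n
    i+n≡ = trans (cong (λ m → wrap w (i + m)) n≡) (wrap-id w (fits (<⇒≤ i+n<Z)))
    small : ∀ {r} → r < n + n → quad r + 3 < Z
    small {r} lt = ≤-trans (≤-reflexive (sym (+-suc (quad r) 3))) (≤-trans (quad-< lt) quad≤)
    qR : quad R < Z
    qR = ≤-<-trans (m≤m+n (quad R) 3) (small (rank< i (<-≤-trans i<n (m≤m+n n n))))
    qR′ : quad R′ < Z
    qR′ = ≤-<-trans (m≤m+n (quad R′) 3) (small (rank< (i + n) i+n<N))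
    plus : ∀ b → b ≤ 3 → quad R < Z → wrap w (quad R + wrap w b) ≡ quad R + b
    plus b b≤3 _ = trans (cong (λ b → wrap w (quad R + b)) (wrap-id w (fits (≤-trans b≤3 3≤Z))))
      (wrap-id w (fits (≤-trans (+-monoʳ-≤ (quad R) b≤3) (<⇒≤ (small (rank< i (<-≤-trans i<n (m≤m+n n n))))))))

module DoubledGraph (problem : Problem) (K₁ S T c : ℕ → ℕ)
  (labels≡ : ∀ v → v < Problem.n problem → K₁ (suc v) ≡ Problem.Lab problem v ×
      K₁ (suc (v + Problem.n problem)) ≡ Problem.Lab problem v)
  (D : DoubledEdges.Doubled problem S T c (Problem.m problem + Problem.m problem) (Problem.m problem)) where
  open Problem problem
  open DoubledEdges problem
  open Doubled D

  state : ∀ x → x < n + n → x < n ⊎ (x ∸ n < n × x ∸ n + n ≡ x)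
  state x x<N with <-or-≥ x n
  ... | inj₁ lt = inj₁ lt
  ... | inj₂ ge = inj₂ (+-cancelʳ-< n _ n (subst (_< n + n) (sym (m∸n+n≡m ge)) x<N) , m∸n+n≡m ge)

  lab-lo : ∀ {v} → v < n → K₁ (suc v) ≡ Lab v
  lab-lo v<n = proj₁ (labels≡ _ v<n)

  lab-hi : ∀ {v} → v < n → K₁ (suc (v + n)) ≡ Lab v
  lab-hi v<n = proj₂ (labels≡ _ v<n)

  high : ∀ {u} → ¬ u + n < n
  high {u} lt = ≤⇒≯ (m≤n+m n u) lt

  graph : Graph
  graph = record
    { n = n ; N = n + n ; M = m + m ; lab = K₁ ∘ suc ; src = S ∘ suc ; tgt = T ∘ suc ; W = λ x y → W x (y ∸ n)
    ; src< = λ e e< → case good e e< of λ where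
        (inj₁ (i , i<m , eq , _)) → subst (_< n + n) (sym eq) (<-≤-trans (src< i i<m) (m≤m+n n n))
        (inj₂ (i , i<m , eq , _)) → subst (_< n + n) (sym eq) (+-monoˡ-< n (src< i i<m))
    ; tgt< = λ e e< → case good e e< of λ where
        (inj₁ (i , i<m , _ , eq)) → subst (_< n + n) (sym eq) (<-≤-trans (tgt< i i<m) (m≤m+n n n))
        (inj₂ (i , i<m , _ , eq)) → subst (_< n + n) (sym eq) (+-monoˡ-< n (tgt< i i<m))
    ; lo-lo = λ e e< lt → case good e e< of λ where
        (inj₁ (i , i<m , eq , _)) → subst (_< n) (sym eq) (src< i i<m)
        (inj₂ (i , i<m , _ , eq)) → contradiction (subst (_< n) eq lt) high
    ; hi-hi = λ e e< le → case good e e< of λ where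
        (inj₁ (i , i<m , _ , eq)) → contradiction (tgt< i i<m) (≤⇒≯ (subst (n ≤_) eq le))
        (inj₂ (i , i<m , eq , _)) → subst (n ≤_) (sym eq) (m≤n+m n (src i))
    ; lab≢0 = λ e e< l0 → case good e e< of λ where
        (inj₁ (i , i<m , _ , eq)) → 0≢suc (trans (sym l0)
            (trans (cong (K₁ ∘ suc) eq) (trans (lab-lo (tgt< i i<m)) (Lab-tgt i i<m))))
        (inj₂ (i , i<m , _ , eq)) → 0≢suc (trans (sym l0)
            (trans (cong (K₁ ∘ suc) eq) (trans (lab-hi (tgt< i i<m)) (Lab-tgt i i<m))))
    ; pred = pred
    ; W-label = λ {x} {y} x<n n≤y y<N lt → case state y y<N of λ where
        (inj₁ y<n) → contradiction y<n (≤⇒≯ n≤y)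
        (inj₂ (v<n , eq)) → W-label x<n v<n (subst₂ _<_ (lab-lo x<n) (trans (cong (K₁ ∘ suc) (sym eq)) (lab-hi v<n)) lt)
    ; W-edge = λ {e} {e′} e< e′< lo hi leq wit → edge-step (good e e<) (good e′ e′<) lo hi leq wit }
    where
    0≢suc : ∀ {x} → 0 ≢ suc x
    0≢suc ()
    pred : ∀ x → x < n + n → K₁ (suc x) ≢ 0 → ∃[ e ] e < m + m × T (suc e) ≡ x
    pred x x<N ne with state x x<N
    ... | inj₁ x<n with incoming x x<n (λ { refl → ne (trans (lab-lo x<n) Lab-root) })
    ...   | i , i<m , refl = let edge e e< _ t = proj₁ (has i i<m) in e , e< , t
    pred x x<N ne | inj₂ (v<n , eq)
      with incoming (x ∸ n) v<n (λ v≡ → ne (trans (cong (K₁ ∘ suc) (sym eq))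
          (trans (lab-hi v<n) (trans (cong Lab v≡) Lab-root))))
    ... | i , i<m , t≡ = let edge e e< _ t = proj₂ (has i i<m) in e , e< , trans t (trans (cong (_+ n) t≡) eq)
    edge-step : ∀ {s t s′ t′} → Good s t → Good s′ t′ → t < n → n ≤ t′ → K₁ (suc t) ≡ K₁ (suc t′) →
      W s (s′ ∸ n) → W t (t′ ∸ n)
    edge-step (inj₂ (_ , _ , _ , refl)) _ lo _ _ _ = contradiction lo high
    edge-step (inj₁ _) (inj₁ (i , i<m , _ , refl)) _ hi _ _ = contradiction (tgt< i i<m) (≤⇒≯ hi)
    edge-step (inj₁ (i , i<m , refl , refl)) (inj₂ (j , j<m , refl , refl)) _ _ leq wit
      rewrite m+n∸n≡m (src j) n | m+n∸n≡m (tgt j) n =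
      W-edge i<m j<m (trans (sym (lab-lo (tgt< i i<m))) (trans leq (lab-hi (tgt< j j<m)))) wit

  state-ranking : ∀ {rank} → Refinement.Ranking graph rank → StateRanking rank
  state-ranking {rank} R = record
    { rank-≤ = λ u v u<n v<n le → case rank-≤ (u + n) v (m≤n+m n u) (+-monoˡ-< n u<n) v<n le of λ where
        (inj₁ lt) → inj₁ (subst₂ _<_ (lab-hi u<n) (lab-lo v<n) lt)
        (inj₂ (eq , h)) → inj₂ (trans (sym (lab-hi u<n)) (trans eq (lab-lo v<n)) , λ i j i<m j<m ti tj →
          let edge e e< s t = proj₂ (has i i<m); edge e′ e′< s′ t′ = proj₁ (has j j<m) in
          subst₂ (λ a b → rank a ≤ rank b) s s′ (h e e′ e< e′< (trans t (cong (_+ n) ti)) (trans t′ tj)))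
    ; rank-< = λ u v u<n v<n lt → case rank-< (u + n) v (m≤n+m n u) (+-monoˡ-< n u<n) v<n lt of λ where
        (inj₁ lt) → inj₁ (subst₂ _<_ (lab-hi u<n) (lab-lo v<n) lt)
        (inj₂ (eq , ne , h)) → inj₂ (trans (sym (lab-hi u<n)) (trans eq (lab-lo v<n)) ,
            (ne ∘ trans (lab-hi u<n)) , λ i j i<m j<m ti tj →
          let edge e e< s t = proj₂ (has i i<m); edge e′ e′< s′ t′ = proj₁ (has j j<m) in
          subst₂ (λ a b → rank a < rank b) s s′ (h e e′ e< e′< (trans t (cong (_+ n) ti)) (trans t′ tj)))
    ; rank-W = λ u v u<n v<n lt → subst (W u) (m+n∸n≡m v n)
        (rank-W u (v + n) u<n (m≤n+m n v) (+-monoˡ-< n v<n) lt) }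
    where open Refinement.Ranking R

-- The whole program and its budget

algorithm : Cmd
algorithm =
  labels ⨾
  vCnt ≔ var vN ⨾
  vK ≔ var vΣ ⊕ lit 1 ⨾
  chain ⨾
  spread ⨾
  edges ⨾
  -- Now the items are the edges and the keys their sources; the chains alone, without `spread`, are
  -- the adjacency lists.
  vCnt ≔ var vj ⨾
  vK ≔ var vN ⨾
  chain ⨾
  vnf ≔ var vΣ ⊕ lit 1 ⨾
  -- All blocks count as new, so the first `emits` queues the starts of the nonempty label classes.
  vr ≔ lit 0 ⨾
  vnc ≔ lit 1 ⨾
  vq ≔ lit 0 ⨾
  vnb ≔ lit 0 ⨾
  -- Together with the zeros in `aC` and `acs` this describes the single compound block of all
  -- nodes.
  ace [ lit 0 ]≔ var vN ⨾
  emits ⨾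
  refine ⨾
  keys ⨾
  vCnt ≔ var vN ⨾
  vK ≔ (var vN ⊕ var vN) ⊕ (var vN ⊕ var vN) ⨾
  chain ⨾
  spread ⨾
  colour

quad-≤ : ∀ {a b i j} → j < 4 → quad a + i ≤ quad b + j → a ≤ b
quad-≤ {a} {b} {i} {j} j<4 le with <-or-≥ b a
... | inj₂ a≤b = a≤b
... | inj₁ b<a = contradiction (≤-trans (+-monoʳ-< (quad b) j<4) (≤-trans (quad-< b<a) (m≤m+n (quad a) i))) (≤⇒≯ le)

quad-cancel-< : ∀ {a b i} → quad a + suc i ≤ quad b → a < b
quad-cancel-< {a} {b} {i} le with <-or-≥ a b
... | inj₁ l = l
... | inj₂ g = contradiction (≤-trans (≤-trans (≤-reflexive (sym (+-suc (quad a) i))) le) (quad-mono g))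
    (m+n≮m (quad a) i)

-- `before` is what makes colour classes chains, `crossing` what makes overlapping intervals
-- incomparable. The alternatives in `crossing` are the ways in which the keys can put a start
-- before an end; the last one is a tie of two points.
record Solution (problem : Problem) (k : ℕ) (col : ℕ → ℕ) : Set where
  open Problem problem
  field
    rank    : ℕ → ℕ
    ranks   : DoubledEdges.StateRanking problem rank
    {E P}   : ℕ → ℕ
    perm    : Perm (n + n) E P
    lo<hi   : ∀ v → v < n → P v < P (v + n)
    before  : ∀ u v → u < n → v < n → P (u + n) < P v → rank (u + n) ≤ rank v
    crossing : ∀ u v → u < n → v < n → P v < P (u + n) → rank v < rank (u + n) ⊎
              (rank (u + n) ≤ rank u × (rank v < rank u ⊎ (rank (v + n) ≤ rank v × rank v ≡ rank u)))
    coloured : Colouring.Coloured n E P perm lo<hi k col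

module Assembly {n K : ℕ} {key E P F fs fe rank : ℕ → ℕ} (S : Sorted (n + n) K key E P F fs fe)
  (keyof : ∀ v → v < n → KeyOf (rank v) (rank (v + n)) (key (suc v)) (key (suc (v + n)))) where
  open Sorted S
  open Perm perm

  private
    <n+n : ∀ {v} → v < n → v < n + n
    <n+n v<n = <-≤-trans v<n (m≤m+n n n)

  key-mono : ∀ {x y} → x < n + n → y < n + n → P x ≤ P y → key (suc x) ≤ key (suc y)
  key-mono {x} {y} x< y< le = subst₂ _≤_ (F-key x<) (F-key y<) (mono (P x) (P y) le (P< y y<))
    where
    F-key : ∀ {x} → x < n + n → F (E (P x)) ≡ key (suc x)
    F-key {x} x< = trans (cong F (E∘P x x<)) (F≡key x x<)

  -- A point has its start and end separated by the offsets 1 and 2. In a proper interval the ranks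
  -- separate them, since the offset 3 is less than the step 4 between ranks.
  lo<hi : ∀ v → v < n → P v < P (v + n)
  lo<hi v v<n with <-or-≥ (P v) (P (v + n))
  ... | inj₁ lt = lt
  ... | inj₂ ge with key-mono (+-monoˡ-< n v<n) (<n+n v<n) ge | keyof v v<n
  ...   | le | proper lt kl kh = contradiction (≤-trans (quad-< lt) (subst₂ _≤_ kh kl le))
      (<⇒≱ (+-monoʳ-< (quad (rank v)) ≤-refl))
  ...   | le | point _ kl kh = contradiction (+-cancelˡ-≤ (quad (rank v)) 2 1 (subst₂ _≤_ kh kl le)) λ { (s≤s ()) }

  before : ∀ u v → u < n → v < n → P (u + n) < P v → rank (u + n) ≤ rank v
  before u v u<n v<n lt with key-mono (+-monoˡ-< n u<n) (<n+n v<n) (<⇒≤ lt) | keyof u u<n | keyof v v<n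
  ... | le | proper _ _ kh | proper _ kl _ = quad-≤ {i = 0} {3} ≤-refl
      (subst₂ _≤_ (trans kh (sym (+-identityʳ _))) kl le)
  ... | le | proper _ _ kh | point _ kl _ = quad-≤ {i = 0} {1} (s≤s (s≤s z≤n))
      (subst₂ _≤_ (trans kh (sym (+-identityʳ _))) kl le)
  ... | le | point r≤ _ kh | proper _ kl _ = ≤-trans r≤ (quad-≤ {i = 2} {3} ≤-refl (subst₂ _≤_ kh kl le))
  ... | le | point r≤ _ kh | point _ kl _ = ≤-trans r≤ (quad-≤ {i = 2} {1} (s≤s (s≤s z≤n)) (subst₂ _≤_ kh kl le))

  crossing : ∀ u v → u < n → v < n → P v < P (u + n) → rank v < rank (u + n) ⊎
            (rank (u + n) ≤ rank u × (rank v < rank u ⊎ (rank (v + n) ≤ rank v × rank v ≡ rank u)))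
  crossing u v u<n v<n lt with key-mono (<n+n v<n) (+-monoˡ-< n u<n) (<⇒≤ lt) | keyof u u<n | keyof v v<n
  ... | le | proper _ _ kh | proper _ kl _ = inj₁ (quad-cancel-< (subst₂ _≤_ kl kh le))
  ... | le | proper _ _ kh | point _ kl _ = inj₁ (quad-cancel-< (subst₂ _≤_ kl kh le))
  ... | le | point r≤ _ kh | proper _ kl _ = inj₂ (r≤ ,
      inj₁ (≤∧≢⇒< (quad-≤ {i = 3} {2} (s≤s (s≤s (s≤s z≤n))) (subst₂ _≤_ kl kh le))
      λ eq → contradiction (+-cancelˡ-≤ (quad (rank u)) 3 2
          (subst₂ _≤_ (trans kl (cong (λ r → quad r + 3) eq)) kh le)) λ { (s≤s (s≤s ())) }))
  ... | le | point r≤ _ kh | point r≤′ kl _ = inj₂ (r≤ ,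
      (case m≤n⇒m<n∨m≡n (quad-≤ {i = 1} {2} (s≤s (s≤s (s≤s z≤n))) (subst₂ _≤_ kl kh le)) of λ where
      (inj₁ lt) → inj₁ lt
      (inj₂ eq) → inj₂ (r≤′ , eq)))

-- Each budget covers its stage and all later ones, so the sums are nested from the last stage back
-- to `T₀`. `s` stands for σ + 1 and `Φ` for the initial weight.
module Times (n m s Φ : ℕ) where
  T₀ T₁ T₂ T₃ T₄ T₅ T₆ T₇ T₈ T₉ : ℕ
  T₉ = 8 + ((n + n) * 24 + (3 + 0))
  T₈ = 4 + (quad (n + n) * 19 + ((n + n) * 23 + (3 + T₉)))
  T₇ = 10 + chainTime (quad (n + n)) (n + n) T₈
  T₆ = 2 + (n * 52 + (3 + T₇))
  -- 302 is `22 + κ` for `κ = 280`; the `s` initial blocks cause at most `s * 2` queue entries of 63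
  -- each.
  T₅ = Φ * 302 + (s * 2 * 63 + (3 + T₆))
  T₄ = 15 + (s * 36 + (3 + T₅))
  T₃ = 4 + chainTime (n + n) (m + m) T₄
  T₂ = 4 + (m * 53 + (3 + T₃))
  T₁ = 6 + chainTime (s) (n + n) (4 + (s * 19 + ((n + n) * 23 + (3 + T₂))))
  T₀ = 8 + (m * 27 + (3 + T₁))

module AlgorithmRun (problem : Problem) (w Z : ℕ) (Z< : Z < 2 ^ w) where
  open Problem problem
  open DoubledEdges problem

  Φ : ℕ
  Φ = (n + n) * ⌊log₂ n + n ⌋ + (m + m) * ⌊log₂ n + n ⌋

  open Times n m (suc σ) Φ

  Solved : ℕ → Store → Set
  Solved _ τ = Solution problem (vars τ vOut) (arrs τ aCol)

  halves : ∀ {x} → x < n + n → x < n ⊎ ∃[ v ] v < n × v + n ≡ x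
  halves {x} x< with <-or-≥ x n
  ... | inj₁ lt = inj₁ lt
  ... | inj₂ ge = inj₂ (x ∸ n , +-cancelʳ-< n _ n (subst (_< n + n) (sym (m∸n+n≡m ge)) x<) , m∸n+n≡m ge)

  -- `quad (n + n)` is for the keys of the last sort and `m + m` for the edges. The rest bounds the
  -- numbers of blocks and queue entries, which grow with the weight spent; 3 is the largest
  -- literal.
  module _ (room : quad (n + n) + (m + m) + (suc σ * 2 + 3) + Φ * 2 ≤ Z) where

    private
      quad≤ : quad (n + n) ≤ Z
      quad≤ = ≤-trans (≤-trans (m≤m+n _ _) (≤-trans (m≤m+n _ _) (m≤m+n _ _))) room
      m+m≤ : m + m ≤ Z
      m+m≤ = ≤-trans (≤-trans (m≤n+m _ (quad (n + n))) (≤-trans (m≤m+n _ _) (m≤m+n _ _))) room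
      extra : suc σ * 2 + 3 + Φ * 2 ≤ Z
      extra = ≤-trans (+-monoˡ-≤ (Φ * 2) (m≤n+m _ (quad (n + n) + (m + m)))) room
      3≤Z : 3 ≤ Z
      3≤Z = ≤-trans (≤-trans (m≤n+m 3 (suc σ * 2)) (m≤m+n _ (Φ * 2))) extra
      σ+Φ : suc σ + Φ ≤ Z
      σ+Φ = ≤-trans (+-mono-≤ (≤-trans (m≤m*n (suc σ) 2) (m≤m+n _ 3)) (m≤m*n Φ 2)) extra
      2σ+2Φ : suc σ * 2 + Φ * 2 ≤ Z
      2σ+2Φ = ≤-trans (+-monoˡ-≤ (Φ * 2) (m≤m+n _ 3)) extra
      n+n< : n + n < Z
      n+n< = ≤-trans (≤-trans (≤-reflexive (+-comm 1 (n + n)))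
        (+-mono-≤ (≤-trans (m≤m+n (n + n) (n + n)) (≤-trans (m≤m+n _ _) (m≤m+n (quad (n + n)) (m + m))))
          (≤-trans (s≤s z≤n) (≤-trans (m≤n+m 3 (suc σ * 2)) (m≤m+n _ (Φ * 2))))))
              (≤-trans (≤-reflexive (sym (+-assoc (quad (n + n) + (m + m)) _ _))) room)
      σ< : suc σ ≤ Z
      σ< = ≤-trans (m≤m+n _ Φ) σ+Φ
      fits : ∀ {x} → x ≤ Z → x < 2 ^ w
      fits le = ≤-<-trans le Z<
      0<n : 0 < n
      0<n = ≤-<-trans z≤n root<
      0<n+n : 0 < n + n
      0<n+n = ≤-trans 0<n (m≤m+n n n)

    colour-stage : ∀ {ρ rank} → vars ρ vN ≡ n + n → vars ρ vn ≡ n → StateRanking rank →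
        (∀ x → x < n + n → rank x < n + n) →
      (∀ v → v < n → KeyOf (rank v) (rank (v + n)) (arrs ρ aKEY (suc v)) (arrs ρ aKEY (suc (v + n)))) →
      Halts w (vCnt ≔ var vN ⨾ vK ≔ (var vN ⊕ var vN) ⊕ (var vN ⊕ var vN) ⨾ chain ⨾ spread ⨾ colour) ρ T₇ Solved
    colour-stage {ρ} {rank} N≡ n≡ SR rank< keyof =
      asg⨾ N≡ (asg⨾ quad≡
      (call⨾ (vi ∷ va ∷ []) (aHEAD ∷ aNEXT ∷ []) (chain-halts (fits quad≤) (fits (<⇒≤ n+n<)) key<)
      λ { (refl , ch) →
      call⨾ (va ∷ vj ∷ ve ∷ vx ∷ []) (aE ∷ aP ∷ aF ∷ afs ∷ afe ∷ [])
          (spread-halts (fits quad≤) (fits (<⇒≤ n+n<)) key< ch)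
      λ { {σ = τ} (refl , S) → call (vp ∷ vhd ∷ vft ∷ vOut ∷ vx ∷ []) (aCol ∷ aFR ∷ [])
        (colour-halts n (Sorted.perm S) (Assembly.lo<hi {rank = rank} S keyof) N≡ n≡ (fits (<⇒≤ n+n<)))
      λ col → record
        { rank = rank ; ranks = SR ; perm = Sorted.perm S ; lo<hi = Assembly.lo<hi {rank = rank} S keyof
        ; before = Assembly.before {rank = rank} S keyof ; crossing = Assembly.crossing {rank = rank} S keyof
        ; coloured = col } } }))
      where
      N = n + n
      quad≡ : wrap w (wrap w (vars ρ vN + vars ρ vN) + wrap w (vars ρ vN + vars ρ vN)) ≡ quad N
      quad≡ = trans (cong₂ (λ a b → wrap w (a + b)) twice twice) (wrap-id w (fits quad≤))
        where
        twice : wrap w (vars ρ vN + vars ρ vN) ≡ N + N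
        twice = trans (cong (λ x → wrap w (x + x)) N≡) (wrap-id w (fits (≤-trans (m≤m+n _ _) quad≤)))
      small : ∀ {r} → r < N → quad r + 3 < quad N
      small {r} lt = ≤-trans (≤-reflexive (sym (+-suc (quad r) 3))) (quad-< lt)
      key< : ∀ x → x < N → arrs ρ aKEY (suc x) < quad N
      key< x x<N with halves x<N
      ... | inj₁ x<n with keyof x x<n
      ...   | proper _ e _ = subst (_< quad N) (sym e) (small (rank< x x<N))
      ...   | point _ e _ = subst (_< quad N) (sym e) (≤-<-trans (+-monoʳ-≤ (quad (rank x)) (s≤s z≤n))
          (small (rank< x x<N)))
      key< x x<N | inj₂ (v , v<n , refl) with keyof v v<n
      ... | proper _ _ e = subst (_< quad N) (sym e) (≤-<-trans (m≤m+n _ 3) (small (rank< x x<N)))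
      ... | point _ _ e = subst (_< quad N) (sym e) (≤-<-trans (+-monoʳ-≤ (quad (rank v)) (s≤s (s≤s z≤n)))
                            (small (rank< v (<-≤-trans v<n (m≤m+n n n)))))

    refine-stage : ∀ {ρ K₁} → vars ρ vN ≡ n + n → vars ρ vn ≡ n → vars ρ vΣ ≡ σ →
      (labels≡ : ∀ v → v < n → K₁ (suc v) ≡ Lab v × K₁ (suc (v + n)) ≡ Lab v) →
      Sorted (n + n) (suc σ) K₁ (arrs ρ aE) (arrs ρ aP) (arrs ρ aF) (arrs ρ afs) (arrs ρ afe) →
      (D : Doubled (arrs ρ aKEY) (arrs ρ aTG) (arrs ρ acnt) (m + m) m) →
      IsChain (arrs ρ aHEAD) (arrs ρ aNEXT) (arrs ρ aKEY) (m + m) (n + n) →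
      (∀ x → arrs ρ aC x ≡ 0) → arrs ρ acs 0 ≡ 0 → (∀ x → arrs ρ acb x ≡ 0) → (∀ x → arrs ρ aK x ≡ 0) →
      (∀ x → arrs ρ achild x ≡ 0) → (∀ x → arrs ρ apar x ≡ 0) →
      Halts w
        (vnf ≔ var vΣ ⊕ lit 1 ⨾ vr ≔ lit 0 ⨾ vnc ≔ lit 1 ⨾ vq ≔ lit 0 ⨾ vnb ≔ lit 0 ⨾ ace [ lit 0 ]≔ var vN ⨾
         emits ⨾ refine ⨾ keys ⨾
         vCnt ≔ var vN ⨾ vK ≔ (var vN ⊕ var vN) ⊕ (var vN ⊕ var vN) ⨾ chain ⨾ spread ⨾ colour)
        ρ T₄ Solved
    refine-stage {ρ} {K₁} N≡ n≡ Σ≡ labels≡ S D ch C0 cs0 cb0 K0 child0 par0 =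
      asg⨾ (trans (inc w (fits (≤-trans (≤-reflexive (cong suc Σ≡)) σ<))) (cong suc Σ≡))
      (asg⨾ (zero-id w) (asg⨾ (lit-id w (≤-trans (s≤s z≤n) 3≤Z) Z<) (asg⨾ (zero-id w) (asg⨾ (zero-id w)
      (wrt⨾ (zero-id w) N≡
      (call⨾ (vr ∷ vf ∷ vnb ∷ []) (aB ∷ [])
        (Refinement.RefineProgram.emits-halts graph w Z 280 Z< m+m≤ (<⇒≤ n+n<) T₅
            (Refinement.initially graph 0<n+n S (s≤s z≤n) (λ _ _ → refl) C0 cs0 ce0 refl cb0
            (λ x _ → Doubled.count D x) K0 child0 par0 refl)
          z≤n σ< (suc σ) refl (≤-trans (m≤m+n _ _) 2σ+2Φ) ≤-refl)
      λ { {σ = τ} (k≤ , r≡ , _ , nb≤ , I) → weaken k≤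
      (call⨾ vsRefine asRefine
        (Refinement.RefineProgram.refine-halts graph w Z 280 Z< m+m≤ (<⇒≤ n+n<) T₆ ≤-refl
            (record { is-chain = ch ; key≡ = λ _ _ → refl ; tg≡ = λ _ _ → refl }) n≡ r≡ I (vars τ vnb) refl
          (subst (λ φ → suc σ + φ ≤ Z) (sym weight≡) σ+Φ)
          (≤-trans (+-mono-≤ nb≤ (≤-reflexive (cong (_* 2) weight≡))) 2σ+2Φ)
          (subst (λ φ → 1 + φ ≤ Z) (sym weight≡) (≤-trans (+-monoˡ-≤ Φ (s≤s (z≤n {σ}))) σ+Φ))
          (+-mono-≤ (≤-reflexive (cong (_* 302) weight≡)) (+-monoˡ-≤ (3 + T₆) (*-monoˡ-≤ 63 nb≤))))
      λ { {σ = υ} (k≤ , q , I , nb≤q) → weaken k≤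
      (call⨾ (vi ∷ vx ∷ va ∷ vy ∷ vg ∷ []) (aKEY ∷ [])
        (keys-halts n Z Z< n≡ quad≤ 3≤Z (rank< I))
      λ { (refl , keyof) → colour-stage N≡ n≡ (state-ranking (Refinement.ranking graph nb≤q I (m≤m+n n n)))
          (rank< I) keyof }) }) }))))))
      where
      open DoubledGraph problem K₁ (arrs ρ aKEY) (arrs ρ aTG) (arrs ρ acnt) labels≡ D
      ce0 : (arrs ρ ace [ 0 ↦ n + n ]) 0 ≡ n + n
      ce0 = upd≡ (arrs ρ ace) 0 (n + n)
      weight≡ : Refinement.weight graph (record (viewOf ρ) { C = arrs ρ aC ; cs = arrs ρ acs ; ce =
          arrs ρ ace [ 0 ↦ n + n ] }) ≡ Φ
      weight≡ = cong₂ _+_ (Σ-const (n + n) λ x _ → extent≡ x) (Σ-const (m + m) λ e _ → extent≡ _)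
        where
        extent≡ : ∀ x → Refinement.extent graph (record
            (viewOf ρ) { C = arrs ρ aC ; cs = arrs ρ acs ; ce = arrs ρ ace [ 0 ↦ n + n ] }) (arrs ρ aC x)
          ≡ ⌊log₂ n + n ⌋
        extent≡ x rewrite C0 x | cs0 = refl
      rank< : ∀ {v q} → Refinement.Inv graph v q (View.nf v) → ∀ x → x < n + n → View.cs v (View.C v x) < n + n
      rank< {v} I x x<N = ≤-<-trans (subst (λ y → View.cs v (View.C v y) ≤ View.P v x) (Perm.E∘P perm x x<N)
        (Blocks.lo≤ coarse (View.P v x) (Perm.P< perm x x<N))) (Perm.P< perm x x<N)
        where open Refinement.Inv I

    algorithm-halts : ∀ {ρ} → vars ρ vOut ≡ n → vars ρ vΣ ≡ σ → vars ρ vm ≡ m →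
      (∀ i → i < m → arrs ρ aSrc i ≡ src i) → (∀ i → i < m → arrs ρ aTgt i ≡ tgt i) →
      (∀ i → i < m → arrs ρ aLab i ≡ let′ i) → (∀ a x → arrs ρ (3 + a) x ≡ 0) →
      Halts w algorithm ρ T₀ Solved
    algorithm-halts {ρ} n≡ Σ≡ m≡ S≡ T≡ L≡ zero-arr =
      call⨾ (vn ∷ vN ∷ vi ∷ vx ∷ va ∷ []) (aKEY ∷ []) (labels-halts n+n< σ< m+m≤ n≡ m≡ T≡ L≡ (zero-arr 0))
      λ { {σ = τ₁} (refl , n≡ , N≡ , labels≡) →
      let key< : ∀ x → x < n + n → arrs τ₁ aKEY (suc x) < suc σ
          key< = λ x x<N → case halves x<N of λ where
            (inj₁ x<n) → subst (_< suc σ) (sym (proj₁ (labels≡ x x<n))) (Lab≤ x<n)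
            (inj₂ (v , v<n , eq)) → subst (_< suc σ) (sym
                (trans (cong (arrs τ₁ aKEY ∘ suc) (sym eq)) (proj₂ (labels≡ v v<n)))) (Lab≤ v<n)
      in
      asg⨾ N≡ (asg⨾ (trans (inc w (fits (≤-trans (≤-reflexive (cong suc Σ≡)) σ<))) (cong suc Σ≡))
      (call⨾ (vi ∷ va ∷ []) (aHEAD ∷ aNEXT ∷ []) (chain-halts (fits σ<) (fits (<⇒≤ n+n<)) key<)
      λ { (refl , ch₁) →
      call⨾ (va ∷ vj ∷ ve ∷ vx ∷ []) (aE ∷ aP ∷ aF ∷ afs ∷ afe ∷ []) (spread-halts (fits σ<) (fits (<⇒≤ n+n<)) key< ch₁)
      λ { (refl , S) →
      call⨾ (vi ∷ vj ∷ vx ∷ va ∷ []) (aKEY ∷ aTG ∷ acnt ∷ []) (edges-halts n+n< σ< m+m≤ n≡ m≡ S≡ T≡ (zero-arr 12))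
      λ { {σ = τ₂} (refl , j≡ , D) →
      asg⨾ j≡ (asg⨾ N≡
      (call⨾ (vi ∷ va ∷ []) (aHEAD ∷ aNEXT ∷ [])
        (chain-halts (fits (<⇒≤ n+n<)) (fits m+m≤) (Graph.src<
            (DoubledGraph.graph problem (arrs τ₁ aKEY) (arrs τ₂ aKEY) (arrs τ₂ aTG) (arrs τ₂ acnt) labels≡ D)))
      λ { (refl , ch₂) →
      refine-stage {K₁ = arrs τ₁ aKEY} N≡ n≡ Σ≡ labels≡ S D ch₂ (zero-arr 8) (zero-arr 9 0) (zero-arr 13)
          (zero-arr 14) (zero-arr 16) (zero-arr 17) })) } } })) }
      where
      open Preparation problem w Z Z<
      Lab≤ : ∀ {v} → v < n → Lab v < suc σ
      Lab≤ {v} v<n with v ≟ root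
      ... | yes refl = subst (_< suc σ) (sym Lab-root) (s≤s z≤n)
      ... | no ne with incoming v v<n ne
      ...   | i , i<m , refl = subst (_< suc σ) (sym (Lab-tgt i i<m)) (s≤s (let< i i<m))

-- Finite subsets

subset-≤1 : ∀ {n} {p : Subset n} → ∣ p ∣ ≤ 1 → ∀ {x y} → x ∈ p → y ∈ p → x ≡ y
subset-≤1 {p = p} le {x} {y} x∈p y∈p with x Fin.≟ y
... | yes eq = eq
... | no ne = contradiction (subst (_< ∣ p ∣) (∣⁅x⁆∣≡1 x)
    (p⊂q⇒∣p∣<∣q∣ ((λ z∈ → subst (_∈ p) (sym (x∈⁅y⁆⇒x≡y x z∈)) x∈p) ,
    y , y∈p , ne ∘ sym ∘ x∈⁅y⁆⇒x≡y x))) (≤⇒≯ le)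

-- Only a lower bound on the size is proved here; where exact size is wanted, `antichain-bound`
-- gives the upper one.
image : ∀ {n} k (f : Fin k → Fin n) → Injective _≡_ _≡_ f →
        ∃[ S ] (∀ {x} → x ∈ S → ∃[ c ] f c ≡ x) × k ≤ ∣ S ∣
image {n} zero f inj = Subset.⊥ , (λ x∈ → contradiction x∈ ∉⊥) , z≤n
image {n} (suc k) f inj with image k (f ∘ Fin.suc) (Finₚ.suc-injective ∘ inj)
... | S , from , le = ⁅ f Fin.zero ⁆ ∪ S ,
  (λ x∈ → case x∈p∪q⁻ ⁅ f Fin.zero ⁆ S x∈ of λ where
    (inj₁ x∈) → Fin.zero , sym (x∈⁅y⁆⇒x≡y _ x∈)
    (inj₂ x∈) → let c , eq = from x∈ in Fin.suc c , eq) ,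
  ≤-<-trans le (p⊂q⇒∣p∣<∣q∣ ((λ x∈ → x∈p∪q⁺ (inj₂ x∈)) , f Fin.zero , x∈p∪q⁺ (inj₁ (x∈⁅x⁆ _)) ,
    λ x∈ → let c , eq = from x∈ in 0≢suc (sym (inj eq))))
  where
  0≢suc : ∀ {c : Fin k} → Fin.zero ≢ Fin.suc c
  0≢suc ()

-- An enumeration without repetition, so that the size of a subset can be bounded by an injection.
elements : ∀ {n} (S : Subset n) → Σ[ e ∈ (Fin ∣ S ∣ → Fin n) ] Injective _≡_ _≡_ e × (∀ i → e i ∈ S)
elements Vec.[] = (λ ()) , (λ { {()} }) , λ ()
elements (Subset.outside Vec.∷ S) with elements S
... | e , inj , e∈ = Fin.suc ∘ e , inj ∘ Finₚ.suc-injective , Vec.there ∘ e∈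
elements (Subset.inside Vec.∷ S) with elements S
... | e , inj , e∈ = e′ , inj′ , e′∈
  where
  e′ : Fin (suc ∣ S ∣) → Fin _
  e′ Fin.zero    = Fin.zero
  e′ (Fin.suc i) = Fin.suc (e i)
  inj′ : Injective _≡_ _≡_ e′
  inj′ {Fin.zero}  {Fin.zero}  _  = refl
  inj′ {Fin.suc i} {Fin.suc j} eq = cong Fin.suc (inj (Finₚ.suc-injective eq))
  e′∈ : ∀ i → e′ i ∈ Subset.inside Vec.∷ S
  e′∈ Fin.zero    = Vec.here
  e′∈ (Fin.suc i) = Vec.there (e∈ i)

-- Automata and their reversed strings

infix 4 _<ˡ_
_<ˡ_ : ∀ {σ} → List (Fin σ) → List (Fin σ) → Set
_<ˡ_ = Lex-< _≡_ Fin._<_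

<ˡ-asym : ∀ {σ} {α β : List (Fin σ)} → α <ˡ β → ¬ β <ˡ α
<ˡ-asym (Lex.base ()) _
<ˡ-asym Lex.halt ()
<ˡ-asym (Lex.this a<b) (Lex.this b<a) = <-asym a<b b<a
<ˡ-asym (Lex.this a<b) (Lex.next refl _) = <-irrefl refl a<b
<ˡ-asym (Lex.next refl _) (Lex.this b<a) = <-irrefl refl b<a
<ˡ-asym (Lex.next refl p) (Lex.next _ q) = <ˡ-asym p q

<ˡ-trans : ∀ {σ} {α β γ : List (Fin σ)} → α <ˡ β → β <ˡ γ → α <ˡ γ
<ˡ-trans (Lex.base ()) _
<ˡ-trans Lex.halt (Lex.this _) = Lex.halt
<ˡ-trans Lex.halt (Lex.next _ _) = Lex.halt
<ˡ-trans (Lex.this a<b) (Lex.this b<c) = Lex.this (<-trans a<b b<c)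
<ˡ-trans (Lex.this a<b) (Lex.next refl _) = Lex.this a<b
<ˡ-trans (Lex.next refl _) (Lex.this b<c) = Lex.this b<c
<ˡ-trans (Lex.next refl p) (Lex.next refl q) = Lex.next refl (<ˡ-trans p q)

-- Constants of the time bound and the word size

log-double : ∀ n → 1 ≤ n → ⌊log₂ n + n ⌋ ≡ suc ⌊log₂ n ⌋
log-double n@(suc _) _ = trans (cong (λ x → ⌊log₂ n + x ⌋) (sym (+-identityʳ n))) (⌊log₂[2*b]⌋≡1+⌊log₂b⌋ n)

-- The left-hand side is Times.T₀ n m s φ, unfolded for the ring solver.
T₀-expand : ∀ n m s φ →
  8 + (m * 27 + (3 + (6 + (2 + (s * 10 + (5 + ((n + n) * 17 + (3 + (4 + (s * 19 + ((n + n) * 23 + (3 + (4 +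
   (m * 53 + (3 + (4 + (2 + ((n + n) * 10 + (5 + ((m + m) * 17 + (3 + (15 + (s * 36 + (3 + (φ * 302 + (s * 2
   * 63 + (3 + (2 + (n * 52 + (3 + (10 + (2 + ((((n + n) + (n + n)) + ((n + n) + (n + n))) * 10 + (5 + ((n +
   n) * 17 + (3 + (4 + ((((n + n) + (n + n)) + ((n + n) + (n + n))) * 19 + ((n + n) * 23 + (3 + (8 + ((n +
   n) * 24 + (3 + 0)))))))))))))))))))))))))))))))))))))))))))
  ≡ n * 512 + m * 114 + s * 191 + φ * 302 + 119
T₀-expand n m s φ = solve (n ∷ m ∷ s ∷ φ ∷ [])

-- Every term is absorbed into `m * l`, which uses `1 ≤ l`. With `n` and `s` at most 2m and `φ` at
-- most 12ml the coefficients add up to 2 * 512 + 114 + 2 * 191 + 12 * 302 + 119 = 5263.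
T₀-bound : ∀ {n m s φ} l → n ≤ m + m → s ≤ m + m → 1 ≤ m → 1 ≤ l → φ ≤ m * l * 12 → Times.T₀ n m s φ ≤ 5263 * (m * l)
T₀-bound {n} {m} {s} {φ} l n≤ s≤ 1≤m 1≤l φ≤ = ≤-trans (≤-reflexive (T₀-expand n m s φ))
  (≤-trans (+-mono-≤ (+-mono-≤ (+-mono-≤ (+-mono-≤ (*-monoˡ-≤ 512 (≤-trans n≤ 2m≤)) (*-monoˡ-≤ 114 m≤))
      (*-monoˡ-≤ 191 (≤-trans s≤ 2m≤)))
    (*-monoˡ-≤ 302 φ≤)) (≤-trans (≤-reflexive (sym (*-identityˡ 119))) (*-monoˡ-≤ 119 (≤-trans 1≤m m≤))))
  (≤-reflexive (total (m * l))))
  where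
  m≤ : m ≤ m * l
  m≤ = ≤-trans (≤-reflexive (sym (*-identityʳ m))) (*-monoʳ-≤ m 1≤l)
  2m≤ : m + m ≤ m * l + m * l
  2m≤ = +-mono-≤ m≤ m≤
  total : ∀ x → (x + x) * 512 + x * 114 + (x + x) * 191 + x * 12 * 302 + x * 119 ≡ 5263 * x
  total x = solve (x ∷ [])

-- The doubled graph has at most 6m nodes and edges together, and `suc l` is at most 2l.
Φ-bound : ∀ {n m} l → n ≤ m + m → 1 ≤ l → (n + n) * suc l + (m + m) * suc l ≤ m * l * 12
Φ-bound {n} {m} l n≤ 1≤l = ≤-trans (≤-reflexive (sym (*-distribʳ-+ (suc l) (n + n) (m + m))))
  (≤-trans (*-mono-≤ (+-monoˡ-≤ (m + m) (+-mono-≤ n≤ n≤)) (+-monoˡ-≤ l 1≤l)) (≤-reflexive (eq m l)))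
  where
  eq : ∀ m l → ((m + m) + (m + m) + (m + m)) * (l + l) ≡ m * l * 12
  eq m l = solve (m ∷ l ∷ [])

-- The logarithm `l` is crudely replaced by `n + n`, so the left side is quadratic, below 27 Q²; and
-- 27 is at most Q³. The exponent 5 becomes the factor in the word size.
room-bound : ∀ {n m s l} → let Q = n + m in 3 ≤ Q → s ≤ n → l ≤ n + n →
  quad (n + n) + (m + m) + (s * 2 + 3) + ((n + n) * l + (m + m) * l) * 2 < Q ^ 5
room-bound {n} {m} {s} {l} 3≤Q s≤n l≤ = <-≤-trans (s≤s step₁) (≤-trans (s≤s step₂) (≤-trans step₃ step₄))
  where
  Q = n + m
  QQ = Q * Q
  Q≤QQ : 3 * Q ≤ QQ
  Q≤QQ = *-monoˡ-≤ Q 3≤Q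
  step₁ : quad (n + n) + (m + m) + (s * 2 + 3) + ((n + n) * l + (m + m) * l) * 2 ≤ Q * 10 + 3 + QQ * 8
  step₁ = ≤-trans (+-mono-≤ (+-monoʳ-≤ (quad (n + n) + (m + m)) (+-monoˡ-≤ 3 (*-monoˡ-≤ 2 s≤n)))
      (*-monoˡ-≤ 2 (≤-trans (≤-reflexive (sym (*-distribʳ-+ l (n + n) (m + m))))
          (*-monoʳ-≤ ((n + n) + (m + m)) (≤-trans l≤ (+-mono-≤ (m≤m+n n m) (m≤m+n n m)))))))
    (≤-trans (m≤m+n _ (8 * m)) (≤-reflexive (eq n m)))
    where
    eq : ∀ n m → (((n + n) + (n + n)) + ((n + n) + (n + n))) + (m + m) + (n * 2 + 3) + ((n + n) + (m + m))
        * ((n + m) + (n + m)) * 2 + 8 * m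
         ≡ (n + m) * 10 + 3 + (n + m) * (n + m) * 8
    eq n m = solve (n ∷ m ∷ [])
  step₂ : Q * 10 + 3 + QQ * 8 ≤ QQ * 13
  step₂ = ≤-trans (+-monoˡ-≤ (QQ * 8) (+-mono-≤ (*-monoʳ-≤ Q {10} {12} (m≤m+n 10 2))
      (≤-trans 3≤Q (≤-trans (m≤n*m Q 3) Q≤QQ))))
    (≤-trans (+-monoˡ-≤ (QQ * 8) (+-monoˡ-≤ QQ (≤-trans (≤-reflexive (e₁ Q)) (*-monoʳ-≤ 4 Q≤QQ))))
        (≤-reflexive (e₂ QQ)))
    where
    e₁ : ∀ q → q * 12 ≡ 4 * (3 * q)
    e₁ q = solve (q ∷ [])
    e₂ : ∀ q → 4 * q + q + q * 8 ≡ q * 13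
    e₂ q = solve (q ∷ [])
  step₃ : suc (QQ * 13) ≤ QQ * 27
  step₃ = ≤-trans (+-monoˡ-≤ (QQ * 13) (≤-trans (≤-trans (s≤s z≤n) 3≤Q) (≤-trans (m≤n*m Q 3) Q≤QQ)))
    (≤-trans (≤-reflexive (e QQ)) (*-monoʳ-≤ QQ {14} {27} (m≤m+n 14 13)))
    where
    e : ∀ q → q + q * 13 ≡ q * 14
    e q = solve (q ∷ [])
  step₄ : QQ * 27 ≤ Q ^ 5
  step₄ = ≤-trans (*-monoʳ-≤ QQ (*-mono-≤ {3} {Q} {9} {QQ} 3≤Q (*-mono-≤ 3≤Q 3≤Q))) (≤-reflexive (e Q))
    where
    e : ∀ q → q * q * (q * (q * q)) ≡ q * (q * (q * (q * (q * 1))))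
    e q = solve (q ∷ [])

nth-map : ∀ {X : Set} (f : X → ℕ) xs (i : Fin (length xs)) → nth (map f xs) (toℕ i) ≡ f (lookup xs i)
nth-map f (x ∷ xs) Fin.zero    = refl
nth-map f (x ∷ xs) (Fin.suc i) = nth-map f xs i

log-≤ : ∀ n → ⌊log₂ n ⌋ ≤ n
log-≤ n = ≤-trans (⌊log₂⌋-mono-≤ (<⇒≤ (n<2^n n))) (≤-reflexive (⌊log₂[2^n]⌋≡n n))
  where
  n<2^n : ∀ n → n < 2 ^ n
  n<2^n zero    = s≤s z≤n
  n<2^n (suc n) = ≤-trans (+-mono-≤ (≤-trans (s≤s z≤n) (n<2^n n)) (n<2^n n)) (+-monoʳ-≤ (2 ^ n) (m≤m+n (2 ^ n) 0))

≤-2^⌈log⌉ : ∀ n → n ≤ 2 ^ ⌈log₂ n ⌉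
≤-2^⌈log⌉ n = go n (<-wellFounded n)
  where
  go : ∀ n → Acc _<_ n → n ≤ 2 ^ ⌈log₂ n ⌉
  go 0 _ = z≤n
  go 1 _ = m^n>0 2 ⌈log₂ 1 ⌉
  go n@(suc (suc k)) (acc rs) = ≤-trans (≤-reflexive (sym (⌊n/2⌋+⌈n/2⌉≡n n)))
    (≤-trans (+-mono-≤ (≤-trans (⌊n/2⌋≤⌈n/2⌉ n) half) half) (≤-reflexive doubled))
    where
    half : ⌈ n /2⌉ ≤ 2 ^ (⌈log₂ n ⌉ ∸ 1)
    half = subst (λ l → ⌈ n /2⌉ ≤ 2 ^ l) (⌈log₂⌈n/2⌉⌉≡⌈log₂n⌉∸1 n) (go ⌈ n /2⌉ (rs (⌈n/2⌉<n k)))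
    doubled : 2 ^ (⌈log₂ n ⌉ ∸ 1) + 2 ^ (⌈log₂ n ⌉ ∸ 1) ≡ 2 ^ ⌈log₂ n ⌉
    doubled = trans (cong (2 ^ (⌈log₂ n ⌉ ∸ 1) +_) (sym (+-identityʳ _)))
      (cong (2 ^_) (m+[n∸m]≡n (⌈log₂⌉-mono-≤ {2} {n} (s≤s (s≤s z≤n)))))

-- Co-lex orders, the string order and ranks

module Automaton {n σ : ℕ} (A : NFA n σ) (SA : StandingAssumptions A) (dfa : IsDFA A) (ic : InputConsistent A) where
  open StandingAssumptions SA

  private
    s = source A
    _≺_ = StringOrder A

  -- γ is the reversal of a string that labels a walk from the source to v.
  data Back : List (Fin σ) → Fin n → Set where
    []  : Back [] s
    _∷_ : ∀ {γ u v a} → v ∈ δ A u a → Back γ u → Back (a ∷ γ) v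

  to-back : ∀ {γ u α v} → Back γ u → Walk A u α v → Back (reverseAcc γ α) v
  to-back b []      = b
  to-back b (e ∷ w) = to-back (e ∷ b) w

  extend : ∀ {u α v w a} → Walk A u α v → w ∈ δ A v a → Walk A u (α ++ a ∷ []) w
  extend []      e = e ∷ []
  extend (f ∷ w) e = f ∷ extend w e

  from-back : ∀ {γ v} → Back γ v → _∈S_ A (reverse γ) v
  from-back [] = []
  from-back {a ∷ γ} (e ∷ b) = subst (λ α → _∈S_ A α _) (sym (unfold-reverse a γ)) (extend (from-back b) e)

  ≺⇒< : ∀ {u v γ γ′} → u ≺ v → Back γ u → Back γ′ v → γ <ˡ γ′
  ≺⇒< {γ = γ} {γ′} u≺v b b′ = subst₂ _<ˡ_ (reverse-involutive γ) (reverse-involutive γ′)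
      (u≺v (from-back b) (from-back b′))

  <⇒≺ : ∀ {u v} → (∀ {γ γ′} → Back γ u → Back γ′ v → γ <ˡ γ′) → u ≺ v
  <⇒≺ h α β = h (to-back [] α) (to-back [] β)

  back : ∀ v → ∃[ γ ] Back γ v
  back v = let α , w = reachable v in _ , to-back [] w

  target≢s : ∀ {u a v} → v ∈ δ A u a → v ≢ s
  target≢s e refl = source-no-incoming _ _ e

  same-letter : ∀ {u u′ a a′ v} → v ∈ δ A u a → v ∈ δ A u′ a′ → a ≡ a′
  same-letter {v = v} e e′ = let _ , _ , unique = ic v (target≢s e) in trans (sym (unique (_ , e))) (unique (_ , e′))

  deterministic : ∀ {u a v v′} → v ∈ δ A u a → v′ ∈ δ A u a → v ≡ v′
  deterministic {u} {a} = subset-≤1 (dfa u a)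

  ≺-asym : ∀ {u v} → u ≺ v → ¬ v ≺ u
  ≺-asym {u} {v} p q = let _ , b = back u; _ , b′ = back v in <ˡ-asym (≺⇒< p b b′) (≺⇒< q b′ b)

  ≺-irrefl : ∀ {u} → ¬ u ≺ u
  ≺-irrefl p = ≺-asym p p

  string-order-is-co-lex : IsCoLexOrder A _≺_
  string-order-is-co-lex = record
    { isStrictPartialOrder = record
        { isEquivalence = isEquivalence
        ; irrefl = λ { refl p → ≺-irrefl (λ {α} {β} → p {α} {β}) }
        ; trans = λ {u} {v} {w} p q → <⇒≺ λ b b″ → let _ , b′ = back v in
            <ˡ-trans (≺⇒< {u} {v} (λ {α} {β} → p {α} {β}) b b′) (≺⇒< {v} {w} (λ {α} {β} → q {α} {β}) b′ b″)
        ; <-resp-≈ = (λ { refl p {α} {β} → p {α} {β} }) , (λ { refl p {α} {β} → p {α} {β} }) }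
    ; source-first = λ {v} v≢s → <⇒≺ (λ b b′ → first v≢s b b′)
    ; by-letter = λ e e′ a<a′ → <⇒≺ (λ b b′ → letters e e′ a<a′ b b′)
    ; backward = λ {u} {u′} {v} {v′} e e′ v≺v′ _ → <⇒≺ λ b b′ →
        tail (≺⇒< {v} {v′} (λ {α} {β} → v≺v′ {α} {β}) (e ∷ b) (e′ ∷ b′)) }
    where
    first : ∀ {v γ γ′} → v ≢ s → Back γ s → Back γ′ v → γ <ˡ γ′
    first v≢s []      []      = contradiction refl v≢s
    first v≢s []      (_ ∷ _) = Lex.halt
    first v≢s (e ∷ _) _       = contradiction refl (target≢s e)
    letters : ∀ {u u′ v v′ a a′ γ γ′} → v ∈ δ A u a → v′ ∈ δ A u′ a′ → a Fin.< a′ → Back γ v → Back γ′ v′ → γ <ˡ γ′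
    letters e e′ lt [] _ = contradiction refl (target≢s e)
    letters e e′ lt (_ ∷ _) [] = contradiction refl (target≢s e′)
    letters e e′ lt (f ∷ _) (f′ ∷ _) = Lex.this (subst₂ Fin._<_ (same-letter e f) (same-letter e′ f′) lt)
    tail : ∀ {a γ γ′} → (a ∷ γ) <ˡ (a ∷ γ′) → γ <ˡ γ′
    tail (Lex.this a<a) = contradiction refl (<⇒≢ a<a)
    tail (Lex.next _ p) = p

  module _ {_≺′_ : Fin n → Fin n → Set} (co-lex : IsCoLexOrder A _≺′_) where
    open IsCoLexOrder co-lex
    open IsStrictPartialOrder isStrictPartialOrder
      using () renaming (irrefl to irrefl′; trans to trans′)

    -- Induction on the two walks. A larger last letter at `u` would contradict `by-letter`; equal
    -- letters hand the comparison to the predecessors by `backward`. If the predecessors coincide,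
    -- determinism makes `u` and `v` equal, against irreflexivity.
    co-lex⇒< : ∀ {u v γ γ′} → u ≺′ v → Back γ u → Back γ′ v → γ <ˡ γ′
    co-lex⇒< u≺v [] [] = contradiction u≺v (irrefl′ refl)
    co-lex⇒< u≺v [] (_ ∷ _) = Lex.halt
    co-lex⇒< u≺v (e ∷ _) [] = contradiction (trans′ u≺v (source-first (target≢s e))) (irrefl′ refl)
    co-lex⇒< u≺v (_∷_ {u = u′} {a = a} e b) (_∷_ {u = v′} {a = a′} e′ b′) with Finₚ.<-cmp a a′
    ... | tri< a<a′ _ _ = Lex.this a<a′
    ... | tri> _ _ a′<a = contradiction (trans′ u≺v (by-letter e′ e a′<a)) (irrefl′ refl)
    ... | tri≈ _ refl _ with u′ Fin.≟ v′
    ...   | yes refl = contradiction u≺v (irrefl′ (deterministic e e′))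
    ...   | no ne = Lex.next refl (co-lex⇒< (backward e e′ u≺v ne) b b′)

    co-lex⊆string : ∀ {u v} → u ≺′ v → u ≺ v
    co-lex⊆string u≺v = <⇒≺ (co-lex⇒< u≺v)

  labF : Fin n → ℕ
  labF v with v Fin.≟ s
  ... | yes _ = 0
  ... | no ne = suc (toℕ (proj₁ (ic v ne)))

  labF-source : labF s ≡ 0
  labF-source with s Fin.≟ s
  ... | yes _ = refl
  ... | no ne = contradiction refl ne

  labF-target : ∀ {u a v} → v ∈ δ A u a → labF v ≡ suc (toℕ a)
  labF-target {v = v} e with v Fin.≟ s
  ... | yes eq = contradiction eq (target≢s e)
  ... | no ne = cong (suc ∘ toℕ) (same-letter (proj₂ (proj₁ (proj₂ (ic v ne)))) e)

  -- The existential counterpart of `≺`: a single pair of strings, which is just what refutes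
  -- `v ≺ u`.
  _⊏_ : Fin n → Fin n → Set
  u ⊏ v = ∃[ γ ] ∃[ γ′ ] Back γ u × Back γ′ v × γ <ˡ γ′

  ⊏⇒⊁ : ∀ {u v} → u ⊏ v → ¬ v ≺ u
  ⊏⇒⊁ (_ , _ , b , b′ , lt) v≺u = <ˡ-asym lt (≺⇒< v≺u b′ b)

  ⊏-label : ∀ {u v} → labF u < labF v → u ⊏ v
  ⊏-label {u} {v} lt = let γ , b = back u; γ′ , b′ = back v in γ , γ′ , b , b′ , cmp lt b b′
    where
    cmp : ∀ {u v γ γ′} → labF u < labF v → Back γ u → Back γ′ v → γ <ˡ γ′
    cmp lt [] [] = contradiction lt (<-irrefl refl)
    cmp lt [] (_ ∷ _) = Lex.halt
    cmp lt (e ∷ _) [] = contradiction (subst (labF _ <_) labF-source lt) λ ()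
    cmp lt (e ∷ _) (e′ ∷ _) = Lex.this (≤-pred (subst₂ _<_ (labF-target e) (labF-target e′) lt))

  ⊏-edge : ∀ {u u′ v v′ a a′} → v ∈ δ A u a → v′ ∈ δ A u′ a′ → labF v ≡ labF v′ → u ⊏ u′ → v ⊏ v′
  ⊏-edge e e′ eq (γ , γ′ , b , b′ , lt) = _ , _ , e ∷ b , e′ ∷ b′ ,
    Lex.next (toℕ-injective (suc-injective (trans (sym (labF-target e)) (trans eq (labF-target e′))))) lt

  -- lo u and hi u are the ranks of the two nodes of the state u.
  module Ranked (lo hi : Fin n → ℕ)
    (rank-≤ : ∀ u v → hi u ≤ lo v → labF u < labF v ⊎
      (labF u ≡ labF v × (∀ {u′ v′ a} → u ∈ δ A u′ a → v ∈ δ A v′ a → hi u′ ≤ lo v′)))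
    (rank-< : ∀ u v → hi u < lo v → labF u < labF v ⊎
      (labF u ≡ labF v × labF u ≢ 0 × (∀ {u′ v′ a} → u ∈ δ A u′ a → v ∈ δ A v′ a → hi u′ < lo v′)))
    (rank-⊏ : ∀ u v → lo u < hi v → u ⊏ v) where

    -- Induction on the finite walks replaces the comparison of a supremum with an infimum: either
    -- the letters decide, or `rank-≤` passes the inequality to the predecessors, which are distinct
    -- by determinism.
    hi≤lo⇒< : ∀ {u v γ γ′} → u ≢ v → hi u ≤ lo v → Back γ u → Back γ′ v → γ <ˡ γ′
    hi≤lo⇒< u≢v le [] [] = contradiction refl u≢v
    hi≤lo⇒< u≢v le [] (_ ∷ _) = Lex.halt
    hi≤lo⇒< {u} {v} u≢v le (e ∷ _) [] with rank-≤ u v le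
    ... | inj₁ lt = contradiction (subst (labF u <_) labF-source lt) λ ()
    ... | inj₂ (eq , _) = contradiction (trans (sym labF-source) (trans (sym eq) (labF-target e))) λ ()
    hi≤lo⇒< {u} {v} u≢v le (e ∷ b) (e′ ∷ b′) with rank-≤ u v le
    ... | inj₁ lt = Lex.this (≤-pred (subst₂ _<_ (labF-target e) (labF-target e′) lt))
    ... | inj₂ (eq , h) with toℕ-injective (suc-injective (trans (sym (labF-target e)) (trans eq (labF-target e′))))
    ...   | refl = Lex.next refl (hi≤lo⇒< (λ { refl → u≢v (deterministic e e′) }) (h e e′) b b′)

    hi≤lo⇒≺ : ∀ {u v} → u ≢ v → hi u ≤ lo v → u ≺ v
    hi≤lo⇒≺ u≢v le = <⇒≺ (hi≤lo⇒< u≢v le)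

    -- Applying `rank-<` to a state and itself would carry a violation back along any walk to the
    -- source, whose label is 0.
    lo≤hi : ∀ v → lo v ≤ hi v
    lo≤hi v = ≮⇒≥ (go (proj₂ (back v)))
      where
      go : ∀ {γ v} → Back γ v → ¬ hi v < lo v
      go {v = v} b lt with rank-< v v lt
      ... | inj₁ l = <-irrefl refl l
      go [] lt | inj₂ (_ , ne , _) = ne labF-source
      go (e ∷ b) lt | inj₂ (_ , _ , h) = go b (h e e)

    -- In the first two cases a pair of strings refutes `u ≺ v`. The last one, two distinct points
    -- of the same rank, cannot arise: each would precede the other.
    incomparable : ∀ {u v} → u ≢ v → (lo v < hi u ⊎ (hi u ≤ lo u ×
        (lo v < lo u ⊎ (hi v ≤ lo v × lo v ≡ lo u)))) → ¬ u ≺ v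
    incomparable {u} {v} _ (inj₁ lt) = ⊏⇒⊁ (rank-⊏ v u lt)
    incomparable {u} {v} _ (inj₂ (_ , inj₁ lt)) = ⊏⇒⊁ (rank-⊏ v u (<-≤-trans lt (lo≤hi u)))
    incomparable {u} {v} u≢v (inj₂ (hu , inj₂ (hv , eq))) _ = ≺-asym
      (hi≤lo⇒≺ u≢v (≤-trans hu (≤-reflexive (sym eq)))) (hi≤lo⇒≺ (u≢v ∘ sym) (≤-trans hv (≤-reflexive eq)))

  -- The numbered instance and its chain partition

  module Instance (ts : List (Transition n σ)) (perm : ts ↭ transitions A) where
    private
      m = length ts

    origins targets letters : ℕ → ℕ
    origins = nth (map (λ (u , _ , _) → toℕ u) ts)
    letters = nth (map (λ (_ , a , _) → toℕ a) ts)
    targets = nth (map (λ (_ , _ , v) → toℕ v) ts)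

    record Listed (i : ℕ) : Set where
      constructor listed
      field
        {u v} : Fin n
        {a}   : Fin σ
        step  : v ∈ δ A u a
        src≡  : origins i ≡ toℕ u
        let≡  : letters i ≡ toℕ a
        tgt≡  : targets i ≡ toℕ v

    listed-at : ∀ i → i < m → Listed i
    listed-at i i<m = subst Listed (toℕ-fromℕ< i<m)
      (listed (proj₂ (∈-filter⁻ (λ (u , a , v) → v ∈? δ A u a)
          {xs = cartesianProduct (allFin n) (cartesianProduct (allFin σ) (allFin n))} (∈-resp-↭ perm (∈-lookup j))))
        (nth-map _ ts j) (nth-map _ ts j) (nth-map _ ts j))
      where
      j : Fin m
      j = fromℕ< i<m

    find : ∀ {u a v} → v ∈ δ A u a → ∃[ i ] i < m × origins i ≡ toℕ u × targets i ≡ toℕ v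
    find {u} {a} {v} e = toℕ j , toℕ<n j , trans (nth-map _ ts j) (cong (toℕ ∘ proj₁) (sym eq)) ,
      trans (nth-map _ ts j) (cong (toℕ ∘ proj₂ ∘ proj₂) (sym eq))
      where
      t∈ : (u , a , v) ∈ˡ ts
      t∈ = ∈-resp-↭ (↭-sym perm) (∈-filter⁺ (λ (u , a , v) → v ∈? δ A u a)
        (∈-cartesianProduct⁺ (∈-allFin u) (∈-cartesianProduct⁺ (∈-allFin a) (∈-allFin v))) e)
      j : Fin m
      j = index t∈
      eq : (u , a , v) ≡ lookup ts j
      eq = lookup-index t∈

    Label : ℕ → ℕ
    Label x with x <? n
    ... | yes x<n = labF (fromℕ< x<n)
    ... | no _    = 0

    Label-toℕ : ∀ v → Label (toℕ v) ≡ labF v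
    Label-toℕ v with toℕ v <? n
    ... | yes v<n = cong labF (fromℕ<-toℕ v v<n)
    ... | no v≮n  = contradiction (toℕ<n v) v≮n

    _⊏ℕ_ : ℕ → ℕ → Set
    x ⊏ℕ y = ∃[ u ] ∃[ v ] toℕ u ≡ x × toℕ v ≡ y × u ⊏ v

    Label-target : ∀ i → i < m → Label (targets i) ≡ suc (letters i)
    Label-target i i<m with listed-at i i<m
    ... | listed {v = v} step _ let≡ tgt≡ =
      trans (cong Label tgt≡) (trans (Label-toℕ v) (trans (labF-target step) (cong suc (sym let≡))))

    into : ∀ v → v ≢ s → ∃[ i ] i < m × targets i ≡ toℕ v
    into v ne = let _ , (_ , e) , _ = ic v ne; i , i<m , _ , eq = find e in i , i<m , eq

    problem : Problem
    problem = record
      { n = n ; σ = σ ; m = m ; src = origins ; let′ = letters ; tgt = targets ; Lab = Label ; root = toℕ s ; W = _⊏ℕ_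
      ; src< = λ i i<m → let listed {u = u} _ eq _ _ = listed-at i i<m in subst (_< n) (sym eq) (toℕ<n u)
      ; tgt< = λ i i<m → let listed {v = v} _ _ _ eq = listed-at i i<m in subst (_< n) (sym eq) (toℕ<n v)
      ; let< = λ i i<m → let listed {a = a} _ _ eq _ = listed-at i i<m in subst (_< σ) (sym eq) (toℕ<n a)
      ; Lab-tgt = Label-target
      ; root< = toℕ<n s
      ; Lab-root = trans (Label-toℕ s) labF-source
      ; incoming = λ v v<n ne → let i , i<m , eq = into (fromℕ< v<n) (λ v≡s → ne (trans (sym (toℕ-fromℕ< v<n)) (cong toℕ v≡s)))
          in i , i<m , trans eq (toℕ-fromℕ< v<n)
      ; W-label = λ u<n v<n lt → fromℕ< u<n , fromℕ< v<n , toℕ-fromℕ< u<n , toℕ-fromℕ< v<n ,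
          ⊏-label (subst₂ _<_ (label-from u<n) (label-from v<n) lt)
      ; W-edge = λ {i} {j} i<m j<m eq (u , v , u≡ , v≡ , lt) → edge (listed-at i i<m) (listed-at j j<m) eq u≡ v≡ lt }
      where
      label-from : ∀ {x} (x<n : x < n) → Label x ≡ labF (fromℕ< x<n)
      label-from x<n = trans (cong Label (sym (toℕ-fromℕ< x<n))) (Label-toℕ (fromℕ< x<n))
      edge : ∀ {i j u v} → Listed i → Listed j → Label (targets i) ≡ Label (targets j) →
             toℕ u ≡ origins i → toℕ v ≡ origins j → u ⊏ v → targets i ⊏ℕ targets j
      edge (listed step src≡ _ tgt≡) (listed step′ src≡′ _ tgt≡′) eq u≡ v≡ lt
        with toℕ-injective (trans u≡ src≡) | toℕ-injective (trans v≡ src≡′)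
      ... | refl | refl = _ , _ , sym tgt≡ , sym tgt≡′ ,
        ⊏-edge step step′ (trans (sym (Label-toℕ _)) (trans
            (trans (cong Label (sym tgt≡)) (trans eq (cong Label tgt≡′))) (Label-toℕ _))) lt

    -- Every state except the source can be charged to a transition that enters it; this lets `m`
    -- absorb the terms in `n`.
    n≤1+m : n ≤ suc m
    n≤1+m = injective⇒≤ {f = number} inj
      where
      number : Fin n → Fin (suc m)
      number v with v Fin.≟ s
      ... | yes _ = Fin.zero
      ... | no ne = Fin.suc (fromℕ< (proj₁ (proj₂ (into v ne))))
      inj : Injective _≡_ _≡_ number
      inj {u} {v} eq with u Fin.≟ s | v Fin.≟ s
      ... | yes refl | yes refl = refl
      ... | no ne | no ne′ = toℕ-injective (trans (sym (proj₂ (proj₂ (into u ne))))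
          (trans (cong targets same) (proj₂ (proj₂ (into v ne′)))))
        where
        same : proj₁ (into u ne) ≡ proj₁ (into v ne′)
        same = trans (sym (toℕ-fromℕ< (proj₁ (proj₂ (into u ne))))) (trans (cong toℕ (Finₚ.suc-injective eq))
          (toℕ-fromℕ< (proj₁ (proj₂ (into v ne′)))))

    -- By input consistency the letters enter distinct states, none of them the source. Hence the
    -- bucket sort by letters stays linear.
    1+σ≤n : suc σ ≤ n
    1+σ≤n = injective⇒≤ {f = pick} inj
      where
      pick : Fin (suc σ) → Fin n
      pick Fin.zero    = s
      pick (Fin.suc a) = let _ , v , _ = letters-used a in v
      label-pick : ∀ c → labF (pick c) ≡ toℕ c
      label-pick Fin.zero    = labF-source
      label-pick (Fin.suc a) = let _ , _ , e = letters-used a in labF-target e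
      inj : Injective _≡_ _≡_ pick
      inj {c} {c′} eq = toℕ-injective (trans (sym (label-pick c)) (trans (cong labF eq) (label-pick c′)))

    module Results {k : ℕ} {col : ℕ → ℕ} (sol : Solution problem k col) where
      open Solution sol renaming (perm to π)
      open Colouring.Coloured coloured
      open DoubledEdges.StateRanking ranks

      private
        edge≤ : ∀ (R : ℕ → ℕ → Set) {u v u′ v′ : Fin n} {a} → u ∈ δ A u′ a → v ∈ δ A v′ a →
          (∀ i j → i < m → j < m → targets i ≡ toℕ u → targets j ≡ toℕ v → R (rank (origins i + n))
              (rank (origins j))) →
          R (rank (toℕ u′ + n)) (rank (toℕ v′))
        edge≤ R e e′ h = let i , i<m , si , ti = find e; j , j<m , sj , tj = find e′ in
          subst₂ (λ x y → R (rank (x + n)) (rank y)) si sj (h i j i<m j<m ti tj)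

        low high : Fin n → ℕ
        low v = rank (toℕ v)
        high v = rank (toℕ v + n)

        high-≤ : ∀ u v → high u ≤ low v → labF u < labF v ⊎
          (labF u ≡ labF v × (∀ {u′ v′ a} → u ∈ δ A u′ a → v ∈ δ A v′ a → high u′ ≤ low v′))
        high-≤ u v le with rank-≤ (toℕ u) (toℕ v) (toℕ<n u) (toℕ<n v) le
        ... | inj₁ lt = inj₁ (subst₂ _<_ (Label-toℕ u) (Label-toℕ v) lt)
        ... | inj₂ (eq , h) = inj₂ (trans (sym (Label-toℕ u)) (trans eq (Label-toℕ v)) , λ e e′ → edge≤ _≤_ e e′ h)

        high-< : ∀ u v → high u < low v → labF u < labF v ⊎
          (labF u ≡ labF v × labF u ≢ 0 × (∀ {u′ v′ a} → u ∈ δ A u′ a → v ∈ δ A v′ a → high u′ < low v′))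
        high-< u v lt with rank-< (toℕ u) (toℕ v) (toℕ<n u) (toℕ<n v) lt
        ... | inj₁ lt′ = inj₁ (subst₂ _<_ (Label-toℕ u) (Label-toℕ v) lt′)
        ... | inj₂ (eq , ne , h) = inj₂ (trans (sym (Label-toℕ u)) (trans eq (Label-toℕ v)) ,
            (ne ∘ trans (Label-toℕ u)) ,
          λ e e′ → edge≤ _<_ e e′ h)

        low-⊏ : ∀ u v → low u < high v → u ⊏ v
        low-⊏ u v lt = let u′ , v′ , u≡ , v≡ , l = rank-W (toℕ u) (toℕ v) (toℕ<n u) (toℕ<n v) lt in
          subst₂ _⊏_ (toℕ-injective u≡) (toℕ-injective v≡) l

      open Ranked low high high-≤ high-< low-⊏

      part : Fin n → Fin k
      part v = fromℕ< (bounded (toℕ v) (toℕ<n v))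

      part-col : ∀ v → toℕ (part v) ≡ col (toℕ v)
      part-col v = toℕ-fromℕ< (bounded (toℕ v) (toℕ<n v))

      chain-partition : IsChainPartition (StringOrder A) part
      chain-partition = record
        { nonempty = λ c → let v , v<n , eq = onto (toℕ c) (toℕ<n c) in fromℕ< v<n ,
            λ { refl → toℕ-injective (trans (part-col (fromℕ< v<n)) (trans (cong col (toℕ-fromℕ< v<n)) eq)) }
        ; chain = same-colour }
        where
        same-colour : ∀ {u v} → part u ≡ part v → u ≢ v → StringOrder A u v ⊎ StringOrder A v u
        same-colour {u} {v} eq ne with chains (toℕ u) (toℕ v) (toℕ<n u) (toℕ<n v) (ne ∘ toℕ-injective)
          (trans (sym (part-col u)) (trans (cong toℕ eq) (part-col v)))
        ... | inj₁ lt = inj₁ (λ {α} {β} → hi≤lo⇒≺ ne (before (toℕ u) (toℕ v) (toℕ<n u) (toℕ<n v) lt) {α} {β})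
        ... | inj₂ lt = inj₂ (λ {α} {β} → hi≤lo⇒≺ (ne ∘ sym) (before (toℕ v) (toℕ u) (toℕ<n v) (toℕ<n u) lt) {α} {β})

      -- When the last colour was opened no colour was free, so that the intervals of
      -- these states meet in one point: they form an antichain with k elements.
      member : ∀ c → ∃[ v ] P (toℕ v) ≤ proj₁ clique × proj₁ clique < P (toℕ v + n) × col (toℕ v) ≡ toℕ {k} c
      member c = let v , v<n , l , h , eq = proj₂ clique (toℕ c) (toℕ<n c) in
        fromℕ< v<n , subst (λ x → P x ≤ proj₁ clique × proj₁ clique < P (x + n) × col x ≡ toℕ c)
            (sym (toℕ-fromℕ< v<n)) (l , h , eq)

      members : Fin k → Fin n
      members = proj₁ ∘ member

      members-injective : Injective _≡_ _≡_ members
      members-injective {c} {c′} eq = toℕ-injective (trans (sym (proj₂ (proj₂ (proj₂ (member c)))))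
        (trans (cong (col ∘ toℕ) eq) (proj₂ (proj₂ (proj₂ (member c′))))))

      unrelated : ∀ c c′ → members c ≢ members c′ → ¬ StringOrder A (members c) (members c′)
      unrelated c c′ ne = incomparable ne (crossing (toℕ (members c)) (toℕ (members c′)) (toℕ<n _) (toℕ<n _)
        (≤-<-trans (proj₁ (proj₂ (member c′))) (proj₁ (proj₂ (proj₂ (member c))))))

      minimum-chain-partition : IsMinimumChainPartition (StringOrder A) part
      minimum-chain-partition = record
        { isChainPartition = chain-partition
        ; minimum = λ part′ cp → injective⇒≤ {f = part′ ∘ members} λ {c} {c′} eq → separate cp c c′ eq }
        where
        separate : ∀ {l} {part′ : Fin n → Fin l} → IsChainPartition (StringOrder A) part′ →
          ∀ c c′ → part′ (members c) ≡ part′ (members c′) → c ≡ c′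
        separate cp c c′ eq with members c Fin.≟ members c′
        ... | yes e = members-injective e
        ... | no ne with IsChainPartition.chain cp eq ne
        ...   | inj₁ lt = contradiction (λ {α} {β} → lt {α} {β}) (unrelated c c′ ne)
        ...   | inj₂ lt = contradiction (λ {α} {β} → lt {α} {β}) (unrelated c′ c (ne ∘ sym))

      antichain-bound : ∀ S → Antichain (StringOrder A) S → ∣ S ∣ ≤ k
      antichain-bound S anti = let e , inj , e∈ = elements S in
        injective⇒≤ {f = part ∘ e} λ {i} {j} eq → inj (separate (e∈ i) (e∈ j) eq)
        where
        separate : ∀ {u v} → u ∈ S → v ∈ S → part u ≡ part v → u ≡ v
        separate {u} {v} u∈ v∈ eq with u Fin.≟ v
        ... | yes e = e
        ... | no ne with IsChainPartition.chain chain-partition eq ne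
        ...   | inj₁ lt = contradiction (λ {α} {β} → lt {α} {β}) (proj₁ (anti u∈ v∈ ne))
        ...   | inj₂ lt = contradiction (λ {α} {β} → lt {α} {β}) (proj₂ (anti u∈ v∈ ne))

      largest-antichain : ∃[ S ] Antichain (StringOrder A) S × ∣ S ∣ ≡ k
      largest-antichain with image k members members-injective
      ... | S , from , k≤ = S , anti , ≤-antisym (antichain-bound S anti) k≤
        where
        anti : Antichain (StringOrder A) S
        anti u∈ v∈ ne with from u∈ | from v∈
        ... | c , refl | c′ , refl = unrelated c c′ ne , unrelated c′ c (ne ∘ sym)

      smallest-width : IsSmallestWidthCoLexOrder A (StringOrder A)
      smallest-width = record
        { isCoLexOrder = string-order-is-co-lex
        ; width = k
        ; hasWidth = largest-antichain , antichain-bound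
        ; smallest = λ {_≺′_} {w} co-lex (_ , bound) → let S , anti , eq = largest-antichain in
            subst (_≤ w) eq (bound S λ u∈ v∈ ne → proj₁ (anti u∈ v∈ ne) ∘ co-lex⊆string co-lex ,
                                                   proj₂ (anti u∈ v∈ ne) ∘ co-lex⊆string co-lex) }

    m≡ : m ≡ ∣δ∣ A
    m≡ = ↭-length perm

    runs : 1 ≤ σ → Halts (wordSize 4 A) algorithm (input A ts) (5263 * (∣δ∣ A * ⌊log₂ n ⌋))
      (λ _ τ → Solution problem (vars τ vOut) (arrs τ aCol))
    runs 1≤σ = weaken time (AlgorithmRun.algorithm-halts problem (wordSize 4 A) Z Z< ≤-refl refl refl refl
        (λ _ _ → refl) (λ _ _ → refl) (λ _ _ → refl) (λ _ _ → refl))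
      where
      2≤n : 2 ≤ n
      2≤n = ≤-trans (s≤s 1≤σ) 1+σ≤n
      1≤m : 1 ≤ m
      1≤m = ≤-pred (≤-trans 2≤n n≤1+m)
      n≤2m : n ≤ m + m
      n≤2m = ≤-trans n≤1+m (+-monoˡ-≤ m 1≤m)
      l = ⌊log₂ n ⌋
      1≤l : 1 ≤ l
      1≤l = ⌊log₂⌋-mono-≤ {2} 2≤n
      log≡ : ⌊log₂ n + n ⌋ ≡ suc l
      log≡ = log-double n (≤-trans (s≤s z≤n) 2≤n)
      Φ = (n + n) * ⌊log₂ n + n ⌋ + (m + m) * ⌊log₂ n + n ⌋
      Z = quad (n + n) + (m + m) + (suc σ * 2 + 3) + Φ * 2
      Q = n + m
      Z< : Z < 2 ^ wordSize 4 A
      Z< = <-≤-trans (room-bound (+-mono-≤ 2≤n 1≤m) 1+σ≤n (log-≤ (n + n)))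
        (≤-trans (^-monoˡ-≤ 5 (≤-2^⌈log⌉ Q)) (≤-reflexive (trans (^-*-assoc 2 ⌈log₂ Q ⌉ 5)
          (cong (2 ^_) (trans (*-comm ⌈log₂ Q ⌉ 5) (cong (λ x → 5 * ⌈log₂ (n + x) ⌉) m≡))))))
      time : Times.T₀ n m (suc σ) Φ ≤ 5263 * (∣δ∣ A * l)
      time = subst (λ x → Times.T₀ n m (suc σ) Φ ≤ 5263 * (x * l)) m≡
          (T₀-bound {n} {m} {suc σ} {Φ} l n≤2m (≤-trans 1+σ≤n n≤2m) 1≤m 1≤l
        (subst (λ x → (n + n) * x + (m + m) * x ≤ m * l * 12) (sym log≡) (Φ-bound {n} {m} l n≤2m 1≤l)))

theorem2 :
    ∃[ P ] ∃[ c ] ∃[ d ]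
      (∀ {n σ} .{{_ : NonZero σ}} (A : NFA n σ) →
        StandingAssumptions A → IsDFA A → InputConsistent A →
        IsSmallestWidthCoLexOrder A (StringOrder A) ×
        (∀ ts → ts ↭ transitions A →
          ∃[ ρ ] ∃[ t ]
            (Run (wordSize d A) P (input A ts) ρ t ×
             t ≤ c * (∣δ∣ A * ⌊log₂ n ⌋) ×
             (∃[ k ] Σ[ part ∈ (Fin n → Fin k) ]
               (Outputs ρ part × IsMinimumChainPartition (StringOrder A) part)))))
-- As `wordSize` takes the successor, 4 stands for five times the logarithm.
theorem2 = algorithm , 5263 , 4 , λ {n} {σ} A SA dfa ic →
  let 1≤σ = n≢0⇒n>0 (≢-nonZero⁻¹ σ)
      module I = Automaton.Instance A SA dfa ic in
  -- This claim mentions no run, but its largest antichain is read off the result of one; any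
  -- listing of the transitions would serve.
  I.Results.smallest-width (transitions A) ↭-refl (Halts.post (I.runs (transitions A) ↭-refl 1≤σ)) ,
  λ ts π → case I.runs ts π 1≤σ of λ where
    (halts {final} {time = t} {left} run (vars≡ , arrs≡) paid sol) →
      final , t , run , ≤-trans (m≤m+n t left) paid , _ , I.Results.part ts π sol ,
      (vars≡ vOut , λ v → trans (arrs≡ aCol (toℕ v)) (sym (I.Results.part-col ts π sol v))) ,
      I.Results.minimum-chain-partition ts π sol
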